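{- Let $\Delta$ be a $(d-1)$-dimensional simplicial complex with homologically isolated singularities. Then for any l.s.o.p. $\Theta$ of $k[\Delta]$, the Hilbert series of $k(\Delta,\Theta)=k[\Delta]/(\Theta)$ is equal to $\sum_{i=0}^d h'_i(\Delta)\lambda^i$, where (for $0\leq i \leq d$) $$h'_i(\Delta)=h_i(\Delta) + \binom{d}{i}\sum_{j=1}^{i-1}(-1)^{i-j-1}\beta_{j-1}(\Delta) +\binom{d-1}{i}\left[\mathcal{K}_{i-1}(\Delta)- \sum_{v\in V} \sum_{j=1}^{i-2}(-1)^{i-j}\beta_{j-1}(\operatorname{lk} v)\right].$$
   Context: Fix an infinite field $k$. $\Delta$ is a simplicial complex on vertex set $V$, $h_i$ its $h$-vector, $\beta_i(\cdot)=\dim_k\tilde H_i(\cdot;k)$ the reduced Betti numbers, and $\operatorname{lk} v$ the vertex link. $k[\Delta]$ is the Stanley–Reisner ring; an l.s.o.p. is a set of $d$ linear forms $\Theta$ with $k[\Delta]/(\Theta)$ finite-dimensional. A pure complex is $k$-CM if every face link (including of $\emptyset$) has vanishing reduced homology below its top dimension, $k$-Buchsbaum if all vertex links are $k$-CM, and a space with isolated singularities if all vertex links are $k$-Buchsbaum. For $v\in V$ let $\operatorname{cost} v=\{F\in\Delta: v\notin F\}$, $H^i_{\{v\}}(\Delta)=H^i(\Delta,\operatorname{cost}v;k)\cong\tilde H^{i-1}(\operatorname{lk}v;k)$, $H^i_\emptyset(\Delta)=\tilde H^i(\Delta;k)$, and $\iota^*:H^i_{\{v\}}(\Delta)\to H^i_\emptyset(\Delta)$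 the map induced by inclusion. For $\theta=\sum_v a_vx_v$ with all $a_v\neq0$ let $f^{i,\theta}=\sum_v a_v\iota^*:\bigoplus_v H^i_{\{v\}}(\Delta)\to H^i_\emptyset(\Delta)$. $\Delta$ has homologically isolated singularities if it is a space with isolated singularities and for all $0\le i\le d-2$ the images $\iota^*(H^i_{\{v\}}(\Delta))$, $v\in V$, are linearly independent subspaces of $H^i_\emptyset(\Delta)$; then $\mathcal{K}_i(\Delta):=\dim_k\ker f^{i,\theta}$ is independent of $\theta$. -}

module Defs where

open import Level using (Level; _⊔_; Lift) renaming (suc to lsuc)
open import Data.Bool using (Bool; true; false; if_then_else_; _∧_; not)
open import Data.Nat as ℕ using (ℕ; zero; suc; _≤_; _<_; _∸_; _≤ᵇ_; _≡ᵇ_)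
open import Data.Nat.Combinatorics using (_C_)
open import Data.Integer as ℤ using (ℤ; +_)
open import Data.Fin using (Fin; zero; suc)
open import Data.Fin.Subset using (Subset; ⁅_⁆; _∈_; _∉_; _⊆_; _∪_; ∣_∣) renaming (⊥ to ∅; _-_ to _∖_)
open import Data.Vec as Vec using (Vec; []; _∷_; lookup; tabulate; zipWith)
open import Data.Vec.Properties using (≡-dec)
open import Data.List as List using (List; []; _∷_; length; filter)
open import Data.List.Relation.Unary.All using (All)
import Data.List.Membership.Propositional as LMem
open import Data.Product using (Σ; _×_; _,_; ∃; proj₁; proj₂)
open import Data.Sum using (_⊎_)
open import Relation.Nullary using (¬_; does)
open import Relation.Binary.PropositionalEquality using (_≡_; _≢_)
open import Algebra.Bundles using (CommutativeRing)

record Field (c ℓ : Level) : Set (lsuc (c ⊔ ℓ)) where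
  field
    commRing : CommutativeRing c ℓ
  open CommutativeRing commRing public
  field
    1≉0     : ¬ (1# ≈ 0#)
    inverse : ∀ x → ¬ (x ≈ 0#) → Σ Carrier λ y → (x * y) ≈ 1#

-- Combinatorics of simplicial complexes on the vertex set Fin n.
-- A (candidate) complex is a Boolean predicate on subsets ("is a face").

allSubsets : (n : ℕ) → List (Subset n)
allSubsets zero    = [] ∷ []
allSubsets (suc n) = List.map (false ∷_) (allSubsets n) List.++ List.map (true ∷_) (allSubsets n)

IsComplex : ∀ {n} → (Subset n → Bool) → Set
IsComplex {n} Γ = (Γ ∅ ≡ true) × (∀ F G → G ⊆ F → Γ F ≡ true → Γ G ≡ true)

IsComplexOnV : ∀ {n} → (Subset n → Bool) → Set
IsComplexOnV {n} Δ = IsComplex Δ × (∀ (v : Fin n) → Δ ⁅ v ⁆ ≡ true)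

IsVertex : ∀ {n} → (Subset n → Bool) → Fin n → Set
IsVertex Γ v = Γ ⁅ v ⁆ ≡ true

disjoint : ∀ {n} → Subset n → Subset n → Bool
disjoint []      []      = true
disjoint (a ∷ F) (b ∷ G) = not (a ∧ b) ∧ disjoint F G

lkF : ∀ {n} → (Subset n → Bool) → Subset n → (Subset n → Bool)
lkF Γ F G = disjoint G F ∧ Γ (G ∪ F)

lk : ∀ {n} → (Subset n → Bool) → Fin n → (Subset n → Bool)
lk Γ v = lkF Γ ⁅ v ⁆

Pure : ∀ {n} → (Subset n → Bool) → ℕ → Set
Pure {n} Γ s = (∀ F → Γ F ≡ true → ∣ F ∣ ≤ s)
             × (∀ F → Γ F ≡ true → Σ (Subset n) λ G → (F ⊆ G) × (Γ G ≡ true) × (∣ G ∣ ≡ s))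

sumL : List ℕ → ℕ
sumL = List.foldr ℕ._+_ 0

-- number of faces with j vertices, f_{j-1}
fcount : ∀ {n} → (Subset n → Bool) → ℕ → ℕ
fcount {n} Γ j = sumL (List.map (λ F → if Γ F ∧ (∣ F ∣ ≡ᵇ j) then 1 else 0) (allSubsets n))

pos : ∀ {n} → Fin n → Subset n → ℕ
pos zero    (_ ∷ _) = 0
pos (suc v) (b ∷ F) = (if b then 1 else 0) ℕ.+ pos v F

sumℤ : (ℕ → ℤ) → ℕ → ℕ → ℤ          -- sumℤ f a b = Σ_{a ≤ j ≤ b} f j  (0 if b < a)
sumℤ f a b = go (suc b ∸ a)
  where
  go : ℕ → ℤ
  go zero    = + 0
  go (suc k) = f (a ℕ.+ k) ℤ.+ go k

sumFinℤ : ∀ {n} → (Fin n → ℤ) → ℤ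
sumFinℤ {zero}  f = + 0
sumFinℤ {suc n} f = f zero ℤ.+ sumFinℤ (λ v → f (suc v))

sgnℤ : ℕ → ℤ
sgnℤ zero          = + 1
sgnℤ (suc zero)    = ℤ.- (+ 1)
sgnℤ (suc (suc k)) = sgnℤ k

hvec : ∀ {n} → (Subset n → Bool) → (d i : ℕ) → ℤ
hvec Γ d i = sumℤ (λ j → sgnℤ (i ∸ j) ℤ.* (+ ((d ∸ j) C (i ∸ j)) ℤ.* + fcount Γ j)) 0 i

module OverField {c ℓ : Level} (K : Field c ℓ) where
  open Field K using (Carrier; _≈_; _+_; _*_; -_; _-_; 0#; 1#)

  Infinite : Set (c ⊔ ℓ)
  Infinite = ∀ (L : List Carrier) → Σ Carrier λ x → All (λ y → ¬ (x ≈ y)) L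

  sumF : ∀ {n} → (Fin n → Carrier) → Carrier
  sumF {zero}  f = 0#
  sumF {suc n} f = f zero + sumF (λ v → f (suc v))

  sgn : ℕ → Carrier
  sgn zero          = 1#
  sgn (suc zero)    = - 1#
  sgn (suc (suc k)) = sgn k

  module _ {a : Level} {I : Set a} where
    -- vectors indexed by I, with pointwise equality; subspaces are predicates
    Vect : Set (a ⊔ c)
    Vect = I → Carrier

    Pred : Set (lsuc (a ⊔ c ⊔ ℓ))
    Pred = Vect → Set (a ⊔ c ⊔ ℓ)

    linComb : ∀ {r} → (Fin r → Carrier) → (Fin r → Vect) → Vect
    linComb cs bs i = sumF (λ j → cs j * bs j i)

    -- dim_k (U / W) = r  (W ⊆ U subspaces): r elements of U whose classes
    -- form a basis of U/W.  (W = 0 gives ordinary dimension.)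
    QDim : Pred → Pred → ℕ → Set (a ⊔ c ⊔ ℓ)
    QDim U W r = Σ (Fin r → Vect) λ bs →
        (∀ j → U (bs j))
      × (∀ (cs : Fin r → Carrier) → W (linComb cs bs) → ∀ j → cs j ≈ 0#)
      × (∀ u → U u → Σ (Fin r → Carrier) λ cs → W (λ i → u i - linComb cs bs i))

    Span : Pred → Pred
    Span G x = Σ (List (Carrier × Vect)) λ L →
      All (λ p → G (proj₂ p)) L × (∀ i → x i ≈ List.foldr (λ p s → proj₁ p * proj₂ p i + s) 0# L)

  -- Reduced simplicial (co)homology, via the augmented chain complex
  -- (the empty face in degree -1).  "Size" s = degree + 1.

  module _ {n : ℕ} (Γ : Subset n → Bool) where
    Chain : ℕ → Pred {I = Subset n}
    Chain s x = Lift c (∀ F → (Γ F ≡ false ⊎ ∣ F ∣ ≢ s) → x F ≈ 0#)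

    ∂ : Vect {I = Subset n} → Vect {I = Subset n}
    ∂ x G = sumF (λ v → if does (v Data.Fin.Subset.Properties.∈? G) then 0#
                         else sgn (pos v (G ∪ ⁅ v ⁆)) * x (G ∪ ⁅ v ⁆))
      where import Data.Fin.Subset.Properties

    δ : Vect {I = Subset n} → Vect {I = Subset n}
    δ x F = sumF (λ v → if does (v Data.Fin.Subset.Properties.∈? F)
                         then sgn (pos v F) * x (F ∖ v) else 0#)
      where import Data.Fin.Subset.Properties

    Cycles : ℕ → Pred
    Cycles i x = Chain (suc i) x × (∀ G → ∂ x G ≈ 0#)

    Boundaries : ℕ → Pred
    Boundaries i x = Chain (suc i) x × Σ Vect λ y → Chain (suc (suc i)) y × (∀ G → x G ≈ ∂ y G)

    Betti : ℕ → ℕ → Set _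
    Betti i r = QDim (Cycles i) (Boundaries i) r

    Acyclic : ℕ → Set _
    Acyclic i = ∀ x → Cycles i x → Boundaries i x

    Cocycles : ℕ → Pred
    Cocycles i x = Chain (suc i) x × (∀ F → Γ F ≡ true → δ x F ≈ 0#)

    Coboundaries : ℕ → Pred
    Coboundaries i x = Chain (suc i) x × Σ Vect λ y → Chain i y × (∀ F → Γ F ≡ true → x F ≈ δ y F)

    -- relative cochains C^i(Γ, cost v): cochains vanishing on faces without v
    RelChain : Fin n → ℕ → Pred
    RelChain v s x = Chain s x × (∀ F → v ∉ F → x F ≈ 0#)

    RelCocycles : Fin n → ℕ → Pred
    RelCocycles v i x = RelChain v (suc i) x × (∀ F → Γ F ≡ true → δ x F ≈ 0#)

    RelCoboundaries : Fin n → ℕ → Pred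
    RelCoboundaries v i x = RelChain v (suc i) x ×
      Σ Vect λ y → RelChain v i y × (∀ F → Γ F ≡ true → x F ≈ δ y F)

    -- ker f^{i,θ} ⊆ ⊕_v H^i_{v}(Γ), θ = Σ a_v x_v, computed on cocycle level
    KerF : (Fin n → Carrier) → ℕ → Pred {I = Fin n × Subset n}
    KerF a i C = (∀ v → RelCocycles v i (λ F → C (v , F)))
               × Coboundaries i (λ F → sumF (λ v → a v * C (v , F)))

    KerF₀ : ℕ → Pred {I = Fin n × Subset n}
    KerF₀ i C = ∀ v → RelCoboundaries v i (λ F → C (v , F))

    -- 𝒦_i(Γ) = dim ker f^{i,θ} = r, for some θ with all coefficients nonzero
    -- (independent of θ under the hypotheses)
    KDim : ℕ → ℕ → Set _
    KDim i r = Σ (Fin n → Carrier) λ a → (∀ v → ¬ (a v ≈ 0#)) × QDim (KerF a i) (KerF₀ i) r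

  -- Cohen–Macaulay, Buchsbaum, isolated singularities  (s = dim + 1)

  module _ {n : ℕ} where
    CM : (Subset n → Bool) → ℕ → Set _
    CM Γ s = Pure Γ s × (∀ F → Γ F ≡ true → ∀ i → suc (i ℕ.+ ∣ F ∣) < s → Acyclic (lkF Γ F) i)

    Buchsbaum : (Subset n → Bool) → ℕ → Set _
    Buchsbaum Γ s = Pure Γ s × (∀ u → IsVertex Γ u → CM (lk Γ u) (s ∸ 1))

    IsolatedSing : (Subset n → Bool) → ℕ → Set _
    IsolatedSing Γ s = Pure Γ s × (∀ v → IsVertex Γ v → Buchsbaum (lk Γ v) (s ∸ 1))

    -- homologically isolated singularities, for a (d-1)-dimensional complex:
    -- images ι*(H^i_{v}) linearly independent in H̃^i for 0 ≤ i ≤ d-2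
    HIS : (Subset n → Bool) → ℕ → Set _
    HIS Γ d = IsolatedSing Γ d ×
      (∀ i → suc (suc i) ≤ d → ∀ (C : Fin n → Vect {I = Subset n}) →
         (∀ v → RelCocycles Γ v i (C v)) →
         Coboundaries Γ i (λ F → sumF (λ v → C v F)) →
         ∀ v → Coboundaries Γ i (C v))

  -- Polynomial ring k[x_v : v ∈ Fin n]: finitely supported functions on
  -- exponent vectors.

  module _ {n : ℕ} where
    Mon : Set
    Mon = Vec ℕ n

    _≟ᴹ_ : (e f : Mon) → Bool
    e ≟ᴹ f = does (≡-dec ℕ._≟_ e f)

    leqᴹ : ∀ {m} → Vec ℕ m → Vec ℕ m → Bool
    leqᴹ []      []      = true
    leqᴹ (a ∷ e) (b ∷ f) = (a ≤ᵇ b) ∧ leqᴹ e f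

    Poly : Pred {I = Mon}
    Poly f = Lift c (Σ (List Mon) λ L → ∀ e → ¬ (LMem._∈_ e L) → f e ≈ 0#)

    Hom : ℕ → Pred {I = Mon}
    Hom i f = Poly f × (∀ e → Vec.sum e ≢ i → f e ≈ 0#)

    mulMon : Mon → Vect {I = Mon} → Vect {I = Mon}
    mulMon m g e = if leqᴹ m e then g (zipWith _∸_ e m) else 0#

    monoF : Subset n → Vect {I = Mon}
    monoF F e = if e ≟ᴹ Vec.map (λ b → if b then 1 else 0) F then 1# else 0#

    unitᴹ : Fin n → Mon
    unitᴹ v = tabulate (λ u → if does (Data.Fin._≟_ u v) then 1 else 0)
      where import Data.Fin

    linForm : (Fin n → Carrier) → Vect {I = Mon}
    linForm a e = sumF (λ v → if e ≟ᴹ unitᴹ v then a v else 0#)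

    GenSR : ∀ {d} → (Subset n → Bool) → (Fin d → Fin n → Carrier) → Pred {I = Mon}
    GenSR Δ Θ g = Lift c ((Σ (Subset n) λ F → (Δ F ≡ false) × (∀ e → g e ≈ monoF F e))
                ⊎ (Σ (Fin _) λ j → ∀ e → g e ≈ linForm (Θ j) e))

    IdealSR : ∀ {d} → (Subset n → Bool) → (Fin d → Fin n → Carrier) → Pred {I = Mon}
    IdealSR Δ Θ = Span (λ g → Σ Mon λ m → Σ Vect λ g₀ → GenSR Δ Θ g₀ × (∀ e → g e ≈ mulMon m g₀ e))

    -- Θ is an l.s.o.p.: k[Δ]/(Θ) = k[x]/(I_Δ + (Θ)) is finite-dimensional
    LSOP : ∀ {d} → (Subset n → Bool) → (Fin d → Fin n → Carrier) → Set _
    LSOP Δ Θ = Σ ℕ λ r → QDim Poly (IdealSR Δ Θ) r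

    HilbDim : ∀ {d} → (Subset n → Bool) → (Fin d → Fin n → Carrier) → ℕ → ℕ → Set _
    HilbDim Δ Θ i r = QDim (Hom i) (λ f → Hom i f × IdealSR Δ Θ f) r

-- h'_i, given the Betti numbers β_m(Δ), β_m(lk v) and 𝒦_m(Δ) as functions
-- (𝒦_{-1} := 0, the term only occurs with i = 0).

hprime : ∀ {n} → (Subset n → Bool) → (d : ℕ) → (β : ℕ → ℕ) → (βlk : Fin n → ℕ → ℕ) → (𝒦 : ℕ → ℕ) → ℕ → ℤ
hprime Δ d β βlk 𝒦 i =
    hvec Δ d i
  ℤ.+ (+ (d C i)) ℤ.* sumℤ (λ j → sgnℤ (i ∸ j ∸ 1) ℤ.* + β (j ∸ 1)) 1 (i ∸ 1)
  ℤ.+ (+ ((d ∸ 1) C i)) ℤ.* (Km i ℤ.- sumFinℤ (λ v → sumℤ (λ j → sgnℤ (i ∸ j) ℤ.* + βlk v (j ∸ 1)) 1 (i ∸ 2)))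
  where
  Km : ℕ → ℤ
  Km zero    = + 0
  Km (suc m) = + 𝒦 m

-- Fix a degree i and write A = k[Δ]. The degree i part of A/(Θ) is the zeroth homology of
-- the Koszul complex Λ(k^d) ⊗ A, so its dimension is the alternating sum of the dimensions
-- of the Koszul terms, which is h_i(Δ), corrected by the higher Koszul homology. The latter
-- does not change when A is replaced by its Čech complex, since (Θ) contains a power of x_v
-- and hence becomes the unit ideal in A[x_v⁻¹]. The total complex is multigraded by ℤ^n.
-- Multidegrees with a positive entry form a cone; those with at least two negative entries
-- are acyclic in the relevant range because links of faces with at least two vertices have
-- homology only on top; the remaining multidegrees 0 and -t e_v leave the kernels and
-- cokernels of the maps
--   Φ_s : ⨁_v W_v ⊗ H^s(Δ, cost v) → Λ^i ⊗ H^s(Δ),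
-- where W_v ⊆ Λ^i is the kernel of contraction with the v-th coefficients of Θ, of
-- dimension C(d-1, i). In the alternating sum the ranks of all Φ_s cancel and only one
-- kernel survives, which is W ⊗ ker ι* because the images of the maps ι* are independent.
-- Ranks exist only up to double negation, as equality in k is not decidable; this is
-- harmless because the conclusion is a decidable equation.

module Submission where

open import Defs
open import Level using (Level; _⊔_; Lift; lift; lower)
open import Data.Bool as Bool using (Bool; true; false; if_then_else_; not; _∨_; _∧_)
open import Data.Nat as ℕ using (ℕ; zero; suc; _≤_; _<_; z≤n; s≤s; _∸_; _≡ᵇ_)
open import Data.Integer as ℤ using (ℤ; +_; -[1+_])
open import Data.Fin as Fin using (Fin; zero; suc; punchIn; splitAt; _↑ˡ_; _↑ʳ_; toℕ)
open import Data.Maybe using (Maybe; just; nothing)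
open import Data.Product using (Σ; _×_; _,_; proj₁; proj₂)
open import Relation.Nullary using (¬_; yes; no; Dec; does)
open import Relation.Binary.PropositionalEquality as ≡ using (_≡_; _≢_)
open import Algebra.Solver.Ring.AlmostCommutativeRing using (fromCommutativeRing; _-Raw-AlmostCommutative⟶_)
open import Data.Empty using (⊥; ⊥-elim)
open import Data.Unit using (⊤; tt)
open import Data.Vec.Functional using (insertAt)
open import Data.Vec.Functional.Properties using (insertAt-lookup; insertAt-punchIn)
open import Data.Sum using (_⊎_; inj₁; inj₂; [_,_]′)
open import Function using (_∘_; id; case_of_)
open import Relation.Nullary.Decidable using (decidable-stable; _×-dec_; dec-true; dec-false; _→-dec_)
open import Data.Fin.Subset using (Subset; ⁅_⁆; _∈_; _∉_; _⊆_; _∪_; ∣_∣) renaming (⊥ to ∅; _-_ to _∖_)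
open import Data.Vec as Vec using (Vec; []; _∷_; lookup; _[_]≔_; here; there; zipWith; replicate; tabulate; updateAt)
open import Data.List as List using (List; []; _∷_; allFin)
open import Data.Fin.Subset.Properties using (_∈?_; ∪-identityʳ; x∈⁅y⁆⇒x≡y; ∣p∣≤n)
open import Data.Integer.Tactic.RingSolver using (solve-∀)
open import Data.List.Membership.Propositional using () renaming (_∈_ to _∈ˡ_)
open import Data.List.Relation.Unary.Any using (here; there)
open import Data.List.Membership.Propositional.Properties using (∈-allFin; ∈-++⁺ˡ; ∈-++⁺ʳ; ∈-tabulate⁺)
open import Data.Nat.Combinatorics using (_C_; nCk+nC[k+1]≡[n+1]C[k+1]; nCn≡1; nCk≡nC[n∸k]; k>n⇒nCk≡0)
open import Data.List.Relation.Unary.All.Properties using (++⁺)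
open import Data.List.Relation.Unary.All as All using (All; []; _∷_)
import Data.Integer.Properties as ℤP
import Algebra.Solver.Ring
import Data.Nat.Properties as ℕP
import Data.Fin.Properties as FinP
import Data.Vec.Properties as VecP
import Data.Bool.Properties as BoolP
import Data.Fin.Subset.Properties as SubP
import Relation.Binary
import Data.List.Properties as ListP
import Data.List.Membership.Propositional as LMem

-- All complexes live in a single function space: a cochain is a function on positions (face,
-- exterior monomial, multidegree), and the one differential `D` reads only positions below the
-- given one. Hence a convex set of positions carries a subquotient complex, and every reduction
-- consists in adding or deleting a set of positions whose own complex is exact. The Čech terms are
-- infinite-dimensional even in a fixed degree, so along these reductions dimensions are only
-- transported, through isomorphisms `QIso` given on representatives; they are computed at the two
-- ends. The acyclicity of links cannot be used one multidegree at a time, because the Koszul part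
-- moves between multidegrees. It is turned into a linear, finitary contraction depending only on
-- the set of negative entries, which therefore commutes with the Koszul part. The rays -t e_v are
-- split by a vector g(v) that pairs to one with the coefficients θ(v) of x_v in Θ; it is read off
-- from the relation expressing a power of x_v through Θ. The index `m` of a complex is its
-- homological degree plus one.

module DoubleNegation where
  DN : ∀ {a} → Set a → Set a
  DN A = ¬ ¬ A

  return : ∀ {a} {A : Set a} → A → DN A
  return x k = k x

  infixl 1 _>>=_
  _>>=_ : ∀ {a b} {A : Set a} {B : Set b} → DN A → (A → DN B) → DN B
  (m >>= f) k = m (λ x → f x k)

  em : ∀ {a} (A : Set a) → DN (A ⊎ ¬ A)
  em A k = k (inj₂ (λ x → k (inj₁ x)))

  -- Double negation commutes with finite products; this is how a pivot can be chosen for all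
  -- vertices at once.
  DN-Fin : ∀ {a n} {P : Fin n → Set a} → (∀ j → DN (P j)) → DN (∀ j → P j)
  DN-Fin {n = zero}  f = return (λ ())
  DN-Fin {n = suc n} {P} f = do
    p ← f zero
    q ← DN-Fin (λ j → f (suc j))
    return (λ where zero → p ; (suc j) → q j)

open DoubleNegation

-- Counting by enumeration

-- What is counted are the indices, not pairs of an index with a proof: injectivity and surjectivity
-- concern the index alone, so `P` need not be a proposition.
record Card {I : Set} (P : I → Set) (N : ℕ) : Set where
  field
    en     : Fin N → I
    en∈    : ∀ k → P (en k)
    en-inj : ∀ {k l} → en k ≡ en l → k ≡ l
    en-sur : ∀ {i} → P i → Σ (Fin N) λ k → en k ≡ i

Card-0 : ∀ {I : Set} {P : I → Set} → (∀ {i} → ¬ P i) → Card P 0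
Card-0 n = record { en = λ () ; en∈ = λ () ; en-inj = λ {} ; en-sur = λ p → ⊥-elim (n p) }

Card-1 : ∀ {I : Set} {P : I → Set} (i : I) → P i → (∀ {j} → P j → i ≡ j) → Card P 1
Card-1 i p u = record { en = λ _ → i ; en∈ = λ _ → p ; en-inj = λ { {zero} {zero} _ → ≡.refl } ; en-sur = λ q → zero , u q }

Card-image : ∀ {I J : Set} {P : I → Set} {Q : J → Set} (f : I → J) → (∀ {i j} → f i ≡ f j → i ≡ j) →
  (∀ {i} → P i → Q (f i)) → (∀ {j} → Q j → Σ I λ i → P i × f i ≡ j) → ∀ {N} → Card P N → Card Q N
Card-image f inj to sur c = record
  { en = f ∘ en ; en∈ = to ∘ en∈ ; en-inj = en-inj ∘ inj
  ; en-sur = λ q → let (i , p , e) = sur q ; (k , e') = en-sur p in k , ≡.trans (≡.cong f e') e }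
  where open Card c

Card-⊎ : ∀ {I : Set} {P Q R : I → Set} → (∀ {i} → P i → R i) → (∀ {i} → Q i → R i) →
  (∀ {i} → R i → P i ⊎ Q i) → (∀ {i} → P i → Q i → ⊥) → ∀ {M N} → Card P M → Card Q N → Card R (M ℕ.+ N)
Card-⊎ {I} {P} {Q} {R} f g s dis {M} {N} c c' = record { en = en ; en∈ = en∈ ; en-inj = λ {k} {l} → en-inj k l ; en-sur = en-sur }
  where
  module Cˡ = Card c
  module Cʳ = Card c'
  en : Fin (M ℕ.+ N) → I
  en k = [ Cˡ.en , Cʳ.en ]′ (splitAt M k)
  en∈ : ∀ k → R (en k)
  en∈ k with splitAt M k
  ... | inj₁ a = f (Cˡ.en∈ a)
  ... | inj₂ b = g (Cʳ.en∈ b)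
  en-inj : ∀ k l → en k ≡ en l → k ≡ l
  en-inj k l e with splitAt M k | FinP.join-splitAt M N k | splitAt M l | FinP.join-splitAt M N l
  ... | inj₁ a | p | inj₁ b | q = ≡.trans (≡.sym p) (≡.trans (≡.cong (_↑ˡ N) (Cˡ.en-inj e)) q)
  ... | inj₂ a | p | inj₂ b | q = ≡.trans (≡.sym p) (≡.trans (≡.cong (M ↑ʳ_) (Cʳ.en-inj e)) q)
  ... | inj₁ a | p | inj₂ b | q = ⊥-elim (dis (Cˡ.en∈ a) (≡.subst Q (≡.sym e) (Cʳ.en∈ b)))
  ... | inj₂ a | p | inj₁ b | q = ⊥-elim (dis (Cˡ.en∈ b) (≡.subst Q e (Cʳ.en∈ a)))
  en-sur : ∀ {i} → R i → Σ (Fin (M ℕ.+ N)) λ k → en k ≡ i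
  en-sur r with s r
  ... | inj₁ p = let (k , e) = Cˡ.en-sur p in k ↑ˡ N , ≡.trans (≡.cong [ Cˡ.en , Cʳ.en ]′ (FinP.splitAt-↑ˡ M k N)) e
  ... | inj₂ q = let (k , e) = Cʳ.en-sur q in M ↑ʳ k , ≡.trans (≡.cong [ Cˡ.en , Cʳ.en ]′ (FinP.splitAt-↑ʳ M N k)) e

Card-× : ∀ {I J : Set} {P : I → Set} {Q : J → Set} {M N} → Card P M → Card Q N →
         Card {I × J} (λ (i , j) → P i × Q j) (M ℕ.* N)
Card-× {I} {J} {P} {Q} {M} {N} c c' = record
  { en = λ k → let (a , b) = Fin.remQuot {M} N k in Cˡ.en a , Cʳ.en b
  ; en∈ = λ k → Cˡ.en∈ _ , Cʳ.en∈ _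
  ; en-inj = λ {k} {l} e → ≡.trans (≡.sym (FinP.combine-remQuot {M} N k)) (≡.trans
      (≡.cong₂ Fin.combine (Cˡ.en-inj (≡.cong proj₁ e)) (Cʳ.en-inj (≡.cong proj₂ e))) (FinP.combine-remQuot {M} N l))
  ; en-sur = λ (p , q) → let (a , e) = Cˡ.en-sur p ; (b , e') = Cʳ.en-sur q in
      Fin.combine a b , ≡.cong₂ _,_ (≡.trans (≡.cong (Cˡ.en ∘ proj₁) (FinP.remQuot-combine a b)) e)
                                    (≡.trans (≡.cong (Cʳ.en ∘ proj₂) (FinP.remQuot-combine a b)) e') }
  where
  module Cˡ = Card c
  module Cʳ = Card c'

card-Subset : ∀ {n} {P : Subset n → Set} → (∀ F → Dec (P F)) → Σ ℕ (Card P)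
card-Subset {zero} P? with P? []
... | yes p = 1 , Card-1 [] p (λ { {[]} _ → ≡.refl })
... | no ¬p = 0 , Card-0 (λ { {[]} p → ¬p p })
card-Subset {suc n} {P} P? =
  let (a , c) = card-Subset (λ F → P? (false ∷ F)) ; (b , c') = card-Subset (λ F → P? (true ∷ F)) in
  a ℕ.+ b , Card-⊎ {P = λ F → Vec.head F ≡ false × P F} {Q = λ F → Vec.head F ≡ true × P F} proj₂ proj₂
    (λ { {false ∷ F} p → inj₁ (≡.refl , p) ; {true ∷ F} p → inj₂ (≡.refl , p) })
    (λ { {true ∷ F} (() , _) _ ; {false ∷ F} _ (() , _) })
    (Card-image (false ∷_) VecP.∷-injectiveʳ (λ p → ≡.refl , p) (λ { {false ∷ F} (_ , p) → F , p , ≡.refl }) c)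
    (Card-image (true ∷_) VecP.∷-injectiveʳ (λ p → ≡.refl , p) (λ { {true ∷ F} (_ , p) → F , p , ≡.refl }) c')

sumℕ : ∀ {n} → (Fin n → ℕ) → ℕ
sumℕ {zero}  f = 0
sumℕ {suc n} f = f zero ℕ.+ sumℕ (λ v → f (suc v))

sumℕ-const : ∀ n r → sumℕ {n} (λ _ → r) ≡ n ℕ.* r
sumℕ-const zero    r = ≡.refl
sumℕ-const (suc n) r = ≡.cong (r ℕ.+_) (sumℕ-const n r)

-- Subsets, faces and vertex links

-- Pointwise updates recurse coordinate by coordinate, as the exterior operators do; unions with a
-- singleton are converted to them once and for all.
∪⁅⁆≡ : ∀ {n} (F : Subset n) v → F ∪ ⁅ v ⁆ ≡ F [ v ]≔ true
∪⁅⁆≡ (b ∷ F) zero    = ≡.cong₂ _∷_ (BoolP.∨-zeroʳ b) (∪-identityʳ F)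
∪⁅⁆≡ (b ∷ F) (suc v) = ≡.cong₂ _∷_ (BoolP.∨-identityʳ b) (∪⁅⁆≡ F v)

∖≡ : ∀ {n} (F : Subset n) v → F ∖ v ≡ F [ v ]≔ false
∖≡ (b ∷ F) zero    = ≡.cong₂ _∷_ ≡.refl (SubP.p─⊥≡p F)
∖≡ (b ∷ F) (suc v) = ≡.cong₂ _∷_ ≡.refl (∖≡ F v)

∈?-lookup : ∀ {n} v (F : Subset n) → does (v ∈? F) ≡ lookup F v
∈?-lookup zero    (true ∷ F)  = ≡.refl
∈?-lookup zero    (false ∷ F) = ≡.refl
∈?-lookup (suc v) (b ∷ F)     = ∈?-lookup v F

true≢false : ∀ {b} → b ≡ true → b ≡ false → ⊥
true≢false ≡.refl ()

¬true : ∀ {b} → ¬ (b ≡ true) → b ≡ false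
¬true {false} _ = ≡.refl
¬true {true}  p = ⊥-elim (p ≡.refl)

∧-true : ∀ {a b} → a ∧ b ≡ true → a ≡ true × b ≡ true
∧-true {true} {true} _ = ≡.refl , ≡.refl

∧-intro : ∀ {a b} → a ≡ true → b ≡ true → a ∧ b ≡ true
∧-intro ≡.refl ≡.refl = ≡.refl

∉⇒lookup : ∀ {n} {v : Fin n} {F} → v ∉ F → lookup F v ≡ false
∉⇒lookup p = ¬true (λ e → p (VecP.lookup⇒[]= _ _ e))

lookup⇒∉ : ∀ {n} {v : Fin n} {F} → lookup F v ≡ false → v ∉ F
lookup⇒∉ e p = true≢false (VecP.[]=⇒lookup p) e

⊆-from : ∀ {n} {F G : Subset n} → (∀ u → lookup F u ≡ true → lookup G u ≡ true) → F ⊆ G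
⊆-from f {u} p = VecP.lookup⇒[]= u _ (f u (VecP.[]=⇒lookup p))

⊆-to : ∀ {n} {F G : Subset n} → F ⊆ G → ∀ u → lookup F u ≡ true → lookup G u ≡ true
⊆-to f u e = VecP.[]=⇒lookup (f (VecP.lookup⇒[]= u _ e))

size-add : ∀ {n} (v : Fin n) F → lookup F v ≡ false → ∣ F [ v ]≔ true ∣ ≡ suc ∣ F ∣
size-add zero    (false ∷ F) e = ≡.refl
size-add (suc v) (false ∷ F) e = size-add v F e
size-add (suc v) (true ∷ F)  e = ≡.cong suc (size-add v F e)

size-remove : ∀ {n} (v : Fin n) F → lookup F v ≡ true → suc ∣ F [ v ]≔ false ∣ ≡ ∣ F ∣
size-remove zero    (true ∷ F)  e = ≡.refl
size-remove (suc v) (false ∷ F) e = size-remove v F e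
size-remove (suc v) (true ∷ F)  e = ≡.cong suc (size-remove v F e)

add-remove : ∀ {n} (v : Fin n) F → lookup F v ≡ true → (F [ v ]≔ false) [ v ]≔ true ≡ F
add-remove v F e = ≡.trans (VecP.[]≔-idempotent F v) (≡.trans (≡.cong (F [ v ]≔_) (≡.sym e)) (VecP.[]≔-lookup F v))

lookup-[]≔ : ∀ {n} {A : Set} (F : Vec A n) v {b} → lookup (F [ v ]≔ b) v ≡ b
lookup-[]≔ F v = VecP.lookup∘update v F _

remove-⊆ : ∀ {n} (v : Fin n) F u → lookup (F [ v ]≔ false) u ≡ true → lookup F u ≡ true
remove-⊆ v F u e with u Fin.≟ v
... | yes ≡.refl = ⊥-elim (true≢false e (lookup-[]≔ F v))
... | no p = ≡.trans (≡.sym (VecP.lookup∘update′ p F false)) e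

⊆-add : ∀ {n} (v : Fin n) F u → lookup F u ≡ true → lookup (F [ v ]≔ true) u ≡ true
⊆-add v F u e with u Fin.≟ v
... | yes ≡.refl = lookup-[]≔ F v
... | no p = ≡.trans (VecP.lookup∘update′ p F true) e

disjoint-⁅⁆ : ∀ {n} (F : Subset n) v → disjoint F ⁅ v ⁆ ≡ not (lookup F v)
disjoint-⁅⁆ (b ∷ F) zero    = ≡.trans (≡.cong₂ _∧_ (≡.cong not (BoolP.∧-identityʳ b)) (disjoint-∅ F)) (BoolP.∧-identityʳ _)
  where
  disjoint-∅ : ∀ {n} (F : Subset n) → disjoint F ∅ ≡ true
  disjoint-∅ []      = ≡.refl
  disjoint-∅ (b ∷ F) = ≡.trans (≡.cong₂ _∧_ (≡.cong not (BoolP.∧-zeroʳ b)) (disjoint-∅ F)) ≡.refl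
disjoint-⁅⁆ (b ∷ F) (suc v) = ≡.trans (≡.cong (λ x → not x ∧ disjoint F ⁅ v ⁆) (BoolP.∧-zeroʳ b)) (disjoint-⁅⁆ F v)

lk-true : ∀ {n} {Γ : Subset n → Bool} {v F} → lk Γ v F ≡ true → lookup F v ≡ false × Γ (F [ v ]≔ true) ≡ true
lk-true {Γ = Γ} {v} {F} e = let (a , b) = ∧-true e in
  BoolP.not-injective (≡.trans (≡.sym (disjoint-⁅⁆ F v)) a) , ≡.trans (≡.cong Γ (≡.sym (∪⁅⁆≡ F v))) b

lk-intro : ∀ {n} {Γ : Subset n → Bool} {v F} → lookup F v ≡ false → Γ (F [ v ]≔ true) ≡ true → lk Γ v F ≡ true
lk-intro {Γ = Γ} {v} {F} a b = ∧-intro (≡.trans (disjoint-⁅⁆ F v) (≡.cong not a)) (≡.trans (≡.cong Γ (∪⁅⁆≡ F v)) b)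

Complex-down : ∀ {n} {Γ : Subset n → Bool} → IsComplex Γ → ∀ {F G} → (∀ u → lookup G u ≡ true → lookup F u ≡ true) → Γ F ≡ true → Γ G ≡ true
Complex-down (_ , d) {F} {G} p e = d F G (⊆-from p) e

lk-complex : ∀ {n} {Γ : Subset n → Bool} → IsComplex Γ → ∀ v → IsVertex Γ v → IsComplex (lk Γ v)
lk-complex {n} {Γ} cx v e =
  lk-intro {Γ = Γ} (lookup-∅ v) (≡.trans (≡.cong Γ (≡.trans (≡.sym (∪⁅⁆≡ ∅ v)) (∪-∅ ⁅ v ⁆))) e) ,
  λ F G G⊆F p → let (a , b) = lk-true {Γ = Γ} p
                    a' = ¬true (λ q → true≢false (⊆-to G⊆F v q) a) in
    lk-intro {Γ = Γ} a' (Complex-down cx (mono F G (⊆-to G⊆F)) b)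
  where
  lookup-∅ : ∀ {n} (v : Fin n) → lookup ∅ v ≡ false
  lookup-∅ v = VecP.lookup-replicate v false
  ∪-∅ : ∀ {n} (F : Subset n) → ∅ ∪ F ≡ F
  ∪-∅ []      = ≡.refl
  ∪-∅ (b ∷ F) = ≡.cong (b ∷_) (∪-∅ F)
  mono : ∀ F G → (∀ u → lookup G u ≡ true → lookup F u ≡ true) → ∀ u → lookup (G [ v ]≔ true) u ≡ true → lookup (F [ v ]≔ true) u ≡ true
  mono F G s u q with u Fin.≟ v
  ... | yes ≡.refl = lookup-[]≔ F v
  ... | no p = ≡.trans (VecP.lookup∘update′ p F true) (s u (≡.trans (≡.sym (VecP.lookup∘update′ p G true)) q))

-- Integer multidegrees

vext : ∀ {A : Set} {n} {a b : Vec A n} → (∀ u → lookup a u ≡ lookup b u) → a ≡ b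
vext {a = []}    {[]}    e = ≡.refl
vext {a = x ∷ a} {y ∷ b} e = ≡.cong₂ _∷_ (e zero) (vext (e ∘ suc))

infixl 6 _-ᵥ_
_-ᵥ_ : ∀ {n} → Vec ℤ n → Vec ℤ n → Vec ℤ n
_-ᵥ_ = zipWith ℤ._-_

lookup-- : ∀ {n} (a b : Vec ℤ n) u → lookup (a -ᵥ b) u ≡ lookup a u ℤ.- lookup b u
lookup-- a b u = VecP.lookup-zipWith ℤ._-_ u a b

sumᵥ : ∀ {n} → Vec ℤ n → ℤ
sumᵥ []      = + 0
sumᵥ (x ∷ a) = x ℤ.+ sumᵥ a

𝟘 : ∀ {n} → Vec ℤ n
𝟘 = replicate _ (+ 0)

unit : ∀ {n} → Fin n → Vec ℤ n
unit v = 𝟘 [ v ]≔ + 1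

lookup-𝟘 : ∀ {n} (u : Fin n) → lookup 𝟘 u ≡ + 0
lookup-𝟘 u = VecP.lookup-replicate u (+ 0)

unit-refl : ∀ {n} (v : Fin n) → lookup (unit v) v ≡ + 1
unit-refl v = VecP.lookup∘update v 𝟘 (+ 1)

unit-≢ : ∀ {n} {u v : Fin n} → u ≢ v → lookup (unit v) u ≡ + 0
unit-≢ {u = u} p = ≡.trans (VecP.lookup∘update′ p 𝟘 (+ 1)) (lookup-𝟘 u)

dec : ∀ {n} → Fin n → Vec ℤ n → Vec ℤ n
dec v a = a -ᵥ unit v

sum-- : ∀ {n} (a b : Vec ℤ n) → sumᵥ (a -ᵥ b) ≡ sumᵥ a ℤ.- sumᵥ b
sum-- []      []      = ≡.refl
sum-- (x ∷ a) (y ∷ b) = ≡.trans (≡.cong (ℤ._+_ (x ℤ.- y)) (sum-- a b)) (rearrange x y (sumᵥ a) (sumᵥ b))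
  where
  rearrange : ∀ x y s t → (x ℤ.- y) ℤ.+ (s ℤ.- t) ≡ (x ℤ.+ s) ℤ.- (y ℤ.+ t)
  rearrange = solve-∀

sum-𝟘 : ∀ {n} → sumᵥ (𝟘 {n}) ≡ + 0
sum-𝟘 {zero}  = ≡.refl
sum-𝟘 {suc n} = ≡.trans (ℤP.+-identityˡ _) (sum-𝟘 {n})

sum-[]≔ : ∀ {n} (v : Fin n) x → sumᵥ (𝟘 [ v ]≔ x) ≡ x
sum-[]≔ {suc n} zero    x = ≡.trans (≡.cong (ℤ._+_ x) (sum-𝟘 {n})) (ℤP.+-identityʳ x)
sum-[]≔ {suc n} (suc v) x = ≡.trans (ℤP.+-identityˡ _) (sum-[]≔ v x)

sum-dec : ∀ {n} (v : Fin n) a → sumᵥ (dec v a) ≡ sumᵥ a ℤ.- + 1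
sum-dec v a = ≡.trans (sum-- a (unit v)) (≡.cong (ℤ._-_ (sumᵥ a)) (sum-[]≔ v (+ 1)))

dec-comm : ∀ {n} (v w : Fin n) a → dec v (dec w a) ≡ dec w (dec v a)
dec-comm v w a = vext (λ u → ≡.trans (e v w u) (≡.trans (swap (lookup a u) _ _) (≡.sym (e w v u))))
  where
  e : ∀ v w u → lookup (dec v (dec w a)) u ≡ (lookup a u ℤ.- lookup (unit w) u) ℤ.- lookup (unit v) u
  e v w u = ≡.trans (lookup-- (dec w a) (unit v) u) (≡.cong (ℤ._- lookup (unit v) u) (lookup-- a (unit w) u))
  swap : ∀ x y z → (x ℤ.- y) ℤ.- z ≡ (x ℤ.- z) ℤ.- y
  swap = solve-∀

-- Regions of the total complex

-- The order in which the differential acts: its value at a position depends on positions with a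
-- vertex removed or with a multidegree lowered.
record Le {n : ℕ} (F : Subset n) (a : Vec ℤ n) (F' : Subset n) (a' : Vec ℤ n) : Set where
  constructor le
  field
    le-F : ∀ u → lookup F u ≡ true → lookup F' u ≡ true
    le-a : ∀ u → lookup a u ℤ.≤ lookup a' u
open Le public

dec-≤ : ∀ {n} (v : Fin n) a u → lookup (dec v a) u ℤ.≤ lookup a u
dec-≤ v a u with u Fin.≟ v
... | yes ≡.refl = ℤP.≤-trans (ℤP.≤-reflexive (≡.trans (lookup-- a (unit v) v) (≡.cong (ℤ._-_ (lookup a v)) (unit-refl v)))) (ℤP.i-j≤i (lookup a v) (+ 1))
... | no p = ℤP.≤-reflexive (≡.trans (lookup-- a (unit v) u) (≡.trans (≡.cong (ℤ._-_ (lookup a u)) (unit-≢ p)) (ℤP.+-identityʳ _)))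

Mask : ℕ → Set
Mask n = Subset n → Vec ℤ n → Bool

-- A convex set of positions carries a subquotient: the differential restricted to it still squares
-- to zero.
Convex : ∀ {n} → Mask n → Set
Convex B = ∀ {F a F' a' F'' a''} → Le F a F' a' → Le F' a' F'' a'' → B F a ≡ true → B F'' a'' ≡ true → B F' a' ≡ true

-- Values are moved upwards by the differential, so a part of `B` closed upwards inside `B` carries
-- a subcomplex and its complement the quotient.
UpIn : ∀ {n} → Mask n → Mask n → Set
UpIn B E = ∀ {F a F' a'} → Le F a F' a' → B F a ≡ true → E F a ≡ true → B F' a' ≡ true → E F' a' ≡ true

_∧ᵐ_ _∖ᵐ_ : ∀ {n} → Mask n → Mask n → Mask n
(B ∧ᵐ E) F a = B F a ∧ E F a
(B ∖ᵐ E) F a = B F a ∧ not (E F a)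

does-true : ∀ {P : Set} (p : Dec P) → does p ≡ true → P
does-true (yes q) _ = q

allB : ∀ {n} → (Fin n → Bool) → Bool
allB {zero}  f = true
allB {suc n} f = f zero ∧ allB (f ∘ suc)

allB-elim : ∀ {n} {f : Fin n → Bool} → allB f ≡ true → ∀ u → f u ≡ true
allB-elim e zero    = proj₁ (∧-true e)
allB-elim e (suc u) = allB-elim (proj₂ (∧-true e)) u

allB-intro : ∀ {n} {f : Fin n → Bool} → (∀ u → f u ≡ true) → allB f ≡ true
allB-intro {zero}  p = ≡.refl
allB-intro {suc n} p = ∧-intro (p zero) (allB-intro (p ∘ suc))

∨-true : ∀ {a b} → a ∨ b ≡ true → a ≡ true ⊎ b ≡ true
∨-true {true}  _ = inj₁ ≡.refl
∨-true {false} e = inj₂ e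

∨-introʳ : ∀ a {b} → b ≡ true → a ∨ b ≡ true
∨-introʳ true  _ = ≡.refl
∨-introʳ false e = e

∨-introˡ : ∀ {a} b → a ≡ true → a ∨ b ≡ true
∨-introˡ b ≡.refl = ≡.refl

-- The support condition for a monomial of a localised face ring: the inverted variables together
-- with those of positive exponent must form a face.
mrg : ∀ {n} → Subset n → Vec ℤ n → Subset n
mrg F a = tabulate (λ u → lookup F u ∨ does (+ 0 ℤ.<? lookup a u))

mrg-elim : ∀ {n} (F : Subset n) a u → lookup (mrg F a) u ≡ true → lookup F u ≡ true ⊎ + 0 ℤ.< lookup a u
mrg-elim F a u e = case ∨-true {lookup F u} (≡.trans (≡.sym (VecP.lookup∘tabulate _ u)) e) of λ where
  (inj₁ p) → inj₁ p
  (inj₂ p) → inj₂ (does-true (+ 0 ℤ.<? lookup a u) p)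

mrg-F : ∀ {n} (F : Subset n) a u → lookup F u ≡ true → lookup (mrg F a) u ≡ true
mrg-F F a u e = ≡.trans (VecP.lookup∘tabulate _ u) (∨-introˡ _ e)

mrg-a : ∀ {n} (F : Subset n) a u → + 0 ℤ.< lookup a u → lookup (mrg F a) u ≡ true
mrg-a F a u p = ≡.trans (VecP.lookup∘tabulate _ u) (∨-introʳ (lookup F u) (dec-true (+ 0 ℤ.<? lookup a u) p))

opaque
  -- The multidegrees a of the Čech component A[x_F⁻¹] of the Stanley–Reisner ring A.
  ok : ∀ {n} → (Subset n → Bool) → Mask n
  ok Δ F a = allB (λ u → lookup F u ∨ does (+ 0 ℤ.≤? lookup a u)) ∧ Δ (mrg F a)

  ok-nonneg : ∀ {n} {Δ : Subset n → Bool} {F a} → ok Δ F a ≡ true → ∀ u → lookup F u ≡ false → + 0 ℤ.≤ lookup a u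
  ok-nonneg {F = F} {a} e u q = case ∨-true {lookup F u} (allB-elim (proj₁ (∧-true e)) u) of λ where
    (inj₁ p) → ⊥-elim (true≢false p q)
    (inj₂ p) → does-true (+ 0 ℤ.≤? lookup a u) p

  ok-face : ∀ {n} {Δ : Subset n → Bool} {F a} → ok Δ F a ≡ true → Δ (mrg F a) ≡ true
  ok-face e = proj₂ (∧-true e)

  ok-intro : ∀ {n} {Δ : Subset n → Bool} {F a} → (∀ u → lookup F u ≡ false → + 0 ℤ.≤ lookup a u) → Δ (mrg F a) ≡ true → ok Δ F a ≡ true
  ok-intro {F = F} {a} p q = ∧-intro (allB-intro (λ u → case lookup F u Bool.≟ true of λ where
    (yes e) → ∨-introˡ _ e
    (no e) → ∨-introʳ (lookup F u) (dec-true (+ 0 ℤ.≤? lookup a u) (p u (¬true e))))) q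

-- Coordinates in F are units of A[x_F⁻¹], so they are ignored.
record Le′ {n : ℕ} (F : Subset n) (a : Vec ℤ n) (F' : Subset n) (a' : Vec ℤ n) : Set where
  constructor le′
  field
    le′-F : ∀ u → lookup F u ≡ true → lookup F' u ≡ true
    le′-a : ∀ u → lookup F u ≡ true ⊎ lookup a u ℤ.≤ lookup a' u
open Le′ public

Le⇒Le′ : ∀ {n} {F F' : Subset n} {a a'} → Le F a F' a' → Le′ F a F' a'
Le⇒Le′ (le p q) = le′ p (λ u → inj₂ (q u))

Convex′ : ∀ {n} → Mask n → Set
Convex′ B = ∀ {F a F' a' F'' a''} → Le′ F a F' a' → Le′ F' a' F'' a'' → B F a ≡ true → B F'' a'' ≡ true → B F' a' ≡ true

Convex′⇒Convex : ∀ {n} {B : Mask n} → Convex′ B → Convex B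
Convex′⇒Convex cv l l' = cv (Le⇒Le′ l) (Le⇒Le′ l')

-- Nonnegativity outside the inverted set is inherited from the lower end, the face condition from
-- the upper end. Neither looks at coordinates inverted below, so the coarser order `Le′` suffices.
ok-convex : ∀ {n} {Δ : Subset n → Bool} → IsComplex Δ → Convex′ (ok Δ)
ok-convex {Δ = Δ} cx {F} {a} {F'} {a'} {F''} {a''} l l' p r = ok-intro {Δ = Δ}
  (λ u e → case le′-a l u of λ where
    (inj₁ q) → ⊥-elim (true≢false (le′-F l u q) e)
    (inj₂ q) → ℤP.≤-trans (ok-nonneg {Δ = Δ} p u (¬true (λ q' → true≢false (le′-F l u q') e))) q)
  (Complex-down cx (λ u e → case mrg-elim F' a' u e of λ where
    (inj₁ q) → mrg-F F'' a'' u (le′-F l' u q)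
    (inj₂ q) → case le′-a l' u of λ where
      (inj₁ q') → mrg-F F'' a'' u (le′-F l' u q')
      (inj₂ q') → mrg-a F'' a'' u (ℤP.<-≤-trans q q')) (ok-face {Δ = Δ} r))

∧-convex : ∀ {n} {B E : Mask n} → Convex B → UpIn B E → Convex (B ∧ᵐ E)
∧-convex cv up l l' p r = let (b , e) = ∧-true p ; b' = cv l l' b (proj₁ (∧-true r)) in ∧-intro b' (up l b e b')

∖-convex : ∀ {n} {B E : Mask n} → Convex B → UpIn B E → Convex (B ∖ᵐ E)
∖-convex cv up l l' p r = let (b'' , e'') = ∧-true r ; b' = cv l l' (proj₁ (∧-true p)) b'' in
  ∧-intro b' (≡.cong not (¬true (λ e' → true≢false (up l' b' e' b'') (BoolP.not-injective e''))))

module _ {n : ℕ} (E : Fin n → Mask n) where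
  -- The regions are deleted one vertex at a time, so that each deletion is a single short exact
  -- sequence.
  Without : Mask n → List (Fin n) → Mask n
  Without B []      = B
  Without B (v ∷ L) = Without B L ∖ᵐ E v

  Without-elim : ∀ {B} L {F a} → Without B L F a ≡ true → B F a ≡ true × (∀ {v} → v ∈ˡ L → E v F a ≡ false)
  Without-elim []      e = e , λ ()
  Without-elim (v ∷ L) e = let (p , q) = ∧-true e ; (b , r) = Without-elim L p in
    b , λ { (here ≡.refl) → BoolP.not-injective q ; (there m) → r m }

  Without-intro : ∀ {B} L {F a} → B F a ≡ true → (∀ {v} → v ∈ˡ L → E v F a ≡ false) → Without B L F a ≡ true
  Without-intro []      b r = b
  Without-intro (v ∷ L) b r = ∧-intro (Without-intro L b (r ∘ there)) (≡.cong not (r (here ≡.refl)))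

  Without-convex : ∀ {B} → Convex B → (∀ v → UpIn B (E v)) → ∀ L → Convex (Without B L)
  Without-convex cv up []      = cv
  Without-convex cv up (v ∷ L) = ∖-convex (Without-convex cv up L)
    (λ l p q r → up v l (proj₁ (Without-elim L p)) q (proj₁ (Without-elim L r)))

-- Exponent vectors

inc : ∀ {n} → Fin n → Vec ℕ n → Vec ℕ n
inc w e = updateAt e w suc

supp : ∀ {n} → Vec ℕ n → Subset n
supp e = Vec.map (λ k → does (0 ℕ.<? k)) e

powᵥ : ∀ {n} → Fin n → ℕ → Vec ℕ n
powᵥ v N = replicate _ 0 [ v ]≔ N

sum-map+ : ∀ {m} (e : Vec ℕ m) → sumᵥ (Vec.map +_ e) ≡ + Vec.sum e
sum-map+ []      = ≡.refl
sum-map+ (x ∷ e) = ≡.cong (ℤ._+_ (+ x)) (sum-map+ e)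

sum-pred : ∀ {m} (e : Vec ℕ m) w → 0 < lookup e w → suc (Vec.sum (updateAt e w ℕ.pred)) ≡ Vec.sum e
sum-pred (suc x ∷ e) zero    p = ≡.refl
sum-pred (x ∷ e)     (suc w) p = ≡.trans (≡.sym (ℕP.+-suc x _)) (≡.cong (x ℕ.+_) (sum-pred e w p))

pred-inc : ∀ {m} (e : Vec ℕ m) w → updateAt (inc w e) w ℕ.pred ≡ e
pred-inc (x ∷ e) zero    = ≡.refl
pred-inc (x ∷ e) (suc w) = ≡.cong (x ∷_) (pred-inc e w)

inc-pos : ∀ {m} (e : Vec ℕ m) w → 0 < lookup (inc w e) w
inc-pos (x ∷ e) zero    = s≤s z≤n
inc-pos (x ∷ e) (suc w) = inc-pos e w

-- Inclusion of subsets and iterated links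

Sub : ∀ {n} → Subset n → Subset n → Set
Sub G F = ∀ u → lookup G u ≡ true → lookup F u ≡ true

Sub? : ∀ {n} (G F : Subset n) → Dec (Sub G F)
Sub? G F = FinP.all? (λ u → (lookup G u Bool.≟ true) →-dec (lookup F u Bool.≟ true))

iff⇒≡ : ∀ {a b} → (a ≡ true → b ≡ true) → (b ≡ true → a ≡ true) → a ≡ b
iff⇒≡ {true}  {b}     f g = ≡.sym (f ≡.refl)
iff⇒≡ {false} {true}  f g = g ≡.refl
iff⇒≡ {false} {false} f g = ≡.refl

disjoint-elim : ∀ {n} (H G : Subset n) → disjoint H G ≡ true → ∀ u → lookup H u ≡ true → lookup G u ≡ true → ⊥
disjoint-elim (true ∷ H)  (true ∷ G) () zero p q
disjoint-elim (a ∷ H)     (b ∷ G) e (suc u) p q = disjoint-elim H G (proj₂ (∧-true {not (a ∧ b)} e)) u p q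

disjoint-intro : ∀ {n} (H G : Subset n) → (∀ u → lookup H u ≡ true → lookup G u ≡ true → ⊥) → disjoint H G ≡ true
disjoint-intro []      []      f = ≡.refl
disjoint-intro (a ∷ H) (b ∷ G) f = ∧-intro (≡.cong not (head a b (f zero))) (disjoint-intro H G (f ∘ suc))
  where
  head : ∀ a b → (a ≡ true → b ≡ true → ⊥) → a ∧ b ≡ false
  head true  true  f = ⊥-elim (f ≡.refl ≡.refl)
  head true  false f = ≡.refl
  head false b     f = ≡.refl

lookup-∪ : ∀ {n} (H G : Subset n) u → lookup (H ∪ G) u ≡ lookup H u ∨ lookup G u
lookup-∪ H G u = VecP.lookup-zipWith _∨_ u H G

sub-ext : ∀ {n} (F G : Subset n) → Sub F G → Sub G F → F ≡ G
sub-ext []      []      p q = ≡.refl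
sub-ext (a ∷ F) (b ∷ G) p q = ≡.cong₂ _∷_ (iff⇒≡ (p zero) (q zero)) (sub-ext F G (p ∘ suc) (q ∘ suc))

sub-size : ∀ {n} (F G : Subset n) → Sub F G → ∣ F ∣ ≤ ∣ G ∣
sub-size []          []          p = z≤n
sub-size (true ∷ F)  (true ∷ G)  p = s≤s (sub-size F G (p ∘ suc))
sub-size (true ∷ F)  (false ∷ G) p = case p zero ≡.refl of λ ()
sub-size (false ∷ F) (true ∷ G)  p = ℕP.m≤n⇒m≤1+n (sub-size F G (p ∘ suc))
sub-size (false ∷ F) (false ∷ G) p = sub-size F G (p ∘ suc)

extra-vertex : ∀ {n} (F G : Subset n) → ∣ F ∣ < ∣ G ∣ → Σ (Fin n) λ w → lookup G w ≡ true × lookup F w ≡ false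
extra-vertex F G lt = case FinP.any? (λ w → (lookup G w Bool.≟ true) ×-dec (lookup F w Bool.≟ false)) of λ where
  (yes p) → p
  (no p) → ⊥-elim (ℕP.<⇒≱ lt (sub-size G F (λ u e → case lookup F u Bool.≟ true of λ where
    (yes f) → f
    (no f) → ⊥-elim (p (u , e , ¬true f)))))

lookup-⊥ : ∀ {n} (u : Fin n) → lookup ∅ u ≡ false
lookup-⊥ u = VecP.lookup-replicate u false

∣∅∣≡0 : ∀ n → ∣ ∅ {n} ∣ ≡ 0
∣∅∣≡0 zero  = ≡.refl
∣∅∣≡0 (suc n) = ∣∅∣≡0 n

size-zero : ∀ {n} (G : Subset n) → ∣ G ∣ ≡ 0 → ∀ u → lookup G u ≡ false
size-zero (false ∷ G) e zero    = ≡.refl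
size-zero (false ∷ G) e (suc u) = size-zero G e u

lkF-true : ∀ {n} {Γ : Subset n → Bool} {G H} → lkF Γ G H ≡ true → (∀ u → lookup H u ≡ true → lookup G u ≡ true → ⊥) × Γ (H ∪ G) ≡ true
lkF-true {G = G} {H} e = let (a , b) = ∧-true e in disjoint-elim H G a , b

lkF-intro : ∀ {n} {Γ : Subset n → Bool} {G H} → (∀ u → lookup H u ≡ true → lookup G u ≡ true → ⊥) → Γ (H ∪ G) ≡ true → lkF Γ G H ≡ true
lkF-intro {G = G} {H} p q = ∧-intro (disjoint-intro H G p) q

∪-elim : ∀ {n} (H G : Subset n) u → lookup (H ∪ G) u ≡ true → lookup H u ≡ true ⊎ lookup G u ≡ true
∪-elim H G u e with lookup H u | lookup-∪ H G u
... | true  | _ = inj₁ ≡.refl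
... | false | q = inj₂ (≡.trans (≡.sym q) e)

∪-introˡ : ∀ {n} (H G : Subset n) u → lookup H u ≡ true → lookup (H ∪ G) u ≡ true
∪-introˡ H G u e = ≡.trans (lookup-∪ H G u) (≡.cong (_∨ lookup G u) e)

∪-introʳ : ∀ {n} (H G : Subset n) u → lookup G u ≡ true → lookup (H ∪ G) u ≡ true
∪-introʳ H G u e = ≡.trans (lookup-∪ H G u) (≡.trans (≡.cong (lookup H u ∨_) e) (BoolP.∨-zeroʳ _))

-- Peeling off one vertex at a time turns the link of a face into iterated vertex links, the form in
-- which the hypotheses on singularities are stated.
lkF-step : ∀ {n} (Γ : Subset n → Bool) {g G} → lookup G g ≡ true → ∀ H → lkF (lk Γ g) (G [ g ]≔ false) H ≡ lkF Γ G H
lkF-step {n} Γ {g} {G} e H = iff⇒≡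
  (λ p → let (a , b) = lkF-true {Γ = lk Γ g} {G [ g ]≔ false} {H} p ; (c , d) = lk-true {Γ = Γ} {g} {H ∪ (G [ g ]≔ false)} b in lkF-intro {Γ = Γ} {G} {H} (dis a c) (≡.trans (≡.cong Γ (≡.sym un)) d))
  (λ p → let (a , b) = lkF-true {Γ = Γ} {G} {H} p in lkF-intro {Γ = lk Γ g} {G [ g ]≔ false} {H} (λ u h q → a u h (remove-⊆ g G u q))
    (lk-intro {Γ = Γ} (¬true (λ q → case ∪-elim H (G [ g ]≔ false) g q of λ where
       (inj₁ h) → a g h e
       (inj₂ h) → true≢false h (lookup-[]≔ G g))) (≡.trans (≡.cong Γ un) b)))
  where
  un : (H ∪ (G [ g ]≔ false)) [ g ]≔ true ≡ H ∪ G
  un = sub-ext _ _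
    (λ u q → case u Fin.≟ g of λ where
      (yes ≡.refl) → ∪-introʳ H G g e
      (no ne) → case ∪-elim H (G [ g ]≔ false) u (≡.trans (≡.sym (VecP.lookup∘update′ ne (H ∪ (G [ g ]≔ false)) true)) q) of λ where
        (inj₁ h) → ∪-introˡ H G u h
        (inj₂ h) → ∪-introʳ H G u (remove-⊆ g G u h))
    (λ u q → case u Fin.≟ g of λ where
      (yes ≡.refl) → lookup-[]≔ (H ∪ (G [ g ]≔ false)) g
      (no ne) → ≡.trans (VecP.lookup∘update′ ne (H ∪ (G [ g ]≔ false)) true) (case ∪-elim H G u q of λ where
        (inj₁ h) → ∪-introˡ H (G [ g ]≔ false) u h
        (inj₂ h) → ∪-introʳ H (G [ g ]≔ false) u (≡.trans (VecP.lookup∘update′ ne G false) h)))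
  dis : (∀ u → lookup H u ≡ true → lookup (G [ g ]≔ false) u ≡ true → ⊥) → lookup (H ∪ (G [ g ]≔ false)) g ≡ false → ∀ u → lookup H u ≡ true → lookup G u ≡ true → ⊥
  dis a c u h q = case u Fin.≟ g of λ where
    (yes ≡.refl) → true≢false (∪-introˡ H (G [ g ]≔ false) g h) c
    (no ne) → a u h (≡.trans (VecP.lookup∘update′ ne G false) q)

size-zero-∅ : ∀ {n} (S : Subset n) → ∣ S ∣ ≡ 0 → S ≡ ∅
size-zero-∅ S p = sub-ext S ∅ (λ u q → ⊥-elim (true≢false q (size-zero S p u))) (λ u q → ⊥-elim (true≢false q (lookup-⊥ u)))

negSupp : ∀ {n} → Vec ℤ n → Subset n
negSupp a = tabulate (λ u → does (lookup a u ℤ.<? + 0))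

negSupp-elim : ∀ {n} (a : Vec ℤ n) u → lookup (negSupp a) u ≡ true → lookup a u ℤ.< + 0
negSupp-elim a u e = does-true (lookup a u ℤ.<? + 0) (≡.trans (≡.sym (VecP.lookup∘tabulate _ u)) e)

negSupp-intro : ∀ {n} (a : Vec ℤ n) u → lookup a u ℤ.< + 0 → lookup (negSupp a) u ≡ true
negSupp-intro a u e = ≡.trans (VecP.lookup∘tabulate _ u) (dec-true (lookup a u ℤ.<? + 0) e)

negSupp-mono : ∀ {n} (a a' : Vec ℤ n) → (∀ u → lookup a u ℤ.≤ lookup a' u) → Sub (negSupp a') (negSupp a)
negSupp-mono a a' l u e = negSupp-intro a u (ℤP.≤-<-trans (l u) (negSupp-elim a' u e))

sub-size-≡ : ∀ {n} (F G : Subset n) → Sub F G → ∣ F ∣ ≡ ∣ G ∣ → F ≡ G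
sub-size-≡ F G s e = sub-ext F G s (λ u h → case lookup F u Bool.≟ true of λ where
  (yes q) → q
  (no q) → ⊥-elim (ℕP.1+n≰n (≡.subst₂ _≤_ (size-add u F (¬true q)) (≡.sym e)
    (sub-size (F [ u ]≔ true) G (λ u' h' → case u' Fin.≟ u of λ where
      (yes ≡.refl) → h
      (no ne) → s u' (≡.trans (≡.sym (VecP.lookup∘update′ ne F true)) h'))))))

-- The multidegrees 0 and -t e_v

-- A decidable classification, so that cochains can be defined by cases on the multidegree.
-- `ray v t` stands for -(t+1) e_v, so that `t` ranges over all natural numbers.
data Pos (n : ℕ) : Set where
  origin : Pos n
  ray    : Fin n → ℕ → Pos n
  other  : Pos n

extend-pos : ∀ {n} → ℤ → Pos n → Pos (suc n)
extend-pos (+ zero)    origin    = origin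
extend-pos (+ zero)    (ray v t) = ray (suc v) t
extend-pos (-[1+ t ])  origin    = ray zero t
extend-pos _           _         = other

cls : ∀ {n} → Vec ℤ n → Pos n
cls []      = origin
cls (x ∷ a) = extend-pos x (cls a)

pt : ∀ {n} → Fin n → ℕ → Vec ℤ n
pt v t = 𝟘 [ v ]≔ -[1+ t ]

cls-𝟘 : ∀ {n} → cls (𝟘 {n}) ≡ origin
cls-𝟘 {zero}  = ≡.refl
cls-𝟘 {suc n} = ≡.cong (extend-pos (+ 0)) (cls-𝟘 {n})

cls-pt : ∀ {n} (v : Fin n) t → cls (pt v t) ≡ ray v t
cls-pt {suc n} zero    t = ≡.cong (extend-pos -[1+ t ]) (cls-𝟘 {n})
cls-pt {suc n} (suc v) t = ≡.cong (extend-pos (+ 0)) (cls-pt v t)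

lookup-pt : ∀ {n} (v : Fin n) t → lookup (pt v t) v ≡ -[1+ t ]
lookup-pt v t = VecP.lookup∘update v 𝟘 _

lookup-pt-≢ : ∀ {n} {u v : Fin n} t → u ≢ v → lookup (pt v t) u ≡ + 0
lookup-pt-≢ {u = u} t p = ≡.trans (VecP.lookup∘update′ p 𝟘 _) (lookup-𝟘 u)

dec-𝟘 : ∀ {n} (v : Fin n) → dec v 𝟘 ≡ pt v 0
dec-𝟘 v = vext (λ u → ≡.trans (lookup-- 𝟘 (unit v) u) (≡.trans (≡.cong (ℤ._- lookup (unit v) u) (lookup-𝟘 u)) (case u Fin.≟ v of λ where
  (yes ≡.refl) → ≡.trans (≡.cong (ℤ._-_ (+ 0)) (unit-refl v)) (≡.sym (lookup-pt v 0))
  (no p) → ≡.trans (≡.cong (ℤ._-_ (+ 0)) (unit-≢ p)) (≡.sym (lookup-pt-≢ 0 p)))))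

dec-pt : ∀ {n} (v : Fin n) t → dec v (pt v t) ≡ pt v (suc t)
dec-pt v t = vext (λ u → ≡.trans (lookup-- (pt v t) (unit v) u) (case u Fin.≟ v of λ where
  (yes ≡.refl) → ≡.trans (≡.cong₂ ℤ._-_ (lookup-pt v t) (unit-refl v)) (≡.trans (≡.cong (λ z → -[1+ suc z ]) (ℕP.+-identityʳ t)) (≡.sym (lookup-pt v (suc t))))
  (no p) → ≡.trans (≡.cong₂ ℤ._-_ (lookup-pt-≢ t p) (unit-≢ p)) (≡.sym (lookup-pt-≢ (suc t) p))))

two-in : ∀ {n} (G : Subset n) {u v} → u ≢ v → lookup G u ≡ true → lookup G v ≡ true → 2 ≤ ∣ G ∣
two-in G {u} {v} p eu ev = ≡.subst (2 ≤_) (size-remove u G eu) (s≤s (≡.subst (1 ≤_) (size-remove v (G [ u ]≔ false) (≡.trans (VecP.lookup∘update′ (λ e → p (≡.sym e)) G false) ev)) (s≤s z≤n)))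

-- Binomial counts

Pascal : ∀ n k → n C suc k ℕ.+ n C k ≡ suc n C suc k
Pascal n k = ≡.trans (ℕP.+-comm (n C suc k) (n C k)) (nCk+nC[k+1]≡[n+1]C[k+1] n k)

C-zero : ∀ n → n C 0 ≡ 1
C-zero n = ≡.trans (nCk≡nC[n∸k] {0} {n} z≤n) (nCn≡1 n)

Card-size : ∀ d q → Card {Subset d} (λ S → ∣ S ∣ ≡ q) (d C q)
Card-size zero    zero    = Card-1 [] ≡.refl (λ { {[]} _ → ≡.refl })
Card-size zero    (suc q) = Card-0 (λ { {[]} () })
Card-size (suc d) zero    = ≡.subst (Card _) (≡.trans (C-zero d) (≡.sym (C-zero (suc d))))
  (Card-image (false ∷_) VecP.∷-injectiveʳ id (λ { {false ∷ S} e → S , e , ≡.refl ; {true ∷ S} () }) (Card-size d zero))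
Card-size (suc d) (suc q) = ≡.subst (Card _) (Pascal d q)
  (Card-⊎ {P = λ S → Vec.head S ≡ false × ∣ S ∣ ≡ suc q} {Q = λ S → Vec.head S ≡ true × ∣ S ∣ ≡ suc q} proj₂ proj₂
    (λ { {false ∷ F} p → inj₁ (≡.refl , p) ; {true ∷ F} p → inj₂ (≡.refl , p) })
    (λ { {true ∷ F} (() , _) _ ; {false ∷ F} _ (() , _) })
    (Card-image (false ∷_) VecP.∷-injectiveʳ (λ p → ≡.refl , p) (λ { {false ∷ F} (_ , p) → F , p , ≡.refl }) (Card-size d (suc q)))
    (Card-image (true ∷_) VecP.∷-injectiveʳ (λ p → ≡.refl , ≡.cong suc p) (λ { {true ∷ F} (_ , p) → F , ℕP.suc-injective p , ≡.refl }) (Card-size d q)))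

-- The sets avoiding a fixed coordinate will index a basis of the kernel of a contraction; this is
-- the origin of the binomials of `d` next to those of `suc d`.
Card-avoid : ∀ d q (j : Fin (suc d)) → Card {Subset (suc d)} (λ S → ∣ S ∣ ≡ q × lookup S j ≡ false) (d C q)
Card-avoid d q j = Card-image (λ S → Vec.insertAt S j false)
    (λ {S} {T} e → ≡.trans (≡.sym (VecP.removeAt-insertAt S j false)) (≡.trans (≡.cong (λ R → Vec.removeAt R j) e) (VecP.removeAt-insertAt T j false)))
    (λ {S} e → ≡.trans (size-insert S j) e , VecP.insertAt-lookup S j false)
    (λ {T} (e , l) → let eq = ≡.trans (≡.cong (Vec.insertAt (Vec.removeAt T j) j) (≡.sym l)) (VecP.insertAt-removeAt T j) in
       Vec.removeAt T j , ≡.trans (≡.sym (size-insert (Vec.removeAt T j) j)) (≡.trans (≡.cong ∣_∣ eq) e) , eq)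
    (Card-size d q)
  where
  size-insert : ∀ {d} (S : Subset d) j → ∣ Vec.insertAt S j false ∣ ≡ ∣ S ∣
  size-insert S           zero    = ≡.refl
  size-insert (true ∷ S)  (suc j) = ≡.cong suc (size-insert S j)
  size-insert (false ∷ S) (suc j) = size-insert S j

-- Alternating sums and the Hilbert series of the face ring

module _ where
  open ≡.≡-Reasoning

  sumTo : (ℕ → ℤ) → ℕ → ℕ → ℤ
  sumTo f a zero    = + 0
  sumTo f a (suc k) = f (a ℕ.+ k) ℤ.+ sumTo f a k

  private
    recursion-unique : ∀ (f : ℕ → ℤ) (g h : ℕ → ℤ) → g 0 ≡ + 0 → (∀ k → g (suc k) ≡ f k ℤ.+ g k) →
      h 0 ≡ + 0 → (∀ k → h (suc k) ≡ f k ℤ.+ h k) → ∀ k → g k ≡ h k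
    recursion-unique f g h g0 gs h0 hs zero    = ≡.trans g0 (≡.sym h0)
    recursion-unique f g h g0 gs h0 hs (suc k) = ≡.trans (gs k) (≡.trans (≡.cong (ℤ._+_ (f k)) (recursion-unique f g h g0 gs h0 hs k)) (≡.sym (hs k)))

  -- The local recursion of sumℤ cannot be named here; it is found by unification.
  mutual
    private
      sumℤ-rec : (ℕ → ℤ) → ℕ → ℕ → ℕ → ℤ
      sumℤ-rec = _

    sumℤ≡ : ∀ f a b → sumℤ f a b ≡ sumTo f a (suc b ∸ a)
    sumℤ≡ f a b with suc b ∸ a
    ... | k = recursion-unique (λ k → f (a ℕ.+ k)) (sumℤ-rec f a b) (sumTo f a) ≡.refl (λ _ → ≡.refl) ≡.refl (λ _ → ≡.refl) k

  sumTo-cong : ∀ {f g} a k → (∀ j → j < k → f (a ℕ.+ j) ≡ g (a ℕ.+ j)) → sumTo f a k ≡ sumTo g a k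
  sumTo-cong a zero    e = ≡.refl
  sumTo-cong a (suc k) e = ≡.cong₂ ℤ._+_ (e k ℕP.≤-refl) (sumTo-cong a k (λ j l → e j (ℕP.m≤n⇒m≤1+n l)))

  sumTo-+ : ∀ f g a k → sumTo (λ j → f j ℤ.+ g j) a k ≡ sumTo f a k ℤ.+ sumTo g a k
  sumTo-+ f g a zero    = ≡.refl
  sumTo-+ f g a (suc k) = ≡.trans (≡.cong (ℤ._+_ (f (a ℕ.+ k) ℤ.+ g (a ℕ.+ k))) (sumTo-+ f g a k)) (rearrange (f (a ℕ.+ k)) (g (a ℕ.+ k)) (sumTo f a k) (sumTo g a k))
    where
    rearrange : ∀ x y s t → (x ℤ.+ y) ℤ.+ (s ℤ.+ t) ≡ (x ℤ.+ s) ℤ.+ (y ℤ.+ t)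
    rearrange = solve-∀

  sumTo-0 : ∀ {f} a k → (∀ j → f (a ℕ.+ j) ≡ + 0) → sumTo f a k ≡ + 0
  sumTo-0 a zero    e = ≡.refl
  sumTo-0 a (suc k) e = ≡.trans (≡.cong₂ ℤ._+_ (e k) (sumTo-0 a k e)) ≡.refl

  sumTo-first : ∀ f k → sumTo f 0 (suc k) ≡ sumTo (f ∘ suc) 0 k ℤ.+ f 0
  sumTo-first f zero    = ℤP.+-comm (f 0) (+ 0)
  sumTo-first f (suc k) = ≡.trans (≡.cong (ℤ._+_ (f (suc k))) (sumTo-first f k)) (≡.sym (ℤP.+-assoc (f (suc k)) _ _))

  sumTo-shift : ∀ f a k → sumTo f (suc a) k ≡ sumTo (f ∘ suc) a k
  sumTo-shift f a zero    = ≡.refl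
  sumTo-shift f a (suc k) = ≡.cong (ℤ._+_ (f (suc (a ℕ.+ k)))) (sumTo-shift f a k)

  sgnℤ-suc : ∀ k → sgnℤ (suc k) ≡ ℤ.- sgnℤ k
  sgnℤ-suc zero          = ≡.refl
  sgnℤ-suc (suc zero)    = ≡.refl
  sgnℤ-suc (suc (suc k)) = sgnℤ-suc k

  alt : (ℕ → ℤ) → ℕ → ℤ
  alt f zero    = f 0
  alt f (suc k) = f 0 ℤ.- alt (f ∘ suc) k

  alt-cong : ∀ {f g} k → (∀ j → j ≤ k → f j ≡ g j) → alt f k ≡ alt g k
  alt-cong zero    e = e 0 z≤n
  alt-cong (suc k) e = ≡.cong₂ ℤ._-_ (e 0 z≤n) (alt-cong k (λ j l → e (suc j) (s≤s l)))

  alt-+ : ∀ f g k → alt (λ j → f j ℤ.+ g j) k ≡ alt f k ℤ.+ alt g k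
  alt-+ f g zero    = ≡.refl
  alt-+ f g (suc k) = ≡.trans (≡.cong (ℤ._-_ (f 0 ℤ.+ g 0)) (alt-+ (f ∘ suc) (g ∘ suc) k)) (rearrange (f 0) (g 0) (alt (f ∘ suc) k) (alt (g ∘ suc) k))
    where
    rearrange : ∀ x y s t → (x ℤ.+ y) ℤ.- (s ℤ.+ t) ≡ (x ℤ.- s) ℤ.+ (y ℤ.- t)
    rearrange = solve-∀

  alt-* : ∀ c f k → alt (λ j → c ℤ.* f j) k ≡ c ℤ.* alt f k
  alt-* c f zero    = ≡.refl
  alt-* c f (suc k) = ≡.trans (≡.cong (ℤ._-_ (c ℤ.* f 0)) (alt-* c (f ∘ suc) k)) (rearrange c (f 0) (alt (f ∘ suc) k))
    where
    rearrange : ∀ c x s → c ℤ.* x ℤ.- c ℤ.* s ≡ c ℤ.* (x ℤ.- s)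
    rearrange = solve-∀

  -- Reversal of the order of summation: Koszul degree `q` becomes cohomological size `s`, and the
  -- sign turns into the parity of `I ∸ s`.
  alt-sum : ∀ (x : ℕ → ℤ) I → alt (λ q → x (I ∸ q)) I ≡ sumTo (λ s → sgnℤ (I ∸ s) ℤ.* x s) 0 (suc I)
  alt-sum x zero    = ≡.trans (≡.sym (ℤP.*-identityˡ (x 0))) (≡.sym (ℤP.+-identityʳ _))
  alt-sum x (suc I) = begin
    x (suc I) ℤ.- alt (λ q → x (I ∸ q)) I
      ≡⟨ ≡.cong (ℤ._-_ (x (suc I))) (alt-sum x I) ⟩
    x (suc I) ℤ.- sumTo (λ s → sgnℤ (I ∸ s) ℤ.* x s) 0 (suc I)
      ≡⟨ ≡.cong₂ ℤ._+_ (≡.trans (≡.sym (ℤP.*-identityˡ _)) (≡.cong (λ k → sgnℤ k ℤ.* x (suc I)) (≡.sym (ℕP.n∸n≡0 I)))) (negate (suc I) ℕP.≤-refl) ⟩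
    sgnℤ (I ∸ I) ℤ.* x (suc I) ℤ.+ sumTo (λ s → sgnℤ (suc I ∸ s) ℤ.* x s) 0 (suc I) ∎
    where
    negate : ∀ k → k ≤ suc I → ℤ.- sumTo (λ s → sgnℤ (I ∸ s) ℤ.* x s) 0 k ≡ sumTo (λ s → sgnℤ (suc I ∸ s) ℤ.* x s) 0 k
    negate zero    l = ≡.refl
    negate (suc k) (s≤s l) = ≡.trans (ℤP.neg-distrib-+ (sgnℤ (I ∸ k) ℤ.* x k) _) (≡.cong₂ ℤ._+_
      (≡.trans (ℤP.neg-distribˡ-* (sgnℤ (I ∸ k)) (x k)) (≡.cong (ℤ._* x k) (≡.trans (≡.sym (sgnℤ-suc (I ∸ k))) (≡.cong sgnℤ (≡.sym (ℕP.+-∸-assoc 1 l))))))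
      (negate k (ℕP.m≤n⇒m≤1+n l)))

  -- Multiplication of the generating series by 1 - λ.
  ∇ : (ℕ → ℤ) → ℕ → ℤ
  ∇ f zero    = f 0
  ∇ f (suc k) = f (suc k) ℤ.- f k

  ∇^ : ℕ → (ℕ → ℤ) → ℕ → ℤ
  ∇^ zero    f = f
  ∇^ (suc d) f = ∇^ d (∇ f)

  ∇-cong : ∀ {f g} → (∀ k → f k ≡ g k) → ∀ k → ∇ f k ≡ ∇ g k
  ∇-cong e zero    = e 0
  ∇-cong e (suc k) = ≡.cong₂ ℤ._-_ (e (suc k)) (e k)

  ∇^-cong : ∀ d {f g} → (∀ k → f k ≡ g k) → ∀ k → ∇^ d f k ≡ ∇^ d g k
  ∇^-cong zero    e = e
  ∇^-cong (suc d) e = ∇^-cong d (∇-cong e)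

  ∇^-+ : ∀ d f g k → ∇^ d (λ j → f j ℤ.+ g j) k ≡ ∇^ d f k ℤ.+ ∇^ d g k
  ∇^-+ zero    f g k = ≡.refl
  ∇^-+ (suc d) f g k = ≡.trans (∇^-cong d (λ where
      zero → ≡.refl
      (suc k) → rearrange (f (suc k)) (g (suc k)) (f k) (g k)) k) (∇^-+ d (∇ f) (∇ g) k)
    where
    rearrange : ∀ x y s t → (x ℤ.+ y) ℤ.- (s ℤ.+ t) ≡ (x ℤ.- s) ℤ.+ (y ℤ.- t)
    rearrange = solve-∀

  ∇^-suc : ∀ d f k → ∇^ (suc d) f k ≡ ∇ (∇^ d f) k
  ∇^-suc zero    f k = ≡.refl
  ∇^-suc (suc d) f k = ∇^-suc d (∇ f) k

  Σalt : ℕ → (ℕ → ℤ) → ℕ → ℤ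
  Σalt d f i = alt (λ q → + (d C q) ℤ.* f (i ∸ q)) i

  -- Pascal's rule gives the binomial sum the same recursion in `d` as repeated multiplication by 1
  -- - λ.
  Σalt≡∇^ : ∀ d f i → Σalt d f i ≡ ∇^ d f i
  Σalt≡∇^ zero f zero = ℤP.*-identityˡ (f 0)
  Σalt≡∇^ zero f (suc i) = ≡.trans (≡.cong (ℤ._-_ (+ 1 ℤ.* f (suc i))) (≡.trans (alt-cong {g = λ _ → + 0} i (λ j _ → ≡.refl)) (alt-zero i))) (≡.trans (ℤP.+-identityʳ _) (ℤP.*-identityˡ _))
    where
    alt-zero : ∀ k → alt (λ _ → + 0) k ≡ + 0
    alt-zero zero    = ≡.refl
    alt-zero (suc k) = ≡.cong (ℤ._-_ (+ 0)) (alt-zero k)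
  Σalt≡∇^ (suc d) f i = ≡.trans (step i) (≡.trans (∇-cong (Σalt≡∇^ d f) i) (≡.sym (∇^-suc d f i)))
    where
    step : ∀ i → Σalt (suc d) f i ≡ ∇ (Σalt d f) i
    step zero = ≡.cong (λ c → + c ℤ.* f 0) (≡.trans (C-zero (suc d)) (≡.sym (C-zero d)))
    step (suc i) = begin
      + (suc d C 0) ℤ.* f (suc i) ℤ.- alt (λ q → + (suc d C suc q) ℤ.* f (i ∸ q)) i
        ≡⟨ ≡.cong₂ ℤ._-_ (≡.cong (λ c → + c ℤ.* f (suc i)) (≡.trans (C-zero (suc d)) (≡.sym (C-zero d))))
             (≡.trans (alt-cong i (λ q _ → ≡.trans (≡.cong (λ c → + c ℤ.* f (i ∸ q)) (≡.sym (Pascal d q))) (≡.trans (≡.cong (ℤ._* f (i ∸ q)) (ℤP.pos-+ (d C suc q) (d C q))) (ℤP.*-distribʳ-+ (f (i ∸ q)) (+ (d C suc q)) (+ (d C q))))))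
               (alt-+ (λ q → + (d C suc q) ℤ.* f (i ∸ q)) (λ q → + (d C q) ℤ.* f (i ∸ q)) i)) ⟩
      + (d C 0) ℤ.* f (suc i) ℤ.- (alt (λ q → + (d C suc q) ℤ.* f (i ∸ q)) i ℤ.+ Σalt d f i)
        ≡⟨ rearrange (+ (d C 0) ℤ.* f (suc i)) (alt (λ q → + (d C suc q) ℤ.* f (i ∸ q)) i) (Σalt d f i) ⟩
      Σalt d f (suc i) ℤ.- Σalt d f i ∎
      where
      rearrange : ∀ x y z → x ℤ.- (y ℤ.+ z) ≡ (x ℤ.- y) ℤ.- z
      rearrange = solve-∀

  mutual
    -- Face-supported monomials are split by their first exponent. A positive exponent is lowered by
    -- one, after which it is zero or still positive; hence the recursion of `cpos` on the degree.
    cnt : ∀ n → (Subset n → Bool) → ℕ → ℕ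
    cnt zero    Δ zero    = if Δ [] then 1 else 0
    cnt zero    Δ (suc k) = 0
    cnt (suc n) Δ k       = cnt n (Δ ∘ (false ∷_)) k ℕ.+ cpos n (Δ ∘ (true ∷_)) k

    cpos : ∀ n → (Subset n → Bool) → ℕ → ℕ
    cpos n Δ zero    = 0
    cpos n Δ (suc k) = cnt n Δ k ℕ.+ cpos n Δ k

  mutual
    Card-monomials : ∀ n (Δ : Subset n → Bool) k → Card {Vec ℕ n} (λ e → Vec.sum e ≡ k × Δ (supp e) ≡ true) (cnt n Δ k)
    Card-monomials zero Δ zero with Δ [] in eq
    ... | true  = Card-1 [] (≡.refl , eq) (λ { {[]} _ → ≡.refl })
    ... | false = Card-0 (λ { {[]} (_ , e) → true≢false e eq })
    Card-monomials zero Δ (suc k) = Card-0 (λ { {[]} () })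
    Card-monomials (suc n) Δ k = Card-⊎
      {P = λ e → Vec.head e ≡ 0 × Vec.sum e ≡ k × Δ (supp e) ≡ true} {Q = λ e → 0 < Vec.head e × Vec.sum e ≡ k × Δ (supp e) ≡ true}
      proj₂ proj₂ (λ { {zero ∷ e} p → inj₁ (≡.refl , p) ; {suc x ∷ e} p → inj₂ (s≤s z≤n , p) })
      (λ { {zero ∷ e} _ (() , _) ; {suc x ∷ e} (() , _) _ })
      (Card-image (0 ∷_) VecP.∷-injectiveʳ (λ p → ≡.refl , p) (λ { {zero ∷ e} (_ , p) → e , p , ≡.refl }) (Card-monomials n (Δ ∘ (false ∷_)) k))
      (Card-positive n Δ k)

    Card-positive : ∀ n (Δ : Subset (suc n) → Bool) k → Card {Vec ℕ (suc n)} (λ e → 0 < Vec.head e × Vec.sum e ≡ k × Δ (supp e) ≡ true) (cpos n (Δ ∘ (true ∷_)) k)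
    Card-positive n Δ zero    = Card-0 (λ { {zero ∷ e} (() , _) ; {suc x ∷ e} (_ , () , _) })
    Card-positive n Δ (suc k) = Card-⊎
      {P = λ e → Vec.head e ≡ 1 × Vec.sum e ≡ suc k × Δ (supp e) ≡ true} {Q = λ e → 1 < Vec.head e × Vec.sum e ≡ suc k × Δ (supp e) ≡ true}
      (λ { {suc zero ∷ e} (_ , p) → s≤s z≤n , p }) (λ { {suc x ∷ e} (_ , p) → s≤s z≤n , p })
      (λ { {zero ∷ e} (() , _) ; {suc zero ∷ e} (_ , p) → inj₁ (≡.refl , p) ; {suc (suc x) ∷ e} (_ , p) → inj₂ (s≤s (s≤s z≤n) , p) })
      (λ { {suc zero ∷ e} _ (s≤s () , _) ; {suc (suc x) ∷ e} (() , _) _ })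
      (Card-image (1 ∷_) VecP.∷-injectiveʳ (λ (p , q) → ≡.refl , ≡.cong suc p , q) (λ { {suc zero ∷ e} (_ , p , q) → e , (ℕP.suc-injective p , q) , ≡.refl }) (Card-monomials n (Δ ∘ (true ∷_)) k))
      (Card-image bump (λ { {x ∷ e} {y ∷ f} p → ≡.cong₂ _∷_ (ℕP.suc-injective (VecP.∷-injectiveˡ p)) (VecP.∷-injectiveʳ p) })
        (λ { {suc x ∷ e} (_ , p , q) → s≤s (s≤s z≤n) , ≡.cong suc p , q })
        (λ { {suc (suc x) ∷ e} (_ , p , q) → suc x ∷ e , (s≤s z≤n , ℕP.suc-injective p , q) , ≡.refl ; {suc zero ∷ e} (s≤s () , _) }) (Card-positive n Δ k))
      where
      bump : Vec ℕ (suc n) → Vec ℕ (suc n)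
      bump (x ∷ e) = suc x ∷ e

  private
    sumL-++ : ∀ xs ys → sumL (xs List.++ ys) ≡ sumL xs ℕ.+ sumL ys
    sumL-++ []       ys = ≡.refl
    sumL-++ (x ∷ xs) ys = ≡.trans (≡.cong (x ℕ.+_) (sumL-++ xs ys)) (≡.sym (ℕP.+-assoc x _ _))

    sumL-0 : ∀ {A : Set} (f : A → ℕ) → (∀ a → f a ≡ 0) → ∀ xs → sumL (List.map f xs) ≡ 0
    sumL-0 f e []       = ≡.refl
    sumL-0 f e (x ∷ xs) = ≡.cong₂ ℕ._+_ (e x) (sumL-0 f e xs)

    ∧-zero : ∀ b → (if b ∧ false then 1 else 0) ≡ 0
    ∧-zero true  = ≡.refl
    ∧-zero false = ≡.refl

    fcount-split : ∀ n (Δ : Subset (suc n) → Bool) j → fcount Δ j ≡ fcount (Δ ∘ (false ∷_)) j ℕ.+ sumL (List.map (λ F → if Δ (true ∷ F) ∧ (suc ∣ F ∣ ≡ᵇ j) then 1 else 0) (allSubsets n))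
    fcount-split n Δ j = ≡.trans (≡.cong sumL (ListP.map-++ w (List.map (false ∷_) (allSubsets n)) _)) (≡.trans (sumL-++ (List.map w (List.map (false ∷_) (allSubsets n))) _)
      (≡.cong₂ (λ x y → sumL x ℕ.+ sumL y) (≡.sym (ListP.map-∘ (allSubsets n))) (≡.sym (ListP.map-∘ (allSubsets n)))))
      where
      w : Subset (suc n) → ℕ
      w F = if Δ F ∧ (∣ F ∣ ≡ᵇ j) then 1 else 0

  fcount-zero : ∀ n (Δ : Subset (suc n) → Bool) → fcount Δ 0 ≡ fcount (Δ ∘ (false ∷_)) 0
  fcount-zero n Δ = ≡.trans (fcount-split n Δ 0) (≡.trans (≡.cong (fcount (Δ ∘ (false ∷_)) 0 ℕ.+_) (sumL-0 _ (λ F → ∧-zero (Δ (true ∷ F))) (allSubsets n))) (ℕP.+-identityʳ _))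

  fcount-suc : ∀ n (Δ : Subset (suc n) → Bool) j → fcount Δ (suc j) ≡ fcount (Δ ∘ (false ∷_)) (suc j) ℕ.+ fcount (Δ ∘ (true ∷_)) j
  fcount-suc n Δ j = fcount-split n Δ (suc j)

  hterm : (ℕ → ℕ) → ℕ → ℕ → ℕ → ℤ
  hterm F d i j = sgnℤ (i ∸ j) ℤ.* (+ ((d ∸ j) C (i ∸ j)) ℤ.* + F j)

  hsum : (ℕ → ℕ) → ℕ → ℕ → ℤ
  hsum F d i = sumTo (hterm F d i) 0 (suc i)

  hsum-+ : ∀ {F G H} d i → (∀ j → H j ≡ F j ℕ.+ G j) → hsum H d i ≡ hsum F d i ℤ.+ hsum G d i
  hsum-+ {F} {G} {H} d i e = ≡.trans (sumTo-cong 0 (suc i) (λ j _ → ≡.trans (≡.cong (λ x → sgnℤ (i ∸ j) ℤ.* (+ ((d ∸ j) C (i ∸ j)) ℤ.* x)) (≡.trans (≡.cong +_ (e j)) (ℤP.pos-+ (F j) (G j))))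
      (rearrange (sgnℤ (i ∸ j)) (+ ((d ∸ j) C (i ∸ j))) (+ F j) (+ G j)))) (sumTo-+ (hterm F d i) (hterm G d i) 0 (suc i))
    where
    rearrange : ∀ s c x y → s ℤ.* (c ℤ.* (x ℤ.+ y)) ≡ s ℤ.* (c ℤ.* x) ℤ.+ s ℤ.* (c ℤ.* y)
    rearrange = solve-∀

  private
    *0*0 : ∀ s c → s ℤ.* (c ℤ.* + 0) ≡ + 0
    *0*0 s c = ≡.trans (≡.cong (ℤ._*_ s) (ℤP.*-zeroʳ c)) (ℤP.*-zeroʳ s)

  hsum-0 : ∀ {F} d i → (∀ j → F j ≡ 0) → hsum F d i ≡ + 0
  hsum-0 {F} d i e = sumTo-0 0 (suc i) (λ j → ≡.trans (≡.cong (λ x → sgnℤ (i ∸ j) ℤ.* (+ ((d ∸ j) C (i ∸ j)) ℤ.* + x)) (e j)) (*0*0 (sgnℤ (i ∸ j)) (+ ((d ∸ j) C (i ∸ j)))))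

  -- Face numbers of the faces through the first vertex: removing the vertex lowers the size by one,
  -- and with it both `d` and `i` in the h-vector.
  delay : (ℕ → ℕ) → ℕ → ℕ
  delay F zero    = 0
  delay F (suc j) = F j

  hsum-delay : ∀ F d i → hsum (delay F) (suc d) (suc i) ≡ hsum F d i
  hsum-delay F d i = ≡.trans (sumTo-first (hterm (delay F) (suc d) (suc i)) (suc i)) (≡.trans (≡.cong (ℤ._+_ (hsum F d i)) (*0*0 (sgnℤ (suc i)) (+ (suc d C suc i)))) (ℤP.+-identityʳ _))

  hsum-delay-0 : ∀ F d → hsum (delay F) d 0 ≡ + 0
  hsum-delay-0 F d = ≡.trans (ℤP.+-identityʳ _) (*0*0 (sgnℤ 0) (+ (d C 0)))

  shiftℤ : (ℕ → ℤ) → ℕ → ℤ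
  shiftℤ f zero    = + 0
  shiftℤ f (suc k) = f k

  ∇^-shift : ∀ d f k → ∇^ d (shiftℤ f) k ≡ shiftℤ (∇^ d f) k
  ∇^-shift zero    f k = ≡.refl
  ∇^-shift (suc d) f k = ≡.trans (∇^-cong d (λ where
    zero → ≡.refl
    (suc zero) → ℤP.+-identityʳ (f 0)
    (suc (suc k)) → ≡.refl) k) (∇^-shift d (∇ f) k)

  private
    δ₀ : ℕ → ℕ → ℤ
    δ₀ c zero    = + c
    δ₀ c (suc k) = + 0

    ∇^-δ₀ : ∀ d c i → ∇^ d (δ₀ c) i ≡ sgnℤ i ℤ.* (+ (d C i) ℤ.* + c)
    ∇^-δ₀ zero    c zero    = ≡.sym (≡.trans (ℤP.*-identityˡ _) (ℤP.*-identityˡ (+ c)))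
    ∇^-δ₀ zero    c (suc i) = ≡.sym (≡.trans (≡.cong (ℤ._*_ (sgnℤ (suc i))) (ℤP.*-zeroˡ (+ c))) (ℤP.*-zeroʳ (sgnℤ (suc i))))
    ∇^-δ₀ (suc d) c zero    = ≡.trans (∇^-suc d (δ₀ c) 0) (≡.trans (∇^-δ₀ d c 0) (≡.cong (λ z → sgnℤ 0 ℤ.* (+ z ℤ.* + c)) (≡.trans (C-zero d) (≡.sym (C-zero (suc d))))))
    ∇^-δ₀ (suc d) c (suc i) = ≡.trans (∇^-suc d (δ₀ c) (suc i)) (≡.trans (≡.cong₂ ℤ._-_ (∇^-δ₀ d c (suc i)) (∇^-δ₀ d c i))
      (≡.trans (≡.cong (λ s → s ℤ.* (+ (d C suc i) ℤ.* + c) ℤ.- sgnℤ i ℤ.* (+ (d C i) ℤ.* + c)) (sgnℤ-suc i)) (≡.trans (rearrange (sgnℤ i) (+ (d C suc i)) (+ (d C i)) (+ c))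
        (≡.cong₂ (λ s z → s ℤ.* (z ℤ.* + c)) (≡.sym (sgnℤ-suc i)) (≡.trans (≡.sym (ℤP.pos-+ (d C suc i) (d C i))) (≡.cong +_ (Pascal d i)))))))
      where
      rearrange : ∀ s x y c → (ℤ.- s) ℤ.* (x ℤ.* c) ℤ.- s ℤ.* (y ℤ.* c) ≡ (ℤ.- s) ℤ.* ((x ℤ.+ y) ℤ.* c)
      rearrange = solve-∀

  cnt-empty : ∀ n {Δ : Subset n → Bool} → (∀ F → Δ F ≡ false) → ∀ k → cnt n Δ k ≡ 0
  cnt-empty zero    e zero    = ≡.cong (λ b → if b then 1 else 0) (e [])
  cnt-empty zero    e (suc k) = ≡.refl
  cnt-empty (suc n) {Δ} e k = ≡.cong₂ ℕ._+_ (cnt-empty n (λ F → e (false ∷ F)) k) (pos-empty k)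
    where
    pos-empty : ∀ k → cpos n (Δ ∘ (true ∷_)) k ≡ 0
    pos-empty zero    = ≡.refl
    pos-empty (suc k) = ≡.cong₂ ℕ._+_ (cnt-empty n (λ F → e (true ∷ F)) k) (pos-empty k)

  fcount-empty : ∀ n {Δ : Subset n → Bool} → (∀ F → Δ F ≡ false) → ∀ j → fcount Δ j ≡ 0
  fcount-empty n {Δ} e j = sumL-0 _ (λ F → ≡.cong (λ b → if b ∧ (∣ F ∣ ≡ᵇ j) then 1 else 0) (e F)) (allSubsets n)

  -- Induction on the vertices. Faces through the first vertex contribute λ/(1 - λ) times the series
  -- of what is left of them, so they use up one of the `d` factors 1 - λ; the bound on face sizes
  -- guarantees that the factor is there.
  ∇^-cnt : ∀ n (Δ : Subset n → Bool) d → (∀ F → Δ F ≡ true → ∣ F ∣ ≤ d) → ∀ i → ∇^ d (λ k → + cnt n Δ k) i ≡ hsum (fcount Δ) d i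
  ∇^-cnt zero Δ d dm i = begin
    ∇^ d (λ k → + cnt 0 Δ k) i          ≡⟨ ∇^-cong d (λ { zero → ≡.refl ; (suc k) → ≡.refl }) i ⟩
    ∇^ d (δ₀ (cnt 0 Δ 0)) i             ≡⟨ ∇^-δ₀ d (cnt 0 Δ 0) i ⟩
    sgnℤ i ℤ.* (+ (d C i) ℤ.* + cnt 0 Δ 0)  ≡⟨ ≡.cong (λ c → sgnℤ i ℤ.* (+ (d C i) ℤ.* + c)) f0 ⟩
    sgnℤ i ℤ.* (+ (d C i) ℤ.* + fcount Δ 0)  ≡⟨ ≡.sym (ℤP.+-identityˡ _) ⟩
    + 0 ℤ.+ sgnℤ i ℤ.* (+ (d C i) ℤ.* + fcount Δ 0)  ≡⟨ ≡.cong (ℤ._+ (sgnℤ i ℤ.* (+ (d C i) ℤ.* + fcount Δ 0))) (≡.sym (sumTo-0 0 i (λ j → ≡.trans (≡.cong (λ x → sgnℤ (i ∸ suc j) ℤ.* (+ ((d ∸ suc j) C (i ∸ suc j)) ℤ.* + x)) (fs j)) (*0*0 (sgnℤ (i ∸ suc j)) (+ ((d ∸ suc j) C (i ∸ suc j))))))) ⟩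
    sumTo (term ∘ suc) 0 i ℤ.+ term 0  ≡⟨ ≡.sym (sumTo-first term i) ⟩
    hsum (fcount Δ) d i ∎
    where
    term : ℕ → ℤ
    term = hterm (fcount Δ) d i
    f0 : cnt 0 Δ 0 ≡ fcount Δ 0
    f0 with Δ []
    ... | true  = ≡.refl
    ... | false = ≡.refl
    fs : ∀ j → fcount Δ (suc j) ≡ 0
    fs j with Δ []
    ... | true  = ≡.refl
    ... | false = ≡.refl
  ∇^-cnt (suc n) Δ d dm i = begin
    ∇^ d (λ k → + (cnt n Δf k ℕ.+ cpos n Δt k)) i        ≡⟨ ∇^-cong d (λ k → ℤP.pos-+ (cnt n Δf k) (cpos n Δt k)) i ⟩
    ∇^ d (λ k → + cnt n Δf k ℤ.+ + cpos n Δt k) i        ≡⟨ ∇^-+ d (λ k → + cnt n Δf k) (λ k → + cpos n Δt k) i ⟩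
    ∇^ d (λ k → + cnt n Δf k) i ℤ.+ ∇^ d (λ k → + cpos n Δt k) i  ≡⟨ ≡.cong₂ ℤ._+_ (∇^-cnt n Δf d (λ F → dm (false ∷ F)) i) (rest d dm i) ⟩
    hsum (fcount Δf) d i ℤ.+ hsum (delay (fcount Δt)) d i  ≡⟨ ≡.sym (hsum-+ d i (λ { zero → ≡.trans (fcount-zero n Δ) (≡.sym (ℕP.+-identityʳ _)) ; (suc j) → fcount-suc n Δ j })) ⟩
    hsum (fcount Δ) d i ∎
    where
    Δf = Δ ∘ (false ∷_)
    Δt = Δ ∘ (true ∷_)
    rest : ∀ d → (∀ F → Δ F ≡ true → ∣ F ∣ ≤ d) → ∀ i → ∇^ d (λ k → + cpos n Δt k) i ≡ hsum (delay (fcount Δt)) d i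
    -- No factor is left, but then no face contains the first vertex.
    rest zero dm i = ≡.trans (≡.cong +_ (pos-empty i)) (≡.sym (hsum-0 0 i (λ { zero → ≡.refl ; (suc j) → fcount-empty n empty j })))
      where
      empty : ∀ F → Δt F ≡ false
      empty F = ¬true (λ e → case dm (true ∷ F) e of λ ())
      pos-empty : ∀ k → cpos n Δt k ≡ 0
      pos-empty zero    = ≡.refl
      pos-empty (suc k) = ≡.cong₂ ℕ._+_ (cnt-empty n empty k) (pos-empty k)
    rest (suc d) dm i = ≡.trans (∇^-cong d (λ { zero → ≡.refl ; (suc k) → ≡.trans (≡.cong (ℤ._- + cpos n Δt k) (ℤP.pos-+ (cnt n Δt k) (cpos n Δt k))) (cancel (+ cnt n Δt k) (+ cpos n Δt k)) }) i)
        (≡.trans (∇^-shift d (λ k → + cnt n Δt k) i) (by-cases i))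
      where
      cancel : ∀ x y → (x ℤ.+ y) ℤ.- y ≡ x
      cancel = solve-∀
      by-cases : ∀ i → shiftℤ (∇^ d (λ k → + cnt n Δt k)) i ≡ hsum (delay (fcount Δt)) (suc d) i
      by-cases zero    = ≡.sym (hsum-delay-0 (fcount Δt) (suc d))
      by-cases (suc i) = ≡.trans (∇^-cnt n Δt d (λ F e → ℕP.≤-pred (dm (true ∷ F) e)) i) (≡.sym (hsum-delay (fcount Δt) d i))

  -- The Hilbert series of k[Δ] multiplied by (1 - λ)^d.
  hvec-Σalt : ∀ n (Δ : Subset n → Bool) d → (∀ F → Δ F ≡ true → ∣ F ∣ ≤ d) → ∀ i → Σalt d (λ k → + cnt n Δ k) i ≡ hvec Δ d i
  hvec-Σalt n Δ d dm i = ≡.trans (Σalt≡∇^ d (λ k → + cnt n Δ k) i) (≡.trans (∇^-cnt n Δ d dm i) (≡.sym (sumℤ≡ (hterm (fcount Δ) d i) 0 i)))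

-- Natural exponents and their integer multidegrees

indᵥ : ∀ {n} → Subset n → Vec ℕ n
indᵥ F = Vec.map (λ b → if b then 1 else 0) F

lookup-∸ : ∀ {n} (e m : Vec ℕ n) u → lookup (zipWith _∸_ e m) u ≡ lookup e u ∸ lookup m u
lookup-∸ e m u = VecP.lookup-zipWith _∸_ u e m

inc-≤ : ∀ {n} (m : Vec ℕ n) w u → lookup m u ≤ lookup (inc w m) u
inc-≤ m w u with u Fin.≟ w
... | yes ≡.refl = ℕP.≤-trans (ℕP.n≤1+n _) (ℕP.≤-reflexive (≡.sym (VecP.lookup∘updateAt w m)))
... | no p = ℕP.≤-reflexive (≡.sym (VecP.lookup∘updateAt′ u w p m))

pred⇒inc : ∀ {n} (m e : Vec ℕ n) w → 0 < lookup e w → updateAt e w ℕ.pred ≡ m → e ≡ inc w m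
pred⇒inc m (suc x ∷ e) zero    p ≡.refl = ≡.refl
pred⇒inc (a ∷ m) (x ∷ e) (suc w) p q = ≡.cong₂ _∷_ (VecP.∷-injectiveˡ q) (pred⇒inc m e w p (VecP.∷-injectiveʳ q))

pred-incᵥ : ∀ {n} (e : Vec ℕ n) w → updateAt (inc w e) w ℕ.pred ≡ e
pred-incᵥ (x ∷ e) zero    = ≡.refl
pred-incᵥ (x ∷ e) (suc w) = ≡.cong (x ∷_) (pred-incᵥ e w)

inc-posᵥ : ∀ {n} (e : Vec ℕ n) w → 0 < lookup (inc w e) w
inc-posᵥ (x ∷ e) zero    = s≤s z≤n
inc-posᵥ (x ∷ e) (suc w) = inc-posᵥ e w

inc-pred : ∀ {n} (e : Vec ℕ n) w → 0 < lookup e w → inc w (updateAt e w ℕ.pred) ≡ e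
inc-pred e w p = ≡.sym (pred⇒inc _ e w p ≡.refl)

sum-inc : ∀ {n} (e : Vec ℕ n) w → Vec.sum (inc w e) ≡ suc (Vec.sum e)
sum-inc (x ∷ e) zero    = ≡.refl
sum-inc (x ∷ e) (suc w) = ≡.trans (≡.cong (x ℕ.+_) (sum-inc e w)) (ℕP.+-suc x _)

supp-true : ∀ {n} (e : Vec ℕ n) u → lookup (supp e) u ≡ true → 0 < lookup e u
supp-true e u p = does-true (0 ℕ.<? lookup e u) (≡.trans (≡.sym (VecP.lookup-map u _ e)) p)

supp-intro : ∀ {n} (e : Vec ℕ n) u → 0 < lookup e u → lookup (supp e) u ≡ true
supp-intro e u p = ≡.trans (VecP.lookup-map u _ e) (dec-true (0 ℕ.<? lookup e u) p)

lookup-ind : ∀ {n} (F : Subset n) u → lookup (indᵥ F) u ≡ (if lookup F u then 1 else 0)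
lookup-ind F u = VecP.lookup-map u _ F

ind-supp-≤ : ∀ {n} (e : Vec ℕ n) u → lookup (indᵥ (supp e)) u ≤ lookup e u
ind-supp-≤ e u = ℕP.≤-trans (ℕP.≤-reflexive (lookup-ind (supp e) u)) (at (lookup (supp e) u) ≡.refl)
  where
  at : ∀ b → lookup (supp e) u ≡ b → (if b then 1 else 0) ≤ lookup e u
  at true  p = supp-true e u p
  at false p = z≤n

toℤ : ∀ {n} → Vec ℕ n → Vec ℤ n
toℤ = Vec.map +_

absᵥ : ∀ {n} → Vec ℤ n → Vec ℕ n
absᵥ = Vec.map ℤ.∣_∣

toℤ-abs : ∀ {n} (a : Vec ℤ n) → (∀ u → + 0 ℤ.≤ lookup a u) → toℤ (absᵥ a) ≡ a
toℤ-abs []      p = ≡.refl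
toℤ-abs (x ∷ a) p = ≡.cong₂ _∷_ (ℤP.0≤i⇒+∣i∣≡i (p zero)) (toℤ-abs a (p ∘ suc))

abs-toℤ : ∀ {n} (e : Vec ℕ n) → absᵥ (toℤ e) ≡ e
abs-toℤ []      = ≡.refl
abs-toℤ (x ∷ e) = ≡.cong (x ∷_) (abs-toℤ e)

lookup-toℤ : ∀ {n} (e : Vec ℕ n) u → lookup (toℤ e) u ≡ + lookup e u
lookup-toℤ e u = VecP.lookup-map u +_ e

mrg-toℤ : ∀ {n} (e : Vec ℕ n) → mrg ∅ (toℤ e) ≡ supp e
mrg-toℤ e = sub-ext _ _
  (λ u p → supp-intro e u (case mrg-elim ∅ (toℤ e) u p of λ where
    (inj₁ q) → ⊥-elim (true≢false q (lookup-⊥ u))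
    (inj₂ q) → ℤP.drop‿+<+ (≡.subst (+ 0 ℤ.<_) (lookup-toℤ e u) q)))
  (λ u p → mrg-a ∅ (toℤ e) u (≡.subst (+ 0 ℤ.<_) (≡.sym (lookup-toℤ e u)) (ℤ.+<+ (supp-true e u p))))

dec-toℤ : ∀ {n} (e : Vec ℕ n) w → 0 < lookup e w → dec w (toℤ e) ≡ toℤ (updateAt e w ℕ.pred)
dec-toℤ e w p = vext (λ u → ≡.trans (lookup-- (toℤ e) (unit w) u) (case u Fin.≟ w of λ where
  (yes ≡.refl) → ≡.trans (≡.cong₂ ℤ._-_ (lookup-toℤ e w) (unit-refl w)) (≡.trans (minus-one (lookup e w) p) (≡.sym (≡.trans (lookup-toℤ (updateAt e w ℕ.pred) w) (≡.cong +_ (VecP.lookup∘updateAt w e)))))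
  (no ne) → ≡.trans (≡.cong₂ ℤ._-_ (lookup-toℤ e u) (unit-≢ ne)) (≡.trans (ℤP.+-identityʳ _) (≡.sym (≡.trans (lookup-toℤ (updateAt e w ℕ.pred) u) (≡.cong +_ (VecP.lookup∘updateAt′ u w ne e)))))))
  where
  minus-one : ∀ k → 0 < k → + k ℤ.- + 1 ≡ + ℕ.pred k
  minus-one (suc k) _ = ≡.refl

-- Alternating sums of ranks and Betti numbers

-- Unlike `alt` this has `k` terms, possibly none: the sum over positive Koszul homology is one term
-- shorter than the sum over Koszul terms.
alt′ : (ℕ → ℤ) → ℕ → ℤ
alt′ f zero    = + 0
alt′ f (suc k) = f 0 ℤ.- alt′ (f ∘ suc) k

alt′-cong : ∀ {f g} k → (∀ j → j < k → f j ≡ g j) → alt′ f k ≡ alt′ g k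
alt′-cong zero    e = ≡.refl
alt′-cong (suc k) e = ≡.cong₂ ℤ._-_ (e 0 (s≤s z≤n)) (alt′-cong k (λ j l → e (suc j) (s≤s l)))

alt′≡alt : ∀ f k → alt′ f (suc k) ≡ alt f k
alt′≡alt f zero    = ℤP.+-identityʳ (f 0)
alt′≡alt f (suc k) = ≡.cong (ℤ._-_ (f 0)) (alt′≡alt (f ∘ suc) k)

sum-nonpos : ∀ {n} (a : Vec ℤ n) → (∀ u → lookup a u ℤ.≤ + 0) → sumᵥ a ℤ.≤ + 0
sum-nonpos []      p = ℤP.≤-refl
sum-nonpos (x ∷ a) p = ℤP.+-mono-≤ (p zero) (sum-nonpos a (p ∘ suc))

module _ where
  open ≡.≡-Reasoning

  +-vanishes : ∀ {x y} → y ≡ + 0 → x ℤ.+ y ≡ x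
  +-vanishes {x} ≡.refl = ℤP.+-identityʳ x

  sumFinℤ-cong : ∀ {n} {f g : Fin n → ℤ} → (∀ v → f v ≡ g v) → sumFinℤ f ≡ sumFinℤ g
  sumFinℤ-cong {zero}  e = ≡.refl
  sumFinℤ-cong {suc n} e = ≡.cong₂ ℤ._+_ (e zero) (sumFinℤ-cong (e ∘ suc))

  sumFinℤ-0 : ∀ {n} {f : Fin n → ℤ} → (∀ v → f v ≡ + 0) → sumFinℤ f ≡ + 0
  sumFinℤ-0 {zero}  e = ≡.refl
  sumFinℤ-0 {suc n} e = ≡.cong₂ ℤ._+_ (e zero) (sumFinℤ-0 (e ∘ suc))

  sumFinℤ-sumTo : ∀ {n} (s : ℕ → ℤ) (f : Fin n → ℕ → ℕ) k →
    sumFinℤ (λ v → sumTo (λ j → s j ℤ.* + f v j) 0 k) ≡ sumTo (λ j → s j ℤ.* + sumℕ (λ v → f v j)) 0 k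
  sumFinℤ-sumTo {zero}  s f k = ≡.sym (sumTo-0 0 k (λ j → ℤP.*-zeroʳ (s j)))
  sumFinℤ-sumTo {suc n} s f k = begin
    sumTo (λ j → s j ℤ.* + f zero j) 0 k ℤ.+ sumFinℤ (λ v → sumTo (λ j → s j ℤ.* + f (suc v) j) 0 k)
      ≡⟨ ≡.cong (ℤ._+_ (sumTo (λ j → s j ℤ.* + f zero j) 0 k)) (sumFinℤ-sumTo s (f ∘ suc) k) ⟩
    sumTo (λ j → s j ℤ.* + f zero j) 0 k ℤ.+ sumTo (λ j → s j ℤ.* + sumℕ (λ v → f (suc v) j)) 0 k
      ≡⟨ sumTo-+ _ _ 0 k ⟨
    sumTo (λ j → s j ℤ.* + f zero j ℤ.+ s j ℤ.* + sumℕ (λ v → f (suc v) j)) 0 k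
      ≡⟨ sumTo-cong 0 k (λ j _ → ≡.trans (≡.sym (ℤP.*-distribˡ-+ (s j) _ _)) (≡.cong (ℤ._*_ (s j)) (≡.sym (ℤP.pos-+ (f zero j) _)))) ⟩
    sumTo (λ j → s j ℤ.* + sumℕ (λ v → f v j)) 0 k ∎

  -- In the alternating sum all kernels but the last cancel against cokernels up to the
  -- difference of the dimensions of target and source.
  rank-telescope : ∀ (ker coker rank : ℕ → ℕ) (source target : ℕ → ℕ) I →
    (∀ s → s ≤ I → ker s ℕ.+ rank s ≡ source s) → (∀ s → s ≤ I → coker s ℕ.+ rank s ≡ target s) → source 0 ≡ 0 →
    alt (λ j → + (ker (suc (I ∸ j)) ℕ.+ coker (I ∸ j))) I ≡ + ker (suc I) ℤ.+ alt (λ j → + target (I ∸ j) ℤ.- + source (I ∸ j)) I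
  rank-telescope ker coker rank source target zero k c z = begin
    + (ker 1 ℕ.+ coker 0)                            ≡⟨ ≡.cong (λ x → + (ker 1 ℕ.+ x)) coker≡ ⟩
    + (ker 1 ℕ.+ target 0)                           ≡⟨ ≡.cong +_ (≡.cong (ker 1 ℕ.+_) (ℕP.+-identityʳ (target 0))) ⟨
    + (ker 1) ℤ.+ (+ target 0 ℤ.- + 0)               ≡⟨ ≡.cong (λ x → + ker 1 ℤ.+ (+ target 0 ℤ.- + x)) z ⟨
    + ker 1 ℤ.+ (+ target 0 ℤ.- + source 0)          ∎
    where
    -- A vanishing source at level zero forces kernel and rank there to vanish, so the cokernel is
    -- the whole target.
    coker≡ : coker 0 ≡ target 0
    coker≡ = ≡.trans (≡.sym (ℕP.+-identityʳ _)) (≡.trans (≡.cong (coker 0 ℕ.+_) (≡.sym (ℕP.m+n≡0⇒n≡0 (ker 0) (≡.trans (k 0 z≤n) z)))) (c 0 z≤n))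
  rank-telescope ker coker rank source target (suc I) k c z = begin
    + (ker (suc (suc I)) ℕ.+ coker (suc I)) ℤ.- alt (λ j → + (ker (suc (I ∸ j)) ℕ.+ coker (I ∸ j))) I
      ≡⟨ ≡.cong (ℤ._-_ (+ (ker (suc (suc I)) ℕ.+ coker (suc I)))) (rank-telescope ker coker rank source target I (λ s l → k s (ℕP.m≤n⇒m≤1+n l)) (λ s l → c s (ℕP.m≤n⇒m≤1+n l)) z) ⟩
    + (ker (suc (suc I)) ℕ.+ coker (suc I)) ℤ.- (+ ker (suc I) ℤ.+ A)
      ≡⟨ step (ker (suc (suc I))) (coker (suc I)) (ker (suc I)) (rank (suc I)) A (k (suc I) ℕP.≤-refl) (c (suc I) ℕP.≤-refl) ⟩
    + ker (suc (suc I)) ℤ.+ ((+ target (suc I) ℤ.- + source (suc I)) ℤ.- A) ∎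
    where
    A = alt (λ j → + target (I ∸ j) ℤ.- + source (I ∸ j)) I
    rearrange : ∀ x c k r A → (x ℤ.+ c) ℤ.- (k ℤ.+ A) ≡ x ℤ.+ (((c ℤ.+ r) ℤ.- (k ℤ.+ r)) ℤ.- A)
    rearrange = solve-∀
    step : ∀ x c k r A {s t} → k ℕ.+ r ≡ s → c ℕ.+ r ≡ t → + (x ℕ.+ c) ℤ.- (+ k ℤ.+ A) ≡ + x ℤ.+ ((+ t ℤ.- + s) ℤ.- A)
    step x c k r A ≡.refl ≡.refl = rearrange (+ x) (+ c) (+ k) (+ r) A

  module _ {n : ℕ} (β : ℕ → ℕ) (βlk : Fin n → ℕ → ℕ) where
    -- Dimensions of H̃^{s-1}(Δ) and ⨁_v H̃^{s-2}(lk v); the number e₁ is that of H̃^{-1}(lk v).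
    bettiΔ : ℕ → ℕ
    bettiΔ zero    = 0
    bettiΔ (suc s) = β s

    bettiLk : ℕ → Fin n → ℕ → ℕ
    bettiLk e₁ v zero    = e₁
    bettiLk e₁ v (suc s) = βlk v s

    bettiLks : ℕ → ℕ → ℕ
    bettiLks e₁ zero    = 0
    bettiLks e₁ (suc s) = sumℕ (λ v → bettiLk e₁ v s)

    betti-sum : ∀ I → alt (λ j → + bettiΔ (I ∸ j)) I ≡ sumℤ (λ j → sgnℤ (suc I ∸ j ∸ 1) ℤ.* + β (j ∸ 1)) 1 I
    betti-sum I = begin
      alt (λ j → + bettiΔ (I ∸ j)) I                                       ≡⟨ alt-sum (λ s → + bettiΔ s) I ⟩
      sumTo (λ s → sgnℤ (I ∸ s) ℤ.* + bettiΔ s) 0 (suc I)                  ≡⟨ sumTo-first (λ s → sgnℤ (I ∸ s) ℤ.* + bettiΔ s) I ⟩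
      sumTo (λ s → sgnℤ (I ∸ suc s) ℤ.* + β s) 0 I ℤ.+ sgnℤ I ℤ.* + 0      ≡⟨ +-vanishes (ℤP.*-zeroʳ (sgnℤ I)) ⟩
      sumTo (λ s → sgnℤ (I ∸ suc s) ℤ.* + β s) 0 I                         ≡⟨ sumTo-cong 0 I (λ j _ → ≡.cong (λ k → sgnℤ k ℤ.* + β j) (≡.sym (≡.trans (ℕP.∸-+-assoc I j 1) (≡.cong (I ∸_) (ℕP.+-comm j 1))))) ⟩
      sumTo (λ s → sgnℤ (I ∸ s ∸ 1) ℤ.* + β s) 0 I                         ≡⟨ sumTo-shift (λ j → sgnℤ (suc I ∸ j ∸ 1) ℤ.* + β (j ∸ 1)) 0 I ⟨
      sumTo (λ j → sgnℤ (suc I ∸ j ∸ 1) ℤ.* + β (j ∸ 1)) 1 I               ≡⟨ sumℤ≡ _ 1 I ⟨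
      sumℤ (λ j → sgnℤ (suc I ∸ j ∸ 1) ℤ.* + β (j ∸ 1)) 1 I ∎

    -- The left side contains a contribution of degree -1 of the links that the formula does not
    -- have. It enters exactly when `I` is positive, and there the hypothesis kills it.
    bettiLk-sum : ∀ e₁ I → (1 ≤ I → e₁ ≡ 0) →
      alt (λ j → + bettiLks e₁ (I ∸ j)) I ≡ sumFinℤ (λ v → sumℤ (λ j → sgnℤ (suc I ∸ j) ℤ.* + βlk v (j ∸ 1)) 1 (I ∸ 1))
    bettiLk-sum e₁ zero    z = ≡.sym (sumFinℤ-0 {n} (λ v → sumℤ≡ (λ j → sgnℤ (1 ∸ j) ℤ.* + βlk v (j ∸ 1)) 1 0))
    bettiLk-sum e₁ (suc I) z = begin
      alt (λ j → + bettiLks e₁ (suc I ∸ j)) (suc I)                         ≡⟨ alt-sum (λ s → + bettiLks e₁ s) (suc I) ⟩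
      sumTo (λ s → sgnℤ (suc I ∸ s) ℤ.* + bettiLks e₁ s) 0 (suc (suc I))    ≡⟨ sumTo-first (λ s → sgnℤ (suc I ∸ s) ℤ.* + bettiLks e₁ s) (suc I) ⟩
      sumTo (λ s → sgnℤ (I ∸ s) ℤ.* + bettiLks e₁ (suc s)) 0 (suc I) ℤ.+ sgnℤ (suc I) ℤ.* + 0
                                                                            ≡⟨ +-vanishes (ℤP.*-zeroʳ (sgnℤ (suc I))) ⟩
      sumTo (λ s → sgnℤ (I ∸ s) ℤ.* + bettiLks e₁ (suc s)) 0 (suc I)        ≡⟨ sumTo-first (λ s → sgnℤ (I ∸ s) ℤ.* + bettiLks e₁ (suc s)) I ⟩
      sumTo (λ s → sgnℤ (I ∸ suc s) ℤ.* + sumℕ (λ v → βlk v s)) 0 I ℤ.+ sgnℤ I ℤ.* + sumℕ {n} (λ _ → e₁)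
                                                                            ≡⟨ +-vanishes vanish ⟩
      sumTo (λ s → sgnℤ (I ∸ suc s) ℤ.* + sumℕ (λ v → βlk v s)) 0 I         ≡⟨ sumTo-cong 0 I (λ j l → ≡.cong (λ x → x ℤ.* + sumℕ (λ v → βlk v j)) (parity j l)) ⟩
      sumTo (λ s → sgnℤ (suc I ∸ s) ℤ.* + sumℕ (λ v → βlk v s)) 0 I         ≡⟨ sumFinℤ-sumTo (λ s → sgnℤ (suc I ∸ s)) βlk I ⟨
      sumFinℤ (λ v → sumTo (λ s → sgnℤ (suc I ∸ s) ℤ.* + βlk v s) 0 I)      ≡⟨ sumFinℤ-cong (λ v → ≡.trans (≡.sym (sumTo-shift (λ j → sgnℤ (suc (suc I) ∸ j) ℤ.* + βlk v (j ∸ 1)) 0 I)) (≡.sym (sumℤ≡ _ 1 I))) ⟩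
      sumFinℤ (λ v → sumℤ (λ j → sgnℤ (suc (suc I) ∸ j) ℤ.* + βlk v (j ∸ 1)) 1 I) ∎
      where
      vanish : sgnℤ I ℤ.* + sumℕ {n} (λ _ → e₁) ≡ + 0
      vanish = ≡.trans (≡.cong (λ x → sgnℤ I ℤ.* + x) (≡.trans (sumℕ-const n e₁) (≡.trans (≡.cong (n ℕ.*_) (z (s≤s z≤n))) (ℕP.*-zeroʳ n)))) (ℤP.*-zeroʳ (sgnℤ I))
      -- The two exponents differ by two.
      parity : ∀ j → j < I → sgnℤ (I ∸ suc j) ≡ sgnℤ (suc I ∸ j)
      parity j l = ≡.cong sgnℤ {suc (suc (I ∸ suc j))} (≡.trans (≡.cong suc (≡.sym (ℕP.+-∸-assoc 1 l))) (≡.sym (ℕP.+-∸-assoc 1 (ℕP.<⇒≤ l))))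

-- Only finitely many levels are ever inspected, so finite choice is enough; beyond the bound the
-- values are arbitrary.
DN-choice : ∀ {a b} {A : Set a} {Q : ℕ → A → Set b} → (∀ s → DN (Σ A (Q s))) → ∀ k → DN (Σ (ℕ → A) λ f → ∀ s → s ≤ k → Q s (f s))
DN-choice h zero = do
  (x , q) ← h 0
  return ((λ _ → x) , λ { zero _ → q })
DN-choice h (suc k) = do
  (x , q) ← h 0
  (f , p) ← DN-choice (λ s → h (suc s)) k
  return ((λ { zero → x ; (suc s) → f s }) , λ { zero _ → q ; (suc s) (s≤s l) → p s l })

pure-vertex : ∀ {n} {Γ : Subset n → Bool} {k} → IsComplex Γ → Pure Γ (suc k) → Σ (Fin n) (IsVertex Γ)
pure-vertex {n} {Γ} {k} cx (_ , ext) =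
  let (G , _ , g , e) = ext ∅ (proj₁ cx)
      (w , p , _) = extra-vertex ∅ G (≡.subst₂ _<_ (≡.sym (∣∅∣≡0 n)) (≡.sym e) (s≤s z≤n)) in
  w , Complex-down cx {G} {⁅ w ⁆} (λ u q → ≡.subst (λ z → lookup G z ≡ true) (≡.sym (SubP.x∈⁅y⁆⇒x≡y w (VecP.lookup⇒[]= u ⁅ w ⁆ q))) p) g

-- The dimension of H̃^{-1} of a pure complex of dimension d - 1.
point : ℕ → ℕ
point zero    = 1
point (suc d) = 0

-- Linear algebra over a field without decidable equality

module FaceRing {c ℓ : Level} (K : Field c ℓ) where
  open Field K public hiding (zero)
  open OverField K public
  open import Algebra.Properties.Ring ring public using (-0#≈0#; -‿involutive; -‿+-comm; -1*x≈-x; -‿distribˡ-*; -‿distribʳ-*)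
  open import Algebra.Properties.Semiring.Mult semiring using (×1-homo-*; ×-homo-+) renaming (_×_ to _⋆_)
  open import Relation.Binary.Reasoning.Setoid setoid public

  ≡⇒≈ : ∀ {x y} → x ≡ y → x ≈ y
  ≡⇒≈ ≡.refl = refl

  -- Ring normalisation compares coefficients, which cannot be done in the field itself; integers
  -- acting through the unit serve as coefficients instead.
  ⟦_⟧ℤ : ℤ → Carrier
  ⟦ + n ⟧ℤ      = n ⋆ 1#
  ⟦ -[1+ n ] ⟧ℤ = - (suc n ⋆ 1#)

  private
    ⟦-⟧ : ∀ x → ⟦ ℤ.- x ⟧ℤ ≈ - ⟦ x ⟧ℤ
    ⟦-⟧ (+ zero)     = sym -0#≈0#
    ⟦-⟧ (+ suc n)    = refl
    ⟦-⟧ (-[1+ n ])   = sym (-‿involutive _)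

    ⟦⊖⟧ : ∀ m n → ⟦ m ℤ.⊖ n ⟧ℤ ≈ m ⋆ 1# + - (n ⋆ 1#)
    ⟦⊖⟧ m       zero    = sym (trans (+-congˡ -0#≈0#) (+-identityʳ _))
    ⟦⊖⟧ zero    (suc n) = sym (+-identityˡ _)
    ⟦⊖⟧ (suc m) (suc n) = begin
      ⟦ suc m ℤ.⊖ suc n ⟧ℤ             ≈⟨ ≡⇒≈ (≡.cong ⟦_⟧ℤ (ℤP.[1+m]⊖[1+n]≡m⊖n m n)) ⟩
      ⟦ m ℤ.⊖ n ⟧ℤ                     ≈⟨ ⟦⊖⟧ m n ⟩
      a + - b                          ≈⟨ +-congʳ (sym (+-identityˡ a)) ⟩
      0# + a + - b                     ≈⟨ +-congʳ (+-congʳ (sym (-‿inverseʳ 1#))) ⟩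
      1# + - 1# + a + - b              ≈⟨ +-congʳ (trans (+-assoc _ _ _) (+-congˡ (+-comm _ _))) ⟩
      1# + (a + - 1#) + - b            ≈⟨ trans (+-congʳ (sym (+-assoc _ _ _))) (+-assoc _ _ _) ⟩
      (1# + a) + (- 1# + - b)          ≈⟨ +-congˡ (-‿+-comm 1# b) ⟩
      (1# + a) + - (1# + b)            ∎
      where
      a = m ⋆ 1#
      b = n ⋆ 1#

    ⟦+⟧ : ∀ x y → ⟦ x ℤ.+ y ⟧ℤ ≈ ⟦ x ⟧ℤ + ⟦ y ⟧ℤ
    ⟦+⟧ (+ m)      (+ n)      = ×-homo-+ 1# m n
    ⟦+⟧ (+ m)      (-[1+ n ]) = ⟦⊖⟧ m (suc n)
    ⟦+⟧ (-[1+ m ]) (+ n)      = trans (⟦⊖⟧ n (suc m)) (+-comm _ _)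
    ⟦+⟧ (-[1+ m ]) (-[1+ n ]) = begin
      - (suc (suc (m ℕ.+ n)) ⋆ 1#)         ≈⟨ -‿cong (≡⇒≈ (≡.cong (λ k → suc k ⋆ 1#) (≡.sym (Data.Nat.Properties.+-suc m n)))) ⟩
      - ((suc m ℕ.+ suc n) ⋆ 1#)           ≈⟨ -‿cong (×-homo-+ 1# (suc m) (suc n)) ⟩
      - (suc m ⋆ 1# + suc n ⋆ 1#)          ≈⟨ sym (-‿+-comm _ _) ⟩
      - (suc m ⋆ 1#) + - (suc n ⋆ 1#)      ∎
      where import Data.Nat.Properties

    ⟦*⟧₊ : ∀ m y → ⟦ + m ℤ.* y ⟧ℤ ≈ m ⋆ 1# * ⟦ y ⟧ℤ
    ⟦*⟧₊ m (+ n) = trans (≡⇒≈ (≡.cong ⟦_⟧ℤ (≡.sym (ℤP.pos-* m n)))) (×1-homo-* m n)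
    ⟦*⟧₊ m (-[1+ n ]) = begin
      ⟦ + m ℤ.* ℤ.- (+ suc n) ⟧ℤ         ≈⟨ ≡⇒≈ (≡.cong ⟦_⟧ℤ (≡.sym (ℤP.neg-distribʳ-* (+ m) (+ suc n)))) ⟩
      ⟦ ℤ.- (+ m ℤ.* + suc n) ⟧ℤ         ≈⟨ ⟦-⟧ (+ m ℤ.* + suc n) ⟩
      - ⟦ + m ℤ.* + suc n ⟧ℤ             ≈⟨ -‿cong (⟦*⟧₊ m (+ suc n)) ⟩
      - (m ⋆ 1# * suc n ⋆ 1#)            ≈⟨ -‿distribʳ-* _ _ ⟩
      m ⋆ 1# * - (suc n ⋆ 1#)            ∎

    ⟦*⟧ : ∀ x y → ⟦ x ℤ.* y ⟧ℤ ≈ ⟦ x ⟧ℤ * ⟦ y ⟧ℤ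
    ⟦*⟧ (+ m)      y = ⟦*⟧₊ m y
    ⟦*⟧ (-[1+ m ]) y = begin
      ⟦ ℤ.- (+ suc m) ℤ.* y ⟧ℤ    ≈⟨ ≡⇒≈ (≡.cong ⟦_⟧ℤ (≡.sym (ℤP.neg-distribˡ-* (+ suc m) y))) ⟩
      ⟦ ℤ.- (+ suc m ℤ.* y) ⟧ℤ    ≈⟨ ⟦-⟧ (+ suc m ℤ.* y) ⟩
      - ⟦ + suc m ℤ.* y ⟧ℤ        ≈⟨ -‿cong (⟦*⟧₊ (suc m) y) ⟩
      - (suc m ⋆ 1# * ⟦ y ⟧ℤ)     ≈⟨ -‿distribˡ-* _ _ ⟩
      - (suc m ⋆ 1#) * ⟦ y ⟧ℤ     ∎

    ℤ-morphism : ℤ.+-*-rawRing -Raw-AlmostCommutative⟶ fromCommutativeRing commRing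
    ℤ-morphism = record
      { ⟦_⟧ = ⟦_⟧ℤ ; +-homo = ⟦+⟧ ; *-homo = ⟦*⟧ ; -‿homo = ⟦-⟧
      ; 0-homo = refl ; 1-homo = +-identityʳ 1# }

    coeff≟ : ∀ x y → Maybe (⟦ x ⟧ℤ ≈ ⟦ y ⟧ℤ)
    coeff≟ x y with x ℤ.≟ y
    ... | yes p = just (≡⇒≈ (≡.cong ⟦_⟧ℤ p))
    ... | no  _ = nothing

  module Solver = Algebra.Solver.Ring ℤ.+-*-rawRing (fromCommutativeRing commRing) ℤ-morphism coeff≟
  open Solver public using (solve; _:=_; _:+_; _:*_; :-_; _:-_; con)

  V : Set → Set c
  V I = I → Carrier

  Pr : Set → Set _
  Pr I = V I → Set (c ⊔ ℓ)

  infix 4 _≋_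
  _≋_ : {I : Set} → V I → V I → Set ℓ
  x ≋ y = ∀ i → x i ≈ y i

  opaque
    ∑ : ∀ {n} → V (Fin n) → Carrier
    ∑ = sumF

    ∑≡sumF : ∀ {n} (f : V (Fin n)) → ∑ f ≡ sumF f
    ∑≡sumF f = ≡.refl

    ∑-suc : ∀ {n} (f : V (Fin (suc n))) → ∑ f ≡ f zero + ∑ (λ j → f (suc j))
    ∑-suc f = ≡.refl

    ∑-zero : ∀ (f : V (Fin 0)) → ∑ f ≡ 0#
    ∑-zero f = ≡.refl

    lc≡∑ : {I : Set} {n : ℕ} (cs : Fin n → Carrier) (bs : Fin n → V I) (i : I) →
           linComb cs bs i ≡ ∑ (λ j → cs j * bs j i)
    lc≡∑ cs bs i = ≡.refl

    sum-cong : ∀ {n} {f g : V (Fin n)} → f ≋ g → ∑ f ≈ ∑ g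
    sum-cong {zero}  e = refl
    sum-cong {suc n} e = +-cong (e zero) (sum-cong (λ j → e (suc j)))

    sum-+ : ∀ {n} (f g : V (Fin n)) → ∑ (λ j → f j + g j) ≈ ∑ f + ∑ g
    sum-+ {zero}  f g = sym (+-identityˡ 0#)
    sum-+ {suc n} f g = trans (+-congˡ (sum-+ (f ∘ suc) (g ∘ suc)))
      (solve 4 (λ a b x y → (a :+ b) :+ (x :+ y) := (a :+ x) :+ (b :+ y)) refl _ _ _ _)

    sum-* : ∀ {n} k (f : V (Fin n)) → ∑ (λ j → k * f j) ≈ k * ∑ f
    sum-* {zero}  k f = sym (zeroʳ k)
    sum-* {suc n} k f = trans (+-congˡ (sum-* k (f ∘ suc))) (sym (distribˡ _ _ _))

    sum-0 : ∀ {n} {f : V (Fin n)} → (∀ j → f j ≈ 0#) → ∑ f ≈ 0#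
    sum-0 {zero}  e = refl
    sum-0 {suc n} e = trans (+-cong (e zero) (sum-0 (λ j → e (suc j)))) (+-identityˡ 0#)

    sum-neg : ∀ {n} (f : V (Fin n)) → ∑ (λ j → - f j) ≈ - ∑ f
    sum-neg {zero}  f = sym -0#≈0#
    sum-neg {suc n} f = trans (+-congˡ (sum-neg (f ∘ suc))) (-‿+-comm _ _)

    sum-swap : ∀ {m n} (f : Fin m → Fin n → Carrier) →
               ∑ (λ j → ∑ (λ k → f j k)) ≈ ∑ (λ k → ∑ (λ j → f j k))
    sum-swap {zero} {n} f = sym (sum-0 {n} (λ _ → refl))
    sum-swap {suc m} f = trans (+-congˡ (sum-swap (f ∘ suc))) (sym (sum-+ (f zero) _))

    sum-punchIn : ∀ {n} (f : V (Fin (suc n))) k → ∑ f ≈ f k + ∑ (λ j → f (punchIn k j))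
    sum-punchIn f zero = refl
    sum-punchIn {suc n} f (suc k) = trans (+-congˡ (sum-punchIn (f ∘ suc) k))
      (solve 3 (λ a b x → a :+ (b :+ x) := b :+ (a :+ x)) refl _ _ _)

    sum-single : ∀ {n} (f : V (Fin n)) k → (∀ j → ¬ j ≡ k → f j ≈ 0#) → ∑ f ≈ f k
    sum-single {suc n} f k e = trans (sum-punchIn f k)
      (trans (+-congˡ (sum-0 (λ j → e _ (λ q → FinP.punchInᵢ≢i k j q)))) (+-identityʳ _))

    sum-split : ∀ {m n} (f : V (Fin (m ℕ.+ n))) →
                ∑ f ≈ ∑ (λ j → f (j ↑ˡ n)) + ∑ (λ j → f (m ↑ʳ j))
    sum-split {zero}  f = sym (+-identityˡ _)
    sum-split {suc m} f = trans (+-congˡ (sum-split {m} (f ∘ suc))) (sym (+-assoc _ _ _))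

  lc∑ : {I : Set} {n : ℕ} (cs : Fin n → Carrier) (bs : Fin n → V I) (i : I) →
        linComb cs bs i ≈ ∑ (λ j → cs j * bs j i)
  lc∑ cs bs i = ≡⇒≈ (lc≡∑ cs bs i)

  ∑lc : {I : Set} {n : ℕ} (cs : Fin n → Carrier) (bs : Fin n → V I) (i : I) →
        ∑ (λ j → cs j * bs j i) ≈ linComb cs bs i
  ∑lc cs bs i = ≡⇒≈ (≡.sym (lc≡∑ cs bs i))

  record IsSub {I : Set} (U : Pr I) : Set (c ⊔ ℓ) where
    field
      0∈ : U (λ _ → 0#)
      +∈ : ∀ {x y} → U x → U y → U (λ i → x i + y i)
      *∈ : ∀ k {x} → U x → U (λ i → k * x i)
      ≈∈ : ∀ {x y} → x ≋ y → U x → U y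

    -∈ : ∀ {x y} → U x → U y → U (λ i → x i - y i)
    -∈ u v = ≈∈ (λ i → +-congˡ (-1*x≈-x _)) (+∈ u (*∈ (- 1#) v))

    Σ∈ : ∀ {n} {x : Fin n → V I} → (∀ j → U (x j)) → U (λ i → ∑ (λ j → x j i))
    Σ∈ {zero}  u = ≈∈ (λ i → ≡⇒≈ (≡.sym (∑-zero _))) 0∈
    Σ∈ {suc n} u = ≈∈ (λ i → ≡⇒≈ (≡.sym (∑-suc _))) (+∈ (u zero) (Σ∈ (λ j → u (suc j))))

    linComb∈ : ∀ {n} (cs : Fin n → Carrier) {bs : Fin n → V I} → (∀ j → U (bs j)) → U (linComb cs bs)
    linComb∈ cs {bs} u = ≈∈ (λ i → ≡⇒≈ (≡.sym (lc≡∑ cs bs i))) (Σ∈ (λ j → *∈ (cs j) (u j)))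
  open IsSub public

  Zero : {I : Set} → Pr I
  Zero x = Lift c (x ≋ (λ _ → 0#))

  Zero-sub : {I : Set} → IsSub (Zero {I})
  Zero-sub = record
    { 0∈ = lift (λ _ → refl)
    ; +∈ = λ { (lift u) (lift v) → lift (λ i → trans (+-cong (u i) (v i)) (+-identityˡ _)) }
    ; *∈ = λ { k (lift u) → lift (λ i → trans (*-congˡ (u i)) (zeroʳ k)) }
    ; ≈∈ = λ { e (lift u) → lift (λ i → trans (sym (e i)) (u i)) } }

  Zero-min : {I : Set} {W : Pr I} → IsSub W → ∀ {x} → Zero x → W x
  Zero-min s (lift z) = ≈∈ s (λ i → sym (z i)) (0∈ s)

  _∩_ : {I : Set} → Pr I → Pr I → Pr I
  (U ∩ W) x = U x × W x

  ∩-sub : {I : Set} {U W : Pr I} → IsSub U → IsSub W → IsSub (U ∩ W)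
  ∩-sub s t = record
    { 0∈ = 0∈ s , 0∈ t
    ; +∈ = λ (a , b) (a' , b') → +∈ s a a' , +∈ t b b'
    ; *∈ = λ k (a , b) → *∈ s k a , *∈ t k b
    ; ≈∈ = λ e (a , b) → ≈∈ s e a , ≈∈ t e b }

  record Lin {I J : Set} (φ : V I → V J) : Set (c ⊔ ℓ) where
    field
      φ-cong : ∀ {x y} → x ≋ y → φ x ≋ φ y
      φ-+    : ∀ x y → φ (λ i → x i + y i) ≋ (λ j → φ x j + φ y j)
      φ-*    : ∀ k x → φ (λ i → k * x i) ≋ (λ j → k * φ x j)

    φ-0 : φ (λ _ → 0#) ≋ (λ _ → 0#)
    φ-0 j = trans (φ-cong (λ _ → sym (zeroˡ 0#)) j) (trans (φ-* 0# (λ _ → 0#) j) (zeroˡ _))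

    φ-neg : ∀ x → φ (λ i → - x i) ≋ (λ j → - φ x j)
    φ-neg x j = trans (φ-cong (λ i → sym (-1*x≈-x _)) j) (trans (φ-* _ x j) (-1*x≈-x _))

    φ-- : ∀ x y → φ (λ i → x i - y i) ≋ (λ j → φ x j - φ y j)
    φ-- x y j = trans (φ-+ x (λ i → - y i) j) (+-congˡ (φ-neg y j))

    φ-Σ : ∀ {n} (x : Fin n → V I) → φ (λ i → ∑ (λ k → x k i)) ≋ (λ j → ∑ (λ k → φ (x k) j))
    φ-Σ {zero}  x j = trans (φ-cong (λ _ → ≡⇒≈ (∑-zero _)) j) (trans (φ-0 j) (≡⇒≈ (≡.sym (∑-zero _))))
    φ-Σ {suc n} x j = trans (φ-cong (λ _ → ≡⇒≈ (∑-suc _)) j)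
      (trans (φ-+ (x zero) _ j) (trans (+-congˡ (φ-Σ (x ∘ suc) j)) (≡⇒≈ (≡.sym (∑-suc _)))))

    φ-lc : ∀ {n} (cs : Fin n → Carrier) (bs : Fin n → V I) →
           φ (linComb cs bs) ≋ linComb cs (λ j → φ (bs j))
    φ-lc cs bs j = trans (φ-cong (λ i → ≡⇒≈ (lc≡∑ cs bs i)) j) (trans (φ-Σ (λ k i → cs k * bs k i) j) (trans (sum-cong (λ k → φ-* (cs k) (bs k) j)) (∑lc cs (λ k → φ (bs k)) j)))
  open Lin public

  preimage-sub : {I J : Set} {φ : V I → V J} {W : Pr J} → Lin φ → IsSub W → IsSub (λ x → W (φ x))
  preimage-sub l s = record
    { 0∈ = ≈∈ s (λ j → sym (φ-0 l j)) (0∈ s)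
    ; +∈ = λ u v → ≈∈ s (λ j → sym (φ-+ l _ _ j)) (+∈ s u v)
    ; *∈ = λ k u → ≈∈ s (λ j → sym (φ-* l k _ j)) (*∈ s k u)
    ; ≈∈ = λ e u → ≈∈ s (φ-cong l e) u }

  lc-cong : {I : Set} {n : ℕ} {cs ds : Fin n → Carrier} (bs : Fin n → V I) →
            (∀ j → cs j ≈ ds j) → linComb cs bs ≋ linComb ds bs
  lc-cong bs e i = trans (lc∑ _ bs i) (trans (sum-cong (λ j → *-congʳ (e j))) (∑lc _ bs i))

  lc-+ : {I : Set} {n : ℕ} (cs ds : Fin n → Carrier) (bs : Fin n → V I) →
         linComb (λ j → cs j + ds j) bs ≋ (λ i → linComb cs bs i + linComb ds bs i)
  lc-+ cs ds bs i = trans (lc∑ _ bs i) (trans (sum-cong (λ j → distribʳ (bs j i) (cs j) (ds j)))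
    (trans (sum-+ _ _) (+-cong (∑lc cs bs i) (∑lc ds bs i))))

  lc-* : {I : Set} {n : ℕ} (k : Carrier) (cs : Fin n → Carrier) (bs : Fin n → V I) →
         linComb (λ j → k * cs j) bs ≋ (λ i → k * linComb cs bs i)
  lc-* k cs bs i = trans (lc∑ _ bs i) (trans (sum-cong (λ j → *-assoc k (cs j) (bs j i)))
    (trans (sum-* k _) (*-congˡ (∑lc cs bs i))))

  lc-neg : {I : Set} {n : ℕ} (cs : Fin n → Carrier) (bs : Fin n → V I) →
         linComb (λ j → - cs j) bs ≋ (λ i → - linComb cs bs i)
  lc-neg cs bs i = trans (lc∑ _ bs i) (trans (sum-cong (λ j → sym (-‿distribˡ-* (cs j) (bs j i))))
    (trans (sum-neg _) (-‿cong (∑lc cs bs i))))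

  lc-- : {I : Set} {n : ℕ} (cs ds : Fin n → Carrier) (bs : Fin n → V I) →
         linComb (λ j → cs j - ds j) bs ≋ (λ i → linComb cs bs i - linComb ds bs i)
  lc-- cs ds bs i = trans (lc-+ cs (λ j → - ds j) bs i) (+-congˡ (lc-neg ds bs i))

  lc-diff : {I : Set} {n : ℕ} (cs : Fin n → Carrier) (bs bs' : Fin n → V I) →
         linComb cs (λ j i → bs j i - bs' j i) ≋ (λ i → linComb cs bs i - linComb cs bs' i)
  lc-diff cs bs bs' i = trans (lc∑ cs (λ j i → bs j i - bs' j i) i)
    (trans (sum-cong (λ j → solve 3 (λ x y z → x :* (y :- z) := x :* y :+ :- (x :* z)) refl (cs j) (bs j i) (bs' j i)))
    (trans (sum-+ _ _) (+-cong (∑lc cs bs i) (trans (sum-neg _) (-‿cong (∑lc cs bs' i))))))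

  record Dim {I : Set} (U W : Pr I) (r : ℕ) : Set (c ⊔ ℓ) where
    constructor dim
    field
      basis       : Fin r → V I
      basis∈      : ∀ j → U (basis j)
      independent : ∀ (cs : Fin r → Carrier) → W (linComb cs basis) → ∀ j → cs j ≈ 0#
      spanning    : ∀ u → U u → Σ (Fin r → Carrier) λ cs → W (λ i → u i - linComb cs basis i)

  fromQDim : {I : Set} (U W : Pr I) {r : ℕ} → QDim U W r → Dim U W r
  fromQDim U W (bs , inU , ind , spn) = dim bs inU ind spn

  -- An isomorphism of U/W with U'/W' given on representatives: `refW` is injectivity and `surj`
  -- surjectivity. No inverse map has to be linear, or even well defined.
  record QIso {I J : Set} (U W : Pr I) (U' W' : Pr J) : Set (c ⊔ ℓ) where
    field
      φ    : V I → V J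
      lin  : Lin φ
      subU : IsSub U
      subW' : IsSub W'
      toU  : ∀ {u} → U u → U' (φ u)
      toW  : ∀ {u} → U u → W u → W' (φ u)
      refW : ∀ {u} → U u → W' (φ u) → W u
      surj : ∀ u' → U' u' → Σ (V I) λ u → U u × W' (λ j → u' j - φ u j)

  Dim→ : ∀ {I J : Set} {U W : Pr I} {U' W' : Pr J} → QIso U W U' W' → ∀ {r} → Dim U W r → Dim U' W' r
  Dim→ q (dim bs inU ind spn) = dim
    (λ j → φ (bs j)) (λ j → toU (inU j))
    (λ cs w → ind cs (refW (linComb∈ subU cs inU) (≈∈ subW' (λ j → sym (φ-lc lin cs bs j)) w)))
    λ u' Uu' → let (u , Uu , w) = surj u' Uu' ; (cs , w₁) = spn u Uu in
      cs , ≈∈ subW' (λ j → trans (+-congˡ (trans (φ-- lin u (linComb cs bs) j) (+-congˡ (-‿cong (φ-lc lin cs bs j)))))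
                                 (solve 3 (λ x y z → (x :- y) :+ (y :- z) := x :- z) refl _ _ _))
             (+∈ subW' w (toW (-∈ subU Uu (linComb∈ subU cs inU)) w₁))
    where open QIso q

  -- Chosen lifts of the basis map to it only modulo `W'`; the errors `bW` form linear combinations
  -- inside `W'` and are absorbed there.
  Dim← : ∀ {I J : Set} {U W : Pr I} {U' W' : Pr J} → QIso U W U' W' → ∀ {r} → Dim U' W' r → Dim U W r
  Dim← {I} {W' = W'} q {r} (dim bs' inU ind spn) = dim
    bs bU
    (λ cs w → ind cs (≈∈ subW' (λ j → trans (+-cong (φ-lc lin cs bs j) (lc-diff cs bs' (φ ∘ bs) j))
                                  (solve 2 (λ x y → x :+ (y :- x) := y) refl _ _))
                 (+∈ subW' (toW (linComb∈ subU cs bU) w) (linComb∈ subW' cs bW))))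
    λ u Uu → let (cs , w) = spn (φ u) (toU Uu) in
      cs , refW (-∈ subU Uu (linComb∈ subU cs bU))
        (≈∈ subW' (λ j → trans (+-congˡ (lc-diff cs bs' (φ ∘ bs) j))
                     (trans (solve 3 (λ x y z → (x :- y) :+ (y :- z) := x :- z) refl _ _ _)
                       (sym (trans (φ-- lin u (linComb cs bs) j) (+-congˡ (-‿cong (φ-lc lin cs bs j)))))))
          (+∈ subW' w (linComb∈ subW' cs bW)))
    where
    open QIso q
    bs : Fin r → V I
    bs j = proj₁ (surj (bs' j) (inU j))
    bU = λ j → proj₁ (proj₂ (surj (bs' j) (inU j)))
    bW : ∀ j → W' (λ i → bs' j i - φ (bs j) i)
    bW = λ j → proj₂ (proj₂ (surj (bs' j) (inU j)))

  id-lin : {I : Set} → Lin {I} id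
  id-lin = record { φ-cong = id ; φ-+ = λ _ _ _ → refl ; φ-* = λ _ _ _ → refl }

  Dim-≐ : ∀ {I : Set} {U W U' W' : Pr I} → (∀ {x} → U x → U' x) → (∀ {x} → U' x → U x) →
           (∀ {x} → W x → W' x) → (∀ {x} → W' x → W x) → ∀ {r} → Dim U W r → Dim U' W' r
  Dim-≐ a b p q (dim bs inU ind spn) =
    dim bs (λ j → a (inU j)) (λ cs w → ind cs (q w)) λ u Uu → let (cs , w) = spn u (b Uu) in cs , p w

  Dim-0 : ∀ {I : Set} {U W : Pr I} → IsSub W → (∀ {x} → U x → W x) → Dim U W 0
  Dim-0 s f = dim (λ ()) (λ ()) (λ _ _ ())
    λ u Uu → (λ ()) , ≈∈ s (λ i → sym (trans (+-congˡ -0#≈0#) (+-identityʳ _))) (f Uu)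

  δF : ∀ {n} → Fin n → Fin n → Carrier
  δF zero    zero    = 1#
  δF zero    (suc _) = 0#
  δF (suc _) zero    = 0#
  δF (suc j) (suc k) = δF j k

  δF-refl : ∀ {n} (k : Fin n) → δF k k ≡ 1#
  δF-refl zero    = ≡.refl
  δF-refl (suc k) = δF-refl k

  δF-≢ : ∀ {n} {j k : Fin n} → ¬ j ≡ k → δF j k ≡ 0#
  δF-≢ {j = zero}  {zero}  p = ⊥-elim (p ≡.refl)
  δF-≢ {j = zero}  {suc k} p = ≡.refl
  δF-≢ {j = suc j} {zero}  p = ≡.refl
  δF-≢ {j = suc j} {suc k} p = δF-≢ (λ q → p (≡.cong suc q))

  sum-δ : ∀ {n} (f : V (Fin n)) k → ∑ (λ j → δF j k * f j) ≈ f k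
  sum-δ f k = trans (sum-single _ k (λ j p → trans (*-congʳ (≡⇒≈ (δF-≢ p))) (zeroˡ _)))
    (trans (*-congʳ (≡⇒≈ (δF-refl k))) (*-identityˡ _))

  lc-δ : ∀ {I : Set} {n} (bs : Fin n → V I) k → linComb (λ j → δF j k) bs ≋ bs k
  lc-δ bs k i = trans (≡⇒≈ (lc≡∑ _ bs i)) (sum-δ (λ j → bs j i) k)

  Dim-0⁻ : ∀ {I : Set} {U W : Pr I} → IsSub W → (∀ {x} → U x → W x) → ∀ {r} → Dim U W r → r ≡ 0
  Dim-0⁻ s f {zero}  _ = ≡.refl
  Dim-0⁻ s f {suc r} (dim bs inU ind _) =
    ⊥-elim (1≉0 (ind (λ j → δF j zero) (≈∈ s (λ i → sym (lc-δ bs zero i)) (f (inU zero))) zero))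

  -- The sequence M/W, U/W, U/M: a relation is first read modulo `M`, which kills the coefficients
  -- of the lifted vectors, and then modulo `W`.
  Dim-+ : ∀ {I : Set} {U M W : Pr I} → IsSub M → IsSub W → (∀ {x} → M x → U x) → (∀ {x} → W x → M x) →
           ∀ {a b} → Dim U M a → Dim M W b → Dim U W (a ℕ.+ b)
  Dim-+ {I} {U} {M} {W} sM sW M⊆U W⊆M {a} {b} (dim us inU indU spnU) (dim ms inM indM spnM) =
    dim bs inB ind spn
    where
    bs : Fin (a ℕ.+ b) → V I
    bs j = [ us , ms ]′ (splitAt a j)
    inB : ∀ j → U (bs j)
    inB j with splitAt a j
    ... | inj₁ k = inU k
    ... | inj₂ k = M⊆U (inM k)
    bsˡ : ∀ j → bs (j ↑ˡ b) ≡ us j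
    bsˡ j = ≡.cong [ us , ms ]′ (FinP.splitAt-↑ˡ a j b)
    bsʳ : ∀ j → bs (a ↑ʳ j) ≡ ms j
    bsʳ j = ≡.cong [ us , ms ]′ (FinP.splitAt-↑ʳ a b j)
    lc-split : ∀ cs → linComb cs bs ≋ (λ i → linComb (λ j → cs (j ↑ˡ b)) us i + linComb (λ j → cs (a ↑ʳ j)) ms i)
    lc-split cs i = trans (≡⇒≈ (lc≡∑ cs bs i)) (trans (sum-split {a} (λ j → cs j * bs j i))
      (+-cong (trans (sum-cong (λ j → *-congˡ (≡⇒≈ (≡.cong-app (bsˡ j) i)))) (≡⇒≈ (≡.sym (lc≡∑ _ us i))))
              (trans (sum-cong (λ j → *-congˡ (≡⇒≈ (≡.cong-app (bsʳ j) i)))) (≡⇒≈ (≡.sym (lc≡∑ _ ms i))))))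
    module _ (cs : Fin (a ℕ.+ b) → Carrier) (w : W (linComb cs bs)) where
      zu : ∀ j → cs (j ↑ˡ b) ≈ 0#
      zu = indU _ (≈∈ sM (λ i → trans (+-congʳ (lc-split cs i)) (solve 2 (λ x y → (x :+ y) :- y := x) refl _ _))
                     (-∈ sM (W⊆M w) (linComb∈ sM (λ j → cs (a ↑ʳ j)) inM)))
      zm : ∀ j → cs (a ↑ʳ j) ≈ 0#
      zm = indM _ (≈∈ sW (λ i → trans (lc-split cs i)
                      (trans (+-congʳ (trans (≡⇒≈ (lc≡∑ _ us i)) (sum-0 (λ j → trans (*-congʳ (zu j)) (zeroˡ _))))) (+-identityˡ _))) w)
      ind : ∀ j → cs j ≈ 0#
      ind j with splitAt a j | FinP.join-splitAt a b j
      ... | inj₁ k | e = trans (≡⇒≈ (≡.cong cs (≡.sym e))) (zu k)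
      ... | inj₂ k | e = trans (≡⇒≈ (≡.cong cs (≡.sym e))) (zm k)
    spn : ∀ u → U u → Σ (Fin (a ℕ.+ b) → Carrier) λ cs → W (λ i → u i - linComb cs bs i)
    spn u Uu = cs , ≈∈ sW (λ i → trans (solve 3 (λ x y z → (x :- y) :- z := x :- (y :+ z)) refl _ _ _)
                   (+-congˡ (-‿cong (sym (trans (lc-split cs i)
                     (+-cong (lc-cong us (λ j → ≡⇒≈ (≡.cong [ cu , cm ]′ (FinP.splitAt-↑ˡ a j b))) i)
                             (lc-cong ms (λ j → ≡⇒≈ (≡.cong [ cu , cm ]′ (FinP.splitAt-↑ʳ a b j))) i)))))))
                 (proj₂ sm)
      where
      su = spnU u Uu
      cu = proj₁ su
      sm = spnM _ (proj₂ su)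
      cm = proj₁ sm
      cs : Fin (a ℕ.+ b) → Carrier
      cs j = [ cu , cm ]′ (splitAt a j)

  -- Elimination, invariance of dimension and rank

  -- The zero test of elimination, made entry by entry under double negation.
  zero-or-pivot : ∀ n (x : Fin n → Carrier) → DN ((∀ j → x j ≈ 0#) ⊎ Σ (Fin n) λ j → ¬ (x j ≈ 0#))
  zero-or-pivot zero    x = return (inj₁ (λ ()))
  zero-or-pivot (suc n) x = do
    e ← em (x zero ≈ 0#)
    r ← zero-or-pivot n (x ∘ suc)
    return (case e of λ where
      (inj₂ p) → inj₂ (zero , p)
      (inj₁ z) → case r of λ where
        (inj₁ zs)      → inj₁ (λ where zero → z ; (suc j) → zs j)
        (inj₂ (j , p)) → inj₂ (suc j , p))

  Independent : ∀ {a b} → (Fin a → Fin b → Carrier) → Set (c ⊔ ℓ)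
  Independent {a} P = ∀ (cs : Fin a → Carrier) → (∀ k → ∑ (λ j → cs j * P j k) ≈ 0#) → ∀ j → cs j ≈ 0#

  -- Gaussian elimination on the first column. The conclusion is negative, so the case distinction
  -- under double negation costs nothing.
  dependent : ∀ b (P : Fin (suc b) → Fin b → Carrier) → ¬ Independent P
  dependent zero    P ind = 1≉0 (ind (λ _ → 1#) (λ ()) zero)
  dependent (suc b) P ind = zero-or-pivot _ (λ j → P j zero) λ where
    (inj₁ z) → dependent b (λ j k → P (suc j) (suc k)) λ cs e j →
      ind (λ where zero → 0# ; (suc j) → cs j)
        (λ where
          zero    → sum-0 (λ j → trans (*-congˡ (z j)) (zeroʳ _))
          (suc k) → trans (≡⇒≈ (∑-suc _)) (trans (+-congʳ (zeroˡ _)) (trans (+-identityˡ _) (e k))))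
        (suc j)
    (inj₂ (p , nz)) → let
        (inv , inv-eq) = inverse (P p zero) nz
        q : Fin (suc b) → Carrier
        q j = P (punchIn p j) zero * inv
        P' : Fin (suc b) → Fin b → Carrier
        P' j k = P (punchIn p j) (suc k) - q j * P p (suc k)
      in dependent b P' λ cs e j → let
        -- The coefficient of the pivot row is forced by the first column; with it a relation among
        -- the reduced rows becomes one among the original rows.
        c₀ = - ∑ (λ j → cs j * q j)
        ext : Fin (suc (suc b)) → Carrier
        ext = insertAt cs p c₀
        ext-p : ext p ≈ c₀
        ext-p = ≡⇒≈ (insertAt-lookup cs p c₀)
        ext-q : ∀ j → ext (punchIn p j) ≈ cs j
        ext-q j = ≡⇒≈ (insertAt-punchIn cs p c₀ j)
        expand : ∀ k → ∑ (λ j → ext j * P j k) ≈ c₀ * P p k + ∑ (λ j → cs j * P (punchIn p j) k)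
        expand k = trans (sum-punchIn _ p) (+-cong (*-congʳ ext-p) (sum-cong (λ j → *-congʳ (ext-q j))))
        total : ∀ k → c₀ * P p k + ∑ (λ j → cs j * P (punchIn p j) k)
                    ≈ ∑ (λ j → cs j * (P (punchIn p j) k - q j * P p k))
        total k = trans (+-congʳ (trans (sym (-‿distribˡ-* _ _)) (-‿cong (trans (*-comm _ _) (sym (sum-* _ _))))))
          (trans (+-congʳ (sym (sum-neg _))) (trans (sym (sum-+ _ _))
            (sum-cong (λ j → solve 4 (λ c x y z → :- (x :* (c :* y)) :+ c :* z := c :* (z :- y :* x)) refl (cs j) (P p k) (q j) _))))
      in trans (sym (ext-q j)) (ind ext
        (λ where
          zero → trans (expand zero) (trans (total zero) (sum-0 (λ j → trans (*-congˡ
                   (trans (+-congˡ (-‿cong (trans (*-assoc _ _ _) (trans (*-congˡ (trans (*-comm _ _) inv-eq)) (*-identityʳ _)))))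
                          (-‿inverseʳ _))) (zeroʳ _))))
          (suc k) → trans (expand (suc k)) (trans (total (suc k)) (e k)))
        (punchIn p j))

  -- The order of natural numbers is decidable, hence it is enough to refute `suc b` independent
  -- rows in `b` columns.
  independent⇒≤ : ∀ {I : Set} {W : Pr I} → IsSub W → ∀ {a b} (us : Fin a → V I) (vs : Fin b → V I) →
    (∀ cs → W (linComb cs us) → ∀ j → cs j ≈ 0#) →
    (P : Fin a → Fin b → Carrier) → (∀ j → W (λ i → us j i - linComb (P j) vs i)) → a ≤ b
  independent⇒≤ {I} {W} sW {a} {b} us vs ind P spn = decidable-stable (a ℕP.≤? b) λ a≰b →
    absurd (ℕP.m+[n∸m]≡n (ℕP.≰⇒> a≰b))
    where
    lc-lc : ∀ (cs : Fin a → Carrier) →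
            linComb cs (λ j → linComb (P j) vs) ≋ linComb (λ k → ∑ (λ j → cs j * P j k)) vs
    lc-lc cs i = begin
      linComb cs (λ j → linComb (P j) vs) i          ≈⟨ lc∑ cs (λ j → linComb (P j) vs) i ⟩
      ∑ (λ j → cs j * linComb (P j) vs i)            ≈⟨ sum-cong (λ j → *-congˡ (lc∑ (P j) vs i)) ⟩
      ∑ (λ j → cs j * ∑ (λ k → P j k * vs k i))      ≈⟨ sum-cong (λ j → sym (sum-* (cs j) _)) ⟩
      ∑ (λ j → ∑ (λ k → cs j * (P j k * vs k i)))    ≈⟨ sum-swap _ ⟩
      ∑ (λ k → ∑ (λ j → cs j * (P j k * vs k i)))    ≈⟨ sum-cong (λ k → sum-cong (λ j →
                     solve 3 (λ x y z → x :* (y :* z) := z :* (x :* y)) refl (cs j) (P j k) (vs k i))) ⟩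
      ∑ (λ k → ∑ (λ j → vs k i * (cs j * P j k)))    ≈⟨ sum-cong (λ k → trans (sum-* _ _) (*-comm _ _)) ⟩
      ∑ (λ k → ∑ (λ j → cs j * P j k) * vs k i)      ≈⟨ ∑lc (λ k → ∑ (λ j → cs j * P j k)) vs i ⟩
      linComb (λ k → ∑ (λ j → cs j * P j k)) vs i    ∎
    indP : Independent P
    indP cs e = ind cs (≈∈ sW (λ i → trans (+-congʳ (trans (lc-diff cs us (λ j → linComb (P j) vs) i) (+-congˡ (-‿cong (lc-lc cs i)))))
        (solve 2 (λ x y → (x :- y) :+ y := x) refl _ _))
      (+∈ sW (linComb∈ sW cs spn)
        (≈∈ sW (λ i → sym (trans (lc∑ _ vs i) (sum-0 (λ k → trans (*-congʳ (e k)) (zeroˡ _))))) (0∈ sW))))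
    absurd : ∀ {k} → suc b ℕ.+ k ≡ a → ⊥
    absurd {k} ≡.refl = dependent b (λ j → P (j ↑ˡ k)) λ cs e j → let
        cs' : Fin (suc b ℕ.+ k) → Carrier
        cs' j = [ cs , (λ _ → 0#) ]′ (splitAt (suc b) j)
        csˡ : ∀ j → cs' (j ↑ˡ k) ≈ cs j
        csˡ j = ≡⇒≈ (≡.cong [ cs , (λ _ → 0#) ]′ (FinP.splitAt-↑ˡ (suc b) j k))
        csʳ : ∀ j → cs' (suc b ↑ʳ j) ≈ 0#
        csʳ j = ≡⇒≈ (≡.cong [ cs , (λ _ → 0#) ]′ (FinP.splitAt-↑ʳ (suc b) k j))
      in trans (sym (csˡ j)) (indP cs' (λ m → trans (sum-split {suc b} (λ j → cs' j * P j m))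
           (trans (+-cong (trans (sum-cong (λ j → *-congʳ (csˡ j))) (e m))
                          (sum-0 (λ j → trans (*-congʳ (csʳ j)) (zeroˡ _)))) (+-identityˡ 0#))) (j ↑ˡ k))

  Dim-≤ : ∀ {I : Set} {U W : Pr I} → IsSub W → ∀ {a b} → Dim U W a → Dim U W b → a ≤ b
  Dim-≤ sW (dim us inU ind _) (dim vs _ _ spn) =
    independent⇒≤ sW us vs ind (λ j → proj₁ (spn _ (inU j))) (λ j → proj₂ (spn _ (inU j)))

  Dim-unique : ∀ {I : Set} {U W : Pr I} → IsSub W → ∀ {a b} → Dim U W a → Dim U W b → a ≡ b
  Dim-unique sW p q = ℕP.≤-antisym (Dim-≤ sW p q) (Dim-≤ sW q p)

  -- Steinitz exchange: the basis vector at which `w` has a nonzero coordinate becomes redundant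
  -- once the multiples of `w` are divided out.
  exchange : ∀ {I : Set} {V₀ W : Pr I} → IsSub W → ∀ {n} (q : Dim V₀ W (suc n)) →
    ∀ w (Vw : V₀ w) k → ¬ (proj₁ (Dim.spanning q w Vw) k ≈ 0#) →
    Dim V₀ (λ x → Σ Carrier λ μ → W (λ i → x i - μ * w i)) n
  exchange {I} {V₀} {W} sW {n} (dim vs inV ind spn) w Vw k nz =
    dim (λ j → vs (punchIn k j)) (λ j → inV _) ind' spn'
    where
    ds = proj₁ (spn w Vw)
    iv = proj₁ (inverse (ds k) nz)
    iv-eq = proj₂ (inverse (ds k) nz)
    lc-k : (cs : Fin (suc n) → Carrier) → linComb cs vs ≋ (λ i → cs k * vs k i + linComb (cs ∘ punchIn k) (vs ∘ punchIn k) i)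
    lc-k cs i = trans (lc∑ cs vs i) (trans (sum-punchIn _ k) (+-congˡ (∑lc (cs ∘ punchIn k) (vs ∘ punchIn k) i)))
    ind' : ∀ cs → (Σ Carrier λ μ → W (λ i → linComb cs (vs ∘ punchIn k) i - μ * w i)) → ∀ j → cs j ≈ 0#
    ind' cs (μ , m) j = begin
      cs j                                     ≈⟨ solve 2 (λ x y → x := x :- con (+ 0) :* y) refl _ _ ⟩
      cs j - 0# * ds (punchIn k j)             ≈⟨ +-congˡ (-‿cong (*-congʳ (sym μ≈0))) ⟩
      cs j - μ * ds (punchIn k j)              ≈⟨ +-congʳ (≡⇒≈ (≡.sym (insertAt-punchIn cs k 0# j))) ⟩
      es (punchIn k j) - μ * ds (punchIn k j)  ≈⟨ zs (punchIn k j) ⟩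
      0#                                       ∎
      where
      es = insertAt cs k 0#
      es-lc : linComb es vs ≋ linComb cs (vs ∘ punchIn k)
      es-lc i = trans (lc-k es i) (trans (+-cong (trans (*-congʳ (≡⇒≈ (insertAt-lookup cs k 0#))) (zeroˡ _))
        (lc-cong (vs ∘ punchIn k) (λ j → ≡⇒≈ (insertAt-punchIn cs k 0# j)) i)) (+-identityˡ _))
      zs : ∀ j → es j - μ * ds j ≈ 0#
      zs = ind _ (≈∈ sW (λ i → trans (solve 4 (λ x m y z → (x :- m :* y) :+ m :* (y :- z) := x :- m :* z) refl _ _ _ _)
             (sym (trans (lc-- es (λ j → μ * ds j) vs i) (+-cong (es-lc i) (-‿cong (lc-* μ ds vs i))))))
             (+∈ sW m (*∈ sW μ (proj₂ (spn w Vw)))))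
      μ≈0 : μ ≈ 0#
      μ≈0 = begin
        μ                        ≈⟨ sym (*-identityʳ μ) ⟩
        μ * 1#                   ≈⟨ *-congˡ (sym iv-eq) ⟩
        μ * (ds k * iv)          ≈⟨ solve 3 (λ m d v → m :* (d :* v) := :- ((con (+ 0) :- m :* d) :* v)) refl _ _ _ ⟩
        - ((0# - μ * ds k) * iv) ≈⟨ -‿cong (*-congʳ (+-congʳ (≡⇒≈ (≡.sym (insertAt-lookup cs k 0#))))) ⟩
        - ((es k - μ * ds k) * iv) ≈⟨ -‿cong (*-congʳ (zs k)) ⟩
        - (0# * iv)              ≈⟨ trans (-‿cong (zeroˡ iv)) -0#≈0# ⟩
        0#                       ∎
    spn' : ∀ u → V₀ u → Σ (Fin n → Carrier) λ cs → Σ Carrier λ μ → W (λ i → (u i - linComb cs (vs ∘ punchIn k) i) - μ * w i)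
    spn' u Vu = (λ j → es (punchIn k j) - μ * ds (punchIn k j)) , μ ,
      ≈∈ sW (λ i → trans (solve 5 (λ u x m w y → (u :- x) :- m :* (w :- y) := (u :- (x :- m :* y)) :- m :* w) refl _ _ μ _ _)
               (+-congʳ (+-congˡ (-‿cong (eq i)))))
        (-∈ sW (proj₂ (spn u Vu)) (*∈ sW μ (proj₂ (spn w Vw))))
      where
      es = proj₁ (spn u Vu)
      μ = es k * iv
      eq : ∀ i → linComb es vs i - μ * linComb ds vs i ≈ linComb (λ j → es (punchIn k j) - μ * ds (punchIn k j)) (vs ∘ punchIn k) i
      eq i = begin
        linComb es vs i - μ * linComb ds vs i      ≈⟨ +-congˡ (-‿cong (sym (lc-* μ ds vs i))) ⟩
        linComb es vs i - linComb (λ j → μ * ds j) vs i ≈⟨ sym (lc-- es (λ j → μ * ds j) vs i) ⟩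
        linComb (λ j → es j - μ * ds j) vs i       ≈⟨ lc-k (λ j → es j - μ * ds j) i ⟩
        (es k - es k * iv * ds k) * vs k i + _     ≈⟨ +-congʳ (trans (*-congʳ (trans (+-congˡ (-‿cong
              (trans (*-assoc _ _ _) (trans (*-congˡ (trans (*-comm _ _) iv-eq)) (*-identityʳ _))))) (-‿inverseʳ _))) (zeroˡ _)) ⟩
        0# + _                                     ≈⟨ +-identityˡ _ ⟩
        linComb (λ j → es (punchIn k j) - μ * ds (punchIn k j)) (vs ∘ punchIn k) i ∎

  -- Membership is only modulo `W'`, so that for `W'` inside `X` the image contains `W'` and can be
  -- the denominator of a cokernel.
  Image : {I J : Set} → (V I → V J) → Pr I → Pr J → Pr J → Pr J
  Image {I} φ U X W' v = X v × Σ (V I) λ u → U u × W' (λ j → v j - φ u j)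

  Kernel : {I J : Set} → (V I → V J) → Pr I → Pr J → Pr I
  Kernel φ U W' u = U u × W' (φ u)

  record Rank {I J : Set} (φ : V I → V J) (U W : Pr I) (X W' : Pr J) (r s : ℕ) : Set (c ⊔ ℓ) where
    field
      rank ker coker : ℕ
      ker+rank   : ker ℕ.+ rank ≡ r
      coker+rank : coker ℕ.+ rank ≡ s
      ker-dim    : Dim (Kernel φ U W') W ker
      coker-dim  : Dim X (Image φ U X W') coker
      image-dim  : Dim (Image φ U X W') W' rank

  Image-sub : {I J : Set} {φ : V I → V J} {U : Pr I} {X W' : Pr J} → Lin φ → IsSub U → IsSub X → IsSub W' → IsSub (Image φ U X W')
  Image-sub l sU sX sW' = record
    { 0∈ = 0∈ sX , _ , 0∈ sU , ≈∈ sW' (λ j → sym (trans (+-congˡ (trans (-‿cong (φ-0 l j)) -0#≈0#)) (+-identityˡ _))) (0∈ sW')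
    ; +∈ = λ (a , u , b , w) (a' , u' , b' , w') → +∈ sX a a' , _ , +∈ sU b b' ,
        ≈∈ sW' (λ j → trans (solve 4 (λ x y z t → (x :- y) :+ (z :- t) := (x :+ z) :- (y :+ t)) refl _ _ _ _) (+-congˡ (-‿cong (sym (φ-+ l u u' j))))) (+∈ sW' w w')
    ; *∈ = λ k (a , u , b , w) → *∈ sX k a , _ , *∈ sU k b ,
        ≈∈ sW' (λ j → trans (solve 3 (λ k x y → k :* (x :- y) := k :* x :- k :* y) refl _ _ _) (+-congˡ (-‿cong (sym (φ-* l k u j))))) (*∈ sW' k w)
    ; ≈∈ = λ e (a , u , b , w) → ≈∈ sX e a , u , b , ≈∈ sW' (λ j → +-congʳ (e j)) w }

  -- Induction on the dimension of the source, one basis vector at a time: either its image already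
  -- lies in the image so far and the kernel grows, or it has a nonzero coordinate in the cokernel
  -- and the cokernel shrinks. Which case occurs is a zero test, whence the double negation.
  rank-lemma : {I J : Set} {φ : V I → V J} → Lin φ → {U W : Pr I} {X W' : Pr J} →
    IsSub U → IsSub W → IsSub X → IsSub W' → (∀ {x} → W x → U x) → (∀ {x} → W' x → X x) →
    (∀ {u} → U u → X (φ u)) → (∀ {u} → W u → W' (φ u)) →
    ∀ {r s} → Dim U W r → Dim X W' s → DN (Rank φ U W X W' r s)
  rank-lemma l {U} {W} {X} {W'} sU sW sX sW' W⊆U W'⊆X toX toW {zero} {s} (dim bs inU ind spn) q = return (record
    { rank = 0 ; ker = 0 ; coker = s ; ker+rank = ≡.refl ; coker+rank = ℕP.+-identityʳ s
    ; ker-dim = Dim-0 sW (λ (Uu , _) → U⊆W Uu)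
    ; coker-dim = Dim-≐ id id
        (λ {x} w → W'⊆X w , _ , 0∈ sU , ≈∈ sW' (λ j → sym (trans (+-congˡ (trans (-‿cong (φ-0 l j)) -0#≈0#)) (+-identityʳ _))) w)
        Im⊆W' q
    ; image-dim = Dim-0 sW' Im⊆W' })
    where
    U⊆W : ∀ {x} → U x → W x
    U⊆W Uu = ≈∈ sW (λ i → trans (+-congˡ -0#≈0#) (+-identityʳ _)) (proj₂ (spn _ Uu))
    Im⊆W' : ∀ {v} → Image _ U X W' v → W' v
    Im⊆W' (_ , u , Uu , w) = ≈∈ sW' (λ j → solve 2 (λ x y → (x :- y) :+ y := x) refl _ _) (+∈ sW' w (toW (U⊆W Uu)))
  rank-lemma {I} {φ = φ} l {U} {W} {X} {W'} sU sW sX sW' W⊆U W'⊆X toX toW {suc r} {s} (dim bs inU ind spn) q = do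
    R ← rank-lemma l {U₀} {W} {X} {W'} sU₀ sW sX sW' (λ w → W⊆U w , (λ _ → 0#) , ≈∈ sW (λ i → sym (trans (+-congˡ (trans (-‿cong (lc-0 i)) -0#≈0#)) (+-identityʳ _))) w)
          W'⊆X (λ u → toX (proj₁ u)) toW dim₀ q
    step R
    where
    bt = bs ∘ suc
    b₀ = bs zero
    lc-0 : linComb (λ _ → 0#) bt ≋ (λ _ → 0#)
    lc-0 i = trans (lc∑ _ bt i) (sum-0 (λ j → zeroˡ _))
    -- The span of the remaining basis vectors together with `W`, to which the induction applies.
    U₀ : Pr I
    U₀ u = U u × Σ (Fin r → Carrier) λ cs → W (λ i → u i - linComb cs bt i)
    sU₀ : IsSub U₀
    sU₀ = record
      { 0∈ = 0∈ sU , (λ _ → 0#) , ≈∈ sW (λ i → sym (trans (+-congˡ (trans (-‿cong (lc-0 i)) -0#≈0#)) (+-identityʳ _))) (0∈ sW)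
      ; +∈ = λ (a , cs , w) (a' , cs' , w') → +∈ sU a a' , _ ,
          ≈∈ sW (λ i → trans (solve 4 (λ x y z t → (x :- y) :+ (z :- t) := (x :+ z) :- (y :+ t)) refl _ _ _ _) (+-congˡ (-‿cong (sym (lc-+ cs cs' bt i))))) (+∈ sW w w')
      ; *∈ = λ k (a , cs , w) → *∈ sU k a , _ ,
          ≈∈ sW (λ i → trans (solve 3 (λ k x y → k :* (x :- y) := k :* x :- k :* y) refl _ _ _) (+-congˡ (-‿cong (sym (lc-* k cs bt i))))) (*∈ sW k w)
      ; ≈∈ = λ e (a , cs , w) → ≈∈ sU e a , cs , ≈∈ sW (λ j → +-congʳ (e j)) w }
    dim₀ : Dim U₀ W r
    dim₀ = dim bt (λ j → inU (suc j) , (λ k → δF k j) , ≈∈ sW (λ i → sym (trans (+-congˡ (-‿cong (lc-δ bt j i))) (-‿inverseʳ _))) (0∈ sW))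
      (λ cs w j → ind (λ where zero → 0# ; (suc j) → cs j)
          (≈∈ sW (λ i → sym (trans (+-congʳ (zeroˡ _)) (+-identityˡ _))) w) (suc j))
      λ u (_ , cs , w) → cs , w
    split : ∀ {u} → U u → Σ Carrier λ μ → U₀ (λ i → u i - μ * b₀ i)
    split {u} Uu = let (cs , w) = spn u Uu in cs zero , -∈ sU Uu (*∈ sU _ (inU zero)) , cs ∘ suc ,
      ≈∈ sW (λ i → solve 3 (λ u x y → u :- (x :+ y) := (u :- x) :- y) refl _ _ _) w
    step : Rank φ U₀ W X W' r s → DN (Rank φ U W X W' (suc r) s)
    step R = zero-or-pivot _ ds >>= λ where
        (inj₁ z) → return (in-image z)
        (inj₂ (k , nz)) → return (pivot k nz)
      where
      open Rank R
      sIm : IsSub (Image φ U₀ X W')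
      sIm = Image-sub l sU₀ sX sW'
      sKer : {Y : Pr I} → IsSub Y → IsSub (Kernel φ Y W')
      sKer sY = ∩-sub sY (preimage-sub l sW')
      cb = Dim.spanning coker-dim (φ b₀) (toX (inU zero))
      ds = proj₁ cb
      in-image : (∀ j → ds j ≈ 0#) → Rank φ U W X W' (suc r) s
      in-image z = record
        { rank = rank ; ker = suc ker ; coker = coker ; ker+rank = ≡.cong suc ker+rank ; coker+rank = coker+rank
        ; ker-dim = Dim-+ (sKer sU₀) sW (λ (u₀ , w) → proj₁ u₀ , w) (λ w → (W⊆U w , (λ _ → 0#) , ≈∈ sW (λ i → sym (trans (+-congˡ (trans (-‿cong (lc-0 i)) -0#≈0#)) (+-identityʳ _))) w) , toW w)
            one-dim ker-dim
        ; coker-dim = Dim-≐ id id im₀⊆im im⊆im₀ coker-dim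
        ; image-dim = Dim-≐ im₀⊆im im⊆im₀ id id image-dim }
        where
        φb∈ : Image φ U₀ X W' (φ b₀)
        φb∈ = ≈∈ sIm (λ j → trans (+-congˡ (trans (-‿cong (trans (lc∑ ds (Dim.basis coker-dim) j) (sum-0 (λ k → trans (*-congʳ (z k)) (zeroˡ _))))) -0#≈0#)) (+-identityʳ _)) (proj₂ cb)
        im₀⊆im : ∀ {x} → Image φ U₀ X W' x → Image φ U X W' x
        im₀⊆im (x , u , u₀ , w) = x , u , proj₁ u₀ , w
        im⊆im₀ : ∀ {x} → Image φ U X W' x → Image φ U₀ X W' x
        im⊆im₀ {x} (Xx , u , Uu , w) = let (μ , Uμ) = split Uu in
               ≈∈ sIm (λ j → solve 3 (λ x m y → (x :- m :* y) :+ m :* y := x) refl _ _ _)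
                 (+∈ sIm {λ j → x j - μ * φ b₀ j} (-∈ sX Xx (*∈ sX μ (toX (inU zero))) , _ , Uμ ,
                    ≈∈ sW' (λ j → trans (solve 4 (λ x y m b → x :- y := (x :- m :* b) :- (y :- m :* b)) refl _ _ μ (φ b₀ j))
                       (+-congˡ (-‿cong (sym (trans (φ-- l u _ j) (+-congˡ (-‿cong (φ-* l μ b₀ j)))))))) w)
                   (*∈ sIm μ φb∈))
        u₀ = proj₁ (proj₂ φb∈)
        U₀u₀ : U₀ u₀
        U₀u₀ = proj₁ (proj₂ (proj₂ φb∈))
        -- The new kernel vector: `b₀` corrected by an element of `U₀` with the same image.
        bk : V I
        bk i = b₀ i - u₀ i
        one-dim : Dim (Kernel φ U W') (Kernel φ U₀ W') 1
        one-dim = dim (λ _ → bk) (λ _ → -∈ sU (inU zero) (proj₁ U₀u₀) , ≈∈ sW' (λ j → sym (φ-- l b₀ u₀ j)) (proj₂ (proj₂ (proj₂ φb∈))))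
          (λ cs ((_ , ts , w) , _) → λ where
             zero → ind (λ where zero → cs zero ; (suc j) → - (ts j + cs zero * proj₁ (proj₂ U₀u₀) j))
               (≈∈ sW (λ i → trans (solve 6 (λ c b u o t v → ((c :* (b :- u) :+ con (+ 0)) :- t) :+ c :* (u :- v) := c :* b :- (t :+ c :* v)) refl (cs zero) (b₀ i) (u₀ i) (u₀ i) _ _)
                    (+-congˡ (sym (trans (lc-neg _ bt i) (-‿cong (trans (lc-+ ts _ bt i) (+-congˡ (lc-* (cs zero) _ bt i))))))))
                 (+∈ sW w (*∈ sW (cs zero) (proj₂ (proj₂ U₀u₀))))) zero)
          λ u (Uu , w) → let (μ , Uμ) = split Uu
                             m∈ = ≈∈ sU₀ (λ i → solve 4 (λ u m b v → (u :- m :* b) :+ m :* v := u :- (m :* (b :- v) :+ con (+ 0))) refl (u i) μ (b₀ i) (u₀ i))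
                                     (+∈ sU₀ Uμ (*∈ sU₀ μ U₀u₀)) in
            (λ _ → μ) , m∈ ,
            -∈ (preimage-sub l sW') w (≈∈ (preimage-sub l sW') (λ i → sym (+-identityʳ _)) (*∈ (preimage-sub l sW') μ
               (≈∈ sW' (λ j → sym (φ-- l b₀ u₀ j)) (proj₂ (proj₂ (proj₂ φb∈))))))
      pivot : ∀ k → ¬ (ds k ≈ 0#) → Rank φ U W X W' (suc r) s
      pivot k nz = go coker coker-dim coker+rank k nz
        where
        -- The dimension of the cokernel is generalised so that it can be matched; the pivot index
        -- rules out zero.
        go : ∀ n (q : Dim X (Image φ U₀ X W') n) → n ℕ.+ rank ≡ s → ∀ k →
             ¬ (proj₁ (Dim.spanning q (φ b₀) (toX (inU zero))) k ≈ 0#) → Rank φ U W X W' (suc r) s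
        go (suc n) q e k nz = record
          { rank = suc rank ; ker = ker ; coker = n
          ; ker+rank = ≡.trans (ℕP.+-suc ker rank) (≡.cong suc ker+rank)
          ; coker+rank = ≡.trans (ℕP.+-suc n rank) e
          ; ker-dim = Dim-≐ (λ (u₀ , w) → proj₁ u₀ , w) kin id id ker-dim
          ; image-dim = Dim-+ sIm sW' (λ (x , u , u₀ , w) → x , u , proj₁ u₀ , w)
              (λ {x} w → W'⊆X w , _ , 0∈ sU₀ , ≈∈ sW' (λ j → sym (trans (+-congˡ (trans (-‿cong (φ-0 l j)) -0#≈0#)) (+-identityʳ _))) w)
              one-dim image-dim
          ; coker-dim = Dim-≐ id id
              (λ {x} (μ , Xx , u , Uu , w) → ≈∈ sX (λ j → solve 2 (λ x y → (x :- y) :+ y := x) refl _ _) (+∈ sX Xx (*∈ sX μ (toX (inU zero)))) ,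
                 (λ i → u i + μ * b₀ i) , +∈ sU (proj₁ Uu) (*∈ sU μ (inU zero)) ,
                 ≈∈ sW' (λ j → trans (solve 4 (λ x m b y → (x :- m :* b) :- y := x :- (y :+ m :* b)) refl _ μ (φ b₀ j) _)
                   (+-congˡ (-‿cong (sym (trans (φ-+ l u _ j) (+-congˡ (φ-* l μ b₀ j))))))) w)
              mod-φb ex }
          where
          mod-φb : ∀ {x} → Image φ U X W' x → Σ Carrier λ μ → Image φ U₀ X W' (λ j → x j - μ * φ b₀ j)
          mod-φb {x} (Xx , u , Uu , w) = let (μ , Uμ) = split Uu in μ , -∈ sX Xx (*∈ sX μ (toX (inU zero))) , _ , Uμ ,
                 ≈∈ sW' (λ j → trans (solve 4 (λ x y m b → x :- y := (x :- m :* b) :- (y :- m :* b)) refl _ _ μ (φ b₀ j))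
                       (+-congˡ (-‿cong (sym (trans (φ-- l u _ j) (+-congˡ (-‿cong (φ-* l μ b₀ j)))))))) w
          vs = Dim.basis q
          indq = Dim.independent q
          cq = Dim.spanning q (φ b₀) (toX (inU zero))
          es = proj₁ cq
          ex = exchange sIm q (φ b₀) (toX (inU zero)) k nz
          scalar-zero : ∀ {μ} → Image φ U₀ X W' (λ j → μ * φ b₀ j) → μ ≈ 0#
          scalar-zero {μ} m = trans (sym (*-identityʳ μ)) (trans (*-congˡ (sym (proj₂ iv)))
              (trans (sym (*-assoc _ _ _)) (trans (*-congʳ (z k)) (zeroˡ _))))
            where
            z : ∀ j → μ * es j ≈ 0#
            z = indq _ (≈∈ sIm (λ j → trans (solve 3 (λ m x y → m :* x :- m :* (x :- y) := m :* y) refl μ _ _) (sym (lc-* μ es vs j)))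
                  (-∈ sIm m (*∈ sIm μ (proj₂ cq))))
            iv = inverse (es k) nz
          one-dim : Dim (Image φ U X W') (Image φ U₀ X W') 1
          one-dim = dim (λ _ → φ b₀)
            (λ _ → toX (inU zero) , b₀ , inU zero , ≈∈ sW' (λ j → sym (-‿inverseʳ _)) (0∈ sW'))
            (λ cs m → λ where zero → scalar-zero (≈∈ sIm (λ j → +-identityʳ _) m))
            λ x m → let (μ , m') = mod-φb m in (λ _ → μ) , ≈∈ sIm (λ j → +-congˡ (-‿cong (sym (+-identityʳ _)))) m'
          kin : ∀ {u} → Kernel φ U W' u → Kernel φ U₀ W' u
          kin {u} (Uu , w) = ≈∈ sU₀ (λ i → trans (+-congˡ (trans (-‿cong (trans (*-congʳ (scalar-zero μφb∈)) (zeroˡ _))) -0#≈0#)) (+-identityʳ _)) Uμ , w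
            where
            μ = proj₁ (split Uu)
            Uμ = proj₂ (split Uu)
            μφb∈ : Image φ U₀ X W' (λ j → μ * φ b₀ j)
            μφb∈ = *∈ sX μ (toX (inU zero)) , (λ i → - 1# * (u i - μ * b₀ i)) , *∈ sU₀ (- 1#) Uμ ,
              ≈∈ sW' (λ j → trans (solve 2 (λ x y → x := y :- (:- (x :- y)) ) refl _ (μ * φ b₀ j))
                 (+-congˡ (-‿cong (sym (trans (φ-* l (- 1#) _ j) (trans (-1*x≈-x _) (-‿cong (trans (φ-- l u _ j) (+-congˡ (-‿cong (φ-* l μ b₀ j)))))))) ))) w

  -- Coordinate spaces, direct sums and finitary functionals

  Full : {I : Set} → Pr I
  Full _ = Lift (c ⊔ ℓ) ⊤

  Full-dim : ∀ N → Dim (Full {Fin N}) Zero N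
  Full-dim N = dim (λ j k → δF j k) (λ _ → lift tt)
    (λ cs (lift z) j → trans (sym (lc-std cs j)) (z j))
    λ u _ → u , lift (λ k → trans (+-congˡ (-‿cong (lc-std u k))) (-‿inverseʳ _))
    where
    lc-std : ∀ (cs : Fin N → Carrier) k → linComb cs (λ j k → δF j k) k ≈ cs k
    lc-std cs k = trans (lc∑ cs (λ j k → δF j k) k) (trans (sum-cong (λ j → *-comm _ _)) (sum-δ cs k))

  Supp : {I : Set} → (I → Set) → Pr I
  Supp P x = Lift c (∀ i → ¬ P i → x i ≈ 0#)

  Supp-sub : {I : Set} {P : I → Set} → IsSub (Supp P)
  Supp-sub = record
    { 0∈ = lift (λ _ _ → refl)
    ; +∈ = λ { (lift u) (lift v) → lift (λ i n → trans (+-cong (u i n) (v i n)) (+-identityˡ _)) }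
    ; *∈ = λ { k (lift u) → lift (λ i n → trans (*-congˡ (u i n)) (zeroʳ k)) }
    ; ≈∈ = λ { e (lift u) → lift (λ i n → trans (sym (e i)) (u i n)) } }

  module Enumerated {I : Set} {P : I → Set} (P? : ∀ i → Dec (P i)) {N : ℕ} (cd : Card P N) where
    open Card cd

    extend : V (Fin N) → V I
    extend y i with P? i
    ... | yes p = y (proj₁ (en-sur p))
    ... | no _  = 0#

    extend-en : ∀ y k → extend y (en k) ≡ y k
    extend-en y k with P? (en k)
    ... | yes p = ≡.cong y (en-inj (proj₂ (en-sur p)))
    ... | no ¬p = ⊥-elim (¬p (en∈ k))

    extend-∉ : ∀ y {i} → ¬ P i → extend y i ≡ 0#
    extend-∉ y {i} ¬p with P? i
    ... | yes p = ⊥-elim (¬p p)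
    ... | no _  = ≡.refl

    vanishes : ∀ {x} → (∀ i → ¬ P i → x i ≈ 0#) → (∀ k → x (en k) ≈ 0#) → ∀ i → x i ≈ 0#
    vanishes {x} s z i with P? i
    ... | yes p = trans (≡⇒≈ (≡.cong x (≡.sym (proj₂ (en-sur p))))) (z _)
    ... | no ¬p = s i ¬p

  Supp-dim : {I : Set} {P : I → Set} → (∀ i → Dec (P i)) → ∀ {N} → Card P N → Dim (Supp P) Zero N
  Supp-dim P? {N} cd = Dim← (record
    { φ = λ x k → x (en k)
    ; lin = record { φ-cong = λ e k → e _ ; φ-+ = λ _ _ _ → refl ; φ-* = λ _ _ _ → refl }
    ; subU = Supp-sub ; subW' = Zero-sub ; toU = λ _ → lift tt
    ; toW = λ _ (lift z) → lift (λ k → z _)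
    ; refW = λ (lift s) (lift z) → lift (vanishes s z)
    ; surj = λ y _ → extend y , lift (λ i n → ≡⇒≈ (extend-∉ y n)) ,
        lift (λ k → trans (+-congˡ (-‿cong (≡⇒≈ (extend-en y k)))) (-‿inverseʳ _)) }) (Full-dim N)
    where
    open Card cd
    open Enumerated P? cd

  ⨁ : {n : ℕ} {I : Set} → (Fin n → Pr I) → Pr (Fin n × I)
  ⨁ U C′ = ∀ v → U v (λ i → C′ (v , i))

  ⨁-sub : {n : ℕ} {I : Set} {U : Fin n → Pr I} → (∀ v → IsSub (U v)) → IsSub (⨁ U)
  ⨁-sub s = record
    { 0∈ = λ v → 0∈ (s v) ; +∈ = λ a b v → +∈ (s v) (a v) (b v)
    ; *∈ = λ k a v → *∈ (s v) k (a v) ; ≈∈ = λ e a v → ≈∈ (s v) (λ i → e (v , i)) (a v) }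

  x-0 : ∀ {x} → x - 0# ≈ x
  x-0 = trans (+-congˡ -0#≈0#) (+-identityʳ _)

  ⨁-dim : {n : ℕ} {I : Set} {U W : Fin n → Pr I} → (∀ v → IsSub (U v)) → (∀ v → IsSub (W v)) →
          (∀ v {x} → W v x → U v x) → {r : Fin n → ℕ} → (∀ v → Dim (U v) (W v) (r v)) → Dim (⨁ U) (⨁ W) (sumℕ r)
  ⨁-dim {zero} sU sW W⊆U d = Dim-0 (⨁-sub sW) (λ _ ())
  ⨁-dim {suc n} {I} {U} {W} sU sW W⊆U d = Dim-+ sM (⨁-sub sW)
      (λ (a , b) → λ { zero → W⊆U zero a ; (suc v) → b v })
      (λ w → w zero , λ v → W⊆U (suc v) (w (suc v)))
      (Dim→ head (d zero)) (Dim→ tail (⨁-dim (sU ∘ suc) (sW ∘ suc) (λ v → W⊆U (suc v)) (d ∘ suc)))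
    where
    M : Pr (Fin (suc n) × I)
    M C′ = W zero (λ i → C′ (zero , i)) × ⨁ (U ∘ suc) (λ (v , i) → C′ (suc v , i))
    sM : IsSub M
    sM = record
      { 0∈ = 0∈ (sW zero) , λ v → 0∈ (sU (suc v))
      ; +∈ = λ (a , b) (a' , b') → +∈ (sW zero) a a' , λ v → +∈ (sU (suc v)) (b v) (b' v)
      ; *∈ = λ k (a , b) → *∈ (sW zero) k a , λ v → *∈ (sU (suc v)) k (b v)
      ; ≈∈ = λ e (a , b) → ≈∈ (sW zero) (λ i → e (zero , i)) a , λ v → ≈∈ (sU (suc v)) (λ i → e (suc v , i)) (b v) }
    inj : V I → V (Fin (suc n) × I)
    inj x (zero , i)  = x i
    inj x (suc v , i) = 0#
    head : QIso (U zero) (W zero) (⨁ U) M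
    head = record
      { φ = inj
      ; lin = record
        { φ-cong = λ { e (zero , i) → e i ; e (suc v , i) → refl }
        ; φ-+ = λ { x y (zero , i) → refl ; x y (suc v , i) → sym (+-identityˡ _) }
        ; φ-* = λ { k x (zero , i) → refl ; k x (suc v , i) → sym (zeroʳ k) } }
      ; subU = sU zero ; subW' = sM
      ; toU = λ u → λ { zero → u ; (suc v) → 0∈ (sU (suc v)) }
      ; toW = λ _ w → w , λ v → 0∈ (sU (suc v))
      ; refW = λ _ w → proj₁ w
      ; surj = λ C′ u → (λ i → C′ (zero , i)) , u zero ,
          ≈∈ (sW zero) (λ i → sym (-‿inverseʳ _)) (0∈ (sW zero)) , λ v → ≈∈ (sU (suc v)) (λ i → sym x-0) (u (suc v)) }
    injs : V (Fin n × I) → V (Fin (suc n) × I)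
    injs x (zero , i)  = 0#
    injs x (suc v , i) = x (v , i)
    tail : QIso (⨁ (U ∘ suc)) (⨁ (W ∘ suc)) M (⨁ W)
    tail = record
      { φ = injs
      ; lin = record
        { φ-cong = λ { e (zero , i) → refl ; e (suc v , i) → e (v , i) }
        ; φ-+ = λ { x y (suc v , i) → refl ; x y (zero , i) → sym (+-identityˡ _) }
        ; φ-* = λ { k x (suc v , i) → refl ; k x (zero , i) → sym (zeroʳ k) } }
      ; subU = ⨁-sub (sU ∘ suc) ; subW' = ⨁-sub sW
      ; toU = λ u → 0∈ (sW zero) , u
      ; toW = λ _ w → λ { zero → 0∈ (sW zero) ; (suc v) → w v }
      ; refW = λ _ w v → w (suc v)
      ; surj = λ C′ u → (λ (v , i) → C′ (suc v , i)) , proj₂ u ,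
          λ { zero → ≈∈ (sW zero) (λ i → sym x-0) (proj₁ u)
            ; (suc v) → ≈∈ (sW (suc v)) (λ i → sym (-‿inverseʳ _)) (0∈ (sW (suc v))) } }

  -- Over infinite index sets, finitariness is what makes independent functionals commute.
  eval : {A : Set} → List (Carrier × A) → V A → Carrier
  eval []            X = 0#
  eval ((k , a) ∷ L) X = k * X a + eval L X

  IsFin : {A : Set} → (V A → Carrier) → Set (c ⊔ ℓ)
  IsFin {A} f = Σ (List (Carrier × A)) λ L → ∀ X → f X ≈ eval L X

  module _ {A : Set} where
    eval-cong : ∀ L {X Y : V A} → X ≋ Y → eval L X ≈ eval L Y
    eval-cong []            e = refl
    eval-cong ((k , a) ∷ L) e = +-cong (*-congˡ (e a)) (eval-cong L e)

    eval-+ : ∀ L (X Y : V A) → eval L (λ a → X a + Y a) ≈ eval L X + eval L Y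
    eval-+ []            X Y = sym (+-identityˡ _)
    eval-+ ((k , a) ∷ L) X Y = trans (+-congˡ (eval-+ L X Y))
      (solve 5 (λ k x y p q → k :* (x :+ y) :+ (p :+ q) := (k :* x :+ p) :+ (k :* y :+ q)) refl _ _ _ _ _)

    eval-* : ∀ L k (X : V A) → eval L (λ a → k * X a) ≈ k * eval L X
    eval-* []            k X = sym (zeroʳ k)
    eval-* ((j , a) ∷ L) k X = trans (+-congˡ (eval-* L k X))
      (solve 4 (λ j k x p → j :* (k :* x) :+ k :* p := k :* (j :* x :+ p)) refl _ _ _ _)

    eval-++ : ∀ L M (X : V A) → eval (L List.++ M) X ≈ eval L X + eval M X
    eval-++ []            M X = sym (+-identityˡ _)
    eval-++ ((k , a) ∷ L) M X = trans (+-congˡ (eval-++ L M X)) (sym (+-assoc _ _ _))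

    eval-scale : ∀ L k (X : V A) → eval (List.map (λ (j , a) → k * j , a) L) X ≈ k * eval L X
    eval-scale []            k X = sym (zeroʳ k)
    eval-scale ((j , a) ∷ L) k X = trans (+-congˡ (eval-scale L k X))
      (solve 4 (λ j k x p → k :* j :* x :+ k :* p := k :* (j :* x :+ p)) refl _ _ _ _)

    module _ {f : V A → Carrier} (F : IsFin f) where
      fin-cong : ∀ {X Y} → X ≋ Y → f X ≈ f Y
      fin-cong {X} {Y} e = trans (proj₂ F X) (trans (eval-cong (proj₁ F) e) (sym (proj₂ F Y)))

      fin-+ : ∀ X Y → f (λ a → X a + Y a) ≈ f X + f Y
      fin-+ X Y = trans (proj₂ F _) (trans (eval-+ (proj₁ F) X Y) (sym (+-cong (proj₂ F X) (proj₂ F Y))))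

      fin-* : ∀ k X → f (λ a → k * X a) ≈ k * f X
      fin-* k X = trans (proj₂ F _) (trans (eval-* (proj₁ F) k X) (*-congˡ (sym (proj₂ F X))))

      fin-0 : ∀ {X} → (∀ a → X a ≈ 0#) → f X ≈ 0#
      fin-0 z = trans (fin-cong (λ a → trans (z a) (sym (zeroˡ 0#)))) (trans (fin-* 0# (λ _ → 0#)) (zeroˡ _))

      fin-neg : ∀ X → f (λ a → - X a) ≈ - f X
      fin-neg X = trans (fin-cong (λ a → sym (-1*x≈-x _))) (trans (fin-* _ X) (-1*x≈-x _))

      fin-∑ : ∀ {n} (X : Fin n → V A) → f (λ a → ∑ (λ j → X j a)) ≈ ∑ (λ j → f (X j))
      fin-∑ {zero}  X = trans (fin-0 (λ a → ≡⇒≈ (∑-zero _))) (≡⇒≈ (≡.sym (∑-zero _)))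
      fin-∑ {suc n} X = trans (fin-cong (λ a → ≡⇒≈ (∑-suc _))) (trans (fin-+ (X zero) _)
        (trans (+-congˡ (fin-∑ (X ∘ suc))) (≡⇒≈ (≡.sym (∑-suc _)))))

    pt-fin : ∀ a → IsFin {A} (λ X → X a)
    pt-fin a = (1# , a) ∷ [] , λ X → sym (trans (+-identityʳ _) (*-identityˡ _))

    0-fin : IsFin {A} (λ X → 0#)
    0-fin = [] , λ X → refl

    +-fin : ∀ {f g} → IsFin {A} f → IsFin g → IsFin (λ X → f X + g X)
    +-fin (L , p) (M , q) = L List.++ M , λ X → trans (+-cong (p X) (q X)) (sym (eval-++ L M X))

    *-fin : ∀ k {f} → IsFin {A} f → IsFin (λ X → k * f X)
    *-fin k (L , p) = List.map (λ (j , a) → k * j , a) L , λ X → trans (*-congˡ (p X)) (sym (eval-scale L k X))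

    neg-fin : ∀ {f} → IsFin {A} f → IsFin (λ X → - f X)
    neg-fin F = let (L , p) = *-fin (- 1#) F in L , λ X → trans (sym (-1*x≈-x _)) (p X)

    ∑-fin : ∀ {n} {f : Fin n → V A → Carrier} → (∀ j → IsFin (f j)) → IsFin (λ X → ∑ (λ j → f j X))
    ∑-fin {zero}  F = [] , λ X → ≡⇒≈ (∑-zero _)
    ∑-fin {suc n} F = let (L , p) = +-fin (F zero) (∑-fin (F ∘ suc)) in L , λ X → trans (≡⇒≈ (∑-suc _)) (p X)

  ∘-fin : {A B : Set} {f : V A → Carrier} {g : A → V B → Carrier} → IsFin f → (∀ a → IsFin (g a)) →
          IsFin (λ X → f (λ a → g a X))
  ∘-fin {A} {B} {f} {g} (L , p) G = go L .proj₁ , λ X → trans (p _) (go L .proj₂ X)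
    where
    go : ∀ L → IsFin (λ X → eval L (λ a → g a X))
    go []            = 0-fin
    go ((k , a) ∷ L) = +-fin (*-fin k (G a)) (go L)

  -- Only `g` is expanded into its finite list; of `f` nothing but linearity is then used.
  fubini : {A B : Set} {f : V A → Carrier} {g : V B → Carrier} → IsFin f → IsFin g →
           ∀ (X : A → B → Carrier) → f (λ a → g (λ b → X a b)) ≈ g (λ b → f (λ a → X a b))
  fubini {A} {B} {f} {g} F (M , q) X = trans (fin-cong F (λ a → q (X a)))
      (trans (go M) (sym (q _)))
    where
    go : ∀ M → f (λ a → eval M (X a)) ≈ eval M (λ b → f (λ a → X a b))
    go []            = fin-0 F (λ _ → refl)
    go ((k , b) ∷ M) = trans (fin-+ F _ _) (+-cong (fin-* F k _) (go M))

  fin-lin : {I J : Set} {φ : V I → V J} → (∀ j → IsFin (λ X → φ X j)) → Lin φ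
  fin-lin F = record
    { φ-cong = λ e j → fin-cong (F j) e
    ; φ-+ = λ x y j → fin-+ (F j) x y
    ; φ-* = λ k x j → fin-* (F j) k x }

  -- The exterior algebra in coordinates

  -- Exterior multiplication by e_v and contraction with its dual. The sign counts the elements of
  -- the subset before `v`, one per step of the recursion.
  cr an : ∀ {n} → Fin n → V (Subset n) → V (Subset n)
  cr zero    X (true ∷ F)  = X (false ∷ F)
  cr zero    X (false ∷ F) = 0#
  cr (suc v) X (true ∷ F)  = - cr v (λ G → X (true ∷ G)) F
  cr (suc v) X (false ∷ F) = cr v (λ G → X (false ∷ G)) F

  an zero    X (false ∷ F) = X (true ∷ F)
  an zero    X (true ∷ F)  = 0#
  an (suc v) X (true ∷ F)  = - an v (λ G → X (true ∷ G)) F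
  an (suc v) X (false ∷ F) = an v (λ G → X (false ∷ G)) F

  cr-fin : ∀ {n} (v : Fin n) F → IsFin (λ X → cr v X F)
  cr-fin zero    (true ∷ F)  = pt-fin (false ∷ F)
  cr-fin zero    (false ∷ F) = 0-fin
  cr-fin (suc v) (true ∷ F)  = neg-fin (∘-fin (cr-fin v F) (λ G → pt-fin (true ∷ G)))
  cr-fin (suc v) (false ∷ F) = ∘-fin (cr-fin v F) (λ G → pt-fin (false ∷ G))

  an-fin : ∀ {n} (v : Fin n) F → IsFin (λ X → an v X F)
  an-fin zero    (false ∷ F) = pt-fin (true ∷ F)
  an-fin zero    (true ∷ F)  = 0-fin
  an-fin (suc v) (true ∷ F)  = neg-fin (∘-fin (an-fin v F) (λ G → pt-fin (true ∷ G)))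
  an-fin (suc v) (false ∷ F) = ∘-fin (an-fin v F) (λ G → pt-fin (false ∷ G))

  private
    0+0 : 0# + 0# ≈ 0#
    0+0 = +-identityˡ 0#

    two-neg : ∀ {A : Set} {f g : V A → Carrier} → IsFin f → IsFin g → ∀ X Y →
              - f (λ G → - X G) + - g (λ G → - Y G) ≈ f X + g Y
    two-neg p q X Y = +-cong (trans (-‿cong (fin-neg p X)) (-‿involutive _)) (trans (-‿cong (fin-neg q Y)) (-‿involutive _))

  cr-cr : ∀ {n} (v w : Fin n) X F → cr v (cr w X) F + cr w (cr v X) F ≈ 0#
  cr-cr zero zero X (true ∷ F)  = 0+0
  cr-cr zero zero X (false ∷ F) = 0+0
  cr-cr zero (suc w) X (true ∷ F)  = -‿inverseʳ _
  cr-cr zero (suc w) X (false ∷ F) = trans (+-congˡ (fin-0 (cr-fin w F) (λ _ → refl))) 0+0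
  cr-cr (suc v) zero X (true ∷ F)  = -‿inverseˡ _
  cr-cr (suc v) zero X (false ∷ F) = trans (+-congʳ (fin-0 (cr-fin v F) (λ _ → refl))) 0+0
  cr-cr (suc v) (suc w) X (true ∷ F)  = trans (two-neg (cr-fin v F) (cr-fin w F) _ _) (cr-cr v w _ F)
  cr-cr (suc v) (suc w) X (false ∷ F) = cr-cr v w _ F

  cr² : ∀ {n} (v : Fin n) X F → cr v (cr v X) F ≈ 0#
  cr² zero    X (true ∷ F)  = refl
  cr² zero    X (false ∷ F) = refl
  cr² (suc v) X (true ∷ F)  = trans (-‿cong (fin-neg (cr-fin v F) _)) (trans (-‿involutive _) (cr² v _ F))
  cr² (suc v) X (false ∷ F) = cr² v _ F

  an-an : ∀ {n} (v w : Fin n) X F → an v (an w X) F + an w (an v X) F ≈ 0#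
  an-an zero zero X (true ∷ F)  = 0+0
  an-an zero zero X (false ∷ F) = 0+0
  an-an zero (suc w) X (false ∷ F) = -‿inverseˡ _
  an-an zero (suc w) X (true ∷ F)  = trans (+-congˡ (trans (-‿cong (fin-0 (an-fin w F) (λ _ → refl))) -0#≈0#)) 0+0
  an-an (suc v) zero X (false ∷ F) = -‿inverseʳ _
  an-an (suc v) zero X (true ∷ F)  = trans (+-congʳ (trans (-‿cong (fin-0 (an-fin v F) (λ _ → refl))) -0#≈0#)) 0+0
  an-an (suc v) (suc w) X (true ∷ F)  = trans (two-neg (an-fin v F) (an-fin w F) _ _) (an-an v w _ F)
  an-an (suc v) (suc w) X (false ∷ F) = an-an v w _ F

  an² : ∀ {n} (v : Fin n) X F → an v (an v X) F ≈ 0#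
  an² zero    X (true ∷ F)  = refl
  an² zero    X (false ∷ F) = refl
  an² (suc v) X (true ∷ F)  = trans (-‿cong (fin-neg (an-fin v F) _)) (trans (-‿involutive _) (an² v _ F))
  an² (suc v) X (false ∷ F) = an² v _ F

  -- The Clifford relation, from which the cone and Koszul homotopies are derived.
  an-cr : ∀ {n} (v w : Fin n) X F → an v (cr w X) F + cr w (an v X) F ≈ δF v w * X F
  an-cr zero zero X (true ∷ F)  = trans (+-identityˡ _) (sym (*-identityˡ _))
  an-cr zero zero X (false ∷ F) = trans (+-identityʳ _) (sym (*-identityˡ _))
  an-cr zero (suc w) X (true ∷ F)  = trans (+-congˡ (trans (-‿cong (fin-0 (cr-fin w F) (λ _ → refl))) -0#≈0#)) (trans 0+0 (sym (zeroˡ _)))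
  an-cr zero (suc w) X (false ∷ F) = trans (-‿inverseˡ _) (sym (zeroˡ _))
  an-cr (suc v) zero X (true ∷ F)  = trans (-‿inverseˡ _) (sym (zeroˡ _))
  an-cr (suc v) zero X (false ∷ F) = trans (+-congʳ (fin-0 (an-fin v F) (λ _ → refl))) (trans 0+0 (sym (zeroˡ _)))
  an-cr (suc v) (suc w) X (true ∷ F)  = trans (two-neg (an-fin v F) (cr-fin w F) _ _) (an-cr v w _ F)
  an-cr (suc v) (suc w) X (false ∷ F) = an-cr v w _ F

  cr-∉ : ∀ {n} (v : Fin n) X F → lookup F v ≡ false → cr v X F ≈ 0#
  cr-∉ zero    X (false ∷ F) e = refl
  cr-∉ (suc v) X (true ∷ F)  e = trans (-‿cong (cr-∉ v _ F e)) -0#≈0#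
  cr-∉ (suc v) X (false ∷ F) e = cr-∉ v _ F e

  an-∈ : ∀ {n} (v : Fin n) X F → lookup F v ≡ true → an v X F ≈ 0#
  an-∈ zero    X (true ∷ F)  e = refl
  an-∈ (suc v) X (true ∷ F)  e = trans (-‿cong (an-∈ v _ F e)) -0#≈0#
  an-∈ (suc v) X (false ∷ F) e = an-∈ v _ F e

  cr-loc : ∀ {n} (v : Fin n) X F → (lookup F v ≡ true → X (F [ v ]≔ false) ≈ 0#) → cr v X F ≈ 0#
  cr-loc zero    X (true ∷ F)  z = z ≡.refl
  cr-loc zero    X (false ∷ F) z = refl
  cr-loc (suc v) X (true ∷ F)  z = trans (-‿cong (cr-loc v _ F z)) -0#≈0#
  cr-loc (suc v) X (false ∷ F) z = cr-loc v _ F z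

  an-loc : ∀ {n} (v : Fin n) X F → (lookup F v ≡ false → X (F [ v ]≔ true) ≈ 0#) → an v X F ≈ 0#
  an-loc zero    X (false ∷ F) z = z ≡.refl
  an-loc zero    X (true ∷ F)  z = refl
  an-loc (suc v) X (true ∷ F)  z = trans (-‿cong (an-loc v _ F z)) -0#≈0#
  an-loc (suc v) X (false ∷ F) z = an-loc v _ F z

  cr-cong : ∀ {n} (v : Fin n) X Y F → (lookup F v ≡ true → X (F [ v ]≔ false) ≈ Y (F [ v ]≔ false)) → cr v X F ≈ cr v Y F
  cr-cong zero    X Y (true ∷ F)  z = z ≡.refl
  cr-cong zero    X Y (false ∷ F) z = refl
  cr-cong (suc v) X Y (true ∷ F)  z = -‿cong (cr-cong v _ _ F z)
  cr-cong (suc v) X Y (false ∷ F) z = cr-cong v _ _ F z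

  an-cong : ∀ {n} (v : Fin n) X Y F → (lookup F v ≡ false → X (F [ v ]≔ true) ≈ Y (F [ v ]≔ true)) → an v X F ≈ an v Y F
  an-cong zero    X Y (false ∷ F) z = z ≡.refl
  an-cong zero    X Y (true ∷ F)  z = refl
  an-cong (suc v) X Y (true ∷ F)  z = -‿cong (an-cong v _ _ F z)
  an-cong (suc v) X Y (false ∷ F) z = an-cong v _ _ F z

  sgn-suc : ∀ k → sgn (suc k) ≈ - sgn k
  sgn-suc zero          = refl
  sgn-suc (suc zero)    = sym (-‿involutive 1#)
  sgn-suc (suc (suc k)) = sgn-suc k

  cr-formula : ∀ {n} (v : Fin n) X F →
    (if does (v ∈? F) then sgn (pos v F) * X (F ∖ v) else 0#) ≈ cr v X F
  cr-formula v X F = trans (≡⇒≈ (≡.cong₂ (λ b G → if b then sgn (pos v F) * X G else 0#) (∈?-lookup v F) (∖≡ F v))) (go v X F)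
    where
    go : ∀ {n} (v : Fin n) X F → (if lookup F v then sgn (pos v F) * X (F [ v ]≔ false) else 0#) ≈ cr v X F
    go zero    X (true ∷ F)  = *-identityˡ _
    go zero    X (false ∷ F) = refl
    go (suc v) X (false ∷ F) = go v (λ G → X (false ∷ G)) F
    go (suc v) X (true ∷ F)  = trans (flip (lookup F v) (pos v F) _) (-‿cong (go v (λ G → X (true ∷ G)) F))
      where
      flip : ∀ b k x → (if b then sgn (suc k) * x else 0#) ≈ - (if b then sgn k * x else 0#)
      flip true  k x = trans (*-congʳ (sgn-suc k)) (sym (-‿distribˡ-* _ _))
      flip false k x = sym -0#≈0#

  an-formula : ∀ {n} (v : Fin n) X F →
    (if does (v ∈? F) then 0# else sgn (pos v (F ∪ ⁅ v ⁆)) * X (F ∪ ⁅ v ⁆)) ≈ an v X F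
  an-formula v X F = trans (≡⇒≈ (≡.cong₂ (λ b G → if b then 0# else sgn (pos v G) * X G) (∈?-lookup v F) (∪⁅⁆≡ F v))) (go v X F)
    where
    go : ∀ {n} (v : Fin n) X F → (if lookup F v then 0# else sgn (pos v (F [ v ]≔ true)) * X (F [ v ]≔ true)) ≈ an v X F
    go zero    X (true ∷ F)  = refl
    go zero    X (false ∷ F) = *-identityˡ _
    go (suc v) X (false ∷ F) = go v (λ G → X (false ∷ G)) F
    go (suc v) X (true ∷ F)  = trans (flip (lookup F v) (pos v (F [ v ]≔ true)) _) (-‿cong (go v (λ G → X (true ∷ G)) F))
      where
      flip : ∀ b k x → (if b then 0# else sgn (suc k) * x) ≈ - (if b then 0# else sgn k * x)
      flip false k x = trans (*-congʳ (sgn-suc k)) (sym (-‿distribˡ-* _ _))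
      flip true  k x = sym -0#≈0#

  -- Multiplication by the vector Σ t_v e_v and contraction with the functional of coefficients `t`.
  -- With all coefficients one they are the simplicial coboundary and boundary, with coefficients of
  -- Θ the Koszul maps.
  crt ant : ∀ {n} → (Fin n → Carrier) → V (Subset n) → V (Subset n)
  crt t X F = ∑ (λ v → t v * cr v X F)
  ant t X F = ∑ (λ v → t v * an v X F)

  crt-fin : ∀ {n} (t : Fin n → Carrier) F → IsFin (λ X → crt t X F)
  crt-fin t F = ∑-fin (λ v → *-fin (t v) (cr-fin v F))

  ant-fin : ∀ {n} (t : Fin n → Carrier) F → IsFin (λ X → ant t X F)
  ant-fin t F = ∑-fin (λ v → *-fin (t v) (an-fin v F))

  -- The diagonal is assumed to vanish separately, as in characteristic two skew symmetry would say
  -- nothing about it.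
  alternating-sum : ∀ {n} (a : Fin n → Fin n → Carrier) → (∀ v → a v v ≈ 0#) → (∀ v w → a v w + a w v ≈ 0#) →
                    ∑ (λ v → ∑ (λ w → a v w)) ≈ 0#
  alternating-sum {zero}  a d s = ≡⇒≈ (∑-zero _)
  alternating-sum {suc n} a d s = begin
    ∑ (λ v → ∑ (λ w → a v w))                        ≈⟨ trans (≡⇒≈ (∑-suc _)) (+-cong (≡⇒≈ (∑-suc _)) (sum-cong (λ v → ≡⇒≈ (∑-suc _)))) ⟩
    (a zero zero + r) + ∑ (λ v → a (suc v) zero + ∑ (λ w → a (suc v) (suc w)))
                                                     ≈⟨ +-cong (trans (+-congʳ (d zero)) (+-identityˡ _)) (sum-+ _ _) ⟩
    r + (∑ (λ v → a (suc v) zero) + _)               ≈⟨ +-congˡ (trans (+-congˡ (alternating-sum (λ v w → a (suc v) (suc w)) (d ∘ suc) (λ v w → s (suc v) (suc w)))) (+-identityʳ _)) ⟩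
    r + ∑ (λ v → a (suc v) zero)                     ≈⟨ sym (sum-+ _ _) ⟩
    ∑ (λ v → a zero (suc v) + a (suc v) zero)        ≈⟨ sum-0 (λ v → s zero (suc v)) ⟩
    0# ∎
    where r = ∑ (λ w → a zero (suc w))

  private
    expand₂ : ∀ {n} (P Q : Fin n → V (Subset n) → V (Subset n)) → (∀ v F → IsFin (λ X → P v X F)) →
              ∀ (s t : Fin n → Carrier) (X : V (Subset n)) (F : Subset n) → ∑ (λ v → s v * P v (λ G → ∑ (λ w → t w * Q w X G)) F)
                        ≈ ∑ (λ v → ∑ (λ w → s v * t w * P v (Q w X) F))
    expand₂ P Q fin s t X F = sum-cong (λ v → trans (*-congˡ (trans (fin-∑ (fin v F) _) (sum-cong (λ w → fin-* (fin v F) (t w) _))))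
      (trans (sym (sum-* (s v) _)) (sum-cong (λ w → sym (*-assoc _ _ _)))))

  crt² : ∀ {n} (t : Fin n → Carrier) X F → crt t (crt t X) F ≈ 0#
  crt² t X F = trans (expand₂ cr cr cr-fin t t X F) (alternating-sum _
    (λ v → trans (*-congˡ (cr² v X F)) (zeroʳ _))
    (λ v w → trans (+-congˡ (*-congʳ (*-comm _ _))) (trans (sym (distribˡ _ _ _)) (trans (*-congˡ (cr-cr v w X F)) (zeroʳ _)))))

  ant² : ∀ {n} (t : Fin n → Carrier) X F → ant t (ant t X) F ≈ 0#
  ant² t X F = trans (expand₂ an an an-fin t t X F) (alternating-sum _
    (λ v → trans (*-congˡ (an² v X F)) (zeroʳ _))
    (λ v w → trans (+-congˡ (*-congʳ (*-comm _ _))) (trans (sym (distribˡ _ _ _)) (trans (*-congˡ (an-an v w X F)) (zeroʳ _)))))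

  ant-ant : ∀ {n} (s t : Fin n → Carrier) X F → ant s (ant t X) F + ant t (ant s X) F ≈ 0#
  ant-ant s t X F = trans (+-cong (expand₂ an an an-fin s t X F) (trans (expand₂ an an an-fin t s X F) (sum-swap _)))
    (trans (sym (sum-+ _ _)) (sum-0 (λ v → trans (sym (sum-+ _ _)) (sum-0 (λ w →
      trans (+-congˡ (*-congʳ (*-comm _ _))) (trans (sym (distribˡ _ _ _)) (trans (*-congˡ (an-an v w X F)) (zeroʳ _))))))))

  ant-crt : ∀ {n} (s t : Fin n → Carrier) X F → ant s (crt t X) F + crt t (ant s X) F ≈ ∑ (λ v → s v * t v) * X F
  ant-crt s t X F = trans (+-cong (expand₂ an cr an-fin s t X F) (trans (expand₂ cr an cr-fin t s X F) (sum-swap _)))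
    (trans (sym (sum-+ _ _)) (trans (sum-cong (λ v → trans (sym (sum-+ _ _)) (trans (sum-cong (λ w →
        trans (+-congˡ (*-congʳ (*-comm _ _))) (trans (sym (distribˡ _ _ _)) (trans (*-congˡ (an-cr v w X F))
          (solve 4 (λ s t d x → s :* t :* (d :* x) := d :* (s :* t :* x)) refl (s v) (t w) (δF v w) (X F))))))
        (trans (sum-cong (λ w → *-congʳ (≡⇒≈ (δF-sym v w)))) (sum-δ (λ w → s v * t w * X F) v)))))
      (trans (sum-cong (λ v → *-comm _ _)) (trans (sum-* (X F) _) (*-comm _ _)))))
    where
    δF-sym : ∀ {n} (v w : Fin n) → δF v w ≡ δF w v
    δF-sym zero    zero    = ≡.refl
    δF-sym zero    (suc w) = ≡.refl
    δF-sym (suc v) zero    = ≡.refl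
    δF-sym (suc v) (suc w) = δF-sym v w

  𝟙 : ∀ {n} → Fin n → Carrier
  𝟙 _ = 1#

  an-crt : ∀ {n} (v : Fin n) t X F → an v (crt t X) F + crt t (an v X) F ≈ t v * X F
  an-crt v t X F = begin
    an v (crt t X) F + crt t (an v X) F   ≈⟨ +-congʳ (trans (fin-∑ (an-fin v F) _) (sum-cong (λ w → fin-* (an-fin v F) (t w) _))) ⟩
    ∑ (λ w → t w * an v (cr w X) F) + ∑ (λ w → t w * cr w (an v X) F)  ≈⟨ sym (sum-+ _ _) ⟩
    ∑ (λ w → t w * an v (cr w X) F + t w * cr w (an v X) F)            ≈⟨ sum-cong (λ w → trans (sym (distribˡ _ _ _)) (trans (*-congˡ (an-cr v w X F)) (solve 3 (λ t d x → t :* (d :* x) := d :* (t :* x)) refl _ _ _))) ⟩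
    ∑ (λ w → δF v w * (t w * X F))        ≈⟨ sum-single _ v (λ w p → trans (*-congʳ (≡⇒≈ (δF-≢ (λ q → p (≡.sym q))))) (zeroˡ _)) ⟩
    δF v v * (t v * X F)                  ≈⟨ trans (*-congʳ (≡⇒≈ (δF-refl v))) (*-identityˡ _) ⟩
    t v * X F ∎

  cr-ant : ∀ {n} (v : Fin n) t X F → ant t (cr v X) F + cr v (ant t X) F ≈ t v * X F
  cr-ant v t X F = begin
    ant t (cr v X) F + cr v (ant t X) F   ≈⟨ +-congˡ (trans (fin-∑ (cr-fin v F) _) (sum-cong (λ w → fin-* (cr-fin v F) (t w) _))) ⟩
    ∑ (λ w → t w * an w (cr v X) F) + ∑ (λ w → t w * cr v (an w X) F)  ≈⟨ sym (sum-+ _ _) ⟩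
    ∑ (λ w → t w * an w (cr v X) F + t w * cr v (an w X) F)            ≈⟨ sum-cong (λ w → trans (sym (distribˡ _ _ _)) (trans (*-congˡ (an-cr w v X F)) (solve 3 (λ t d x → t :* (d :* x) := d :* (t :* x)) refl _ _ _))) ⟩
    ∑ (λ w → δF w v * (t w * X F))        ≈⟨ sum-δ (λ w → t w * X F) v ⟩
    t v * X F ∎

  -- The sign (-1)^∣S∣, inserted into the total differential to make the Čech and Koszul parts
  -- anticommute.
  sg : ∀ {n} → Subset n → Carrier
  sg []          = 1#
  sg (true ∷ S)  = - sg S
  sg (false ∷ S) = sg S

  sg² : ∀ {n} (S : Subset n) → sg S * sg S ≈ 1#
  sg² []          = *-identityˡ 1#
  sg² (true ∷ S)  = trans (solve 1 (λ x → (:- x) :* (:- x) := x :* x) refl _) (sg² S)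
  sg² (false ∷ S) = sg² S

  an-sg : ∀ {n} (v : Fin n) X S → an v (λ T → sg T * X T) S ≈ - (sg S * an v X S)
  an-sg zero    X (false ∷ S) = sym (-‿distribˡ-* _ _)
  an-sg zero    X (true ∷ S)  = sym (trans (-‿cong (zeroʳ _)) -0#≈0#)
  an-sg (suc v) X (false ∷ S) = an-sg v _ S
  an-sg (suc v) X (true ∷ S)  = trans (-‿cong (trans (fin-cong (an-fin v S) (λ T → sym (-‿distribˡ-* _ _)))
    (trans (fin-neg (an-fin v S) _) (-‿cong (an-sg v (λ G → X (true ∷ G)) S)))))
    (solve 2 (λ x y → :- (:- (:- (x :* y))) := :- ((:- x) :* (:- y))) refl _ _)

  cr-sg : ∀ {n} (v : Fin n) X S → cr v (λ T → sg T * X T) S ≈ - (sg S * cr v X S)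
  cr-sg zero    X (true ∷ S)  = trans (sym (-‿involutive _)) (-‿cong (-‿distribˡ-* _ _))
  cr-sg zero    X (false ∷ S) = sym (trans (-‿cong (zeroʳ _)) -0#≈0#)
  cr-sg (suc v) X (false ∷ S) = cr-sg v _ S
  cr-sg (suc v) X (true ∷ S)  = trans (-‿cong (trans (fin-cong (cr-fin v S) (λ T → sym (-‿distribˡ-* _ _)))
    (trans (fin-neg (cr-fin v S) _) (-‿cong (cr-sg v (λ G → X (true ∷ G)) S)))))
    (solve 2 (λ x y → :- (:- (:- (x :* y))) := :- ((:- x) :* (:- y))) refl _ _)

  private
    t-sg : ∀ {n} (P : Fin n → V (Subset n) → V (Subset n)) → (∀ v X S → P v (λ T → sg T * X T) S ≈ - (sg S * P v X S)) →
           ∀ (t : Fin n → Carrier) (X : V (Subset n)) (S : Subset n) → ∑ (λ v → t v * P v (λ T → sg T * X T) S) ≈ - (sg S * ∑ (λ v → t v * P v X S))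
    t-sg P e t X S = trans (sum-cong (λ v → trans (*-congˡ (e v X S)) (solve 3 (λ t s x → t :* (:- (s :* x)) := :- (s :* (t :* x))) refl (t v) (sg S) _)))
      (trans (sum-neg _) (-‿cong (sum-* (sg S) _)))

  ant-sg : ∀ {n} (t : Fin n → Carrier) X S → ant t (λ T → sg T * X T) S ≈ - (sg S * ant t X S)
  ant-sg = t-sg an an-sg

  crt-sg : ∀ {n} (t : Fin n → Carrier) X S → crt t (λ T → sg T * X T) S ≈ - (sg S * crt t X S)
  crt-sg = t-sg cr cr-sg

  opaque
    S∑ : ∀ {n} → V (Subset n) → Carrier
    S∑ {zero}  f = f []
    S∑ {suc n} f = S∑ (λ F → f (false ∷ F)) + S∑ (λ F → f (true ∷ F))

    S∑-fin : ∀ {n} → IsFin (S∑ {n})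
    S∑-fin {zero}  = pt-fin []
    S∑-fin {suc n} = +-fin (∘-fin (S∑-fin {n}) (λ F → pt-fin (false ∷ F))) (∘-fin (S∑-fin {n}) (λ F → pt-fin (true ∷ F)))

    S∑-single : ∀ {n} (f : V (Subset n)) F → (∀ G → ¬ G ≡ F → f G ≈ 0#) → S∑ f ≈ f F
    S∑-single {zero}  f []          z = refl
    S∑-single {suc n} f (false ∷ F) z = trans (+-cong (S∑-single _ F (λ G p → z _ (λ { ≡.refl → p ≡.refl }))) (fin-0 (S∑-fin {n}) (λ G → z _ (λ ())))) (+-identityʳ _)
    S∑-single {suc n} f (true ∷ F)  z = trans (+-cong (fin-0 (S∑-fin {n}) (λ G → z _ (λ ()))) (S∑-single _ F (λ G p → z _ (λ { ≡.refl → p ≡.refl })))) (+-identityˡ _)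

    S∑-adj : ∀ {n} (v : Fin n) x y → S∑ (λ F → cr v x F * y F) ≈ S∑ (λ F → x F * an v y F)
    S∑-adj {suc n} zero x y = trans (+-congʳ (fin-0 (S∑-fin {n}) (λ F → zeroˡ _))) (trans (+-comm _ _)
      (+-congˡ (sym (fin-0 (S∑-fin {n}) (λ F → zeroʳ _)))))
    S∑-adj {suc n} (suc v) x y = +-cong (S∑-adj v _ _) (begin
      S∑ (λ F → - cr v (λ G → x (true ∷ G)) F * y (true ∷ F))   ≈⟨ fin-cong (S∑-fin {n}) (λ F → sym (-‿distribˡ-* _ _)) ⟩
      S∑ (λ F → - (cr v (λ G → x (true ∷ G)) F * y (true ∷ F))) ≈⟨ fin-neg (S∑-fin {n}) _ ⟩
      - S∑ (λ F → cr v (λ G → x (true ∷ G)) F * y (true ∷ F))   ≈⟨ -‿cong (S∑-adj v _ _) ⟩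
      - S∑ (λ F → x (true ∷ F) * an v (λ G → y (true ∷ G)) F)   ≈⟨ sym (fin-neg (S∑-fin {n}) _) ⟩
      S∑ (λ F → - (x (true ∷ F) * an v (λ G → y (true ∷ G)) F)) ≈⟨ fin-cong (S∑-fin {n}) (λ F → -‿distribʳ-* _ _) ⟩
      S∑ (λ F → x (true ∷ F) * - an v (λ G → y (true ∷ G)) F)   ∎)

  crt-adj : ∀ {n} (t : Fin n → Carrier) x y → S∑ (λ F → crt t x F * y F) ≈ S∑ (λ F → x F * ant t y F)
  crt-adj {n} t x y = begin
    S∑ (λ F → crt t x F * y F)                    ≈⟨ fin-cong S∑-fin (λ F → trans (*-comm _ _) (trans (sym (sum-* (y F) _)) (sum-cong (λ v → solve 3 (λ y t c → y :* (t :* c) := t :* (c :* y)) refl (y F) (t v) (cr v x F))))) ⟩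
    S∑ (λ F → ∑ (λ v → t v * (cr v x F * y F)))   ≈⟨ trans (fin-∑ S∑-fin _) (sum-cong (λ v → trans (fin-* S∑-fin (t v) _) (trans (*-congˡ (S∑-adj v x y)) (sym (fin-* S∑-fin (t v) _))))) ⟩
    ∑ (λ v → S∑ (λ F → t v * (x F * an v y F)))   ≈⟨ sym (fin-∑ S∑-fin _) ⟩
    S∑ (λ F → ∑ (λ v → t v * (x F * an v y F)))   ≈⟨ fin-cong S∑-fin (λ F → trans (sum-cong (λ v → solve 3 (λ y t c → t :* (y :* c) := y :* (t :* c)) refl (x F) (t v) (an v y F))) (sum-* (x F) _)) ⟩
    S∑ (λ F → x F * ant t y F) ∎

  -- Simplicial cochains; cohomology against homology

  module _ {n : ℕ} (Γ : Subset n → Bool) where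
    δ≈crt : ∀ x F → δ Γ x F ≈ crt 𝟙 x F
    δ≈crt x F = trans (≡⇒≈ (≡.sym (∑≡sumF _))) (sum-cong (λ v → trans (cr-formula v x F) (sym (*-identityˡ _))))

    ∂≈ant : ∀ x F → ∂ Γ x F ≈ ant 𝟙 x F
    ∂≈ant x F = trans (≡⇒≈ (≡.sym (∑≡sumF _))) (sum-cong (λ v → trans (an-formula v x F) (sym (*-identityˡ _))))

    Face : ℕ → Subset n → Set
    Face p F = Γ F ≡ true × ∣ F ∣ ≡ p

    Face? : ∀ p F → Dec (Face p F)
    Face? p F = (Γ F Bool.≟ true) ×-dec (∣ F ∣ ℕ.≟ p)

    Supp⇒Chain : ∀ {p x} → Supp (Face p) x → Chain Γ p x
    Supp⇒Chain (lift s) = lift (λ F → λ { (inj₁ e) → s F (λ (a , _) → true≢false a e) ; (inj₂ e) → s F (λ (_ , b) → e b) })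

    Chain⇒Supp : ∀ {p x} → Chain Γ p x → Supp (Face p) x
    Chain⇒Supp {p} (lift s) = lift (λ F q → case Γ F Bool.≟ true of λ where
      (no e) → s F (inj₁ (¬true e))
      (yes e) → s F (inj₂ (λ z → q (e , z))))

    Chain-sub : ∀ p → IsSub (Chain Γ p)
    Chain-sub p = record
      { 0∈ = lift (λ _ _ → refl)
      ; +∈ = λ { (lift u) (lift v) → lift (λ i n → trans (+-cong (u i n) (v i n)) (+-identityˡ _)) }
      ; *∈ = λ { k (lift u) → lift (λ i n → trans (*-congˡ (u i n)) (zeroʳ k)) }
      ; ≈∈ = λ { e (lift u) → lift (λ i n → trans (sym (e i)) (u i n)) } }

    Chain-dim : ∀ p → Σ ℕ (Dim (Chain Γ p) Zero)
    Chain-dim p = let (N , cd) = card-Subset (Face? p) in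
      N , Dim-≐ Supp⇒Chain Chain⇒Supp id id (Supp-dim (Face? p) cd)

    -- Closure under subsets allows the equation for `x`, known on faces only, to be substituted in
    -- the coboundary at a face.
    coboundary-closed : IsComplex Γ → ∀ {x y} → (∀ F → Γ F ≡ true → x F ≈ crt 𝟙 y F) → ∀ F → Γ F ≡ true → crt 𝟙 x F ≈ 0#
    coboundary-closed cx {x} {y} z F f = trans (sum-cong (λ w → *-congˡ (cr-cong w x (crt 𝟙 y) F (λ _ → z _ (Complex-down cx (remove-⊆ w F) f))))) (crt² 𝟙 y F)

    -- Size `p` means degree `p` - 1. Writing the shift as an equation with `suc` leaves no cochains
    -- below size zero, so degree -1 is not a special case.
    PreChain : ℕ → Pr (Subset n)
    PreChain p = Supp (λ F → Γ F ≡ true × suc ∣ F ∣ ≡ p)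

    Zc : ℕ → Pr (Subset n)
    Zc p x = Chain Γ p x × (∀ F → Γ F ≡ true → crt 𝟙 x F ≈ 0#)

    Bc : ℕ → Pr (Subset n)
    Bc p x = Chain Γ p x × Σ (V (Subset n)) λ y → PreChain p y × (∀ F → Γ F ≡ true → x F ≈ crt 𝟙 y F)

    Zc-sub : ∀ p → IsSub (Zc p)
    Zc-sub p = record
      { 0∈ = 0∈ cs , λ F e → fin-0 (crt-fin 𝟙 F) (λ _ → refl)
      ; +∈ = λ (c , a) (c' , b) → +∈ cs c c' , λ F e → trans (fin-+ (crt-fin 𝟙 F) _ _) (trans (+-cong (a F e) (b F e)) (+-identityˡ _))
      ; *∈ = λ k (c , a) → *∈ cs k c , λ F e → trans (fin-* (crt-fin 𝟙 F) k _) (trans (*-congˡ (a F e)) (zeroʳ k))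
      ; ≈∈ = λ q (c , a) → ≈∈ cs q c , λ F e → trans (fin-cong (crt-fin 𝟙 F) (λ G → sym (q G))) (a F e) }
      where cs = Chain-sub p

    Bc-sub : ∀ p → IsSub (Bc p)
    Bc-sub p = record
      { 0∈ = 0∈ (Chain-sub p) , _ , 0∈ Supp-sub , λ F _ → sym (fin-0 (crt-fin 𝟙 F) (λ _ → refl))
      ; +∈ = λ (a , y , b , e) (a' , y' , b' , e') → +∈ (Chain-sub p) a a' , _ , +∈ Supp-sub b b' ,
          λ F q → trans (+-cong (e F q) (e' F q)) (sym (fin-+ (crt-fin 𝟙 F) y y'))
      ; *∈ = λ k (a , y , b , e) → *∈ (Chain-sub p) k a , _ , *∈ Supp-sub k b ,
          λ F q → trans (*-congˡ (e F q)) (sym (fin-* (crt-fin 𝟙 F) k y))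
      ; ≈∈ = λ h (a , y , b , e) → ≈∈ (Chain-sub p) h a , y , b , λ F q → trans (sym (h F)) (e F q) }

    Pre⇒Chain : ∀ {i x} → PreChain (suc i) x → Chain Γ i x
    Pre⇒Chain (lift s) = Supp⇒Chain (lift (λ F q → s F (λ (a , b) → q (a , ℕP.suc-injective b))))

    Chain⇒Pre : ∀ {i x} → Chain Γ i x → PreChain (suc i) x
    Chain⇒Pre ch = lift (λ F q → lower (Chain⇒Supp ch) F (λ (a , b) → q (a , ≡.cong suc b)))

    Bc⇒Zc : IsComplex Γ → ∀ s {x} → Bc s x → Zc s x
    Bc⇒Zc cx s (a , _ , _ , z) = a , coboundary-closed cx z

    Coboundaries⇒Bc : ∀ {i x} → Coboundaries Γ i x → Bc (suc i) x
    Coboundaries⇒Bc (a , y , b , e) = a , y , Chain⇒Pre b , λ F q → trans (e F q) (δ≈crt _ F)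

    Bc⇒Coboundaries : ∀ {i x} → Bc (suc i) x → Coboundaries Γ i x
    Bc⇒Coboundaries (a , y , b , e) = a , y , Pre⇒Chain b , λ F q → trans (e F q) (sym (δ≈crt _ F))

    Coboundaries-sub : ∀ i → IsSub (Coboundaries Γ i)
    Coboundaries-sub i = record
      { 0∈ = Bc⇒Coboundaries (0∈ s)
      ; +∈ = λ a b → Bc⇒Coboundaries (+∈ s (Coboundaries⇒Bc a) (Coboundaries⇒Bc b))
      ; *∈ = λ k a → Bc⇒Coboundaries (*∈ s k (Coboundaries⇒Bc a))
      ; ≈∈ = λ e a → Bc⇒Coboundaries (≈∈ s e (Coboundaries⇒Bc a)) }
      where s = Bc-sub (suc i)

    crt-drop : ∀ {p x} → Chain Γ p x → ∀ F → ¬ (∣ F ∣ ≡ suc p) → crt 𝟙 x F ≈ 0#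
    crt-drop {p} {x} ch F q = sum-0 (λ v → trans (*-congˡ (cr-loc v x F (λ e →
      lower (Chain⇒Supp ch) _ (λ (_ , z) → q (≡.trans (≡.sym (size-remove v F e)) (≡.cong suc z)))))) (zeroʳ _))

    -- The coboundary cut down to faces: only then are its values cochains and its rank a number to
    -- be compared.
    δm : V (Subset n) → V (Subset n)
    δm x F = if Γ F then crt 𝟙 x F else 0#

    δm-fin : ∀ F → IsFin (λ x → δm x F)
    δm-fin F with Γ F
    ... | true  = crt-fin 𝟙 F
    ... | false = 0-fin

    δm-true : ∀ {x F} → Γ F ≡ true → δm x F ≈ crt 𝟙 x F
    δm-true {x} {F} e with Γ F
    δm-true ≡.refl | true = refl

    δm-false : ∀ {x F} → Γ F ≡ false → δm x F ≈ 0#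
    δm-false {x} {F} e with Γ F
    δm-false ≡.refl | false = refl

    δm-chain : ∀ {p x} → Chain Γ p x → Chain Γ (suc p) (δm x)
    δm-chain ch = lift (λ F → λ where
      (inj₁ e) → δm-false e
      (inj₂ q) → case Γ F Bool.≟ true of λ where
        (yes e) → trans (δm-true e) (crt-drop ch F q)
        (no e)  → δm-false (¬true e))

    module _ (cx : IsComplex Γ) where
      ∂-chain : ∀ {p x} → Chain Γ (suc p) x → Chain Γ p (ant 𝟙 x)
      ∂-chain {p} {x} ch = Supp⇒Chain (lift (λ F q → sum-0 (λ v → trans (*-congˡ (an-loc v x F (λ e →
        lower (Chain⇒Supp ch) _ (λ (a , b) → q (Complex-down cx (⊆-add v F) a , ℕP.suc-injective (≡.trans (≡.sym (size-add v F e)) b)))))) (zeroʳ _))))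

      adjoint : ∀ {p q x y} → Chain Γ p x → Chain Γ q y → S∑ (λ F → δm x F * y F) ≈ S∑ (λ F → x F * ant 𝟙 y F)
      adjoint {p} {q} {x} {y} a b = trans (fin-cong S∑-fin (λ F → masked F)) (crt-adj 𝟙 x y)
        where
        masked : ∀ F → δm x F * y F ≈ crt 𝟙 x F * y F
        masked F = case Γ F Bool.≟ true of λ where
          (yes e) → *-congʳ (δm-true e)
          (no e) → let z = lower b F (inj₁ (¬true e)) in trans (*-congˡ z) (trans (zeroʳ _) (sym (trans (*-congˡ z) (zeroʳ _))))

  module _ {n : ℕ} where
    opaque
      indicator : Subset n → V (Subset n)
      indicator F G = if does (VecP.≡-dec Bool._≟_ G F) then 1# else 0#

      indicator-off : ∀ F {G} → ¬ G ≡ F → indicator F G ≈ 0#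
      indicator-off F {G} p = ≡⇒≈ (≡.cong (λ b → if b then 1# else 0#) (dec-false (VecP.≡-dec Bool._≟_ G F) p))

      indicator-on : ∀ F → indicator F F ≈ 1#
      indicator-on F = ≡⇒≈ (≡.cong (λ b → if b then 1# else 0#) (dec-true (VecP.≡-dec Bool._≟_ F F) ≡.refl))

    indicator-sum : ∀ F (x : V (Subset n)) → S∑ (λ G → indicator F G * x G) ≈ x F
    indicator-sum F x = trans (S∑-single _ F (λ G p → trans (*-congʳ (indicator-off F p)) (zeroˡ _))) (trans (*-congʳ (indicator-on F)) (*-identityˡ _))

    -- Row rank against column rank: the coordinates of `φ` on the family `E` representing
    -- evaluations, taken in a basis of the image of `φ`, give functions that span the image of `ψ`.
    adjoint-rank : {U X : Pr (Subset n)} {φ ψ : V (Subset n) → V (Subset n)} →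
      (∀ {x} → U x → X (φ x)) → (∀ {y} → X y → U (ψ y)) →
      (∀ {x y} → U x → X y → S∑ (λ F → φ x F * y F) ≈ S∑ (λ F → x F * ψ y F)) →
      (E : Subset n → V (Subset n)) → (∀ F → U (E F)) → (∀ F {x} → U x → S∑ (λ G → E F G * x G) ≈ x F) →
      ∀ {ρ ρ'} → Dim (Image φ U X Zero) Zero ρ → Dim (Image ψ X U Zero) Zero ρ' → ρ' ≤ ρ
    adjoint-rank {U} {X} {φ} {ψ} toX toU adj E EU Esum {ρ} {ρ'} (dim A inA _ spnA) (dim vs inv ind _) =
      independent⇒≤ Zero-sub vs B ind P eq
      where
      coords : ∀ F → Σ (Fin ρ → Carrier) λ cs → Zero (λ i → φ (E F) i - linComb cs A i)
      coords F = spnA (φ (E F)) (toX (EU F) , E F , EU F , lift (λ i → -‿inverseʳ _))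
      B : Fin ρ → V (Subset n)
      B l F = proj₁ (coords F) l
      ys : Fin ρ' → V (Subset n)
      ys k = proj₁ (proj₂ (inv k))
      P : Fin ρ' → Fin ρ → Carrier
      P k l = S∑ (λ G → A l G * ys k G)
      diff-zero : ∀ {a b} → a - b ≈ 0# → a ≈ b
      diff-zero {a} {b} e = trans (solve 2 (λ a b → a := (a :- b) :+ b) refl a b) (trans (+-congʳ e) (+-identityˡ b))
      eq : ∀ k → Zero (λ F → vs k F - linComb (P k) B F)
      eq k = lift (λ F → trans (+-congʳ (begin
        vs k F                                             ≈⟨ diff-zero (lower (proj₂ (proj₂ (proj₂ (inv k)))) F) ⟩
        ψ (ys k) F                                         ≈⟨ sym (Esum F (toU Xy)) ⟩
        S∑ (λ G → E F G * ψ (ys k) G)                      ≈⟨ sym (adj (EU F) Xy) ⟩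
        S∑ (λ G → φ (E F) G * ys k G)                      ≈⟨ fin-cong S∑-fin (λ G → *-congʳ (trans (diff-zero (lower (proj₂ (coords F)) G)) (lc∑ (λ l → B l F) A G))) ⟩
        S∑ (λ G → ∑ (λ l → B l F * A l G) * ys k G)        ≈⟨ fin-cong S∑-fin (λ G → trans (*-comm _ _) (trans (sym (sum-* _ _)) (sum-cong (λ l → solve 3 (λ y b a → y :* (b :* a) := b :* (a :* y)) refl (ys k G) (B l F) (A l G))))) ⟩
        S∑ (λ G → ∑ (λ l → B l F * (A l G * ys k G)))      ≈⟨ fin-∑ S∑-fin _ ⟩
        ∑ (λ l → S∑ (λ G → B l F * (A l G * ys k G)))      ≈⟨ sum-cong (λ l → trans (fin-* S∑-fin (B l F) _) (*-comm _ _)) ⟩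
        ∑ (λ l → P k l * B l F)                            ≈⟨ ∑lc (P k) B F ⟩
        linComb (P k) B F                                  ∎)) (-‿inverseʳ _))
        where
        Xy : X (ys k)
        Xy = proj₁ (proj₂ (proj₂ (inv k)))

    module _ {Γ : Subset n → Bool} (cx : IsComplex Γ) where
      private
        restrict : ∀ {P : Set} → Dec P → Subset n → V (Subset n)
        restrict (yes _) F = indicator F
        restrict (no _)  F = λ _ → 0#

        -- Indicators represent evaluations but are cochains only for faces of the right size;
        -- elsewhere zero does, since cochains vanish there.
        cut : ℕ → Subset n → V (Subset n)
        cut p F = restrict (Face? Γ p F) F

        cut-chain : ∀ p F → Chain Γ p (cut p F)
        cut-chain p F = go (Face? Γ p F)
          where
          go : (r : Dec (Face Γ p F)) → Chain Γ p (restrict r F)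
          go (yes (a , b)) = Supp⇒Chain Γ (lift (λ G q → indicator-off F {G} (λ { ≡.refl → q (a , b) })))
          go (no _)        = lift (λ _ _ → refl)

        cut-sum : ∀ p F {x} → Chain Γ p x → S∑ (λ G → cut p F G * x G) ≈ x F
        cut-sum p F {x} ch = go (Face? Γ p F)
          where
          go : (r : Dec (Face Γ p F)) → S∑ (λ G → restrict r F G * x G) ≈ x F
          go (yes _) = indicator-sum F x
          go (no q)  = trans (fin-0 S∑-fin (λ G → zeroˡ _)) (sym (lower (Chain⇒Supp Γ ch) F q))

        adj-sym : ∀ {p q x y} → Chain Γ p x → Chain Γ q y → S∑ (λ F → ant 𝟙 x F * y F) ≈ S∑ (λ F → x F * δm Γ y F)
        adj-sym a b = trans (fin-cong S∑-fin (λ F → *-comm _ _)) (trans (sym (adjoint Γ cx b a)) (fin-cong S∑-fin (λ F → *-comm _ _)))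

      ranks-agree : ∀ p {ρ ρ'} → Dim (Image (ant 𝟙) (Chain Γ (suc p)) (Chain Γ p) Zero) Zero ρ →
                    Dim (Image (δm Γ) (Chain Γ p) (Chain Γ (suc p)) Zero) Zero ρ' → ρ ≡ ρ'
      ranks-agree p d d' = ℕP.≤-antisym
        (adjoint-rank (δm-chain Γ) (∂-chain Γ cx) (adjoint Γ cx) (cut p) (cut-chain p) (cut-sum p) d' d)
        (adjoint-rank (∂-chain Γ cx) (δm-chain Γ) adj-sym (cut (suc p)) (cut-chain (suc p)) (cut-sum (suc p)) d d')

      -- Betti numbers are given for homology, whereas the total complex produces cohomology. Both
      -- equal the dimension of the chain space minus its two adjacent ranks, and boundary and
      -- coboundary between the same two spaces have equal ranks, being transposes.
      cohomology-dim : ∀ {s b} → Betti Γ s b → DN (Dim (Zc Γ (suc s)) (Bc Γ (suc s)) b)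
      cohomology-dim {s} {b} q = do
          R₁  ← rank-lemma linA (cs (suc p)) Zero-sub (cs p) Zero-sub (Zero-min (cs _)) (Zero-min (cs _)) (∂-chain Γ cx) (zl linA) (d (suc p)) (d p)
          R₀  ← rank-lemma linA (cs p) (Image-sub linA (cs (suc p)) (cs p) Zero-sub) (cs s) Zero-sub proj₁ (Zero-min (cs _)) (∂-chain Γ cx) im∂ (Rank.coker-dim R₁) (d s)
          R₀' ← rank-lemma linC (cs s) Zero-sub (cs p) Zero-sub (Zero-min (cs _)) (Zero-min (cs _)) (δm-chain Γ) (zl linC) (d s) (d p)
          R₁' ← rank-lemma linC (cs p) (Image-sub linC (cs s) (cs p) Zero-sub) (cs (suc p)) Zero-sub proj₁ (Zero-min (cs _)) (δm-chain Γ) imδ (Rank.coker-dim R₀') (d (suc p))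
          return (finish R₁ R₀ R₀' R₁')
        where
        p = suc s
        cs = Chain-sub Γ
        f : ℕ → ℕ
        f p = proj₁ (Chain-dim Γ p)
        d : ∀ p → Dim (Chain Γ p) Zero (f p)
        d p = proj₂ (Chain-dim Γ p)
        linA : Lin (ant 𝟙)
        linA = fin-lin (λ F → ant-fin 𝟙 F)
        linC : Lin (δm Γ)
        linC = fin-lin (δm-fin Γ)
        zl : ∀ {φ : V (Subset n) → V (Subset n)} → Lin φ → ∀ {u} → Zero u → Zero (φ u)
        zl l (lift z) = lift (λ j → trans (φ-cong l z j) (φ-0 l j))
        from : ∀ {x y : V (Subset n)} → Zero (λ F → x F - y F) → x ≋ y
        from (lift z) F = trans (solve 2 (λ a b → a := (a :- b) :+ b) refl _ _) (trans (+-congʳ (z F)) (+-identityˡ _))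
        im∂ : ∀ {u} → Image (ant 𝟙) (Chain Γ (suc p)) (Chain Γ p) Zero u → Zero (ant 𝟙 u)
        im∂ (_ , y , _ , z) = lift (λ F → trans (fin-cong (ant-fin 𝟙 F) (from z)) (ant² 𝟙 y F))
        imδ : ∀ {u} → Image (δm Γ) (Chain Γ s) (Chain Γ p) Zero u → Zero (δm Γ u)
        imδ {u} (_ , y , _ , z) = lift (λ F → case Γ F Bool.≟ true of λ where
          (no e) → δm-false Γ (¬true e)
          (yes e) → trans (δm-true Γ e) (coboundary-closed Γ cx (λ G g → trans (from z G) (δm-true Γ g)) F e))
        finish : (R₁ : Rank (ant 𝟙) (Chain Γ (suc p)) Zero (Chain Γ p) Zero (f (suc p)) (f p)) →
                 Rank (ant 𝟙) (Chain Γ p) (Image (ant 𝟙) (Chain Γ (suc p)) (Chain Γ p) Zero) (Chain Γ s) Zero (Rank.coker R₁) (f s) →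
                 (R₀' : Rank (δm Γ) (Chain Γ s) Zero (Chain Γ p) Zero (f s) (f p)) →
                 Rank (δm Γ) (Chain Γ p) (Image (δm Γ) (Chain Γ s) (Chain Γ p) Zero) (Chain Γ (suc p)) Zero (Rank.coker R₀') (f (suc p)) →
                 Dim (Zc Γ p) (Bc Γ p) b
        finish R₁ R₀ R₀' R₁' = ≡.subst (Dim (Zc Γ p) (Bc Γ p)) k≡b
            (Dim-≐ (λ (a , lift z) → a , λ F e → trans (sym (δm-true Γ e)) (z F))
                   (λ (a , z) → a , lift (λ F → case Γ F Bool.≟ true of λ where
                       (yes e) → trans (δm-true Γ e) (z F e)
                       (no e) → δm-false Γ (¬true e)))
                   (λ (a , y , b , z) → a , y , Chain⇒Pre Γ b , λ F e → trans (from z F) (δm-true Γ e))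
                   (λ (a , y , b , z) → a , y , Pre⇒Chain Γ b , lift (λ F → case Γ F Bool.≟ true of λ where
                       (yes e) → trans (+-congˡ (-‿cong (δm-true Γ e))) (trans (+-congʳ (z F e)) (-‿inverseʳ _))
                       (no e) → trans (+-congˡ (trans (-‿cong (δm-false Γ (¬true e))) -0#≈0#)) (trans (+-identityʳ _) (lower a F (inj₁ (¬true e))))))
                   (Rank.ker-dim R₁'))
          where
          module A₁ = Rank R₁
          module A₀ = Rank R₀
          module C₀ = Rank R₀'
          module C₁ = Rank R₁'
          ρ₁ : A₁.rank ≡ C₁.rank
          ρ₁ = ranks-agree p A₁.image-dim C₁.image-dim
          ρ₀ : A₀.rank ≡ C₀.rank
          ρ₀ = ranks-agree s A₀.image-dim C₀.image-dim
          A₀ker : A₀.ker ≡ b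
          A₀ker = Dim-unique (Image-sub linA (cs (suc p)) (cs p) Zero-sub) A₀.ker-dim
            (Dim-≐ (λ (a , z) → a , lift (λ G → trans (sym (∂≈ant Γ _ G)) (z G)))
                   (λ (a , lift z) → a , λ G → trans (∂≈ant Γ _ G) (z G))
                   (λ (a , y , b , z) → a , y , b , lift (λ G → trans (+-congʳ (trans (z G) (∂≈ant Γ y G))) (-‿inverseʳ _)))
                   (λ (a , y , b , z) → a , y , b , λ G → trans (from z G) (sym (∂≈ant Γ y G)))
                   (fromQDim (Cycles Γ s) (Boundaries Γ s) q))
          k≡b : C₁.ker ≡ b
          k≡b = ℕP.+-cancelʳ-≡ (C₁.rank ℕ.+ C₀.rank) C₁.ker b (≡.trans (≡.sym (ℕP.+-assoc C₁.ker _ _)) (≡.trans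
              (≡.cong (ℕ._+ C₀.rank) C₁.ker+rank) (≡.trans C₀.coker+rank (≡.trans (≡.sym A₁.coker+rank) (≡.trans
              (≡.cong (ℕ._+ A₁.rank) (≡.sym A₀.ker+rank)) (≡.trans (ℕP.+-assoc A₀.ker _ _) (≡.cong₂ ℕ._+_ A₀ker (≡.trans (ℕP.+-comm A₀.rank _) (≡.cong₂ ℕ._+_ ρ₁ ρ₀)))))))))

  -- Relative cohomology at a vertex and the link

  module _ {n : ℕ} (Γ : Subset n → Bool) (v : Fin n) where
    RelChain-sub : ∀ s → IsSub (RelChain Γ v s)
    RelChain-sub s = record
      { 0∈ = 0∈ cs , λ F _ → refl
      ; +∈ = λ (a , p) (b , q) → +∈ cs a b , λ F e → trans (+-cong (p F e) (q F e)) (+-identityˡ _)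
      ; *∈ = λ k (a , p) → *∈ cs k a , λ F e → trans (*-congˡ (p F e)) (zeroʳ k)
      ; ≈∈ = λ h (a , p) → ≈∈ cs h a , λ F e → trans (sym (h F)) (p F e) }
      where cs = Chain-sub Γ s

    RelCocycles-sub : ∀ i → IsSub (RelCocycles Γ v i)
    RelCocycles-sub i = record
      { 0∈ = 0∈ rs , λ F e → trans (δ≈crt Γ _ F) (fin-0 (crt-fin 𝟙 F) (λ _ → refl))
      ; +∈ = λ {x} {y} (a , p) (b , q) → +∈ rs a b , λ F e → trans (δ≈crt Γ _ F) (trans (fin-+ (crt-fin 𝟙 F) x y)
          (trans (+-cong (trans (sym (δ≈crt Γ x F)) (p F e)) (trans (sym (δ≈crt Γ y F)) (q F e))) (+-identityˡ _)))
      ; *∈ = λ k {x} (a , p) → *∈ rs k a , λ F e → trans (δ≈crt Γ _ F) (trans (fin-* (crt-fin 𝟙 F) k x)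
          (trans (*-congˡ (trans (sym (δ≈crt Γ x F)) (p F e))) (zeroʳ k)))
      ; ≈∈ = λ h (a , p) → ≈∈ rs h a , λ F e → trans (δ≈crt Γ _ F) (trans (fin-cong (crt-fin 𝟙 F) (λ G → sym (h G)))
          (trans (sym (δ≈crt Γ _ F)) (p F e))) }
      where rs = RelChain-sub (suc i)

    RelCoboundaries-sub : ∀ i → IsSub (RelCoboundaries Γ v i)
    RelCoboundaries-sub i = record
      { 0∈ = 0∈ rs , _ , 0∈ (RelChain-sub i) , λ F _ → sym (trans (δ≈crt Γ _ F) (fin-0 (crt-fin 𝟙 F) (λ _ → refl)))
      ; +∈ = λ (a , y , p , e) (b , z , q , e') → +∈ rs a b , _ , +∈ (RelChain-sub i) p q , λ F h →
          trans (+-cong (trans (e F h) (δ≈crt Γ y F)) (trans (e' F h) (δ≈crt Γ z F))) (sym (trans (δ≈crt Γ _ F) (fin-+ (crt-fin 𝟙 F) y z)))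
      ; *∈ = λ k (a , y , p , e) → *∈ rs k a , _ , *∈ (RelChain-sub i) k p , λ F h →
          trans (*-congˡ (trans (e F h) (δ≈crt Γ y F))) (sym (trans (δ≈crt Γ _ F) (fin-* (crt-fin 𝟙 F) k y)))
      ; ≈∈ = λ h (a , y , p , e) → ≈∈ rs h a , y , p , λ F q → trans (sym (h F)) (e F q) }
      where rs = RelChain-sub (suc i)

    module _ (cx : IsComplex Γ) where
      RelCoboundaries⇒Cocycles : ∀ {i x} → RelCoboundaries Γ v i x → RelCocycles Γ v i x
      RelCoboundaries⇒Cocycles {i} {x} (a , y , _ , e) = a , λ F q → trans (δ≈crt Γ x F)
        (coboundary-closed Γ cx (λ G g → trans (e G g) (δ≈crt Γ y G)) F q)

      private
        L = lk Γ v
        crt-cr : ∀ x F → crt 𝟙 (cr v x) F ≈ - cr v (crt 𝟙 x) F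
        crt-cr x F = trans (solve 2 (λ a b → a := (a :+ b) :- b) refl _ _) (trans (+-congʳ
          (trans (+-congˡ (trans (fin-∑ (cr-fin v F) _) (sum-cong (λ w → fin-* (cr-fin v F) 1# _)))) (trans (sym (sum-+ _ _)) (sum-0 (λ w →
            trans (sym (distribˡ _ _ _)) (trans (*-congˡ (cr-cr w v x F)) (zeroʳ _))))))) (+-identityˡ _))

        an-crt' : ∀ x F → crt 𝟙 (an v x) F ≈ x F - an v (crt 𝟙 x) F
        an-crt' x F = trans (solve 2 (λ a b → a := (b :+ a) :- b) refl _ _) (+-congʳ (trans (an-crt v 𝟙 x F) (*-identityˡ _)))

        an-chain : ∀ {s x} → Supp (Face Γ (suc s)) x → Supp (Face L s) (an v x)
        an-chain {s} {x} (lift a) = lift (λ F q → an-loc v x F (λ e → a _ (λ (g , z) →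
          q (lk-intro {Γ = Γ} e g , ℕP.suc-injective (≡.trans (≡.sym (size-add v F e)) z)))))

        cr-chain : ∀ {s x} → Supp (Face L s) x → Supp (Face Γ (suc s)) (cr v x)
        cr-chain {s} {x} (lift a) = lift (λ F q → cr-loc v x F (λ e → a _ (λ (g , z) →
          q (≡.trans (≡.cong Γ (≡.sym (add-remove v F e))) (proj₂ (lk-true {Γ = Γ} g)) , ≡.trans (≡.sym (size-remove v F e)) (≡.cong suc z)))))

        cr-rel : ∀ x F → v ∉ F → cr v x F ≈ 0#
        cr-rel x F q = cr-∉ v x F (∉⇒lookup q)

        cr-an : ∀ x F → lookup F v ≡ true → cr v (an v x) F ≈ x F
        cr-an x F e = trans (solve 2 (λ a b → a := (b :+ a) :- b) refl _ _) (trans (+-cong (trans (an-cr v v x F) (trans (*-congʳ (≡⇒≈ (δF-refl v))) (*-identityˡ _)))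
          (trans (-‿cong (an-∈ v _ F e)) -0#≈0#)) (+-identityʳ _))

        L-remove : ∀ {F} → Γ F ≡ true → lookup F v ≡ true → L (F [ v ]≔ false) ≡ true
        L-remove {F} g e = lk-intro {Γ = Γ} (lookup-[]≔ F v) (≡.trans (≡.cong Γ (add-remove v F e)) g)

        cr-agree : ∀ {x y F} → Γ F ≡ true → lookup F v ≡ true → (∀ G → L G ≡ true → x G ≈ y G) → cr v x F ≈ cr v y F
        cr-agree {x} {y} {F} g e h = cr-cong v x y F (λ _ → h _ (L-remove g e))

      -- Contraction with `v` turns a relative cochain into one of the link, one size smaller. It
      -- anticommutes with the coboundary up to the term `x F`, which vanishes on faces without `v`.
      rel-iso : ∀ s → QIso (RelCocycles Γ v s) (RelCoboundaries Γ v s) (Zc L s) (Bc L s)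
      rel-iso s = record
        { φ = an v ; lin = fin-lin (an-fin v) ; subU = RelCocycles-sub s ; subW' = Bc-sub L s
        ; toU = λ ((a , r) , z) → Supp⇒Chain L (an-chain (Chain⇒Supp Γ a)) , λ F g → let (e , g') = lk-true {Γ = Γ} g in
            trans (an-crt' _ F) (trans (+-cong (r F (lookup⇒∉ e)) (trans (-‿cong (an-loc v _ F (λ _ → trans (sym (δ≈crt Γ _ _)) (z _ g')))) -0#≈0#)) (+-identityˡ _))
        ; toW = λ {x} ((a , _) , _) (_ , y , (b , r) , z) → Supp⇒Chain L (an-chain (Chain⇒Supp Γ a)) ,
            (λ F → - 1# * an v y F) , *∈ Supp-sub (- 1#) (pre-an b) , λ F g → let (e , g') = lk-true {Γ = Γ} g in begin
              an v x F                     ≈⟨ trans (an-cong v x (crt 𝟙 y) F (λ _ → trans (z _ g') (δ≈crt Γ y _))) (sym (+-identityˡ _)) ⟩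
              0# + an v (crt 𝟙 y) F        ≈⟨ solve 2 (λ a b → con (+ 0) :+ a := b :- (b :- a)) refl _ (y F) ⟩
              y F - (y F - an v (crt 𝟙 y) F) ≈⟨ +-cong (r F (lookup⇒∉ e)) (-‿cong (sym (an-crt' y F))) ⟩
              0# - crt 𝟙 (an v y) F        ≈⟨ trans (+-identityˡ _) (sym (-1*x≈-x _)) ⟩
              - 1# * crt 𝟙 (an v y) F      ≈⟨ sym (fin-* (crt-fin 𝟙 F) (- 1#) _) ⟩
              crt 𝟙 (λ F → - 1# * an v y F) F ∎
        -- The sign of the lifted primitive compensates the anticommutation of `cr v` with the
        -- coboundary.
        ; refW = λ {x} ((a , r) , _) (_ , y , b , z) → (a , r) , (λ F → - cr v y F) ,
            (Supp⇒Chain Γ (lift (λ F q → trans (-‿cong (cr-loc v y F (λ e → lower b _ (λ (g , h) →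
                q (≡.trans (≡.cong Γ (≡.sym (add-remove v F e))) (proj₂ (lk-true {Γ = Γ} g)) , ≡.trans (≡.sym (size-remove v F e)) h))))) -0#≈0#)) ,
             λ F q → trans (-‿cong (cr-rel y F q)) -0#≈0#) ,
            λ F g → trans (main x y r z F g) (sym (trans (δ≈crt Γ _ F) (trans (fin-neg (crt-fin 𝟙 F) _) (-‿cong (crt-cr y F)))))
        ; surj = λ z (a , p) → cr v z ,
            ((Supp⇒Chain Γ (cr-chain (Chain⇒Supp L a)) , cr-rel z) ,
              λ F g → trans (δ≈crt Γ _ F) (trans (crt-cr z F) (trans (-‿cong (cr-loc v _ F (λ e → p _ (L-remove g e)))) -0#≈0#))) ,
            ≈∈ (Bc-sub L s) (λ F → sym (trans (+-congˡ (-‿cong (begin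
              an v (cr v z) F                         ≈⟨ solve 2 (λ a b → a := (a :+ b) :- b) refl _ _ ⟩
              (an v (cr v z) F + cr v (an v z) F) - cr v (an v z) F  ≈⟨ +-cong (trans (an-cr v v z F) (trans (*-congʳ (≡⇒≈ (δF-refl v))) (*-identityˡ _)))
                   (trans (-‿cong (trans (fin-cong (cr-fin v F) (an-zero a)) (fin-0 (cr-fin v F) (λ _ → refl)))) -0#≈0#) ⟩
              z F + 0#                                ≈⟨ +-identityʳ _ ⟩
              z F ∎))) (-‿inverseʳ _))) (0∈ (Bc-sub L s)) }
        where
        pre-an : ∀ {y} → Chain Γ s y → Supp (λ F → L F ≡ true × suc ∣ F ∣ ≡ s) (an v y)
        pre-an {y} ch = lift (λ F q → an-loc v y F (λ e → lower (Chain⇒Supp Γ ch) _ (λ (g , z) →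
          q (lk-intro {Γ = Γ} e g , ≡.trans (≡.sym (size-add v F e)) z))))
        an-zero : ∀ {z} → Chain L s z → an v z ≋ (λ _ → 0#)
        an-zero {z} ch F = an-loc v z F (λ _ → lower (Chain⇒Supp L ch) _ (λ (g , _) → true≢false (lookup-[]≔ F v) (proj₁ (lk-true {Γ = Γ} g))))
        main : ∀ x y → (∀ F → v ∉ F → x F ≈ 0#) → (∀ F → L F ≡ true → an v x F ≈ crt 𝟙 y F) → ∀ F → Γ F ≡ true → x F ≈ - - cr v (crt 𝟙 y) F
        main x y r z F g = trans (case lookup F v Bool.≟ true of λ where
            (yes e) → trans (sym (cr-an x F e)) (cr-agree g e z)
            (no e) → trans (r F (lookup⇒∉ (¬true e))) (sym (cr-∉ v _ F (¬true e)))) (sym (-‿involutive _))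

  -- The total complex and its subquotients

  module TotalComplex {n d : ℕ} (Θ : Fin d → Fin n → Carrier) (i : ℕ) where
    θ : Fin n → Fin d → Carrier
    θ v j = Θ j v

    Ix₂ : Set
    Ix₂ = Subset d × Vec ℤ n

    -- (F , S , a): component A[x_F⁻¹] of the Čech complex, exterior monomial e_S of the
    -- Koszul complex, multidegree a.
    Ix : Set
    Ix = Subset n × Ix₂

    opaque
      -- The Koszul differential sends e_j to θ_j. Collected by variables, multiplication by x_v is
      -- the shift of multidegree and the exterior part is contraction with the coefficients of x_v.
      κ : V Ix₂ → V Ix₂
      κ Y (S , a) = ∑ (λ v → ant (θ v) (λ S' → Y (S' , dec v a)) S)

      κ-def : ∀ Y S a → κ Y (S , a) ≡ ∑ (λ v → ant (θ v) (λ S' → Y (S' , dec v a)) S)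
      κ-def Y S a = ≡.refl

    κ≈ : ∀ Y S a → κ Y (S , a) ≈ ∑ (λ v → ant (θ v) (λ S' → Y (S' , dec v a)) S)
    κ≈ Y S a = ≡⇒≈ (κ-def Y S a)

    κ-fin : ∀ p → IsFin (λ Y → κ Y p)
    κ-fin (S , a) = let (L , e) = ∑-fin (λ v → ∘-fin (ant-fin (θ v) S) (λ S' → pt-fin (S' , dec v a))) in
      L , λ Y → trans (κ≈ Y S a) (e Y)

    opaque
      D : V Ix → V Ix
      D X (F , S , a) = sg S * crt 𝟙 (λ F' → X (F' , S , a)) F + κ (λ p → X (F , p)) (S , a)

      D-def : ∀ X F S a → D X (F , S , a) ≡ sg S * crt 𝟙 (λ F' → X (F' , S , a)) F + κ (λ p → X (F , p)) (S , a)
      D-def X F S a = ≡.refl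

    D≈ : ∀ X F S a → D X (F , S , a) ≈ sg S * crt 𝟙 (λ F' → X (F' , S , a)) F + κ (λ p → X (F , p)) (S , a)
    D≈ X F S a = ≡⇒≈ (D-def X F S a)

    D-fin : ∀ p → IsFin (λ X → D X p)
    D-fin (F , S , a) = let (L , e) = +-fin (*-fin (sg S) (∘-fin (crt-fin 𝟙 F) (λ F' → pt-fin (F' , S , a)))) (∘-fin (κ-fin (S , a)) (λ p → pt-fin (F , p))) in
      L , λ X → trans (D≈ X F S a) (e X)

    D-lin : Lin D
    D-lin = fin-lin D-fin

    κ-sg : ∀ Y S a → κ (λ (S' , a') → sg S' * Y (S' , a')) (S , a) ≈ - (sg S * κ Y (S , a))
    κ-sg Y S a = trans (κ≈ _ S a) (trans (sum-cong (λ v → ant-sg (θ v) (λ S' → Y (S' , dec v a)) S))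
      (trans (sum-neg _) (-‿cong (trans (sum-* (sg S) _) (*-congˡ (sym (κ≈ Y S a)))))))

    κ² : ∀ Y p → κ (κ Y) p ≈ 0#
    κ² Y (S , a) = trans (κ≈ _ S a) (trans (sum-cong (λ v → trans (fin-cong (ant-fin (θ v) S) (λ S' → κ≈ Y S' (dec v a)))
        (fin-∑ (ant-fin (θ v) S) (λ w S' → ant (θ w) (λ S'' → Y (S'' , dec w (dec v a))) S'))))
      (alternating-sum (λ v w → ant (θ v) (ant (θ w) (λ S' → Y (S' , dec w (dec v a)))) S)
        (λ v → ant² (θ v) (λ S' → Y (S' , dec v (dec v a))) S)
        (λ v w → trans (+-congˡ (≡⇒≈ (≡.cong (λ b → ant (θ w) (ant (θ v) (λ S' → Y (S' , b))) S) (dec-comm v w a))))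
          (ant-ant (θ v) (θ w) (λ S' → Y (S' , dec w (dec v a))) S))))

    -- The Čech and Koszul parts square to zero separately; the mixed terms cancel by the sign `sg`
    -- once the two commuting operators are exchanged by `fubini`.
    D² : ∀ X p → D (D X) p ≈ 0#
    D² X (F , S , a) = begin
      D (D X) (F , S , a)                                        ≈⟨ D≈ (D X) F S a ⟩
      sg S * crt 𝟙 (λ F' → D X (F' , S , a)) F + κ (λ p → D X (F , p)) (S , a)
        ≈⟨ +-cong (*-congˡ (trans (fin-cong (crt-fin 𝟙 F) (λ F' → D≈ X F' S a)) (trans (fin-+ (crt-fin 𝟙 F) _ _)
                     (+-congʳ (trans (fin-* (crt-fin 𝟙 F) (sg S) _) (trans (*-congˡ (crt² 𝟙 (λ F' → X (F' , S , a)) F)) (zeroʳ _)))))))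
                  (trans (fin-cong (κ-fin (S , a)) (λ (S' , a') → D≈ X F S' a')) (trans (fin-+ (κ-fin (S , a)) (λ (S' , a') → sg S' * Y (S' , a')) _) (+-cong (κ-sg Y S a) (κ² _ (S , a))))) ⟩
      sg S * (0# + crt 𝟙 (λ F' → κ (λ p → X (F' , p)) (S , a)) F) + (- (sg S * κ Y (S , a)) + 0#)
        ≈⟨ +-congʳ (*-congˡ (+-congˡ (fubini (crt-fin 𝟙 F) (κ-fin (S , a)) (λ F' p → X (F' , p))))) ⟩
      sg S * (0# + κ Y (S , a)) + (- (sg S * κ Y (S , a)) + 0#)
        ≈⟨ solve 2 (λ s q → s :* (con (+ 0) :+ q) :+ (:- (s :* q) :+ con (+ 0)) := con (+ 0)) refl (sg S) (κ Y (S , a)) ⟩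
      0# ∎
      where
      Y : V Ix₂
      Y (S' , a') = crt 𝟙 (λ F' → X (F' , S' , a')) F

    D-loc : ∀ X F S a → (∀ v → lookup F v ≡ true → X (F [ v ]≔ false , S , a) ≈ 0#) →
            (∀ v j → lookup S j ≡ false → X (F , S [ j ]≔ true , dec v a) ≈ 0#) → D X (F , S , a) ≈ 0#
    D-loc X F S a p q = trans (D≈ X F S a) (trans (+-cong
      (trans (*-congˡ (sum-0 (λ v → trans (*-congˡ (cr-loc v (λ F' → X (F' , S , a)) F (p v))) (zeroʳ _)))) (zeroʳ _))
      (trans (κ≈ _ S a) (sum-0 (λ v → sum-0 (λ j → trans (*-congˡ (an-loc j (λ S' → X (F , S' , dec v a)) S (q v j))) (zeroʳ _)))))) (+-identityˡ _))

    remove-Le : ∀ (v : Fin n) F a → Le (F [ v ]≔ false) a F a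
    remove-Le v F a = le (remove-⊆ v F) (λ u → ℤP.≤-refl)

    dec-Le : ∀ (v : Fin n) F a → Le F (dec v a) F a
    dec-Le v F a = le (λ u e → e) (dec-≤ v a)

    D-below : ∀ X F S a → (∀ F' S' a' → Le F' a' F a → X (F' , S' , a') ≈ 0#) → D X (F , S , a) ≈ 0#
    D-below X F S a z = D-loc X F S a (λ v _ → z _ _ _ (remove-Le v F a)) (λ v j _ → z _ _ _ (dec-Le v F a))

    D-cong-below : ∀ X Y F S a → (∀ F' S' a' → Le F' a' F a → X (F' , S' , a') ≈ Y (F' , S' , a')) → D X (F , S , a) ≈ D Y (F , S , a)
    D-cong-below X Y F S a e = trans (solve 2 (λ x y → x := (x :- y) :+ y) refl _ _) (trans (+-congʳ (trans (sym (φ-- D-lin X Y (F , S , a)))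
      (D-below _ F S a (λ F' S' a' l → trans (+-congʳ (e F' S' a' l)) (-‿inverseʳ _))))) (+-identityˡ _))

    -- The homological degree is ∣S∣ - ∣F∣ and `m` exceeds it by one, so that degree -1 still has an
    -- index. In the second equation e_S has internal degree ∣S∣.
    Gr : ℕ → Subset n → Subset d → Vec ℤ n → Set
    Gr m F S a = (∣ F ∣ ℕ.+ m ≡ suc ∣ S ∣) × (sumᵥ a ℤ.+ + ∣ S ∣ ≡ + i)

    Gr? : ∀ m F S a → Dec (Gr m F S a)
    Gr? m F S a = (∣ F ∣ ℕ.+ m ℕ.≟ suc ∣ S ∣) ×-dec (sumᵥ a ℤ.+ + ∣ S ∣ ℤ.≟ + i)

    In : Mask n → ℕ → Ix → Set
    In B m (F , S , a) = B F a ≡ true × Gr m F S a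

    In? : ∀ B m p → Dec (In B m p)
    In? B m (F , S , a) = (B F a Bool.≟ true) ×-dec Gr? m F S a

    -- Equations are tested at positions of the mask only; this realises subcomplexes and quotients
    -- alike without new carriers.
    Cx Z Bd : Mask n → ℕ → Pr Ix
    Cx B m = Supp (In B m)
    Z B m X = Cx B m X × (∀ F S a → B F a ≡ true → D X (F , S , a) ≈ 0#)
    Bd B m X = Cx B m X × Σ (V Ix) λ Y → Cx B (suc m) Y × (∀ F S a → B F a ≡ true → X (F , S , a) ≈ D Y (F , S , a))

    Z-sub : ∀ B m → IsSub (Z B m)
    Z-sub B m = record
      { 0∈ = 0∈ Supp-sub , λ F S a _ → φ-0 D-lin _
      ; +∈ = λ (x , p) (y , q) → +∈ Supp-sub x y , λ F S a e → trans (φ-+ D-lin _ _ _) (trans (+-cong (p F S a e) (q F S a e)) (+-identityˡ _))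
      ; *∈ = λ k (x , p) → *∈ Supp-sub k x , λ F S a e → trans (φ-* D-lin k _ _) (trans (*-congˡ (p F S a e)) (zeroʳ k))
      ; ≈∈ = λ h (x , p) → ≈∈ Supp-sub h x , λ F S a e → trans (φ-cong D-lin (λ j → sym (h j)) _) (p F S a e) }

    Bd-sub : ∀ B m → IsSub (Bd B m)
    Bd-sub B m = record
      { 0∈ = 0∈ Supp-sub , _ , 0∈ Supp-sub , λ F S a _ → sym (φ-0 D-lin _)
      ; +∈ = λ (x , Y , y , p) (x' , Y' , y' , p') → +∈ Supp-sub x x' , _ , +∈ Supp-sub y y' ,
          λ F S a e → trans (+-cong (p F S a e) (p' F S a e)) (sym (φ-+ D-lin Y Y' _))
      ; *∈ = λ k (x , Y , y , p) → *∈ Supp-sub k x , _ , *∈ Supp-sub k y , λ F S a e → trans (*-congˡ (p F S a e)) (sym (φ-* D-lin k Y _))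
      ; ≈∈ = λ h (x , Y , y , p) → ≈∈ Supp-sub h x , Y , y , λ F S a e → trans (sym (h _)) (p F S a e) }

    Exact : Mask n → ℕ → Set (c ⊔ ℓ)
    Exact B m = ∀ X → Z B m X → Bd B m X

    opaque
      cut : Mask n → V Ix → V Ix
      cut B X (F , S , a) = if B F a then X (F , S , a) else 0#

      cut-lin : ∀ B → Lin (cut B)
      cut-lin B = fin-lin (λ (F , S , a) → go (B F a) (F , S , a))
        where
        go : ∀ (b : Bool) (p : Ix) → IsFin (λ X → if b then X p else 0#)
        go true  p = pt-fin p
        go false p = 0-fin

      cut-true : ∀ B X {F S a} → B F a ≡ true → cut B X (F , S , a) ≡ X (F , S , a)
      cut-true B X {F} {S} {a} e = ≡.cong (λ b → if b then X (F , S , a) else 0#) e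

      cut-false : ∀ B X {F S a} → B F a ≡ false → cut B X (F , S , a) ≡ 0#
      cut-false B X {F} {S} {a} e = ≡.cong (λ b → if b then X (F , S , a) else 0#) e

    cut-id : ∀ B {m X} → Cx B m X → cut B X ≋ X
    cut-id B {m} {X} (lift s) (F , S , a) = case B F a Bool.≟ true of λ where
      (yes e) → ≡⇒≈ (cut-true B X e)
      (no e) → trans (≡⇒≈ (cut-false B X (¬true e))) (sym (s _ (λ (e' , _) → e e')))

    Graded : ℕ → V Ix → Set _
    Graded m X = ∀ F S a → ¬ Gr m F S a → X (F , S , a) ≈ 0#

    Cx⇒Graded : ∀ {B m X} → Cx B m X → Graded m X
    Cx⇒Graded (lift s) F S a g = s _ (λ (_ , g') → g g')

    Graded⇒Cx : ∀ B {m X} → Graded m X → Cx B m (cut B X)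
    Graded⇒Cx B {m} {X} g = lift (λ (F , S , a) q → case B F a Bool.≟ true of λ where
      (yes e) → trans (≡⇒≈ (cut-true B X e)) (g F S a (λ h → q (e , h)))
      (no e) → ≡⇒≈ (cut-false B X (¬true e)))

    D-Graded : ∀ {m X} → Graded (suc m) X → Graded m (D X)
    D-Graded {m} {X} g F S a q = D-loc X F S a
      (λ v e → g _ _ _ (λ (h , h') → q (≡.trans (≡.cong (ℕ._+ m) (≡.sym (size-remove v F e))) (≡.trans (≡.sym (ℕP.+-suc _ m)) h) , h')))
      (λ v j e → g _ _ _ (λ (h , h') → q (ℕP.suc-injective (≡.trans (≡.sym (ℕP.+-suc _ m)) (≡.trans h (≡.cong suc (size-add j S e)))) ,
         ≡.trans (≡.sym (≡.trans (≡.cong₂ (λ x y → x ℤ.+ + y) (sum-dec v a) (size-add j S e)) (shift (sumᵥ a) (+ ∣ S ∣)))) h')))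
      where
      shift : ∀ x y → (x ℤ.- + 1) ℤ.+ (+ 1 ℤ.+ y) ≡ x ℤ.+ y
      shift = solve-∀

    -- A position outside `B` but below one in `B` cannot lie above another one in `B`. Hence the
    -- part of `D X` that is cut off and would be read again is already zero.
    DD : ∀ {B m X} → Convex B → Cx B m X → ∀ F S a → B F a ≡ true → D (cut B (D X)) (F , S , a) ≈ 0#
    DD {B} {m} {X} cv (lift s) F S a e = trans (D-cong-below _ (D X) F S a (λ F' S' a' l → case B F' a' Bool.≟ true of λ where
        (yes e') → ≡⇒≈ (cut-true B (D X) e')
        (no e') → trans (≡⇒≈ (cut-false B (D X) (¬true e'))) (sym (D-below X F' S' a' (λ F'' S'' a'' l' → s _ (λ (e'' , _) → e' (cv l' l e'' e))))))) (D² X _)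

    Bd⇒Z : ∀ {B m X} → Convex B → Bd B m X → Z B m X
    Bd⇒Z {B} {m} {X} cv (x , Y , y , e) = x , λ F S a k → trans (φ-cong D-lin same (F , S , a)) (DD cv y F S a k)
      where
      same : X ≋ cut B (D Y)
      same (F , S , a) = case B F a Bool.≟ true of λ where
        (yes k) → trans (e F S a k) (≡⇒≈ (≡.sym (cut-true B (D Y) k)))
        (no k) → trans (lower x (F , S , a) (λ (k' , _) → k k')) (≡⇒≈ (≡.sym (cut-false B (D Y) (¬true k))))

    ∧ᵐ-true : ∀ {B E : Mask n} {F a} → (B ∧ᵐ E) F a ≡ true → B F a ≡ true × E F a ≡ true
    ∧ᵐ-true e = ∧-true e

    ∖ᵐ-true : ∀ {B E : Mask n} {F a} → (B ∖ᵐ E) F a ≡ true → B F a ≡ true × E F a ≡ false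
    ∖ᵐ-true e = let (a , b) = ∧-true e in a , BoolP.not-injective b

    ∖ᵐ-intro : ∀ {B E : Mask n} {F a} → B F a ≡ true → E F a ≡ false → (B ∖ᵐ E) F a ≡ true
    ∖ᵐ-intro a b = ∧-intro a (≡.cong not b)

    module _ {B E : Mask n} (cv : Convex B) (up : UpIn B E) where
      private
        off : V Ix → V Ix
        off = cut (λ F a → not (E F a))

        off-E : ∀ X {F S a} → E F a ≡ true → off X (F , S , a) ≈ 0#
        off-E X {F} {S} {a} e = ≡⇒≈ (cut-false (λ F a → not (E F a)) X {F} {S} {a} (≡.cong not e))

        off-¬E : ∀ X {F S a} → E F a ≡ false → off X (F , S , a) ≈ X (F , S , a)
        off-¬E X {F} {S} {a} e = ≡⇒≈ (cut-true (λ F a → not (E F a)) X {F} {S} {a} (≡.cong not e))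

        off-Cx : ∀ {m X} → Cx B m X → Cx (B ∖ᵐ E) m (off X)
        off-Cx {m} {X} (lift s) = lift (λ (F , S , a) q → case E F a Bool.≟ true of λ where
          (yes e) → off-E X e
          (no e) → trans (off-¬E X (¬true e)) (s _ (λ (b , g) → q (∖ᵐ-intro {B} {E} b (¬true e) , g))))

        widen₁ : ∀ {m X} → Cx (B ∖ᵐ E) m X → Cx B m X
        widen₁ (lift s) = lift (λ p q → s p (λ (b , g) → q (proj₁ (∖ᵐ-true {B} {E} b) , g)))

        widen₂ : ∀ {m X} → Cx (B ∧ᵐ E) m X → Cx B m X
        widen₂ (lift s) = lift (λ p q → s p (λ (b , g) → q (proj₁ (∧ᵐ-true {B} {E} b) , g)))

        D-up : ∀ {m X} → Cx (B ∧ᵐ E) m X → ∀ F S a → (B ∖ᵐ E) F a ≡ true → D X (F , S , a) ≈ 0#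
        D-up {m} {X} (lift s) F S a e = let (b , ne) = ∖ᵐ-true {B} {E} e in
          D-below X F S a (λ F' S' a' l → s _ (λ (h , _) → let (b' , e') = ∧ᵐ-true {B} {E} h in true≢false (up l b' e' b) ne))

        D-off : ∀ {m X} → Cx B m X → ∀ F S a → (B ∖ᵐ E) F a ≡ true → D (off X) (F , S , a) ≈ D X (F , S , a)
        D-off {m} {X} (lift s) F S a e = let (b , ne) = ∖ᵐ-true {B} {E} e in
          D-cong-below (off X) X F S a (λ F' S' a' l → case E F' a' Bool.≟ true of λ where
            (no e') → off-¬E X (¬true e')
            (yes e') → trans (off-E X e') (sym (s _ (λ (b' , _) → true≢false (up l b' e' b) ne))))

        split : ∀ {F a} → B F a ≡ true → ((B ∧ᵐ E) F a ≡ true) ⊎ ((B ∖ᵐ E) F a ≡ true)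
        split {F} {a} b = case E F a Bool.≟ true of λ where
          (yes e) → inj₁ (∧-intro b e)
          (no e) → inj₂ (∖ᵐ-intro {B} {E} b (¬true e))

        part₂ : ∀ {m X} → Graded m X → (∀ F S a → (B ∖ᵐ E) F a ≡ true → X (F , S , a) ≈ 0#) → Cx (B ∧ᵐ E) m (cut B X)
        part₂ {m} {X} g z = lift (λ (F , S , a) q → case B F a Bool.≟ true of λ where
          (no b) → ≡⇒≈ (cut-false B X (¬true b))
          (yes b) → trans (≡⇒≈ (cut-true B X b)) (case split b of λ where
            (inj₂ h) → z F S a h
            (inj₁ h) → g F S a (λ g' → q (h , g'))))

        minus : ∀ {m X Y} → Graded m X → Graded m Y → Graded m (λ p → X p - Y p)
        minus g h F S a q = trans (+-cong (g F S a q) (trans (-‿cong (h F S a q)) -0#≈0#)) (+-identityˡ _)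

        D-cut-minus : ∀ {m X Y} → Cx B m X → Cx B (suc m) Y → ∀ F S a → B F a ≡ true →
                      D (cut B (λ p → X p - D Y p)) (F , S , a) ≈ D X (F , S , a)
        D-cut-minus {m} {X} {Y} x y F S a b = trans (φ-cong D-lin (λ p → φ-- (cut-lin B) X (D Y) p) _) (trans (φ-- D-lin _ _ _)
          (trans (+-cong (φ-cong D-lin (cut-id B x) _) (trans (-‿cong (DD cv y F S a b)) -0#≈0#)) (+-identityʳ _)))

      -- A piece of the long exact sequence: exactness of the subcomplex at `suc m` yields
      -- injectivity, exactness at `m` surjectivity.
      quotient-iso : ∀ m → Exact (B ∧ᵐ E) m → Exact (B ∧ᵐ E) (suc m) →
        QIso (Z B (suc m)) (Bd B (suc m)) (Z (B ∖ᵐ E) (suc m)) (Bd (B ∖ᵐ E) (suc m))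
      quotient-iso m ex₀ ex₁ = record
        { φ = off ; lin = cut-lin _ ; subU = Z-sub B (suc m) ; subW' = Bd-sub (B ∖ᵐ E) (suc m)
        ; toU = λ (x , z) → off-Cx x , λ F S a e → trans (D-off x F S a e) (z F S a (proj₁ (∖ᵐ-true {B} {E} e)))
        ; toW = λ {X} _ (x , Y , y , z) → off-Cx x , off Y , off-Cx y , λ F S a e → let (b , ne) = ∖ᵐ-true {B} {E} e in
            trans (off-¬E X ne) (trans (z F S a b) (sym (D-off y F S a e)))
        ; refW = λ {X} (x , zX) (_ , Y , y , z) → reflects X x zX Y y z
        ; surj = λ Y (y , z) → lifts Y y z }
        where
        reflects : ∀ X → Cx B (suc m) X → (∀ F S a → B F a ≡ true → D X (F , S , a) ≈ 0#) → ∀ Y → Cx (B ∖ᵐ E) (suc (suc m)) Y →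
          (∀ F S a → (B ∖ᵐ E) F a ≡ true → off X (F , S , a) ≈ D Y (F , S , a)) → Bd B (suc m) X
        reflects X x zX Y y z = x , (λ p → Y p + Y' p) , +∈ Supp-sub wy (widen₂ y') , λ F S a b → trans (eq F S a b (split b)) (sym (φ-+ D-lin Y Y' _))
          where
          wy = widen₁ y
          -- The defect of the primitive found in the quotient. It lives in the subcomplex, where a
          -- second primitive removes it.
          R : V Ix
          R p = X p - D Y p
          x' : Cx (B ∧ᵐ E) (suc m) (cut B R)
          x' = part₂ (minus (Cx⇒Graded x) (D-Graded (Cx⇒Graded y))) (λ F S a e → trans (+-congʳ (trans (sym (off-¬E X (proj₂ (∖ᵐ-true {B} {E} e)))) (z F S a e))) (-‿inverseʳ _))
          bd : Bd (B ∧ᵐ E) (suc m) (cut B R)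
          bd = ex₁ (cut B R) (x' , λ F S a e → let b = proj₁ (∧ᵐ-true {B} {E} e) in trans (D-cut-minus x wy F S a b) (zX F S a b))
          Y' = proj₁ (proj₂ bd)
          y' = proj₁ (proj₂ (proj₂ bd))
          z' = proj₂ (proj₂ (proj₂ bd))
          eq : ∀ F S a → B F a ≡ true → ((B ∧ᵐ E) F a ≡ true) ⊎ ((B ∖ᵐ E) F a ≡ true) → X (F , S , a) ≈ D Y (F , S , a) + D Y' (F , S , a)
          eq F S a b (inj₁ h) = trans (solve 2 (λ x y → x := y :+ (x :- y)) refl (X (F , S , a)) (D Y (F , S , a))) (+-congˡ (trans (≡⇒≈ (≡.sym (cut-true B R b))) (z' F S a h)))
          eq F S a b (inj₂ h) = trans (sym (off-¬E X (proj₂ (∖ᵐ-true {B} {E} h)))) (trans (z F S a h) (trans (sym (+-identityʳ _)) (+-congˡ (sym (D-up y' F S a h)))))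
        lifts : ∀ Y → Cx (B ∖ᵐ E) (suc m) Y → (∀ F S a → (B ∖ᵐ E) F a ≡ true → D Y (F , S , a) ≈ 0#) →
          Σ (V Ix) λ X → Z B (suc m) X × Bd (B ∖ᵐ E) (suc m) (λ p → Y p - off X p)
        lifts Y y z = X , (-∈ Supp-sub wy (widen₂ y') , λ F S a b → trans (φ-- D-lin Y Y' _) (closed F S a b (split b))) ,
            ≈∈ (Bd-sub (B ∖ᵐ E) (suc m)) (λ (F , S , a) → sym (same F S a (E F a Bool.≟ true))) (0∈ (Bd-sub (B ∖ᵐ E) (suc m)))
          where
          wy = widen₁ y
          bd : Bd (B ∧ᵐ E) m (cut B (D Y))
          bd = ex₀ (cut B (D Y)) (part₂ (D-Graded (Cx⇒Graded y)) z , λ F S a e → DD cv wy F S a (proj₁ (∧ᵐ-true {B} {E} e)))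
          Y' = proj₁ (proj₂ bd)
          y' = proj₁ (proj₂ (proj₂ bd))
          z' = proj₂ (proj₂ (proj₂ bd))
          X : V Ix
          X p = Y p - Y' p
          closed : ∀ F S a → B F a ≡ true → ((B ∧ᵐ E) F a ≡ true) ⊎ ((B ∖ᵐ E) F a ≡ true) → D Y (F , S , a) - D Y' (F , S , a) ≈ 0#
          closed F S a b (inj₁ h) = trans (+-congʳ (trans (≡⇒≈ (≡.sym (cut-true B (D Y) b))) (z' F S a h))) (-‿inverseʳ _)
          closed F S a b (inj₂ h) = trans (+-cong (z F S a h) (trans (-‿cong (D-up y' F S a h)) -0#≈0#)) (+-identityˡ _)
          same : ∀ F S a → Dec (E F a ≡ true) → Y (F , S , a) - off X (F , S , a) ≈ 0#
          same F S a (yes e) = trans (+-cong (lower y (F , S , a) (λ (h , _) → true≢false e (proj₂ (∖ᵐ-true {B} {E} h)))) (trans (-‿cong (off-E X e)) -0#≈0#)) (+-identityˡ _)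
          same F S a (no e) = trans (+-congˡ (-‿cong (trans (off-¬E X (¬true e)) (trans (+-congˡ (trans (-‿cong (lower y' (F , S , a) (λ (h , _) → e (proj₂ (∧ᵐ-true {B} {E} h))))) -0#≈0#)) (+-identityʳ _))))) (-‿inverseʳ _)

      -- The same sequence with an exact quotient: exactness at `suc m` moves a primitive into the
      -- subcomplex, exactness at `m` moves a cycle there.
      subcomplex-iso : ∀ m → Exact (B ∖ᵐ E) m → Exact (B ∖ᵐ E) (suc m) →
        QIso (Z (B ∧ᵐ E) m) (Bd (B ∧ᵐ E) m) (Z B m) (Bd B m)
      subcomplex-iso m ex₀ ex₁ = record
        { φ = id ; lin = id-lin ; subU = Z-sub (B ∧ᵐ E) m ; subW' = Bd-sub B m
        ; toU = λ (x , z) → widen₂ x , λ F S a b → case split b of λ where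
            (inj₁ h) → z F S a h
            (inj₂ h) → D-up x F S a h
        ; toW = λ _ (x , Y , y , z) → widen₂ x , Y , widen₂ y , λ F S a b → case split b of λ where
            (inj₁ h) → z F S a h
            (inj₂ h) → trans (lower x _ (λ (h' , _) → true≢false (proj₂ (∧ᵐ-true {B} {E} h')) (proj₂ (∖ᵐ-true {B} {E} h)))) (sym (D-up y F S a h))
        ; refW = λ {X} (x , _) (_ , Y , y , z) → let
            (_ , T , t , zt) = ex₁ (off Y) (off-Cx y , λ F S a h → trans (D-off y F S a h) (trans (sym (z F S a (proj₁ (∖ᵐ-true {B} {E} h))))
                 (lower x _ (λ (h' , _) → true≢false (proj₂ (∧ᵐ-true {B} {E} h')) (proj₂ (∖ᵐ-true {B} {E} h))))))
            wt = widen₁ t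
          in x , cut B (λ p → Y p - D T p) ,
            part₂ (minus (Cx⇒Graded y) (D-Graded (Cx⇒Graded t))) (λ F S a h → trans (+-congʳ (trans (sym (off-¬E Y (proj₂ (∖ᵐ-true {B} {E} h)))) (zt F S a h))) (-‿inverseʳ _)) ,
            λ F S a e → let b = proj₁ (∧ᵐ-true {B} {E} e) in trans (z F S a b) (sym (D-cut-minus y wt F S a b))
        ; surj = λ X (x , z) → let
            (_ , T , t , zt) = ex₀ (off X) (off-Cx x , λ F S a h → trans (D-off x F S a h) (z F S a (proj₁ (∖ᵐ-true {B} {E} h))))
            wt = widen₁ t
          in cut B (λ p → X p - D T p) ,
            (part₂ (minus (Cx⇒Graded x) (D-Graded (Cx⇒Graded t))) (λ F S a h → trans (+-congʳ (trans (sym (off-¬E X (proj₂ (∖ᵐ-true {B} {E} h)))) (zt F S a h))) (-‿inverseʳ _)) ,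
              λ F S a e → let b = proj₁ (∧ᵐ-true {B} {E} e) in trans (D-cut-minus x wt F S a b) (z F S a b)) ,
            -∈ Supp-sub x (Graded⇒Cx B (minus (Cx⇒Graded x) (D-Graded (Cx⇒Graded t)))) , T , wt ,
            λ F S a b → trans (+-congˡ (-‿cong (≡⇒≈ (cut-true B _ b)))) (solve 2 (λ x y → x :- (x :- y) := y) refl _ _) }

  -- Finite sums over boxes of exponents

  private
    sum-shift : ∀ b (G : ℕ → Carrier) → G 0 + ∑ {b} (λ t → G (suc (toℕ t))) ≈ ∑ {b} (λ t → G (toℕ t)) + G b
    sum-shift zero    G = trans (+-comm _ _) (+-congʳ (trans (≡⇒≈ (∑-zero _)) (≡⇒≈ (≡.sym (∑-zero _)))))
    sum-shift (suc b) G = trans (+-congˡ (trans (≡⇒≈ (∑-suc _)) (sum-shift b (G ∘ suc))))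
      (trans (sym (+-assoc _ _ _)) (+-congʳ (≡⇒≈ (≡.sym (∑-suc _)))))

  opaque
    box : ∀ (b : ℕ) {n} → V (Vec ℕ n) → Carrier
    box b {zero}  f = f []
    box b {suc n} f = ∑ {b} (λ t → box b (λ e → f (toℕ t ∷ e)))

    box-fin : ∀ b {n} → IsFin (box b {n})
    box-fin b {zero}  = pt-fin []
    box-fin b {suc n} = ∑-fin (λ t → ∘-fin (box-fin b {n}) (λ e → pt-fin (toℕ t ∷ e)))

    box-single : ∀ b {n} (f : V (Vec ℕ n)) e₀ → (∀ u → lookup e₀ u < b) → (∀ e → ¬ e ≡ e₀ → f e ≈ 0#) → box b f ≈ f e₀
    box-single b f []       lt z = refl
    box-single b {suc n} f (t ∷ e₀) lt z = begin
      ∑ (λ k → box b (λ e → f (toℕ k ∷ e)))   ≈⟨ sum-single (λ k → box b (λ e → f (toℕ k ∷ e))) k₀ (λ k p → fin-0 (box-fin b {n}) (λ e → z _ (λ q → p (FinP.toℕ-injective (≡.trans (VecP.∷-injectiveˡ q) (≡.sym k₀≡)))))) ⟩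
      box b (λ e → f (toℕ k₀ ∷ e))            ≈⟨ ≡⇒≈ (≡.cong (λ t → box b (λ e → f (t ∷ e))) k₀≡) ⟩
      box b (λ e → f (t ∷ e))                 ≈⟨ box-single b (λ e → f (t ∷ e)) e₀ (lt ∘ suc) (λ e p → z _ (λ q → p (VecP.∷-injectiveʳ q))) ⟩
      f (t ∷ e₀) ∎
      where
      k₀ : Fin b
      k₀ = Fin.fromℕ< (lt zero)
      k₀≡ : toℕ k₀ ≡ t
      k₀≡ = FinP.toℕ-fromℕ< (lt zero)

    -- A shift by one in coordinate `w` loses the slice at zero and gains the slice at `b`; hence
    -- the two vanishing hypotheses.
    box-shift : ∀ b {n} (w : Fin n) (f : V (Vec ℕ n)) → (∀ e → lookup e w ≡ 0 → f e ≈ 0#) → (∀ e → lookup e w ≡ b → f e ≈ 0#) →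
                box b (λ e → f (inc w e)) ≈ box b f
    box-shift b {suc n} zero f z₀ z₁ = begin
      ∑ {b} (λ t → G (suc (toℕ t)))          ≈⟨ sym (trans (+-congʳ (fin-0 (box-fin b {n}) (λ e → z₀ _ ≡.refl))) (+-identityˡ _)) ⟩
      G 0 + ∑ {b} (λ t → G (suc (toℕ t)))    ≈⟨ sum-shift b G ⟩
      ∑ {b} (λ t → G (toℕ t)) + G b          ≈⟨ trans (+-congˡ (fin-0 (box-fin b {n}) (λ e → z₁ _ ≡.refl))) (+-identityʳ _) ⟩
      ∑ {b} (λ t → G (toℕ t)) ∎
      where
      G : ℕ → Carrier
      G t = box b (λ e → f (t ∷ e))
    box-shift b {suc n} (suc w) f z₀ z₁ = sum-cong (λ t → box-shift b w (λ e → f (toℕ t ∷ e)) (λ e p → z₀ _ p) (λ e p → z₁ _ p))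

  -- Homotopies for inverted and for dividing variables

  module Localisation {n d : ℕ} (Θ : Fin d → Fin n → Carrier) (i : ℕ)
    (Δ : Subset n → Bool) (cx : IsComplex Δ) where
    open TotalComplex Θ i

    -- x_v^(N+1) = Σ_j y_j θ_j in k[Δ], read off coefficientwise.
    record Nilpotent (v : Fin n) : Set (c ⊔ ℓ) where
      field
        N      : ℕ
        y      : Vec ℕ n → Fin d → Carrier
        y-deg  : ∀ e j → ¬ Vec.sum e ≡ N → y e j ≈ 0#
        expand : ∀ e → Vec.sum e ≡ suc N → Δ (supp e) ≡ true → ¬ e ≡ powᵥ v (suc N) →
                 ∑ (λ w → if does (0 ℕ.<? lookup e w) then ∑ (λ j → θ w j * y (updateAt e w ℕ.pred) j) else 0#) ≈ 0#
        top    : ∑ (λ w → if does (0 ℕ.<? lookup (powᵥ v (suc N)) w) then ∑ (λ j → θ w j * y (updateAt (powᵥ v (suc N)) w ℕ.pred) j) else 0#) ≈ 1#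

    module _ {v : Fin n} (nl : Nilpotent v) where
      open Nilpotent nl

      coeff : Vec ℕ n → Carrier
      coeff e = ∑ (λ w → if does (0 ℕ.<? lookup e w) then ∑ (λ j → θ w j * y (updateAt e w ℕ.pred) j) else 0#)

      -- The exponent of x^e divided by x_v^(N+1).
      sh : Vec ℕ n → Vec ℤ n
      sh e = Vec.map +_ e -ᵥ (𝟘 [ v ]≔ + suc N)

      -- Exponents of monomials of degree N + 1 are at most N + 1, hence strictly below this bound.
      b : ℕ
      b = suc (suc N)

      h₂ : V Ix₂ → V Ix₂
      h₂ Y (S , a) = box b (λ e → crt (y e) (λ S' → Y (S' , a -ᵥ sh e)) S)

      h₂-fin : ∀ p → IsFin (λ Y → h₂ Y p)
      h₂-fin (S , a) = ∘-fin (box-fin b {n}) (λ e → ∘-fin (crt-fin (y e) S) (λ S' → pt-fin (S' , a -ᵥ sh e)))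

      map-inc : ∀ {m} (e : Vec ℕ m) w u → lookup (Vec.map +_ (inc w e)) u ≡ lookup (Vec.map +_ e) u ℤ.+ lookup (unit w) u
      map-inc (x ∷ e) zero    zero    = ≡.cong +_ (ℕP.+-comm 1 x)
      map-inc (x ∷ e) zero    (suc u) = ≡.sym (≡.trans (≡.cong (ℤ._+_ (lookup (Vec.map +_ e) u)) (lookup-𝟘 u)) (ℤP.+-identityʳ _))
      map-inc (x ∷ e) (suc w) zero    = ≡.sym (ℤP.+-identityʳ _)
      map-inc (x ∷ e) (suc w) (suc u) = map-inc e w u

      lookup-≤-sum : ∀ {m} (e : Vec ℕ m) w → lookup e w ≤ Vec.sum e
      lookup-≤-sum (x ∷ e) zero    = ℕP.m≤m+n x _
      lookup-≤-sum (x ∷ e) (suc w) = ℕP.≤-trans (lookup-≤-sum e w) (ℕP.m≤n+m _ x)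

      lookup-pred : ∀ {m} (e : Vec ℕ m) w → lookup (updateAt e w ℕ.pred) w ≡ ℕ.pred (lookup e w)
      lookup-pred e w = VecP.lookup∘updateAt w e

      shift-inc : ∀ a w e → a -ᵥ sh (inc w e) ≡ dec w (a -ᵥ sh e)
      shift-inc a w e = vext (λ u → ≡.trans (lookup-- a (sh (inc w e)) u) (≡.trans (≡.cong (ℤ._-_ (lookup a u)) (≡.trans (lookup-- (Vec.map +_ (inc w e)) q u) (≡.cong (ℤ._- lookup q u) (map-inc e w u))))
        (≡.trans (arith (lookup a u) (lookup (Vec.map +_ e) u) (lookup (unit w) u) (lookup q u))
          (≡.sym (≡.trans (lookup-- (a -ᵥ sh e) (unit w) u) (≡.cong (ℤ._- lookup (unit w) u) (≡.trans (lookup-- a (sh e) u) (≡.cong (ℤ._-_ (lookup a u)) (lookup-- (Vec.map +_ e) q u)))))))))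
        where
        q : Vec ℤ n
        q = 𝟘 [ v ]≔ + suc N
        arith : ∀ a e w q → a ℤ.- ((e ℤ.+ w) ℤ.- q) ≡ (a ℤ.- (e ℤ.- q)) ℤ.- w
        arith = solve-∀

      shift-comm : ∀ a w e → dec w a -ᵥ sh e ≡ dec w (a -ᵥ sh e)
      shift-comm a w e = vext (λ u → ≡.trans (lookup-- (dec w a) (sh e) u) (≡.trans (≡.cong (ℤ._- lookup (sh e) u) (lookup-- a (unit w) u))
        (≡.trans (arith (lookup a u) (lookup (unit w) u) (lookup (sh e) u)) (≡.sym (≡.trans (lookup-- (a -ᵥ sh e) (unit w) u) (≡.cong (ℤ._- lookup (unit w) u) (lookup-- a (sh e) u)))))))
        where
        arith : ∀ a w s → (a ℤ.- w) ℤ.- s ≡ (a ℤ.- s) ℤ.- w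
        arith = solve-∀

      map-pow : ∀ {m} (v : Fin m) k → Vec.map +_ (powᵥ v k) ≡ 𝟘 [ v ]≔ + k
      map-pow v k = ≡.trans (VecP.map-[]≔ +_ (replicate _ 0) v) (≡.cong (λ z → z [ v ]≔ + k) (VecP.map-replicate +_ 0 _))

      shift-top : ∀ a → a -ᵥ sh (powᵥ v (suc N)) ≡ a
      shift-top a = vext (λ u → ≡.trans (lookup-- a (sh (powᵥ v (suc N))) u) (≡.trans (≡.cong (ℤ._-_ (lookup a u))
        (≡.trans (lookup-- (Vec.map +_ (powᵥ v (suc N))) _ u) (≡.trans (≡.cong (λ z → lookup z u ℤ.- lookup (𝟘 [ v ]≔ + suc N) u) (map-pow v (suc N))) (ℤP.+-inverseʳ (lookup (𝟘 [ v ]≔ + suc N) u))))) (ℤP.+-identityʳ _)))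

      -- The homotopy formula: h is multiplication by x_v^{-(N+1)} Σ_j y_j e_j, so κh + hκ = x_v^{-(N+1)} Σ_j y_j θ_j.
      κh+hκ : ∀ Y S a → κ (h₂ Y) (S , a) + h₂ (κ Y) (S , a) ≈ box b (λ e → coeff e * Y (S , a -ᵥ sh e))
      κh+hκ Y S a = begin
        κ (h₂ Y) (S , a) + h₂ (κ Y) (S , a)
          ≈⟨ +-cong (trans (κ≈ (h₂ Y) S a) (sum-cong (λ w → fubini (ant-fin (θ w) S) (box-fin b {n}) (λ S' e → crt (y e) (λ S'' → Y (S'' , dec w a -ᵥ sh e)) S'))))
                    (trans (fin-cong (box-fin b {n}) (λ e → trans (fin-cong (crt-fin (y e) S) (λ S' → κ≈ Y S' (a -ᵥ sh e))) (fin-∑ (crt-fin (y e) S) _))) (fin-∑ (box-fin b {n}) _)) ⟩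
        ∑ (λ w → box b (λ e → ant (θ w) (crt (y e) (λ S' → Y (S' , dec w a -ᵥ sh e))) S))
          + ∑ (λ w → box b (λ e → crt (y e) (ant (θ w) (λ S' → Y (S' , dec w (a -ᵥ sh e)))) S))
          ≈⟨ trans (sym (sum-+ _ _)) (sum-cong (λ w → trans (sym (fin-+ (box-fin b {n}) _ _)) (fin-cong (box-fin b {n}) (λ e →
               trans (+-congʳ (≡⇒≈ (≡.cong (λ z → ant (θ w) (crt (y e) (λ S' → Y (S' , z))) S) (shift-comm a w e)))) (ant-crt (θ w) (y e) _ S))))) ⟩
        ∑ (λ w → box b (λ e → ∑ (λ j → θ w j * y e j) * Y (S , dec w (a -ᵥ sh e))))
          ≈⟨ sum-cong (λ w → trans (fin-cong (box-fin b {n}) (λ e → sym (f-inc w e))) (box-shift b w (f w) (f-zero w) (f-top w))) ⟩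
        ∑ (λ w → box b (f w))
          ≈⟨ sym (fin-∑ (box-fin b {n}) _) ⟩
        box b (λ e → ∑ (λ w → f w e))
          ≈⟨ fin-cong (box-fin b {n}) (λ e → trans (sum-cong (λ w → *-comm _ _)) (trans (sum-* (Y (S , a -ᵥ sh e)) _) (*-comm _ _))) ⟩
        box b (λ e → coeff e * Y (S , a -ᵥ sh e)) ∎
        where
        t : Fin n → Vec ℕ n → Carrier
        t w e = if does (0 ℕ.<? lookup e w) then ∑ (λ j → θ w j * y (updateAt e w ℕ.pred) j) else 0#
        t-pos : ∀ w e → 0 < lookup e w → t w e ≡ ∑ (λ j → θ w j * y (updateAt e w ℕ.pred) j)
        t-pos w e p = ≡.cong (λ z → if z then ∑ (λ j → θ w j * y (updateAt e w ℕ.pred) j) else 0#) (dec-true (0 ℕ.<? lookup e w) p)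
        t-zero : ∀ w e → lookup e w ≡ 0 → t w e ≡ 0#
        t-zero w e p = ≡.cong (λ z → if z then ∑ (λ j → θ w j * y (updateAt e w ℕ.pred) j) else 0#) (dec-false (0 ℕ.<? lookup e w) (λ q → ℕP.<⇒≢ q (≡.sym p)))
        f : Fin n → Vec ℕ n → Carrier
        f w e = t w e * Y (S , a -ᵥ sh e)
        f-inc : ∀ w e → f w (inc w e) ≈ ∑ (λ j → θ w j * y e j) * Y (S , dec w (a -ᵥ sh e))
        f-inc w e = *-cong (trans (≡⇒≈ (t-pos w (inc w e) (inc-pos e w))) (≡⇒≈ (≡.cong (λ z → ∑ (λ j → θ w j * y z j)) (pred-inc e w)))) (≡⇒≈ (≡.cong (λ z → Y (S , z)) (shift-inc a w e)))
        f-zero : ∀ w e → lookup e w ≡ 0 → f w e ≈ 0#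
        f-zero w e p = trans (*-congʳ (≡⇒≈ (t-zero w e p))) (zeroˡ _)
        f-top : ∀ w e → lookup e w ≡ b → f w e ≈ 0#
        f-top w e p = trans (*-congʳ (trans (≡⇒≈ (t-pos w e (≡.subst (0 <_) (≡.sym p) (s≤s z≤n)))) (sum-0 (λ j → trans (*-congˡ (y-deg _ j (λ q →
          ℕP.1+n≰n (≡.subst (suc N ≤_) q (ℕP.≤-trans (ℕP.≤-reflexive (≡.sym (≡.trans (lookup-pred e w) (≡.cong ℕ.pred p)))) (lookup-≤-sum (updateAt e w ℕ.pred) w)))))) (zeroʳ _))))) (zeroˡ _)

      coeff-deg : ∀ e → ¬ Vec.sum e ≡ suc N → coeff e ≈ 0#
      coeff-deg e p = sum-0 (λ w → case 0 ℕ.<? lookup e w of λ where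
        (yes q) → trans (≡⇒≈ (≡.cong (λ z → if z then ∑ (λ j → θ w j * y (updateAt e w ℕ.pred) j) else 0#) (dec-true (0 ℕ.<? lookup e w) q)))
                    (sum-0 (λ j → trans (*-congˡ (y-deg _ j (λ r → p (≡.trans (≡.sym (sum-pred e w q)) (≡.cong suc r))))) (zeroʳ _)))
        (no q) → ≡⇒≈ (≡.cong (λ z → if z then ∑ (λ j → θ w j * y (updateAt e w ℕ.pred) j) else 0#) (dec-false (0 ℕ.<? lookup e w) q)))

      h : V Ix → V Ix
      h X (F , S , a) = h₂ (λ p → X (F , p)) (S , a)

      Dh+hD : ∀ X F S a → D (h X) (F , S , a) + h (D X) (F , S , a) ≈ box b (λ e → coeff e * X (F , S , a -ᵥ sh e))
      Dh+hD X F S a = begin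
        D (h X) (F , S , a) + h (D X) (F , S , a)
          ≈⟨ +-cong (trans (D≈ (h X) F S a) (+-congʳ (*-congˡ (fubini (crt-fin 𝟙 F) (h₂-fin (S , a)) (λ F' p → X (F' , p))))))
                    (trans (fin-cong (h₂-fin (S , a)) (λ (S' , a') → D≈ X F S' a')) (trans (fin-+ (h₂-fin (S , a)) (λ (S' , a') → sg S' * Y (S' , a')) (κ (λ p → X (F , p)))) (+-congʳ h-sg))) ⟩
        (sg S * h₂ Y (S , a) + κ (h₂ (λ p → X (F , p))) (S , a)) + (- (sg S * h₂ Y (S , a)) + h₂ (κ (λ p → X (F , p))) (S , a))
          ≈⟨ solve 3 (λ s k l → (s :+ k) :+ (:- s :+ l) := k :+ l) refl _ _ _ ⟩
        κ (h₂ (λ p → X (F , p))) (S , a) + h₂ (κ (λ p → X (F , p))) (S , a)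
          ≈⟨ κh+hκ (λ p → X (F , p)) S a ⟩
        box b (λ e → coeff e * X (F , S , a -ᵥ sh e)) ∎
        where
        Y : V Ix₂
        Y (S' , a') = crt 𝟙 (λ F' → X (F' , S' , a')) F
        h-sg : h₂ (λ (S' , a') → sg S' * Y (S' , a')) (S , a) ≈ - (sg S * h₂ Y (S , a))
        h-sg = trans (fin-cong (box-fin b {n}) (λ e → crt-sg (y e) (λ S' → Y (S' , a -ᵥ sh e)) S)) (trans (fin-neg (box-fin b {n}) _) (-‿cong (fin-* (box-fin b {n}) (sg S) _)))

      sh-≤ : ∀ a e u → ¬ u ≡ v → lookup (a -ᵥ sh e) u ≡ lookup a u ℤ.- + lookup e u
      sh-≤ a e u p = ≡.trans (lookup-- a (sh e) u) (≡.cong (ℤ._-_ (lookup a u)) (≡.trans (lookup-- (Vec.map +_ e) (𝟘 [ v ]≔ + suc N) u)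
        (≡.trans (≡.cong₂ ℤ._-_ (VecP.lookup-map u +_ e) (≡.trans (VecP.lookup∘update′ p 𝟘 (+ suc N)) (lookup-𝟘 u))) (ℤP.+-identityʳ _))))

      sh-Le′ : ∀ F a e → lookup F v ≡ true → Le′ F (a -ᵥ sh e) F a
      sh-Le′ F a e q = le′ (λ u p → p) (λ u → case u Fin.≟ v of λ where
        (yes ≡.refl) → inj₁ q
        (no p) → inj₂ (ℤP.≤-trans (ℤP.≤-reflexive (sh-≤ a e u p)) (ℤP.i-j≤i (lookup a u) (+ lookup e u))))

      -- Where every `F` contains `v`, the homotopy `h` connects the identity with zero, because
      -- x_v^(-N-1) Σ y_j θ_j is one there. Its shift raises at most the coordinate `v`, an inverted
      -- one; this is what convexity in the order `Le′` is for.
      h-exact : ∀ {B : Mask n} → Convex′ B → (∀ {F a} → B F a ≡ true → lookup F v ≡ true × ok Δ F a ≡ true) → ∀ m → Exact B m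
      h-exact {B} cv sub m X (x , z) = x , cut B (h X) , Graded⇒Cx B hgr , λ F S a e → begin
          X (F , S , a)                                    ≈⟨ sym (unit-term F S a e) ⟩
          box b (λ e → coeff e * X (F , S , a -ᵥ sh e))    ≈⟨ sym (Dh+hD X F S a) ⟩
          D (h X) (F , S , a) + h (D X) (F , S , a)        ≈⟨ trans (+-congˡ (hD-zero F S a e)) (+-identityʳ _) ⟩
          D (h X) (F , S , a)                              ≈⟨ D-cong-below (h X) (cut B (h X)) F S a (λ F' S' a' l → below F S a e F' S' a' l) ⟩
          D (cut B (h X)) (F , S , a) ∎
        where
        hD-zero : ∀ F S a → B F a ≡ true → h (D X) (F , S , a) ≈ 0#
        hD-zero F S a e = fin-0 (box-fin b {n}) (λ ex → fin-0 (crt-fin (y ex) S) (λ S' → case B F (a -ᵥ sh ex) Bool.≟ true of λ where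
          (yes p) → z F S' (a -ᵥ sh ex) p
          (no p) → D-below X F S' (a -ᵥ sh ex) (λ F'' S'' a'' l → lower x _ (λ (e'' , _) → p (cv (Le⇒Le′ l) (sh-Le′ F a ex (proj₁ (sub e))) e'' e)))))
        below : ∀ F S a → B F a ≡ true → ∀ F' S' a' → Le F' a' F a → h X (F' , S' , a') ≈ cut B (h X) (F' , S' , a')
        below F S a e F' S' a' l = case B F' a' Bool.≟ true of λ where
          (yes p) → ≡⇒≈ (≡.sym (cut-true B (h X) p))
          (no p) → trans (fin-0 (box-fin b {n}) (λ ex → fin-0 (crt-fin (y ex) S') (λ S'' → lower x _ (λ (e'' , _) →
                     p (cv (sh-Le′ F' a' ex (proj₁ (sub e''))) (Le⇒Le′ l) e'' e))))) (≡⇒≈ (≡.sym (cut-false B (h X) (¬true p))))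
        unit-term : ∀ F S a → B F a ≡ true → box b (λ e → coeff e * X (F , S , a -ᵥ sh e)) ≈ X (F , S , a)
        unit-term F S a e = trans (box-single b _ (powᵥ v (suc N)) small vanish) (trans (*-cong top (≡⇒≈ (≡.cong (λ z → X (F , S , z)) (shift-top a)))) (*-identityˡ _))
          where
          small : ∀ u → lookup (powᵥ v (suc N)) u < b
          small u = case u Fin.≟ v of λ where
            (yes ≡.refl) → ≡.subst (_< b) (≡.sym (VecP.lookup∘update v (replicate _ 0) (suc N))) ℕP.≤-refl
            (no p) → ≡.subst (_< b) (≡.sym (≡.trans (VecP.lookup∘update′ p (replicate _ 0) (suc N)) (VecP.lookup-replicate u 0))) (s≤s z≤n)
          supp⊆ : ∀ ex → B F (a -ᵥ sh ex) ≡ true → ∀ u → lookup (supp ex) u ≡ true → lookup (mrg F a) u ≡ true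
          supp⊆ ex e' u r = case lookup F u Bool.≟ true of λ where
            (yes f) → mrg-F F a u f
            (no f) → mrg-a F a u (ℤP.<-≤-trans (ℤ.+<+ (does-true (0 ℕ.<? lookup ex u) (≡.trans (≡.sym (VecP.lookup-map u _ ex)) r)))
              (ℤP.0≤i-j⇒j≤i (≡.subst (+ 0 ℤ.≤_) (sh-≤ a ex u (λ { ≡.refl → f (proj₁ (sub e)) })) (ok-nonneg {Δ = Δ} (proj₂ (sub e')) u (¬true f)))))
          -- In degree N + 1 a face-supported monomial other than x_v^(N+1) has coefficient zero,
          -- and one with nonface support shifts the position out of the region.
          vanish : ∀ ex → ¬ ex ≡ powᵥ v (suc N) → coeff ex * X (F , S , a -ᵥ sh ex) ≈ 0#
          vanish ex ne = case Vec.sum ex ℕ.≟ suc N of λ where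
            (no p) → trans (*-congʳ (coeff-deg ex p)) (zeroˡ _)
            (yes p) → case Δ (supp ex) Bool.≟ true of λ where
              (yes q) → trans (*-congʳ (expand ex p q ne)) (zeroˡ _)
              (no q) → trans (*-congˡ (lower x _ (λ (e' , _) → q (Complex-down cx (λ u r → supp⊆ ex e' u r) (ok-face {Δ = Δ} (proj₂ (sub e))))))) (zeroʳ _)
        hgr : Graded (suc m) (h X)
        hgr F S a q = fin-0' (λ ex → case Vec.sum ex ℕ.≟ N of λ where
            (no p) → sum-0 (λ j → trans (*-congʳ (y-deg ex j p)) (zeroˡ _))
            (yes p) → sum-0 (λ j → trans (*-congˡ (cr-loc j _ S (λ r → lower x _ (λ (_ , g , g') → q (
                ≡.trans (ℕP.+-suc ∣ F ∣ m) (≡.cong suc (≡.trans g (size-remove j S r))) , deg ex p S j r a g'))))) (zeroʳ _)))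
          where
          fin-0' : ∀ {f : V (Vec ℕ n)} → (∀ e → f e ≈ 0#) → box b f ≈ 0#
          fin-0' = fin-0 (box-fin b {n})
          deg : ∀ ex → Vec.sum ex ≡ N → ∀ S j → lookup S j ≡ true → ∀ a → sumᵥ (a -ᵥ sh ex) ℤ.+ + ∣ S [ j ]≔ false ∣ ≡ + i → sumᵥ a ℤ.+ + ∣ S ∣ ≡ + i
          deg ex p S j r a g = ≡.trans (≡.sym (≡.trans (≡.cong (λ z → z ℤ.+ + ∣ S [ j ]≔ false ∣) (≡.trans (sum-- a (sh ex)) (≡.cong (ℤ._-_ (sumᵥ a))
               (≡.trans (sum-- (Vec.map +_ ex) _) (≡.cong₂ ℤ._-_ (≡.trans (sum-map+ ex) (≡.cong +_ p)) (sum-[]≔ v (+ suc N)))))))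
               (≡.trans (arith (sumᵥ a) (+ N) (+ ∣ S [ j ]≔ false ∣)) (≡.cong (λ z → sumᵥ a ℤ.+ + z) (size-remove j S r))))) g
            where
            arith : ∀ a N s → (a ℤ.- (N ℤ.- (+ 1 ℤ.+ N))) ℤ.+ s ≡ a ℤ.+ (+ 1 ℤ.+ s)
            arith = solve-∀

    -- The regions to be deleted: localisations in which x_v is a unit, and multidegrees divisible
    -- by x_v.
    E₁ E₂ : Fin n → Mask n
    E₁ v F a = lookup F v
    E₂ v F a = does (+ 0 ℤ.<? lookup a v)

    E₁-up : ∀ (B : Mask n) v → UpIn B (E₁ v)
    E₁-up B v l _ e _ = le-F l v e

    E₂-up : ∀ (B : Mask n) v → UpIn B (E₂ v)
    E₂-up B v {a = a} {a' = a'} l _ e _ = dec-true (+ 0 ℤ.<? lookup a' v) (ℤP.<-≤-trans (does-true (+ 0 ℤ.<? lookup a v) e) (le-a l v))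

    okᵐ : Mask n
    okᵐ = ok Δ

    ok-Convex : Convex okᵐ
    ok-Convex = Convex′⇒Convex (ok-convex cx)

    module _ (nl : ∀ v → Nilpotent v) where
      localised-exact : ∀ L v m → Exact (Without E₁ okᵐ L ∧ᵐ E₁ v) m
      localised-exact L v m = h-exact (nl v) cv (λ e → let (p , q) = ∧-true e in q , proj₁ (Without-elim E₁ L p)) m
        where
        cv : Convex′ (Without E₁ okᵐ L ∧ᵐ E₁ v)
        cv l l' p r = let (p₁ , p₂) = ∧-true p ; (r₁ , _) = ∧-true r ; (o , _) = Without-elim E₁ L p₁ ; (o' , w) = Without-elim E₁ L r₁ in
          ∧-intro (Without-intro E₁ L (ok-convex cx l l' o o') (λ {u} u∈ → ¬true (λ f → true≢false (le′-F l' u f) (w u∈)))) (le′-F l v p₂)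

      -- Once all sets containing a vertex are deleted only the empty set is left, and with it the
      -- Koszul complex; the deleted regions are exact.
      Koszul→Čech : ∀ L m {r} → Dim (Z (Without E₁ okᵐ L) (suc m)) (Bd (Without E₁ okᵐ L) (suc m)) r → Dim (Z okᵐ (suc m)) (Bd okᵐ (suc m)) r
      Koszul→Čech []      m q = q
      Koszul→Čech (v ∷ L) m q = Koszul→Čech L m (Dim← (quotient-iso (Without-convex E₁ ok-Convex (E₁-up _) L) (E₁-up _ v) m
        (localised-exact L v m) (localised-exact L v (suc m))) q)

    module _ (L : List (Fin n)) (v : Fin n) where
      private
        B : Mask n
        B = Without E₂ okᵐ L ∧ᵐ E₂ v

        pos-v : ∀ {F a} → B F a ≡ true → + 0 ℤ.< lookup a v
        pos-v {F} {a} e = does-true (+ 0 ℤ.<? lookup a v) (proj₂ (∧-true e))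

        same-mask : ∀ {F F' a} → (∀ u → ¬ u ≡ v → lookup F u ≡ lookup F' u) → B F a ≡ true → B F' a ≡ true
        same-mask {F} {F'} {a} s e = let (p , q) = ∧-true e ; (o , w) = Without-elim E₂ L p in
          ∧-intro (Without-intro E₂ L (ok-intro
            (λ u f → case u Fin.≟ v of λ where
              (yes ≡.refl) → ℤP.<⇒≤ (pos-v e)
              (no ne) → ok-nonneg o u (≡.trans (s u ne) f))
            (Complex-down cx (λ u f → case u Fin.≟ v of λ where
              (yes ≡.refl) → mrg-a F a v (pos-v e)
              (no ne) → case mrg-elim F' a u f of λ where
                (inj₁ g) → mrg-F F a u (≡.trans (s u ne) g)
                (inj₂ g) → mrg-a F a u g) (ok-face o))) w) q

        add-mask : ∀ {F a b} → B (F [ v ]≔ b) a ≡ true → B F a ≡ true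
        add-mask {F} = same-mask (λ u ne → VecP.lookup∘update′ ne F _)

        mask-add : ∀ {F a b} → B F a ≡ true → B (F [ v ]≔ b) a ≡ true
        mask-add {F} = same-mask (λ u ne → ≡.sym (VecP.lookup∘update′ ne F _))

      -- x_v divides everything in sight, so the Čech complex is a cone with apex v.
      cone-exact : ∀ m → Exact B m
      cone-exact m X (x , z) = x , Y , y , λ F S a e → sym (begin
          D Y (F , S , a)                                ≈⟨ D≈ Y F S a ⟩
          sg S * crt 𝟙 (λ F' → sg S * an v (X₁ S a) F') F + κ (λ (S' , a') → sg S' * an v (X₁ S' a') F) (S , a)
            ≈⟨ +-cong (trans (*-congˡ (fin-* (crt-fin 𝟙 F) (sg S) _)) (trans (sym (*-assoc _ _ _)) (trans (*-congʳ (sg² S)) (*-identityˡ _))))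
                      (trans (κ-sg (λ (S' , a') → an v (X₁ S' a') F) S a) (-‿cong (*-congˡ (sym (fubini (an-fin v F) (κ-fin (S , a)) (λ F' p → X (F' , p))))))) ⟩
          crt 𝟙 (an v (X₁ S a)) F - sg S * an v (λ F' → κ (λ p → X (F' , p)) (S , a)) F
            ≈⟨ +-congʳ (solve 3 (λ d a x → d := x :- ((x :- a) :- d) :- a) refl _ (an v (crt 𝟙 (X₁ S a)) F) (X (F , S , a))) ⟩
          ((X (F , S , a) - ((X (F , S , a) - an v (crt 𝟙 (X₁ S a)) F) - crt 𝟙 (an v (X₁ S a)) F)) - an v (crt 𝟙 (X₁ S a)) F) - sg S * an v (λ F' → κ (λ p → X (F' , p)) (S , a)) F
            ≈⟨ +-congʳ (+-congʳ (+-congˡ (-‿cong (trans (solve 3 (λ x a d → (x :- a) :- d := x :- (a :+ d)) refl _ _ _) (trans (+-congˡ (-‿cong (trans (an-crt v 𝟙 (X₁ S a) F) (*-identityˡ _)))) (-‿inverseʳ _)))))) ⟩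
          ((X (F , S , a) - 0#) - an v (crt 𝟙 (X₁ S a)) F) - sg S * an v (λ F' → κ (λ p → X (F' , p)) (S , a)) F
            ≈⟨ solve 3 (λ x a k → ((x :- con (+ 0)) :- a) :- k := x :- (a :+ k)) refl _ _ _ ⟩
          X (F , S , a) - (an v (crt 𝟙 (X₁ S a)) F + sg S * an v (λ F' → κ (λ p → X (F' , p)) (S , a)) F)
            ≈⟨ +-congˡ (-‿cong (closed F S a e)) ⟩
          X (F , S , a) - 0#                             ≈⟨ x-0 ⟩
          X (F , S , a) ∎)
        where
        X₁ : Subset d → Vec ℤ n → V (Subset n)
        X₁ S a F = X (F , S , a)
        Y : V Ix
        Y (F , S , a) = sg S * an v (X₁ S a) F
        y : Cx B (suc m) Y
        y = lift (λ (F , S , a) q → trans (*-congˡ (an-loc v (X₁ S a) F (λ e → lower x _ (λ (p , g , g') →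
              q (add-mask p , ≡.trans (ℕP.+-suc ∣ F ∣ m) (≡.trans (≡.cong (ℕ._+ m) (≡.sym (size-add v F e))) g) , g'))))) (zeroʳ _))
        closed : ∀ F S a → B F a ≡ true → an v (crt 𝟙 (X₁ S a)) F + sg S * an v (λ F' → κ (λ p → X (F' , p)) (S , a)) F ≈ 0#
        closed F S a e = trans (+-congˡ (sym (fin-* (an-fin v F) (sg S) _))) (trans (sym (fin-+ (an-fin v F) (crt 𝟙 (X₁ S a)) (λ F' → sg S * κ (λ p → X (F' , p)) (S , a))))
          (an-loc v _ F (λ _ → begin
            crt 𝟙 (X₁ S a) F⁺ + sg S * κ (λ p → X (F⁺ , p)) (S , a)
              ≈⟨ +-congʳ (sym (trans (sym (*-assoc _ _ _)) (trans (*-congʳ (sg² S)) (*-identityˡ _)))) ⟩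
            sg S * (sg S * crt 𝟙 (X₁ S a) F⁺) + sg S * κ (λ p → X (F⁺ , p)) (S , a)
              ≈⟨ sym (distribˡ _ _ _) ⟩
            sg S * (sg S * crt 𝟙 (X₁ S a) F⁺ + κ (λ p → X (F⁺ , p)) (S , a))
              ≈⟨ *-congˡ (trans (sym (D≈ X F⁺ S a)) (z F⁺ S a (mask-add e))) ⟩
            sg S * 0#  ≈⟨ zeroʳ _ ⟩
            0# ∎)))
          where F⁺ = F [ v ]≔ true

    Čech→nonpositive : ∀ L m {r} → Dim (Z okᵐ (suc m)) (Bd okᵐ (suc m)) r → Dim (Z (Without E₂ okᵐ L) (suc m)) (Bd (Without E₂ okᵐ L) (suc m)) r
    Čech→nonpositive []      m q = q
    Čech→nonpositive (v ∷ L) m q = Dim→ (quotient-iso (Without-convex E₂ ok-Convex (E₂-up _) L) (E₂-up _ v) m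
      (cone-exact L v m) (cone-exact L v (suc m))) (Čech→nonpositive L m q)

  -- Chains on the faces containing a given face

  module _ {n : ℕ} where
    Above : (Subset n → Bool) → Subset n → ℕ → Subset n → Set
    Above Γ G p F = Γ F ≡ true × ∣ F ∣ ≡ p × Sub G F

    Above? : ∀ Γ G p F → Dec (Above Γ G p F)
    Above? Γ G p F = (Γ F Bool.≟ true) ×-dec ((∣ F ∣ ℕ.≟ p) ×-dec Sub? G F)

    -- These are the chains of the link of `G` shifted by the size of `G`. Keeping the vertices of
    -- `G` in the faces matches the Čech complex in a multidegree with negative entries exactly at
    -- `G`.
    RelAcyclic : (Subset n → Bool) → Subset n → ℕ → Set (c ⊔ ℓ)
    RelAcyclic Γ G p = ∀ x → Supp (Above Γ G p) x → (∀ F → Sub G F → ant 𝟙 x F ≈ 0#) →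
      Σ (V (Subset n)) λ y → Supp (Above Γ G (suc p)) y × (∀ F → Sub G F → x F ≈ ant 𝟙 y F)

    Sub-remove : ∀ g (G F : Subset n) → Sub G F → Sub (G [ g ]≔ false) (F [ g ]≔ false)
    Sub-remove g G F s u e = case u Fin.≟ g of λ where
      (yes ≡.refl) → ⊥-elim (true≢false e (lookup-[]≔ G g))
      (no ne) → ≡.trans (VecP.lookup∘update′ ne F false) (s u (≡.trans (≡.sym (VecP.lookup∘update′ ne G false)) e))

    Sub-add : ∀ g (G F : Subset n) → Sub (G [ g ]≔ false) F → Sub G (F [ g ]≔ true)
    Sub-add g G F s u e = case u Fin.≟ g of λ where
      (yes ≡.refl) → lookup-[]≔ F g
      (no ne) → ≡.trans (VecP.lookup∘update′ ne F true) (s u (≡.trans (VecP.lookup∘update′ ne G false) e))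

    -- Contraction with `g` carries cycles to the link of `g`, and multiplication by `g` brings
    -- primitives back.
    RelAcyclic-lk : ∀ {Γ g G} → lookup G g ≡ true → ∀ {p} → RelAcyclic (lk Γ g) (G [ g ]≔ false) p → RelAcyclic Γ G (suc p)
    RelAcyclic-lk {Γ} {g} {G} e {p} ac x (lift xs) xz = (λ F → - cr g y' F) ,
        lift (λ F q → trans (-‿cong (cr-loc g y' F (λ f → ys _ (λ (a , b , s) → q (
          ≡.trans (≡.cong Γ (≡.sym (add-remove g F f))) (proj₂ (lk-true {Γ = Γ} a)) , ≡.trans (≡.sym (size-remove g F f)) (≡.cong suc b) ,
          ≡.subst (Sub G) (add-remove g F f) (Sub-add g G (F [ g ]≔ false) s)))))) -0#≈0#) ,
        λ F s → let f = s g e in begin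
          x F                                        ≈⟨ solve 2 (λ x a → x := (a :+ x) :- a) refl _ (an g (cr g x) F) ⟩
          (an g (cr g x) F + x F) - an g (cr g x) F  ≈⟨ +-cong (+-congˡ (sym (trans (an-cr g g x F) (trans (*-congʳ (≡⇒≈ (δF-refl g))) (*-identityˡ _))))) (-‿cong (an-∈ g _ F f)) ⟩
          (an g (cr g x) F + (an g (cr g x) F + cr g x' F)) - 0#  ≈⟨ solve 2 (λ a c → (a :+ (a :+ c)) :- con (+ 0) := (a :+ a) :+ c) refl _ _ ⟩
          (an g (cr g x) F + an g (cr g x) F) + cr g x' F  ≈⟨ trans (+-congʳ (trans (+-cong (an-∈ g _ F f) (an-∈ g _ F f)) (+-identityˡ _))) (+-identityˡ _) ⟩
          cr g x' F                                  ≈⟨ cr-cong g x' (ant 𝟙 y') F (λ _ → yz _ (Sub-remove g G F s)) ⟩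
          cr g (ant 𝟙 y') F                          ≈⟨ solve 2 (λ c a → c := :- (con (+ 0) :- c)) refl _ (y' F) ⟩
          - (0# - cr g (ant 𝟙 y') F)                 ≈⟨ -‿cong (+-congʳ (sym (ys F (λ (a , _) → true≢false f (proj₁ (lk-true {Γ = Γ} a)))))) ⟩
          - (y' F - cr g (ant 𝟙 y') F)               ≈⟨ -‿cong (trans (+-congʳ (sym (trans (cr-ant g 𝟙 y' F) (*-identityˡ _)))) (solve 2 (λ a b → (a :+ b) :- b := a) refl _ _)) ⟩
          - ant 𝟙 (cr g y') F                        ≈⟨ sym (fin-neg (ant-fin 𝟙 F) _) ⟩
          ant 𝟙 (λ F → - cr g y' F) F                ∎
      where
      x' = an g x
      x's : Supp (Above (lk Γ g) (G [ g ]≔ false) p) x'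
      x's = lift (λ F q → an-loc g x F (λ f → xs _ (λ (a , b , s) → q (lk-intro {Γ = Γ} f a ,
        ℕP.suc-injective (≡.trans (≡.sym (size-add g F f)) b) , λ u h → case u Fin.≟ g of λ where
          (yes ≡.refl) → ⊥-elim (true≢false h (lookup-[]≔ G g))
          (no ne) → ≡.trans (≡.sym (VecP.lookup∘update′ ne F true)) (s u (remove-⊆ g G u h))))))
      ant-an : ∀ F → ant 𝟙 (an g x) F ≈ - an g (ant 𝟙 x) F
      ant-an F = trans (solve 2 (λ a b → a := (a :+ b) :- b) refl _ _) (trans (+-congʳ
          (trans (+-congˡ (trans (fin-∑ (an-fin g F) _) (sum-cong (λ w → fin-* (an-fin g F) 1# _)))) (trans (sym (sum-+ _ _)) (sum-0 (λ w →
            trans (sym (distribˡ _ _ _)) (trans (*-congˡ (an-an w g x F)) (zeroʳ _))))))) (+-identityˡ _))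
      x'z : ∀ F → Sub (G [ g ]≔ false) F → ant 𝟙 x' F ≈ 0#
      x'z F s = trans (ant-an F) (trans (-‿cong (an-loc g _ F (λ _ → xz _ (Sub-add g G F s)))) -0#≈0#)
      w = ac x' x's x'z
      y' = proj₁ w
      ys = lower (proj₁ (proj₂ w))
      yz = proj₂ (proj₂ w)

    Acyclic-≡ : ∀ {Γ Γ' : Subset n → Bool} → (∀ F → Γ F ≡ Γ' F) → ∀ {i} → Acyclic Γ i → Acyclic Γ' i
    Acyclic-≡ {Γ} {Γ'} e ac x (a , z) = let (_ , y , b , w) = ac x (chain⁻ a , z) in a , y , chain b , w
      where
      chain : ∀ {p x} → Chain Γ p x → Chain Γ' p x
      chain (lift f) = lift (λ F → λ { (inj₁ q) → f F (inj₁ (≡.trans (e F) q)) ; (inj₂ q) → f F (inj₂ q) })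
      chain⁻ : ∀ {p x} → Chain Γ' p x → Chain Γ p x
      chain⁻ (lift f) = lift (λ F → λ { (inj₁ q) → f F (inj₁ (≡.trans (≡.sym (e F)) q)) ; (inj₂ q) → f F (inj₂ q) })

    acyclic⇒relative : ∀ k Γ G → ∣ G ∣ ≡ k → ∀ {i} → Acyclic (lkF Γ G) i → RelAcyclic Γ G (suc (i ℕ.+ k))
    acyclic⇒relative zero Γ G e {i} ac x (lift xs) xz = y , lift (λ F q → lower (Chain⇒Supp Γ' b) F (λ (g , h) →
          q (≡.trans (≡.sym (same F)) g , ≡.trans h (≡.cong (λ z → suc (suc z)) (≡.sym (ℕP.+-identityʳ i))) , subs F))) , λ F _ → trans (w F) (∂≈ant Γ' y F)
      where
      Γ' = lkF Γ G
      none : ∀ u → lookup G u ≡ false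
      none = size-zero G e
      subs : ∀ F → Sub G F
      subs F u q = ⊥-elim (true≢false q (none u))
      un : ∀ H → H ∪ G ≡ H
      un H = sub-ext (H ∪ G) H (λ u q → case ∪-elim H G u q of λ { (inj₁ h) → h ; (inj₂ h) → ⊥-elim (true≢false h (none u)) }) (∪-introˡ H G)
      same : ∀ H → Γ' H ≡ Γ H
      same H = iff⇒≡ (λ p → ≡.trans (≡.cong Γ (≡.sym (un H))) (proj₂ (lkF-true {Γ = Γ} {G} {H} p)))
                     (λ p → lkF-intro {Γ = Γ} {G} {H} (λ u _ q → true≢false q (none u)) (≡.trans (≡.cong Γ (un H)) p))
      r = ac x (Supp⇒Chain Γ' (lift (λ F q → xs F (λ (a , b , _) → q (≡.trans (same F) a , ≡.trans b (≡.cong suc (ℕP.+-identityʳ i)))))) ,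
                λ F → trans (∂≈ant Γ' x F) (xz F (subs F)))
      y = proj₁ (proj₂ r)
      b = proj₁ (proj₂ (proj₂ r))
      w = proj₂ (proj₂ (proj₂ r))
    acyclic⇒relative (suc k) Γ G e {i} ac = let
        (g , h , _) = extra-vertex ∅ G (≡.subst₂ _<_ (≡.sym (∣∅∣≡0 n)) (≡.sym e) (s≤s z≤n))
        sz : ∣ G [ g ]≔ false ∣ ≡ k
        sz = ℕP.suc-injective (≡.trans (size-remove g G h) e)
      in ≡.subst (RelAcyclic Γ G) (≡.cong suc (≡.sym (ℕP.+-suc i k)))
           (RelAcyclic-lk {Γ} {g} {G} h (acyclic⇒relative k (lk Γ g) (G [ g ]≔ false) sz (Acyclic-≡ (λ H → ≡.sym (lkF-step Γ h H)) ac)))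

    module _ {Δ : Subset n → Bool} {d : ℕ} (cx : IsComplexOnV Δ) (is : IsolatedSing Δ d) where
      private
        down : ∀ {F G} → Sub G F → Δ F ≡ true → Δ G ≡ true
        down = Complex-down (proj₁ cx)

      -- Two vertices of `G` are split off: with isolated singularities the link of the second in
      -- the link of the first is Cohen-Macaulay, and the rest of `G` is a face of it.
      link-acyclic : ∀ G → Δ G ≡ true → 2 ≤ ∣ G ∣ → ∀ i → suc (i ℕ.+ ∣ G ∣) < d → Acyclic (lkF Δ G) i
      link-acyclic G ΔG two i lt =
          Acyclic-≡ (λ H → ≡.trans (lkF-step (lk Δ v) u∈ H) (lkF-step Δ v∈ H))
            (proj₂ (proj₂ (proj₂ is v (proj₂ cx v)) u isu) G₂ face i lt')
        where
        ev = extra-vertex ∅ G (≡.subst (_< ∣ G ∣) (≡.sym (∣∅∣≡0 n)) (ℕP.<-≤-trans (s≤s z≤n) two))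
        v = proj₁ ev
        v∈ = proj₁ (proj₂ ev)
        G₁ = G [ v ]≔ false
        s₁ : suc ∣ G₁ ∣ ≡ ∣ G ∣
        s₁ = size-remove v G v∈
        eu = extra-vertex ∅ G₁ (≡.subst (_< ∣ G₁ ∣) (≡.sym (∣∅∣≡0 n)) (ℕP.≤-pred (≡.subst (2 ≤_) (≡.sym s₁) two)))
        u = proj₁ eu
        u∈ = proj₁ (proj₂ eu)
        G₂ = G₁ [ u ]≔ false
        s₂ : suc ∣ G₂ ∣ ≡ ∣ G₁ ∣
        s₂ = size-remove u G₁ u∈
        u≢v : ¬ u ≡ v
        u≢v e = true≢false (≡.trans (≡.cong (lookup G₁) (≡.sym e)) u∈) (lookup-[]≔ G v)
        singleton : ∀ (u w : Fin n) → lookup ⁅ u ⁆ w ≡ true → w ≡ u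
        singleton u w e = x∈⁅y⁆⇒x≡y u (VecP.lookup⇒[]= w _ e)
        isu : IsVertex (lk Δ v) u
        isu = lk-intro {Γ = Δ} (¬true (λ e → u≢v (≡.sym (singleton u v e)))) (down (λ w e → case w Fin.≟ v of λ where
            (yes ≡.refl) → v∈
            (no p) → ≡.subst (λ z → lookup G z ≡ true) (≡.sym (singleton u w (≡.trans (≡.sym (VecP.lookup∘update′ p ⁅ u ⁆ true)) e))) (remove-⊆ v G u u∈)) ΔG)
        face : lk (lk Δ v) u G₂ ≡ true
        face = lk-intro {Γ = lk Δ v} (lookup-[]≔ G₁ u) (≡.trans (≡.cong (lk Δ v) (add-remove u G₁ u∈))
                 (lk-intro {Γ = Δ} (lookup-[]≔ G v) (≡.trans (≡.cong Δ (add-remove v G v∈)) ΔG)))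
        lt' : suc (i ℕ.+ ∣ G₂ ∣) < d ℕ.∸ 1 ℕ.∸ 1
        lt' = ℕP.m+n≤o⇒m≤o∸n (suc (suc (i ℕ.+ ∣ G₂ ∣))) (ℕP.m+n≤o⇒m≤o∸n (suc (suc (i ℕ.+ ∣ G₂ ∣)) ℕ.+ 1) (≡.subst (_≤ d) eq lt))
          where
          eq : suc (suc (i ℕ.+ ∣ G ∣)) ≡ suc (suc (i ℕ.+ ∣ G₂ ∣)) ℕ.+ 1 ℕ.+ 1
          eq = ≡.trans (≡.cong (λ k → suc (suc (i ℕ.+ k))) (≡.trans (≡.sym s₁) (≡.cong suc (≡.sym s₂))))
            (≡.trans (≡.cong (λ z → suc (suc z)) (≡.trans (ℕP.+-suc i (suc ∣ G₂ ∣)) (≡.cong suc (ℕP.+-suc i ∣ G₂ ∣)))) (≡.sym (≡.trans (ℕP.+-assoc (suc (suc (i ℕ.+ ∣ G₂ ∣))) 1 1) (ℕP.+-comm (suc (suc (i ℕ.+ ∣ G₂ ∣))) 2))))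

      -- Above the size of `G` this is acyclicity of its link. At the size of `G` it concerns degree
      -- -1, which `Acyclic` does not cover; there purity extends `G` to a facet, and any further
      -- vertex of it gives a primitive.
      relative-acyclic : ∀ G → 2 ≤ ∣ G ∣ → ∀ p → p < d → RelAcyclic Δ G p
      relative-acyclic G two p lt x (lift xs) xz with Δ G Bool.≟ true
      ... | no q = (λ _ → 0#) , lift (λ _ _ → refl) , λ F s → trans (xs F (λ (a , _ , _) → q (down s a))) (sym (fin-0 (ant-fin 𝟙 F) (λ _ → refl)))
      ... | yes ΔG with ℕP.<-cmp p ∣ G ∣
      ...   | Relation.Binary.tri< a _ _ = (λ _ → 0#) , lift (λ _ _ → refl) ,
                λ F s → trans (xs F (λ (_ , b , _) → ℕP.<⇒≱ a (≡.subst (∣ G ∣ ≤_) b (sub-size G F s)))) (sym (fin-0 (ant-fin 𝟙 F) (λ _ → refl)))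
      ...   | Relation.Binary.tri> _ _ a = ≡.subst (RelAcyclic Δ G) pe (acyclic⇒relative _ Δ G ≡.refl (link-acyclic G ΔG two (p ℕ.∸ suc ∣ G ∣) (≡.subst (_< d) (≡.sym pe) lt))) x (lift xs) xz
          where
          pe : suc (p ℕ.∸ suc ∣ G ∣ ℕ.+ ∣ G ∣) ≡ p
          pe = ≡.trans (≡.sym (ℕP.+-suc _ ∣ G ∣)) (ℕP.m∸n+n≡m a)
      ...   | Relation.Binary.tri≈ _ pG _ = cr w x ,
              lift (λ F q → cr-loc w x F (λ f → xs _ (λ (a , b , s) → q (
                 down (λ u h → case u Fin.≟ w of λ where
                   (yes ≡.refl) → w∈
                   (no ne) → H⊇ u (≡.subst (λ z → lookup z u ≡ true) (≡.sym (G≡ {F [ w ]≔ false} s b)) (≡.trans (VecP.lookup∘update′ ne F false) h))) ΔH ,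
                 ≡.trans (≡.sym (size-remove w F f)) (≡.cong suc b) , λ u h → remove-⊆ w F u (s u h))))) ,
              λ F s → trans (sym (trans (cr-ant w 𝟙 x F) (*-identityˡ _))) (trans (+-congˡ (cr-loc w _ F (λ _ → xz _ (λ u h → case u Fin.≟ w of λ where
                    (yes ≡.refl) → ⊥-elim (true≢false h w∉)
                    (no ne) → ≡.trans (VecP.lookup∘update′ ne F false) (s u h))))) (+-identityʳ _))
          where
          facet = proj₂ (proj₁ is) G ΔG
          H = proj₁ facet
          H⊇ : Sub G H
          H⊇ = ⊆-to (proj₁ (proj₂ facet))
          ΔH = proj₁ (proj₂ (proj₂ facet))
          ew = extra-vertex G H (≡.subst₂ _<_ pG (≡.sym (proj₂ (proj₂ (proj₂ facet)))) lt)
          w = proj₁ ew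
          w∈ = proj₁ (proj₂ ew)
          w∉ = proj₂ (proj₂ ew)
          G≡ : ∀ {F} → Sub G F → ∣ F ∣ ≡ p → G ≡ F
          G≡ {F} s e = sub-ext G F s (λ u h → case lookup G u Bool.≟ true of λ where
            (yes q) → q
            (no q) → ⊥-elim (ℕP.1+n≰n (≡.subst₂ _≤_ (≡.trans (size-add u G (¬true q)) (≡.cong suc (≡.sym pG))) e
              (sub-size (G [ u ]≔ true) F (λ u' h' → case u' Fin.≟ u of λ where
                (yes ≡.refl) → h
                (no ne) → s u' (≡.trans (≡.sym (VecP.lookup∘update′ ne G true)) h'))))))

    -- Acyclicity alone would not do: the homotopy must be finitary to commute with `κ`, and read a
    -- single face size to respect the grading. The identity is claimed below size `d` only, as top
    -- cohomology survives.
    record Contraction (Δ : Subset n → Bool) (G : Subset n) (d : ℕ) : Set (c ⊔ ℓ) where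
      field
        s      : V (Subset n) → V (Subset n)
        s-fin  : ∀ F → IsFin (λ x → s x F)
        s-supp : ∀ x F → ¬ (Δ F ≡ true × Sub G F) → s x F ≈ 0#
        s-loc  : ∀ x F → (∀ H → Δ H ≡ true → Sub G H → ∣ H ∣ ≡ suc ∣ F ∣ → x H ≈ 0#) → s x F ≈ 0#
        s-law  : ∀ x → (∀ F → ¬ Sub G F → x F ≈ 0#) → ∀ F → Δ F ≡ true → Sub G F → ∣ F ∣ < d →
                 crt 𝟙 (s x) F + s (crt 𝟙 x) F ≈ x F

    -- A chain contraction is built size by size from relative acyclicity; its transpose contracts cochains.
    module _ {Δ : Subset n → Bool} (cx : IsComplex Δ) (G : Subset n) (d : ℕ) (ac : ∀ p → p < d → RelAcyclic Δ G p) where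
      private
        Q : ℕ → Subset n → Set
        Q = Above Δ G

        opaque
          above : V (Subset n) → V (Subset n)
          above x F = if does (Sub? G F) then x F else 0#

          above-yes : ∀ x {F} → Sub G F → above x F ≡ x F
          above-yes x {F} p = ≡.cong (λ b → if b then x F else 0#) (dec-true (Sub? G F) p)

          above-no : ∀ x {F} → ¬ Sub G F → above x F ≡ 0#
          above-no x {F} p = ≡.cong (λ b → if b then x F else 0#) (dec-false (Sub? G F) p)

        ∂e : Subset n → V (Subset n)
        ∂e F = above (ant 𝟙 (indicator F))

        ∂e-supp : ∀ {p F} → Q (suc p) F → Supp (Q p) (∂e F)
        ∂e-supp {p} {F} (a , b , s) = lift (λ H q → case Sub? G H of λ where
          (no h) → ≡⇒≈ (above-no _ h)
          (yes h) → trans (≡⇒≈ (above-yes _ h)) (sum-0 (λ v → trans (*-congˡ (an-loc v _ H (λ e → indicator-off F (λ r →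
            q (Complex-down cx (λ u g → ≡.subst (λ z → lookup z u ≡ true) r (⊆-add v H u g)) a ,
               ℕP.suc-injective (≡.trans (≡.sym (size-add v H e)) (≡.trans (≡.cong ∣_∣ r) b)) , h))))) (zeroʳ _))))

        ∂e-zero : ∀ {F} → Q 0 F → ∀ H → ∂e F H ≈ 0#
        ∂e-zero {F} (_ , b , _) H = case Sub? G H of λ where
          (no h) → ≡⇒≈ (above-no _ h)
          (yes h) → trans (≡⇒≈ (above-yes _ h)) (sum-0 (λ v → trans (*-congˡ (an-loc v _ H (λ e → indicator-off F (λ r →
             case ≡.trans (≡.sym (size-add v H e)) (≡.trans (≡.cong ∣_∣ r) b) of λ ())))) (zeroʳ _)))

        ant-above : ∀ x F → Sub G F → ant 𝟙 (above x) F ≈ ant 𝟙 x F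
        ant-above x F s = sum-cong (λ v → *-congˡ (an-cong v (above x) x F (λ _ → ≡⇒≈ (above-yes x (λ u h → ⊆-add v F u (s u h))))))

        comb : (Subset n → V (Subset n)) → V (Subset n) → V (Subset n)
        comb y z F = S∑ (λ H → z H * y H F)

        -- A chain homotopy on generators: `y F` is its value on the face `F`, and `prev` is the
        -- homotopy one size lower.
        record Stage (p : ℕ) (prev : Subset n → V (Subset n)) : Set (c ⊔ ℓ) where
          field
            y      : Subset n → V (Subset n)
            y-supp : ∀ F → Supp (Q (suc p)) (y F)
            law    : ∀ F → Q p F → ∀ F' → Sub G F' → ant 𝟙 (y F) F' + comb prev (∂e F) F' ≈ indicator F F'

        -- The face minus the previous homotopy of its boundary is a cycle, and any primitive of it
        -- may serve as the new value; for other subsets zero makes the choice total.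
        build : ∀ p prev → RelAcyclic Δ G p → (∀ F → Q p F → Supp (Q p) (comb prev (∂e F))) →
                (∀ F → Q p F → ∀ F' → Sub G F' → ant 𝟙 (λ F'' → indicator F F'' - comb prev (∂e F) F'') F' ≈ 0#) → Stage p prev
        build p prev rac cs cyc = record
            { y = λ F → proj₁ (chosen F (Above? Δ G p F)) ; y-supp = λ F → proj₁ (proj₂ (chosen F (Above? Δ G p F)))
            ; law = λ F q F' s → trans (+-congʳ (sym (proj₂ (proj₂ (chosen F (Above? Δ G p F))) q F' s))) (solve 2 (λ a b → (a :- b) :+ b := a) refl _ _) }
          where
          chosen : ∀ F → Dec (Q p F) → Σ (V (Subset n)) λ y → Supp (Q (suc p)) y ×
                   (Q p F → ∀ F' → Sub G F' → indicator F F' - comb prev (∂e F) F' ≈ ant 𝟙 y F')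
          chosen F (no q)  = (λ _ → 0#) , lift (λ _ _ → refl) , λ q' → ⊥-elim (q q')
          chosen F (yes q) = let (y , a , b) = rac _ (-∈ Supp-sub (lift (λ H r → indicator-off F (λ { ≡.refl → r q }))) (cs F q)) (cyc F q) in y , a , λ _ → b

        0-prev : Subset n → V (Subset n)
        0-prev _ _ = 0#

        comb-0 : ∀ z F → comb 0-prev z F ≈ 0#
        comb-0 z F = fin-0 S∑-fin (λ H → zeroʳ _)

        comb-∂ : ∀ y z F → ant 𝟙 (comb y z) F ≈ S∑ (λ H → z H * ant 𝟙 (y H) F)
        comb-∂ y z F = trans (fubini (ant-fin 𝟙 F) S∑-fin (λ F' H → z H * y H F')) (fin-cong S∑-fin (λ H → fin-* (ant-fin 𝟙 F) (z H) (y H)))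

        ∂∂e : ∀ F H → Sub G H → ant 𝟙 (∂e F) H ≈ 0#
        ∂∂e F H s = trans (ant-above _ H s) (ant² 𝟙 _ H)

        -- By linearity the law on generators applies to any combination of faces. For a cycle the
        -- term passing through the boundary drops out, so the homotopy yields a primitive.
        extend-law : ∀ {p prev} (L : Stage p prev) → ∀ z → Supp (Q p) z → (∀ H → Sub G H → ant 𝟙 z H ≈ 0#) →
                     ∀ F → Sub G F → ant 𝟙 (comb (Stage.y L) z) F ≈ z F
        extend-law {p} {prev} L z (lift zs) zc F s = begin
          ant 𝟙 (comb y z) F                                     ≈⟨ comb-∂ y z F ⟩
          S∑ (λ H → z H * ant 𝟙 (y H) F)                         ≈⟨ fin-cong S∑-fin (λ H → term H (Above? Δ G p H)) ⟩
          S∑ (λ H → indicator F H * z H + - (S∑ (λ J → z H * (∂e H J * prev J F))))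
                                                                 ≈⟨ trans (fin-+ S∑-fin _ _) (+-cong (indicator-sum F z) (fin-neg S∑-fin _)) ⟩
          z F - S∑ (λ H → S∑ (λ J → z H * (∂e H J * prev J F)))   ≈⟨ +-congˡ (-‿cong (trans (fubini S∑-fin S∑-fin (λ H J → z H * (∂e H J * prev J F))) (fin-0 S∑-fin (λ J → coefficient J)))) ⟩
          z F - 0#                                               ≈⟨ x-0 ⟩
          z F ∎
          where
          open Stage L
          sym-ind : ∀ H → indicator H F ≈ indicator F H
          sym-ind H = case VecP.≡-dec Bool._≟_ F H of λ where
            (yes e) → ≡⇒≈ (≡.cong₂ indicator (≡.sym e) e)
            (no ne) → trans (indicator-off H ne) (sym (indicator-off F (λ e → ne (≡.sym e))))
          term : ∀ H → Dec (Q p H) → z H * ant 𝟙 (y H) F ≈ indicator F H * z H + - (S∑ (λ J → z H * (∂e H J * prev J F)))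
          term H (yes q) = begin
            z H * ant 𝟙 (y H) F                      ≈⟨ *-congˡ (trans (solve 2 (λ a b → a := (a :+ b) :- b) refl _ (comb prev (∂e H) F)) (+-congʳ (trans (law H q F s) (sym-ind H)))) ⟩
            z H * (indicator F H - comb prev (∂e H) F)  ≈⟨ solve 3 (λ z a b → z :* (a :- b) := a :* z :+ :- (z :* b)) refl (z H) (indicator F H) (comb prev (∂e H) F) ⟩
            indicator F H * z H + - (z H * comb prev (∂e H) F)  ≈⟨ +-congˡ (-‿cong (sym (fin-* S∑-fin (z H) _))) ⟩
            _ ∎
          term H (no q) = trans (trans (*-congʳ (zs H q)) (zeroˡ _)) (sym (trans (+-cong (trans (*-congˡ (zs H q)) (zeroʳ _))
            (trans (-‿cong (fin-0 S∑-fin (λ J → trans (*-congʳ (zs H q)) (zeroˡ _)))) -0#≈0#)) (+-identityˡ _)))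
          resum : comb indicator z ≋ z
          resum F' = trans (S∑-single _ F' (λ H ne → trans (*-congˡ (indicator-off H (λ e → ne (≡.sym e)))) (zeroʳ _)))
            (trans (*-congˡ (indicator-on F')) (*-identityʳ _))
          coefficient : ∀ J → S∑ (λ H → z H * (∂e H J * prev J F)) ≈ 0#
          coefficient J = case Sub? G J of λ where
            (no h) → fin-0 S∑-fin (λ H → trans (*-congˡ (trans (*-congʳ (≡⇒≈ (above-no _ h))) (zeroˡ _))) (zeroʳ _))
            (yes h) → begin
              S∑ (λ H → z H * (∂e H J * prev J F))           ≈⟨ fin-cong S∑-fin (λ H → trans (*-congˡ (*-congʳ (≡⇒≈ (above-yes _ h)))) (solve 3 (λ z d q → z :* (d :* q) := q :* (z :* d)) refl (z H) (ant 𝟙 (indicator H) J) (prev J F))) ⟩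
              S∑ (λ H → prev J F * (z H * ant 𝟙 (indicator H) J))  ≈⟨ fin-* S∑-fin (prev J F) _ ⟩
              prev J F * S∑ (λ H → z H * ant 𝟙 (indicator H) J)    ≈⟨ *-congˡ (trans (sym (comb-∂ indicator z J)) (trans (fin-cong (ant-fin 𝟙 J) resum) (zc J h))) ⟩
              prev J F * 0#                                  ≈⟨ zeroʳ _ ⟩
              0# ∎

        -- Each stage is stored with the homotopy its law refers to; `levels-prev` identifies the
        -- latter with the stage one size lower.
        levels : ∀ p → p < d → Σ (Subset n → V (Subset n)) (Stage p)
        levels zero lt = 0-prev , build 0 0-prev (ac 0 lt) (λ F q → lift (λ H _ → comb-0 _ H))
          (λ F q F' s → sum-0 (λ v → trans (*-congˡ (trans (fin-cong (an-fin v F') (λ H → trans (+-congˡ (trans (-‿cong (comb-0 _ H)) -0#≈0#)) (+-identityʳ _)))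
             (an-loc v _ F' (λ e → indicator-off F (λ r → case ≡.trans (≡.sym (size-add v F' e)) (≡.trans (≡.cong ∣_∣ r) (proj₁ (proj₂ q))) of λ ()))))) (zeroʳ _)))
        levels (suc p) lt = Stage.y L , build (suc p) (Stage.y L) (ac (suc p) lt)
            (λ F q → lift (λ H h → fin-0 S∑-fin (λ J → trans (*-congˡ (lower (Stage.y-supp L J) H h)) (zeroʳ _))))
            (λ F q F' s → trans (fin-+ (ant-fin 𝟙 F') (indicator F) _) (trans (+-congˡ (trans (fin-neg (ant-fin 𝟙 F') _)
               (-‿cong (trans (extend-law L (∂e F) (∂e-supp q) (∂∂e F) F' s) (≡⇒≈ (above-yes _ s)))))) (-‿inverseʳ _)))
          where L = proj₂ (levels p (ℕP.<-trans (ℕP.n<1+n p) lt))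

        levels-prev : ∀ p lt lt' → proj₁ (levels (suc p) lt) ≡ Stage.y (proj₂ (levels p lt'))
        levels-prev p lt lt' = ≡.cong (λ l → Stage.y (proj₂ (levels p l))) (ℕP.<-irrelevant _ lt')

        pick : ∀ p → Dec (p < d) → Subset n → V (Subset n)
        pick p (yes lt) = Stage.y (proj₂ (levels p lt))
        pick p (no _)   = 0-prev

        pick-supp : ∀ p r F → Supp (Q (suc p)) (pick p r F)
        pick-supp p (yes lt) F = Stage.y-supp (proj₂ (levels p lt)) F
        pick-supp p (no _)   F = lift (λ _ _ → refl)

        Y : Subset n → V (Subset n)
        Y F = pick ∣ F ∣ (∣ F ∣ ℕ.<? d) F

        in? : ∀ F → Dec (Δ F ≡ true × Sub G F)
        in? F = (Δ F Bool.≟ true) ×-dec Sub? G F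

        sD : ∀ {P : Set} → Dec P → Subset n → V (Subset n) → Carrier
        sD (yes _) F x = S∑ (λ H → Y F H * x H)
        sD (no _)  F x = 0#

        sD-fin : ∀ {P : Set} (r : Dec P) F → IsFin (sD r F)
        sD-fin (no _)  F = 0-fin
        sD-fin (yes _) F = ∘-fin S∑-fin (λ H → *-fin (Y F H) (pt-fin H))

      contraction : Contraction Δ G d
      contraction = record
        { s = s ; s-fin = λ F → sD-fin (in? F) F
        ; s-supp = λ x F q → sD-supp x F q (in? F)
        ; s-loc = λ x F z → loc x F z (in? F)
        ; s-law = s-law }
        where
        s : V (Subset n) → V (Subset n)
        s x F = sD (in? F) F x
        sD-supp : ∀ x F → ¬ (Δ F ≡ true × Sub G F) → (r : Dec (Δ F ≡ true × Sub G F)) → sD r F x ≈ 0#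
        sD-supp x F q (yes p) = ⊥-elim (q p)
        sD-supp x F q (no _)  = refl
        loc : ∀ x F → (∀ H → Δ H ≡ true → Sub G H → ∣ H ∣ ≡ suc ∣ F ∣ → x H ≈ 0#) → (r : Dec (Δ F ≡ true × Sub G F)) → sD r F x ≈ 0#
        loc x F z (no _)  = refl
        loc x F z (yes _) = fin-0 S∑-fin (λ H → case Above? Δ G (suc ∣ F ∣) H of λ where
          (yes (a , b , h)) → trans (*-congˡ (z H a h b)) (zeroʳ _)
          (no q) → trans (*-congʳ (lower (pick-supp ∣ F ∣ (∣ F ∣ ℕ.<? d) F) H q)) (zeroˡ _))
        s-in : ∀ x F → Δ F ≡ true → Sub G F → s x F ≈ S∑ (λ H → Y F H * x H)
        s-in x F a b = go (in? F)
          where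
          go : (r : Dec (Δ F ≡ true × Sub G F)) → sD r F x ≈ S∑ (λ H → Y F H * x H)
          go (yes _) = refl
          go (no q)  = ⊥-elim (q (a , b))
        Y≡ : ∀ F {p} (e : ∣ F ∣ ≡ p) (lt : p < d) → Y F ≡ Stage.y (proj₂ (levels p lt)) F
        Y≡ F ≡.refl lt with ∣ F ∣ ℕ.<? d
        ... | yes lt' = ≡.cong (λ l → Stage.y (proj₂ (levels ∣ F ∣ l)) F) (ℕP.<-irrelevant lt' lt)
        ... | no q = ⊥-elim (q lt)
        s-law : ∀ x → (∀ F → ¬ Sub G F → x F ≈ 0#) → ∀ F → Δ F ≡ true → Sub G F → ∣ F ∣ < d → crt 𝟙 (s x) F + s (crt 𝟙 x) F ≈ x F
        s-law x xs F ΔF sF lt = begin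
          crt 𝟙 (s x) F + s (crt 𝟙 x) F                        ≈⟨ +-cong first second ⟩
          S∑ (λ J → prev∂ J * x J) + S∑ (λ J → ant 𝟙 (Y F) J * x J)    ≈⟨ sym (fin-+ S∑-fin _ _) ⟩
          S∑ (λ J → prev∂ J * x J + ant 𝟙 (Y F) J * x J)       ≈⟨ fin-cong S∑-fin (λ J → trans (sym (distribʳ _ _ _)) (final J)) ⟩
          S∑ (λ J → indicator F J * x J)                       ≈⟨ indicator-sum F x ⟩
          x F ∎
          where
          p = ∣ F ∣
          L = proj₂ (levels p lt)
          prev∂ : V (Subset n)
          prev∂ = comb (proj₁ (levels p lt)) (∂e F)
          qF : Q p F
          qF = ΔF , ≡.refl , sF
          final : ∀ J → (prev∂ J + ant 𝟙 (Y F) J) * x J ≈ indicator F J * x J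
          final J = case Sub? G J of λ where
            (no h) → trans (*-congˡ (xs J h)) (trans (zeroʳ _) (sym (trans (*-congˡ (xs J h)) (zeroʳ _))))
            (yes h) → *-congʳ (trans (+-comm _ _) (trans (+-congʳ (≡⇒≈ (≡.cong (λ w → ant 𝟙 w J) (Y≡ F ≡.refl lt)))) (Stage.law L F qF J h)))
          second : s (crt 𝟙 x) F ≈ S∑ (λ J → ant 𝟙 (Y F) J * x J)
          second = trans (s-in _ F ΔF sF) (trans (fin-cong S∑-fin (λ J → *-comm _ _)) (trans (crt-adj 𝟙 x (Y F)) (fin-cong S∑-fin (λ J → *-comm _ _))))
          prev-agree : ∀ p' (lt' : p' < d) H → Q p' F → ∂e F H * s x H ≈ ∂e F H * S∑ (λ J → proj₁ (levels p' lt') H J * x J)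
          prev-agree zero    lt' H q = trans (*-congʳ (∂e-zero q H)) (trans (zeroˡ _) (sym (trans (*-congʳ (∂e-zero q H)) (zeroˡ _))))
          prev-agree (suc p') lt' H q = case Above? Δ G p' H of λ where
            (no h) → trans (*-congʳ (lower (∂e-supp q) H h)) (trans (zeroˡ _) (sym (trans (*-congʳ (lower (∂e-supp q) H h)) (zeroˡ _))))
            (yes (a , b , h)) → *-congˡ (trans (s-in x H a h) (fin-cong S∑-fin (λ J → *-congʳ (≡⇒≈ (≡.cong (λ w → w J) (≡.trans (Y≡ H b (ℕP.<-trans (ℕP.n<1+n p') lt')) (≡.cong (λ w → w H) (≡.sym (levels-prev p' lt' (ℕP.<-trans (ℕP.n<1+n p') lt'))))))))))
          first : crt 𝟙 (s x) F ≈ S∑ (λ J → prev∂ J * x J)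
          first = begin
            crt 𝟙 (s x) F                                     ≈⟨ sym (indicator-sum F (crt 𝟙 (s x))) ⟩
            S∑ (λ H → indicator F H * crt 𝟙 (s x) H)          ≈⟨ trans (fin-cong S∑-fin (λ H → *-comm _ _)) (crt-adj 𝟙 (s x) (indicator F)) ⟩
            S∑ (λ H → s x H * ant 𝟙 (indicator F) H)          ≈⟨ fin-cong S∑-fin (λ H → to∂e H (Sub? G H)) ⟩
            S∑ (λ H → ∂e F H * s x H)                         ≈⟨ fin-cong S∑-fin (λ H → prev-agree p lt H qF) ⟩
            S∑ (λ H → ∂e F H * S∑ (λ J → proj₁ (levels p lt) H J * x J))  ≈⟨ fin-cong S∑-fin (λ H → sym (fin-* S∑-fin _ _)) ⟩
            S∑ (λ H → S∑ (λ J → ∂e F H * (proj₁ (levels p lt) H J * x J))) ≈⟨ fubini S∑-fin S∑-fin (λ H J → ∂e F H * (proj₁ (levels p lt) H J * x J)) ⟩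
            S∑ (λ J → S∑ (λ H → ∂e F H * (proj₁ (levels p lt) H J * x J))) ≈⟨ fin-cong S∑-fin (λ J → trans (fin-cong S∑-fin (λ H → solve 3 (λ a b c → a :* (b :* c) := c :* (a :* b)) refl (∂e F H) (proj₁ (levels p lt) H J) (x J))) (trans (fin-* S∑-fin (x J) _) (*-comm _ _))) ⟩
            S∑ (λ J → prev∂ J * x J) ∎
            where
            to∂e : ∀ H → Dec (Sub G H) → s x H * ant 𝟙 (indicator F) H ≈ ∂e F H * s x H
            to∂e H (yes h) = trans (*-comm _ _) (*-congʳ (sym (≡⇒≈ (above-yes _ h))))
            to∂e H (no h) = trans (*-congʳ (sD-supp x H (λ (_ , b) → h b) (in? H))) (trans (zeroˡ _) (sym (trans (*-congˡ (sD-supp x H (λ (_ , b) → h b) (in? H))) (zeroʳ _))))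

  -- Removing multidegrees with several negative entries

  module Layers {n d : ℕ} (Θ : Fin d → Fin n → Carrier) (i : ℕ)
    (Δ : Subset n → Bool) (cx : IsComplex Δ) where
    open TotalComplex Θ i
    open Localisation Θ i Δ cx

    Dim-mask : ∀ {B B' : Mask n} → (∀ F a → B F a ≡ true → B' F a ≡ true) → (∀ F a → B' F a ≡ true → B F a ≡ true) →
               ∀ {m r} → Dim (Z B m) (Bd B m) r → Dim (Z B' m) (Bd B' m) r
    Dim-mask {B} {B'} f g = Dim-≐
      (λ (x , z) → cxm f x , λ F S a e → z F S a (g F a e)) (λ (x , z) → cxm g x , λ F S a e → z F S a (f F a e))
      (λ (x , Y , y , z) → cxm f x , Y , cxm f y , λ F S a e → z F S a (g F a e))
      (λ (x , Y , y , z) → cxm g x , Y , cxm g y , λ F S a e → z F S a (f F a e))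
      where
      cxm : ∀ {B B' : Mask n} → (∀ F a → B F a ≡ true → B' F a ≡ true) → ∀ {m X} → Cx B m X → Cx B' m X
      cxm f (lift s) = lift (λ (F , S , a) q → s _ (λ (b , g) → q (f F a b , g)))

    opaque
      nonpos : Mask n
      nonpos = Without E₂ okᵐ (allFin n)

      nonpos-def : nonpos ≡ Without E₂ okᵐ (allFin n)
      nonpos-def = ≡.refl

      -- Without positive entries the multidegree adds nothing to the support, so the Čech condition
      -- reduces to faces that contain all negative entries.
      nonpos-elim : ∀ {F a} → nonpos F a ≡ true → (∀ u → lookup a u ℤ.≤ + 0) × Δ F ≡ true × Sub (negSupp a) F
      nonpos-elim {F} {a} e = let (o , w) = Without-elim E₂ (allFin n) e in
        (λ u → ℤP.≮⇒≥ (λ p → true≢false (dec-true (+ 0 ℤ.<? lookup a u) p) (w (∈-allFin u)))) ,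
        Complex-down cx (mrg-F F a) (ok-face o) ,
        λ u p → case lookup F u Bool.≟ true of λ where
          (yes f) → f
          (no f) → ⊥-elim (ℤP.<⇒≱ (negSupp-elim a u p) (ok-nonneg o u (¬true f)))

      nonpos-intro : ∀ {F a} → (∀ u → lookup a u ℤ.≤ + 0) → Δ F ≡ true → Sub (negSupp a) F → nonpos F a ≡ true
      nonpos-intro {F} {a} p f s = Without-intro E₂ (allFin n)
        (ok-intro (λ u q → ℤP.≮⇒≥ (λ l → true≢false (s u (negSupp-intro a u l)) q))
          (Complex-down cx (λ u q → case mrg-elim F a u q of λ where
            (inj₁ r) → r
            (inj₂ r) → ⊥-elim (ℤP.<⇒≱ r (p u))) f))
        (λ {v} _ → dec-false (+ 0 ℤ.<? lookup a v) (ℤP.≤⇒≯ (p v)))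

    nonpos-convex : Convex nonpos
    nonpos-convex = ≡.subst Convex (≡.sym nonpos-def) (Without-convex E₂ ok-Convex (E₂-up _) (allFin n))

    -- Raising a multidegree can only remove negative entries, so these conditions cut out an
    -- increasing chain of subcomplexes.
    small : ℕ → Mask n
    small k F a = does (∣ negSupp a ∣ ℕ.≤? k)

    small-elim : ∀ {k} {F : Subset n} {a} → small k F a ≡ true → ∣ negSupp a ∣ ≤ k
    small-elim {k} {F} {a} e = does-true (∣ negSupp a ∣ ℕ.≤? k) e

    small-intro : ∀ {k} {F : Subset n} {a} → ∣ negSupp a ∣ ≤ k → small k F a ≡ true
    small-intro {k} {F} {a} e = dec-true (∣ negSupp a ∣ ℕ.≤? k) e

    small-up : ∀ B k → UpIn B (small k)
    small-up B k {F} {a} {F'} {a'} l _ e _ = small-intro {k} {F'} {a'} (ℕP.≤-trans (sub-size (negSupp a') (negSupp a) (negSupp-mono a a' (le-a l))) (small-elim {k} {F} {a} e))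

    layer : ℕ → Mask n
    layer k = nonpos ∧ᵐ small k

    module _ (ctr : ∀ G → 2 ≤ ∣ G ∣ → Contraction Δ G d) (k : ℕ) (k≥1 : 1 ≤ k) where
      private
        B : Mask n
        B = layer (suc k) ∖ᵐ small k

        IsLayer : Vec ℤ n → Set
        IsLayer a = (∀ u → lookup a u ℤ.≤ + 0) × ∣ negSupp a ∣ ≡ suc k

        B-elim : ∀ {F a} → B F a ≡ true → IsLayer a × Δ F ≡ true × Sub (negSupp a) F
        B-elim {F} {a} e = let (p , q) = ∖ᵐ-true {layer (suc k)} {small k} {F} {a} e ; (r , t) = ∧-true p ; (x , y , z) = nonpos-elim r in
          (x , ℕP.≤-antisym (small-elim {suc k} {F} {a} t) (ℕP.≰⇒> (λ l → true≢false (small-intro {k} {F} {a} l) q))) , y , z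

        B-intro : ∀ {F a} → IsLayer a → Δ F ≡ true → Sub (negSupp a) F → B F a ≡ true
        B-intro {F} {a} (x , e) y z = ∖ᵐ-intro {layer (suc k)} {small k} {F} {a} (∧-intro (nonpos-intro x y z) (small-intro {suc k} {F} {a} (ℕP.≤-reflexive e)))
          (¬true (λ q → ℕP.1+n≰n (≡.subst (_≤ k) e (small-elim {k} {F} {a} q))))

        pick : ∀ G → Dec (2 ≤ ∣ G ∣) → V (Subset n) → V (Subset n)
        pick G (yes p) = Contraction.s (ctr G p)
        pick G (no _)  = λ _ _ → 0#

        sG : Subset n → V (Subset n) → V (Subset n)
        sG G = pick G (2 ℕ.≤? ∣ G ∣)

        sG≡ : ∀ G (p : 2 ≤ ∣ G ∣) → sG G ≡ Contraction.s (ctr G p)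
        sG≡ G p with 2 ℕ.≤? ∣ G ∣
        ... | yes q = ≡.cong (λ z → Contraction.s (ctr G z)) (ℕP.≤-irrelevant q p)
        ... | no q = ⊥-elim (q p)

      -- The contraction depends on `a` only through its set of negative entries. Lowering `a`
      -- within the layer keeps this set, as it can only grow and its size is fixed; so all
      -- positions read by `κ` share one contraction, and the two commute.
      layer-exact : ∀ m → 2 ≤ m → Exact B m
      layer-exact m m≥2 X (x , z) = x , Y , y , λ F S a e → sym (main F S a e (Gr? m F S a))
        where
        X₁ : Subset d → Vec ℤ n → V (Subset n)
        X₁ S a F = X (F , S , a)
        Y₀ : V Ix
        Y₀ (F , S , a) = sg S * sG (negSupp a) (X₁ S a) F
        Y : V Ix
        Y = cut B Y₀
        module Ctr {a} (la : IsLayer a) where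
          big : 2 ≤ ∣ negSupp a ∣
          big = ≡.subst (2 ≤_) (≡.sym (proj₂ la)) (s≤s k≥1)
          open Contraction (ctr (negSupp a) big) public
          same : ∀ x F → sG (negSupp a) x F ≈ s x F
          same x F = ≡⇒≈ (≡.cong (λ f → f x F) (sG≡ (negSupp a) big))
        y : Cx B (suc m) Y
        y = lift (λ (F , S , a) q → case B F a Bool.≟ true of λ where
          (no e) → ≡⇒≈ (cut-false B Y₀ (¬true e))
          (yes e) → let (la , f , sb) = B-elim {F} {a} e in trans (≡⇒≈ (cut-true B Y₀ e)) (trans (*-congˡ (trans (Ctr.same {a} la (X₁ S a) F) (Ctr.s-loc {a} la (X₁ S a) F (λ H _ _ h → lower x (H , S , a) (λ (_ , g , g') →
                q (e , ≡.trans (ℕP.+-suc ∣ F ∣ m) (≡.trans (≡.cong (ℕ._+ m) (≡.sym h)) g) , g')))))) (zeroʳ _)))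
        main : ∀ F S a → B F a ≡ true → Dec (Gr m F S a) → D Y (F , S , a) ≈ X (F , S , a)
        main F S a e (no ng) = trans (D-Graded (Cx⇒Graded y) F S a ng) (sym (Cx⇒Graded x F S a ng))
        main F S a e (yes (g , _)) = begin
            D Y (F , S , a)                              ≈⟨ D≈ Y F S a ⟩
            sg S * crt 𝟙 (λ F' → Y (F' , S , a)) F + κ (λ p → Y (F , p)) (S , a)
              ≈⟨ +-cong (*-congˡ (trans (fin-cong (crt-fin 𝟙 F) (λ F' → Y-F F' (B F' a Bool.≟ true))) (fin-* (crt-fin 𝟙 F) (sg S) _)))
                        (trans κ-part (trans (κ-sg (λ (S' , a') → s (X₁ S' a') F) S a) (-‿cong (*-congˡ (sym (fubini (s-fin F) (κ-fin (S , a)) (λ F' p → X (F' , p)))))))) ⟩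
            sg S * (sg S * crt 𝟙 (s (X₁ S a)) F) + - (sg S * s (λ F' → κ (λ p → X (F' , p)) (S , a)) F)
              ≈⟨ +-congʳ (trans (sym (*-assoc _ _ _)) (trans (*-congʳ (sg² S)) (*-identityˡ _))) ⟩
            crt 𝟙 (s (X₁ S a)) F + - (sg S * s (λ F' → κ (λ p → X (F' , p)) (S , a)) F)
              ≈⟨ solve 3 (λ c q t → c :+ :- q := (c :+ t) :- (t :+ q)) refl _ _ (s (crt 𝟙 (X₁ S a)) F) ⟩
            (crt 𝟙 (s (X₁ S a)) F + s (crt 𝟙 (X₁ S a)) F) - (s (crt 𝟙 (X₁ S a)) F + sg S * s (λ F' → κ (λ p → X (F' , p)) (S , a)) F)
              ≈⟨ +-cong (s-law (X₁ S a) (λ F' ns → lower x _ (λ (e' , _) → ns (proj₂ (proj₂ (B-elim {F'} {a} e'))))) F f sb F<d) (trans (-‿cong rest) -0#≈0#) ⟩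
            X (F , S , a) + 0#                           ≈⟨ +-identityʳ _ ⟩
            X (F , S , a) ∎
          where
          la = proj₁ (B-elim {F} {a} e)
          f = proj₁ (proj₂ (B-elim {F} {a} e))
          sb = proj₂ (proj₂ (B-elim {F} {a} e))
          open Ctr {a} la
          -- From ∣F∣ + m = ∣S∣ + 1 and ∣S∣ at most `d`. This is the place where positive Koszul
          -- degree, `m` at least two, keeps clear of the top homology of links.
          F<d : ∣ F ∣ < d
          F<d = ℕP.≤-trans (ℕP.≤-pred (≡.subst (suc (suc ∣ F ∣) ≤_) g (≡.subst (_≤ ∣ F ∣ ℕ.+ m) (ℕP.+-comm ∣ F ∣ 2) (ℕP.+-monoʳ-≤ ∣ F ∣ m≥2)))) (∣p∣≤n S)
          Y-F : ∀ F' → Dec (B F' a ≡ true) → Y (F' , S , a) ≈ sg S * s (X₁ S a) F'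
          Y-F F' (yes e') = trans (≡⇒≈ (cut-true B Y₀ e')) (*-congˡ (same _ F'))
          Y-F F' (no e')  = trans (≡⇒≈ (cut-false B Y₀ (¬true e'))) (sym (trans (*-congˡ (s-supp _ F' (λ (p , q) → e' (B-intro {_} {a} la p q)))) (zeroʳ _)))
          -- If lowering leaves the layer, both sides vanish: one is cut off, and `s` reads only
          -- zeros of `X` on the other.
          Y-S : ∀ w S' → Dec (B F (dec w a) ≡ true) → Y (F , S' , dec w a) ≈ sg S' * s (X₁ S' (dec w a)) F
          Y-S w S' (yes e') = trans (≡⇒≈ (cut-true B Y₀ e')) (*-congˡ (trans (≡⇒≈ (≡.cong (λ G → sG G (X₁ S' (dec w a)) F) (≡.sym
              (sub-size-≡ (negSupp a) (negSupp (dec w a)) (negSupp-mono (dec w a) a (dec-≤ w a)) (≡.trans (proj₂ la) (≡.sym (proj₂ (proj₁ (B-elim {F} {dec w a} e'))))))))) (same _ F)))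
          Y-S w S' (no e') = trans (≡⇒≈ (cut-false B Y₀ (¬true e'))) (sym (trans (*-congˡ (s-loc _ F (λ H h sH _ → lower x _ (λ (eH , _) → let (lH , _ , _) = B-elim {H} {dec w a} eH in
              e' (B-intro {F} {dec w a} lH f (λ u q → sb u (≡.subst (λ G → lookup G u ≡ true) (≡.sym (sub-size-≡ (negSupp a) (negSupp (dec w a)) (negSupp-mono (dec w a) a (dec-≤ w a)) (≡.trans (proj₂ la) (≡.sym (proj₂ lH))))) q))))))) (zeroʳ _)))
          κ-part : κ (λ p → Y (F , p)) (S , a) ≈ κ (λ (S' , a') → sg S' * s (X₁ S' a') F) (S , a)
          κ-part = trans (κ≈ _ S a) (trans (sum-cong (λ w → fin-cong (ant-fin (θ w) S) (λ S' → Y-S w S' (B F (dec w a) Bool.≟ true)))) (sym (κ≈ _ S a)))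
          rest : s (crt 𝟙 (X₁ S a)) F + sg S * s (λ F' → κ (λ p → X (F' , p)) (S , a)) F ≈ 0#
          rest = trans (+-congˡ (sym (fin-* (s-fin F) (sg S) _))) (trans (sym (fin-+ (s-fin F) (crt 𝟙 (X₁ S a)) (λ F' → sg S * κ (λ p → X (F' , p)) (S , a))))
            (s-loc _ F (λ H h sH _ → begin
              crt 𝟙 (X₁ S a) H + sg S * κ (λ p → X (H , p)) (S , a)
                ≈⟨ +-congʳ (sym (trans (sym (*-assoc _ _ _)) (trans (*-congʳ (sg² S)) (*-identityˡ _)))) ⟩
              sg S * (sg S * crt 𝟙 (X₁ S a) H) + sg S * κ (λ p → X (H , p)) (S , a)
                ≈⟨ sym (distribˡ _ _ _) ⟩
              sg S * (sg S * crt 𝟙 (X₁ S a) H + κ (λ p → X (H , p)) (S , a))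
                ≈⟨ *-congˡ (trans (sym (D≈ X H S a)) (z H S a (B-intro {_} {a} la h sH))) ⟩
              sg S * 0#  ≈⟨ zeroʳ _ ⟩
              0# ∎)))

    nonpositive→layer : (∀ G → 2 ≤ ∣ G ∣ → Contraction Δ G d) → ∀ m → 2 ≤ m → ∀ {r} → Dim (Z nonpos m) (Bd nonpos m) r → Dim (Z (layer 1) m) (Bd (layer 1) m) r
    -- The starting bound `suc n` exceeds the number of coordinates and imposes nothing.
    nonpositive→layer ctr m m≥2 {r} q = go n (Dim-mask (λ F a e → ∧-intro e (small-intro {suc n} {F} {a} (ℕP.m≤n⇒m≤1+n (∣p∣≤n (negSupp a))))) (λ F a e → proj₁ (∧-true e)) q)
      where
      go : ∀ k → Dim (Z (layer (suc k)) m) (Bd (layer (suc k)) m) r → Dim (Z (layer 1) m) (Bd (layer 1) m) r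
      go zero    q = q
      go (suc k) q = go k (Dim-mask
        (λ F a e → let (p , t) = ∧-true {nonpos F a ∧ small (suc (suc k)) F a} e in ∧-intro (proj₁ (∧-true {nonpos F a} p)) t)
        (λ F a e → let (p , t) = ∧-true e in ∧-intro (∧-intro p (small-intro {suc (suc k)} {F} {a} (ℕP.m≤n⇒m≤1+n (small-elim {suc k} {F} {a} t)))) t)
        (Dim← (subcomplex-iso (∧-convex nonpos-convex (small-up _ (suc (suc k)))) (small-up _ (suc k)) m
          (layer-exact ctr (suc k) (s≤s z≤n) m m≥2) (layer-exact ctr (suc k) (s≤s z≤n) (suc m) (ℕP.m≤n⇒m≤1+n m≥2))) q))

  -- The homology of the origin and the rays

  module Singularities {n d : ℕ} (Θ : Fin d → Fin n → Carrier) (i : ℕ)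
    (Δ : Subset n → Bool) (cx : IsComplex Δ) (g : Fin n → Fin d → Carrier) where
    open TotalComplex Θ i
    open Layers Θ i Δ cx

    G : Mask n
    G = layer 1

    G-origin : ∀ {F} → Δ F ≡ true → G F 𝟘 ≡ true
    G-origin {F} f = ∧-intro (nonpos-intro (λ u → ℤP.≤-reflexive (lookup-𝟘 u)) f (λ u e → ⊥-elim (none u e)))
        (small-intro {1} {F} {𝟘} (ℕP.≤-trans (sub-size (negSupp 𝟘) ∅ (λ u e → ⊥-elim (none u e))) (ℕP.≤-trans (ℕP.≤-reflexive (∣∅∣≡0 n)) z≤n)))
      where
      none : ∀ u → lookup (negSupp (𝟘 {n})) u ≡ true → ⊥
      none u e = ℤP.<-irrefl (lookup-𝟘 u) (negSupp-elim 𝟘 u e)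

    G-face : ∀ {F a} → G F a ≡ true → Δ F ≡ true
    G-face e = proj₁ (proj₂ (nonpos-elim (proj₁ (∧-true e))))

    pt-neg : ∀ (v : Fin n) t u → lookup (negSupp (pt v t)) u ≡ true → u ≡ v
    pt-neg v t u e = case u Fin.≟ v of λ where
      (yes p) → p
      (no p) → ⊥-elim (ℤP.<-irrefl (lookup-pt-≢ t p) (negSupp-elim (pt v t) u e))

    neg-pt : ∀ (v : Fin n) t → lookup (negSupp (pt v t)) v ≡ true
    neg-pt v t = negSupp-intro (pt v t) v (≡.subst (ℤ._< + 0) (≡.sym (lookup-pt v t)) ℤ.-<+)

    G-ray : ∀ {F v} t → Δ F ≡ true → lookup F v ≡ true → G F (pt v t) ≡ true
    G-ray {F} {v} t f fv = ∧-intro (nonpos-intro (λ u → case u Fin.≟ v of λ where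
          (yes ≡.refl) → ≡.subst (ℤ._≤ + 0) (≡.sym (lookup-pt v t)) ℤ.-≤+
          (no p) → ℤP.≤-reflexive (lookup-pt-≢ t p)) f (λ u e → ≡.subst (λ z → lookup F z ≡ true) (≡.sym (pt-neg v t u e)) fv))
      (small-intro {1} {F} {pt v t} (ℕP.≮⇒≥ (λ l → let (w , a , b) = extra-vertex (∅ [ v ]≔ true) (negSupp (pt v t)) (≡.subst (_< ∣ negSupp (pt v t) ∣) one l) in
        true≢false (≡.trans (≡.cong (lookup (∅ [ v ]≔ true)) (pt-neg v t w a)) (lookup-[]≔ ∅ v)) b)))
      where
      one : 1 ≡ ∣ ∅ [ v ]≔ true ∣
      one = ≡.sym (≡.trans (size-add v ∅ (lookup-⊥ v)) (≡.cong suc (∣∅∣≡0 n)))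

    G-ray⁻ : ∀ {F v t} → G F (pt v t) ≡ true → Δ F ≡ true × lookup F v ≡ true
    G-ray⁻ {F} {v} {t} e = let (_ , f , s) = nonpos-elim (proj₁ (∧-true e)) in f , s v (neg-pt v t)

    G-cases : ∀ {F a} → G F a ≡ true → a ≡ 𝟘 ⊎ Σ (Fin n) λ v → Σ ℕ λ t → a ≡ pt v t
    G-cases {F} {a} e = case FinP.any? (λ u → lookup (negSupp a) u Bool.≟ true) of λ where
        (no q) → inj₁ (vext (λ u → ≡.trans (zero-at u (λ p → q (u , p))) (≡.sym (lookup-𝟘 u))))
        (yes (v , p)) → inj₂ (v , go v p (lookup a v) ≡.refl)
      where
      np = proj₁ (nonpos-elim {F} {a} (proj₁ (∧-true e)))
      sm = small-elim {1} {F} {a} (proj₂ (∧-true {nonpos F a} e))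
      zero-at : ∀ u → ¬ (lookup (negSupp a) u ≡ true) → lookup a u ≡ + 0
      zero-at u q = ℤP.≤-antisym (np u) (ℤP.≮⇒≥ (λ l → q (negSupp-intro a u l)))
      go : ∀ v → lookup (negSupp a) v ≡ true → ∀ x → lookup a v ≡ x → Σ ℕ λ t → a ≡ pt v t
      go v p (+ k) q = case ≡.subst (ℤ._< + 0) q (negSupp-elim a v p) of λ { (ℤ.+<+ ()) }
      go v p (-[1+ t ]) q = t , vext (λ u → case u Fin.≟ v of λ where
        (yes ≡.refl) → ≡.trans q (≡.sym (lookup-pt v t))
        (no ne) → ≡.trans (zero-at u (λ r → ℕP.1+n≰n (ℕP.≤-trans (two-in (negSupp a) ne r p) sm))) (≡.sym (lookup-pt-≢ t ne)))

    -- Lowering a second coordinate creates two negative entries, so on the ray of `v` the Koszul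
    -- part sees only x_v.
    G-bad : ∀ {F u v t} → u ≢ v → G F (dec u (pt v t)) ≡ true → ⊥
    G-bad {F} {u} {v} {t} ne e = ℕP.1+n≰n (ℕP.≤-trans (two-in (negSupp b) ne (negSupp-intro b u lu) (negSupp-intro b v lv)) (small-elim {1} {F} {b} (proj₂ (∧-true {nonpos F b} e))))
      where
      b = dec u (pt v t)
      lu : lookup b u ℤ.< + 0
      lu = ≡.subst (ℤ._< + 0) (≡.sym (≡.trans (lookup-- (pt v t) (unit u) u) (≡.cong₂ ℤ._-_ (lookup-pt-≢ t ne) (unit-refl u)))) ℤ.-<+
      lv : lookup b v ℤ.< + 0
      lv = ≡.subst (ℤ._< + 0) (≡.sym (≡.trans (lookup-- (pt v t) (unit u) v) (≡.trans (≡.cong₂ ℤ._-_ (lookup-pt v t) (unit-≢ (λ e → ne (≡.sym e)))) (ℤP.+-identityʳ _)))) ℤ.-<+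

    κ-origin : ∀ (X : V Ix) F S → κ (λ p → X (F , p)) (S , 𝟘) ≈ ∑ (λ v → ant (θ v) (λ S' → X (F , S' , pt v 0)) S)
    κ-origin X F S = trans (κ≈ (λ p → X (F , p)) S 𝟘) (sum-cong (λ v → ≡⇒≈ (≡.cong (λ b → ant (θ v) (λ S' → X (F , S' , b)) S) (dec-𝟘 v))))

    κ-ray : ∀ {m X} → Cx G m X → ∀ F S v t → κ (λ p → X (F , p)) (S , pt v t) ≈ ant (θ v) (λ S' → X (F , S' , pt v (suc t))) S
    κ-ray {m} {X} (lift x) F S v t = trans (κ≈ (λ p → X (F , p)) S (pt v t)) (trans (sum-single _ v (λ u ne → fin-0 (ant-fin (θ u) S) (λ S' → x _ (λ (e , _) → G-bad ne e))))
      (≡⇒≈ (≡.cong (λ b → ant (θ v) (λ S' → X (F , S' , b)) S) (dec-pt v t))))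

    sum-pt : ∀ (v : Fin n) t k → sumᵥ (pt v t) ℤ.+ + k ≡ + i → k ≡ suc t ℕ.+ i
    sum-pt v t k e = ℤP.+-injective (≡.trans (≡.sym (arith (+ suc t) (+ k))) (≡.cong (ℤ._+_ (+ suc t)) (≡.trans (≡.cong (ℤ._+ + k) (≡.sym (sum-[]≔ v -[1+ t ]))) e)))
      where
      arith : ∀ x y → x ℤ.+ (ℤ.- x ℤ.+ y) ≡ y
      arith = solve-∀

    pt-sum : ∀ (v : Fin n) t k → k ≡ suc t ℕ.+ i → sumᵥ (pt v t) ℤ.+ + k ≡ + i
    pt-sum v t k ≡.refl = ≡.trans (≡.cong (ℤ._+ + k) (sum-[]≔ v -[1+ t ])) (≡.trans (≡.cong (ℤ._+_ -[1+ t ]) (ℤP.pos-+ (suc t) i)) (arith (+ suc t) (+ i)))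
      where
      arith : ∀ x y → ℤ.- x ℤ.+ (x ℤ.+ y) ≡ y
      arith = solve-∀

    sum-orig : ∀ k → sumᵥ (𝟘 {n}) ℤ.+ + k ≡ + i → k ≡ i
    sum-orig k e = ℤP.+-injective (≡.trans (≡.sym (≡.trans (≡.cong (ℤ._+ + k) (sum-𝟘 {n})) (ℤP.+-identityˡ _))) e)

    orig-sum : ∀ k → k ≡ i → sumᵥ (𝟘 {n}) ℤ.+ + k ≡ + i
    orig-sum k ≡.refl = ≡.trans (≡.cong (ℤ._+ + k) (sum-𝟘 {n})) (ℤP.+-identityˡ _)

    RelFace : Fin n → ℕ → Subset n → Set
    RelFace v s F = Δ F ≡ true × ∣ F ∣ ≡ s × lookup F v ≡ true

    RelPre : Fin n → ℕ → Subset n → Set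
    RelPre v s F = Δ F ≡ true × suc ∣ F ∣ ≡ s × lookup F v ≡ true

    -- Cohomology of the pair of Δ and the costar of `v`, indexed by face size to keep the bottom
    -- degree uniform.
    RelZ RelB : ℕ → Fin n → Pr (Subset n)
    RelZ s v x = Supp (RelFace v s) x × (∀ F → Δ F ≡ true → crt 𝟙 x F ≈ 0#)
    RelB s v x = Supp (RelFace v s) x × Σ (V (Subset n)) λ y → Supp (RelPre v s) y × (∀ F → Δ F ≡ true → x F ≈ crt 𝟙 y F)

    RelZ-sub : ∀ s v → IsSub (RelZ s v)
    RelZ-sub s v = record
      { 0∈ = 0∈ Supp-sub , λ F _ → fin-0 (crt-fin 𝟙 F) (λ _ → refl)
      ; +∈ = λ (a , p) (b , q) → +∈ Supp-sub a b , λ F e → trans (fin-+ (crt-fin 𝟙 F) _ _) (trans (+-cong (p F e) (q F e)) (+-identityˡ _))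
      ; *∈ = λ k (a , p) → *∈ Supp-sub k a , λ F e → trans (fin-* (crt-fin 𝟙 F) k _) (trans (*-congˡ (p F e)) (zeroʳ k))
      ; ≈∈ = λ h (a , p) → ≈∈ Supp-sub h a , λ F e → trans (fin-cong (crt-fin 𝟙 F) (λ G → sym (h G))) (p F e) }

    RelB-sub : ∀ s v → IsSub (RelB s v)
    RelB-sub s v = record
      { 0∈ = 0∈ Supp-sub , _ , 0∈ Supp-sub , λ F _ → sym (fin-0 (crt-fin 𝟙 F) (λ _ → refl))
      ; +∈ = λ (a , y , b , e) (a' , y' , b' , e') → +∈ Supp-sub a a' , _ , +∈ Supp-sub b b' ,
          λ F q → trans (+-cong (e F q) (e' F q)) (sym (fin-+ (crt-fin 𝟙 F) y y'))
      ; *∈ = λ k (a , y , b , e) → *∈ Supp-sub k a , _ , *∈ Supp-sub k b , λ F q → trans (*-congˡ (e F q)) (sym (fin-* (crt-fin 𝟙 F) k y))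
      ; ≈∈ = λ h (a , y , b , e) → ≈∈ Supp-sub h a , y , b , λ F q → trans (sym (h F)) (e F q) }

    -- Λ^i ⊗ Q, and ⨁_v W_v ⊗ U_v where W_v ⊆ Λ^i is the kernel of contraction with θ(v).
    VT : Pr (Subset n) → Pr (Subset d × Subset n)
    VT Q x = (∀ S F → ¬ ∣ S ∣ ≡ i → x (S , F) ≈ 0#) × (∀ S → Q (λ F → x (S , F)))

    Tens : (Fin n → Pr (Subset n)) → Pr (Fin n × Subset d × Subset n)
    Tens U y = ∀ v → (∀ S F → ¬ ∣ S ∣ ≡ i → y (v , S , F) ≈ 0#) × (∀ S F → ant (θ v) (λ S' → y (v , S' , F)) S ≈ 0#) ×
                     (∀ S → U v (λ F → y (v , S , F)))

    VT-sub : ∀ {Q} → IsSub Q → IsSub (VT Q)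
    VT-sub s = record
      { 0∈ = (λ _ _ _ → refl) , λ S → 0∈ s
      ; +∈ = λ (a , p) (b , q) → (λ S F e → trans (+-cong (a S F e) (b S F e)) (+-identityˡ _)) , λ S → +∈ s (p S) (q S)
      ; *∈ = λ k (a , p) → (λ S F e → trans (*-congˡ (a S F e)) (zeroʳ k)) , λ S → *∈ s k (p S)
      ; ≈∈ = λ h (a , p) → (λ S F e → trans (sym (h _)) (a S F e)) , λ S → ≈∈ s (λ F → h _) (p S) }

    Tens-sub : ∀ {U} → (∀ v → IsSub (U v)) → IsSub (Tens U)
    Tens-sub s = record
      { 0∈ = λ v → (λ _ _ _ → refl) , (λ S F → fin-0 (ant-fin (θ v) S) (λ _ → refl)) , λ S → 0∈ (s v)
      ; +∈ = λ x y v → let (a , b , p) = x v ; (a' , b' , q) = y v in (λ S F e → trans (+-cong (a S F e) (a' S F e)) (+-identityˡ _)) ,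
          (λ S F → trans (fin-+ (ant-fin (θ v) S) _ _) (trans (+-cong (b S F) (b' S F)) (+-identityˡ _))) , λ S → +∈ (s v) (p S) (q S)
      ; *∈ = λ k x v → let (a , b , p) = x v in (λ S F e → trans (*-congˡ (a S F e)) (zeroʳ k)) ,
          (λ S F → trans (fin-* (ant-fin (θ v) S) k _) (trans (*-congˡ (b S F)) (zeroʳ k))) , λ S → *∈ (s v) k (p S)
      ; ≈∈ = λ h x v → let (a , b , p) = x v in (λ S F e → trans (sym (h _)) (a S F e)) ,
          (λ S F → trans (fin-cong (ant-fin (θ v) S) (λ S' → sym (h _))) (b S F)) , λ S → ≈∈ (s v) (λ F → h _) (p S) }

    Φ : V (Fin n × Subset d × Subset n) → V (Subset d × Subset n)
    Φ y (S , F) = ∑ (λ v → y (v , S , F))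

    Φ-lin : Lin Φ
    Φ-lin = fin-lin (λ (S , F) → ∑-fin (λ v → pt-fin (v , S , F)))

    RelFace⇒Face : ∀ s v {x} → Supp (RelFace v s) x → Chain Δ s x
    RelFace⇒Face s v (lift a) = Supp⇒Chain Δ (lift (λ F q → a F (λ (f , e , _) → q (f , e))))

    RelZ⇒Zc : ∀ s v {x} → RelZ s v x → Zc Δ s x
    RelZ⇒Zc s v (a , z) = RelFace⇒Face s v a , z

    RelB⇒Bc : ∀ s v {x} → RelB s v x → Bc Δ s x
    RelB⇒Bc s v (a , y , b , z) = RelFace⇒Face s v a , y , lift (λ F q → lower b F (λ (f , e , _) → q (f , e))) , z

    crt-rel : ∀ {v : Fin n} {x : V (Subset n)} → (∀ F → lookup F v ≡ false → x F ≈ 0#) → ∀ F → lookup F v ≡ false → crt 𝟙 x F ≈ 0#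
    crt-rel {v} {x} z F e = sum-0 (λ w → trans (*-congˡ (cr-loc w x F (λ _ → z _ (¬true (λ q → true≢false (remove-⊆ w F v q) e))))) (zeroʳ _))

    RelB⇒RelZ : ∀ s v {x} → RelB s v x → RelZ s v x
    RelB⇒RelZ s v (a , _ , _ , z) = a , coboundary-closed Δ cx z

    -- On the ray of `v` the Koszul part is contraction with θ(v), which is exact. What survives of
    -- a cochain is its value at -e_v contracted once more, an element of W_v; this is also what the
    -- origin receives.
    res : V Ix → V (Fin n × Subset d × Subset n)
    res X (v , S , F) = ant (θ v) (λ S' → X (F , S' , pt v 0)) S

    res-fin : ∀ p → IsFin (λ X → res X p)
    res-fin (v , S , F) = ∘-fin (ant-fin (θ v) S) (λ S' → pt-fin (F , S' , pt v 0))

    -- Each step down the ray costs one internal degree, which the exterior part has to make up; the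
    -- face size then follows from the homological degree.
    size-at : ∀ {s m F S} v → s ℕ.+ m ≡ suc (suc i) → ∀ {t} → Gr m F S (pt v t) → ∣ F ∣ ≡ t ℕ.+ s × ∣ S ∣ ≡ suc t ℕ.+ i
    size-at {s} {m} {F} {S} v e {t} (gF , gS) = ℕP.+-cancelʳ-≡ m _ _ (≡.trans gF (≡.trans (≡.cong suc S≡) (≡.sym (≡.trans (ℕP.+-assoc t s m) (≡.trans (≡.cong (t ℕ.+_) e) (≡.trans (ℕP.+-suc t (suc i)) (≡.cong suc (ℕP.+-suc t i)))))))) , S≡
      where
      S≡ : ∣ S ∣ ≡ suc t ℕ.+ i
      S≡ = sum-pt v t ∣ S ∣ gS

    at-size : ∀ {s m} {F : Subset n} {S : Subset d} v → s ℕ.+ m ≡ suc (suc i) → ∀ {t} → ∣ F ∣ ≡ t ℕ.+ s → ∣ S ∣ ≡ suc t ℕ.+ i → Gr m F S (pt v t)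
    at-size {s} {m} {F} {S} v e {t} p q = ≡.trans (≡.cong (ℕ._+ m) p) (≡.trans (ℕP.+-assoc t s m) (≡.trans (≡.cong (t ℕ.+_) e) (≡.trans (ℕP.+-suc t (suc i)) (≡.cong suc (≡.trans (ℕP.+-suc t i) (≡.sym q)))))) , pt-sum v t ∣ S ∣ q

    -- Closedness at -e_v expresses the coboundary there by a contraction of the value at -2e_v, and
    -- contracting once more with θ(v) kills it.
    res-Tens : ∀ {s m X} → s ℕ.+ m ≡ suc (suc i) → Cx G m X → (∀ F S v → Δ F ≡ true → lookup F v ≡ true → D X (F , S , pt v 0) ≈ 0#) → Tens (RelZ s) (res X)
    res-Tens {s} {m} {X} sm x z v = vanish , (λ S F → ant² (θ v) _ S) , λ S → lift (λ F q → fin-0 (ant-fin (θ v) S) (λ S' → X-off F S' q)) , closed S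
      where
      X-off : ∀ F S' → ¬ RelFace v s F → X (F , S' , pt v 0) ≈ 0#
      X-off F S' q = lower x _ (λ (e , gr) → let (f , fv) = G-ray⁻ {F} {v} {0} e in q (f , proj₁ (size-at {s} {m} {F} {S'} v sm gr) , fv))
      vanish : ∀ S F → ¬ ∣ S ∣ ≡ i → res X (v , S , F) ≈ 0#
      vanish S F q = sum-0 (λ j → trans (*-congˡ (an-loc j _ S (λ e → lower x _ (λ (_ , gr) → q (ℕP.suc-injective (≡.trans (≡.sym (size-add j S e)) (proj₂ (size-at {s} {m} {F} {S [ j ]≔ true} v sm gr)))))))) (zeroʳ _))
      closed : ∀ S F → Δ F ≡ true → crt 𝟙 (λ F' → res X (v , S , F')) F ≈ 0#
      closed S F f = trans (fubini (crt-fin 𝟙 F) (ant-fin (θ v) S) (λ F' S' → X (F' , S' , pt v 0))) (go (lookup F v Bool.≟ true))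
        where
        W : Subset d → Carrier
        W S' = ant (θ v) (λ S'' → X (F , S'' , pt v 1)) S'
        rewrite-crt : ∀ S' → lookup F v ≡ true → crt 𝟙 (λ F' → X (F' , S' , pt v 0)) F ≈ sg S' * (- 1# * W S')
        rewrite-crt S' e = begin
          C′                              ≈⟨ sym (trans (sym (*-assoc _ _ _)) (trans (*-congʳ (sg² S')) (*-identityˡ _))) ⟩
          sg S' * (sg S' * C′)            ≈⟨ *-congˡ (solve 2 (λ a w → a := (a :+ w) :- w) refl (sg S' * C′) (W S')) ⟩
          sg S' * ((sg S' * C′ + W S') - W S')  ≈⟨ *-congˡ (+-congʳ (trans (+-congˡ (sym (κ-ray x F S' v 0))) (trans (sym (D≈ X F S' (pt v 0))) (z F S' v f e)))) ⟩
          sg S' * (0# - W S')            ≈⟨ *-congˡ (trans (+-identityˡ _) (sym (-1*x≈-x _))) ⟩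
          sg S' * (- 1# * W S') ∎
          where C′ = crt 𝟙 (λ F' → X (F' , S' , pt v 0)) F

        go : Dec (lookup F v ≡ true) → ant (θ v) (λ S' → crt 𝟙 (λ F' → X (F' , S' , pt v 0)) F) S ≈ 0#
        go (no e) = fin-0 (ant-fin (θ v) S) (λ S' → crt-rel {v} {λ F' → X (F' , S' , pt v 0)} (λ F' e' → X-off F' S' (λ (_ , _ , fv) → true≢false fv e')) F (¬true e))
        go (yes e) = begin
          ant (θ v) (λ S' → crt 𝟙 (λ F' → X (F' , S' , pt v 0)) F) S   ≈⟨ fin-cong (ant-fin (θ v) S) (λ S' → rewrite-crt S' e) ⟩
          ant (θ v) (λ S' → sg S' * (- 1# * W S')) S                   ≈⟨ ant-sg (θ v) (λ S' → - 1# * W S') S ⟩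
          - (sg S * ant (θ v) (λ S' → - 1# * W S') S)                  ≈⟨ -‿cong (*-congˡ (trans (fin-* (ant-fin (θ v) S) (- 1#) W) (*-congˡ (ant² (θ v) _ S)))) ⟩
          - (sg S * (- 1# * 0#))                                       ≈⟨ solve 2 (λ s o → :- (s :* (o :* con (+ 0))) := con (+ 0)) refl (sg S) (- 1#) ⟩
          0# ∎

    value : V (Subset d × Subset n) → (Fin n → ℕ → V (Subset d × Subset n)) → Subset n → Subset d → Pos n → Carrier
    value x₀ x₁ F S origin    = x₀ (S , F)
    value x₀ x₁ F S (ray v t) = x₁ v t (S , F)
    value x₀ x₁ F S other     = 0#

    build : V (Subset d × Subset n) → (Fin n → ℕ → V (Subset d × Subset n)) → V Ix
    build x₀ x₁ (F , S , a) = value x₀ x₁ F S (cls a)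

    build-0 : ∀ x₀ x₁ F S → build x₀ x₁ (F , S , 𝟘) ≡ x₀ (S , F)
    build-0 x₀ x₁ F S rewrite cls-𝟘 {n} = ≡.refl

    build-1 : ∀ x₀ x₁ F S v t → build x₀ x₁ (F , S , pt v t) ≡ x₁ v t (S , F)
    build-1 x₀ x₁ F S v t rewrite cls-pt v t = ≡.refl

    cls-origin⁻ : ∀ {n} (a : Vec ℤ n) → cls a ≡ origin → a ≡ 𝟘
    cls-origin⁻ []      e = ≡.refl
    cls-origin⁻ (x ∷ a) e with x | cls a | cls-origin⁻ a | e
    ... | + zero    | origin  | f | _ = ≡.cong (+ 0 ∷_) (f ≡.refl)
    ... | + zero    | ray _ _ | f | ()
    ... | + zero    | other   | f | ()
    ... | + suc _   | origin  | f | ()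
    ... | + suc _   | ray _ _ | f | ()
    ... | + suc _   | other   | f | ()
    ... | -[1+ _ ]  | origin  | f | ()
    ... | -[1+ _ ]  | ray _ _ | f | ()
    ... | -[1+ _ ]  | other   | f | ()

    cls-ray⁻ : ∀ {n} (a : Vec ℤ n) v t → cls a ≡ ray v t → a ≡ pt v t
    cls-ray⁻ (x ∷ a) v t e with x | cls a | cls-ray⁻ a | cls-origin⁻ a | e
    ... | + zero    | ray w s | f | o | ≡.refl = ≡.cong (+ 0 ∷_) (f w s ≡.refl)
    ... | -[1+ s ]  | origin  | f | o | ≡.refl = ≡.cong (-[1+ s ] ∷_) (o ≡.refl)
    ... | + zero    | origin  | f | o | ()
    ... | + zero    | other   | f | o | ()
    ... | + suc _   | origin  | f | o | ()
    ... | + suc _   | ray _ _ | f | o | ()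
    ... | + suc _   | other   | f | o | ()
    ... | -[1+ _ ]  | ray _ _ | f | o | ()
    ... | -[1+ _ ]  | other   | f | o | ()

    build-Cx : ∀ {s m} x₀ x₁ → s ℕ.+ m ≡ suc (suc i) → (∀ S F → ¬ (Δ F ≡ true × suc ∣ F ∣ ≡ s × ∣ S ∣ ≡ i) → x₀ (S , F) ≈ 0#) →
      (∀ v t S F → ¬ (RelFace v (t ℕ.+ s) F × ∣ S ∣ ≡ suc t ℕ.+ i) → x₁ v t (S , F) ≈ 0#) → Cx G m (build x₀ x₁)
    build-Cx {s} {m} x₀ x₁ sm z₀ z₁ = lift (λ (F , S , a) q → go F S a q (cls a) ≡.refl)
      where
      go : ∀ F S a → ¬ In G m (F , S , a) → ∀ k → cls a ≡ k → build x₀ x₁ (F , S , a) ≈ 0#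
      go F S a q origin e = case cls-origin⁻ a e of λ { ≡.refl → trans (≡⇒≈ (build-0 x₀ x₁ F S)) (z₀ S F (λ (f , h , r) →
        q (G-origin f , ℕP.suc-injective (≡.trans (≡.cong (ℕ._+ m) h) (≡.trans sm (≡.cong (λ z → suc (suc z)) (≡.sym r)))) , orig-sum ∣ S ∣ r))) }
      go F S a q (ray v t) e = case cls-ray⁻ a v t e of λ { ≡.refl → trans (≡⇒≈ (build-1 x₀ x₁ F S v t)) (z₁ v t S F (λ ((f , h , fv) , r) →
        q (G-ray t f fv , at-size {s} {m} {F} {S} v sm h r))) }
      go F S a q other e rewrite e = refl

    D-build-0 : ∀ (x₀ : V (Subset d × Subset n)) (x₁ : Fin n → ℕ → V (Subset d × Subset n)) F S → D (build x₀ x₁) (F , S , 𝟘) ≈ sg S * crt 𝟙 (λ F' → x₀ (S , F')) F + ∑ (λ v → ant (θ v) (λ S' → x₁ v 0 (S' , F)) S)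
    D-build-0 x₀ x₁ F S = trans (D≈ (build x₀ x₁) F S 𝟘) (+-cong (*-congˡ (fin-cong (crt-fin 𝟙 F) (λ F' → ≡⇒≈ (build-0 x₀ x₁ F' S))))
      (trans (κ-origin (build x₀ x₁) F S) (sum-cong (λ v → fin-cong (ant-fin (θ v) S) (λ S' → ≡⇒≈ (build-1 x₀ x₁ F S' v 0))))))

    D-build-1 : ∀ {m} (x₀ : V (Subset d × Subset n)) (x₁ : Fin n → ℕ → V (Subset d × Subset n)) → Cx G m (build x₀ x₁) → ∀ F S v t →
      D (build x₀ x₁) (F , S , pt v t) ≈ sg S * crt 𝟙 (λ F' → x₁ v t (S , F')) F + ant (θ v) (λ S' → x₁ v (suc t) (S' , F)) S
    D-build-1 x₀ x₁ b F S v t = trans (D≈ (build x₀ x₁) F S (pt v t)) (+-cong (*-congˡ (fin-cong (crt-fin 𝟙 F) (λ F' → ≡⇒≈ (build-1 x₀ x₁ F' S v t))))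
      (trans (κ-ray b F S v t) (fin-cong (ant-fin (θ v) S) (λ S' → ≡⇒≈ (build-1 x₀ x₁ F S' v (suc t))))))

    on-G : ∀ {p : Subset n → Subset d → Vec ℤ n → Set ℓ} → (∀ F S → Δ F ≡ true → p F S 𝟘) → (∀ F S v t → Δ F ≡ true → lookup F v ≡ true → p F S (pt v t)) →
           ∀ F S a → G F a ≡ true → p F S a
    on-G {p} f₀ f₁ F S a e = case G-cases {F} {a} e of λ where
      (inj₁ ≡.refl) → f₀ F S (G-face {F} {𝟘} e)
      (inj₂ (v , t , ≡.refl)) → let (f , fv) = G-ray⁻ {F} {v} {t} e in f₁ F S v t f fv

    module _ (g1 : ∀ v → ∑ (λ j → θ v j * g v j) ≈ 1#) where
      -- Multiplication by g(v) is a contracting homotopy for contraction with θ(v), which makes the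
      -- rays exact beyond their first point.
      ant-crt-id : ∀ v Y S → ant (θ v) (crt (g v) Y) S + crt (g v) (ant (θ v) Y) S ≈ Y S
      ant-crt-id v Y S = trans (ant-crt (θ v) (g v) Y S) (trans (*-congʳ (g1 v)) (*-identityˡ _))

      ant-crt-0 : ∀ v Y S → (∀ S' → ant (θ v) Y S' ≈ 0#) → ant (θ v) (crt (g v) Y) S ≈ Y S
      ant-crt-0 v Y S z = trans (sym (trans (+-congˡ (fin-0 (crt-fin (g v) S) z)) (+-identityʳ _))) (ant-crt-id v Y S)

      Ker : ℕ → Pr (Fin n × Subset d × Subset n)
      Ker s = Kernel Φ (Tens (RelZ s)) (VT (Bc Δ s))

      Coim : ℕ → Pr (Subset d × Subset n)
      Coim s = Image Φ (Tens (RelZ s)) (VT (Zc Δ s)) (VT (Bc Δ s))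

      -- The middle step of a filtration of the cycles, by those with trivial trace on the rays:
      -- above it lies the kernel of `Φ`, below it the cokernel of `Φ` one size lower.
      Mid : ℕ → ℕ → Pr Ix
      Mid s m X = Z G m X × Tens (RelB s) (res X)

      crt₁-supp : ∀ v {k : ℕ} {y : V (Fin n × Subset d × Subset n)} S F → (∀ S F → ¬ ∣ S ∣ ≡ k → y (v , S , F) ≈ 0#) → ¬ ∣ S ∣ ≡ suc k → crt (g v) (λ S' → y (v , S' , F)) S ≈ 0#
      crt₁-supp v S F z q = sum-0 (λ j → trans (*-congˡ (cr-loc j _ S (λ e → z _ F (λ r → q (≡.trans (≡.sym (size-remove j S e)) (≡.cong suc r)))))) (zeroʳ _))

      -- The cochain with value x₀ at multidegree 0 and ε_{g(v)} y_v at multidegree -e_v.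
      ray₁ : V (Fin n × Subset d × Subset n) → Fin n → ℕ → V (Subset d × Subset n)
      ray₁ y v zero    (S , F) = crt (g v) (λ S' → y (v , S' , F)) S
      ray₁ y v (suc t) (S , F) = 0#

      module _ {s m : ℕ} (sm : s ℕ.+ m ≡ suc (suc i)) {x₀ : V (Subset d × Subset n)} {y : V (Fin n × Subset d × Subset n)}
               (x₀-supp : ∀ S F → ¬ (Δ F ≡ true × suc ∣ F ∣ ≡ s × ∣ S ∣ ≡ i) → x₀ (S , F) ≈ 0#) (ty : Tens (RelZ s) y) where
        lift-Cx : Cx G m (build x₀ (ray₁ y))
        lift-Cx = build-Cx x₀ (ray₁ y) sm x₀-supp (λ where
          v (suc t) S F q → refl
          v zero S F q → case ∣ S ∣ ℕ.≟ suc i of λ where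
            (no r) → crt₁-supp v {i} {y} S F (proj₁ (ty v)) r
            (yes r) → fin-0 (crt-fin (g v) S) (λ S' → lower (proj₁ (proj₂ (proj₂ (ty v)) S')) F (λ f → q (f , r))))

        lift-D₀ : ∀ F S → D (build x₀ (ray₁ y)) (F , S , 𝟘) ≈ sg S * crt 𝟙 (λ F' → x₀ (S , F')) F + Φ y (S , F)
        lift-D₀ F S = trans (D-build-0 x₀ (ray₁ y) F S) (+-congˡ (sum-cong (λ v → ant-crt-0 v (λ S' → y (v , S' , F)) S (λ S' → proj₁ (proj₂ (ty v)) S' F))))

        lift-D₁ : ∀ F S v t → Δ F ≡ true → D (build x₀ (ray₁ y)) (F , S , pt v t) ≈ 0#
        lift-D₁ F S v zero f = trans (D-build-1 x₀ (ray₁ y) lift-Cx F S v 0) (trans (+-cong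
          (trans (*-congˡ (trans (fubini (crt-fin 𝟙 F) (crt-fin (g v) S) (λ F' S' → y (v , S' , F'))) (fin-0 (crt-fin (g v) S) (λ S' → proj₂ (proj₂ (proj₂ (ty v)) S') F f)))) (zeroʳ _))
          (fin-0 (ant-fin (θ v) S) (λ _ → refl))) (+-identityˡ _))
        lift-D₁ F S v (suc t) f = trans (D-build-1 x₀ (ray₁ y) lift-Cx F S v (suc t)) (trans (+-cong
          (trans (*-congˡ (fin-0 (crt-fin 𝟙 F) (λ _ → refl))) (zeroʳ _)) (fin-0 (ant-fin (θ v) S) (λ _ → refl))) (+-identityˡ _))

        res-lift : res (build x₀ (ray₁ y)) ≋ y
        res-lift (v , S , F) = trans (fin-cong (ant-fin (θ v) S) (λ S' → ≡⇒≈ (build-1 x₀ (ray₁ y) F S' v 0)))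
          (ant-crt-0 v (λ S' → y (v , S' , F)) S (λ S' → proj₁ (proj₂ (ty v)) S' F))

      -- Primitives are given separately for each `S`; for `S` of the wrong size they are replaced
      -- by zero to obtain a family with the right support.
      potential : ∀ {s x} → VT (Bc Δ s) x → Σ (V (Subset d × Subset n)) λ b →
        (∀ S F → ¬ (Δ F ≡ true × suc ∣ F ∣ ≡ s × ∣ S ∣ ≡ i) → b (S , F) ≈ 0#) × (∀ S F → Δ F ≡ true → x (S , F) ≈ crt 𝟙 (λ F' → b (S , F')) F)
      potential {s} {x} (z , bc) = (λ (S , F) → pick S (∣ S ∣ ℕ.≟ i) F) , (λ S F q → off S (∣ S ∣ ℕ.≟ i) F q) , λ S F f → eq S (∣ S ∣ ℕ.≟ i) F f
        where
        pick : ∀ S → Dec (∣ S ∣ ≡ i) → V (Subset n)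
        pick S (yes _) = proj₁ (proj₂ (bc S))
        pick S (no _)  = λ _ → 0#
        off : ∀ S r F → ¬ (Δ F ≡ true × suc ∣ F ∣ ≡ s × ∣ S ∣ ≡ i) → pick S r F ≈ 0#
        off S (yes r) F q = lower (proj₁ (proj₂ (proj₂ (bc S)))) F (λ (a , b) → q (a , b , r))
        off S (no _)  F q = refl
        eq : ∀ S r F → Δ F ≡ true → x (S , F) ≈ crt 𝟙 (pick S r) F
        eq S (yes r) F f = proj₂ (proj₂ (proj₂ (bc S))) F f
        eq S (no r)  F f = trans (z S F r) (sym (fin-0 (crt-fin 𝟙 F) (λ _ → refl)))

      module _ {p m : ℕ} (pm : p ℕ.+ m ≡ suc i) where
        private
          sm : suc p ℕ.+ m ≡ suc (suc i)
          sm = ≡.cong suc pm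
          sm⁺ : p ℕ.+ suc m ≡ suc (suc i)
          sm⁺ = ≡.trans (ℕP.+-suc p m) (≡.cong suc pm)

          at-origin : ∀ {X} → Cx G m X → ∀ S F → ¬ (Δ F ≡ true × ∣ F ∣ ≡ p × ∣ S ∣ ≡ i) → X (F , S , 𝟘) ≈ 0#
          at-origin x S F q = lower x _ (λ (e , gF , gS) → let r = sum-orig ∣ S ∣ gS in
            q (G-face {F} {𝟘} e , ℕP.+-cancelʳ-≡ m _ _ (≡.trans gF (≡.trans (≡.cong suc r) (≡.sym pm))) , r))

          at-origin⁺ : ∀ {X} → Cx G (suc m) X → ∀ S F → ¬ (Δ F ≡ true × suc ∣ F ∣ ≡ p × ∣ S ∣ ≡ i) → X (F , S , 𝟘) ≈ 0#
          at-origin⁺ x S F q = lower x _ (λ (e , gF , gS) → let r = sum-orig ∣ S ∣ gS in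
            q (G-face {F} {𝟘} e , ℕP.+-cancelʳ-≡ m _ _ (≡.trans (≡.sym (ℕP.+-suc ∣ F ∣ m)) (≡.trans gF (≡.trans (≡.cong suc r) (≡.sym pm)))) , r))

          sg-sg : ∀ (S : Subset d) z → sg S * (sg S * z) ≈ z
          sg-sg S z = trans (sym (*-assoc _ _ _)) (trans (*-congʳ (sg² S)) (*-identityˡ _))

        -- Closedness at the origin says that the traces on the rays add up to a coboundary, with
        -- the value at the origin as primitive up to sign. Conversely, a primitive of the sum of
        -- given traces supplies the missing value at the origin.
        Z/Mid-iso : QIso (Z G m) (Mid (suc p) m) (Ker (suc p)) (Tens (RelB (suc p)))
        Z/Mid-iso = record
          { φ = res ; lin = fin-lin res-fin ; subU = Z-sub G m ; subW' = Tens-sub (RelB-sub (suc p))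
          ; toU = λ {X} (x , z) → to X x z ; toW = λ _ w → proj₂ w ; refW = λ u w → u , w ; surj = λ y k → from y k }
          where
          to : ∀ X → Cx G m X → (∀ F S a → G F a ≡ true → D X (F , S , a) ≈ 0#) → Ker (suc p) (res X)
          to X x z = t , (λ S F q → sum-0 (λ v → proj₁ (t v) S F q)) , λ S → ch S , b S , pre S , eq S
            where
            t : Tens (RelZ (suc p)) (res X)
            t = res-Tens sm x (λ F S v f fv → z F S (pt v 0) (G-ray 0 f fv))
            ch : ∀ S → Chain Δ (suc p) (λ F → Φ (res X) (S , F))
            ch S = Σ∈ (Chain-sub Δ (suc p)) (λ v → RelFace⇒Face (suc p) v (proj₁ (proj₂ (proj₂ (t v)) S)))
            b : Subset d → V (Subset n)
            b S F = - sg S * X (F , S , 𝟘)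
            pre : ∀ S → PreChain Δ (suc p) (b S)
            pre S = lift (λ F q → trans (*-congˡ (at-origin x S F (λ (f , e , _) → q (f , ≡.cong suc e)))) (zeroʳ _))
            eq : ∀ S F → Δ F ≡ true → Φ (res X) (S , F) ≈ crt 𝟙 (b S) F
            eq S F f = begin
              Φ (res X) (S , F)                        ≈⟨ solve 2 (λ a w → w := :- a :+ (a :+ w)) refl (sg S * C′) _ ⟩
              - (sg S * C′) + (sg S * C′ + Φ (res X) (S , F))  ≈⟨ +-congˡ (trans (+-congˡ (sym (κ-origin X F S))) (trans (sym (D≈ X F S 𝟘)) (z F S 𝟘 (G-origin f)))) ⟩
              - (sg S * C′) + 0#                        ≈⟨ trans (+-identityʳ _) (-‿distribˡ-* _ _) ⟩
              - sg S * C′                               ≈⟨ sym (fin-* (crt-fin 𝟙 F) (- sg S) _) ⟩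
              crt 𝟙 (b S) F ∎
              where C′ = crt 𝟙 (λ F' → X (F' , S , 𝟘)) F
          from : ∀ y → Ker (suc p) y → Σ (V Ix) λ X → Z G m X × Tens (RelB (suc p)) (λ j → y j - res X j)
          from y (ty , vb) = X , (lift-Cx sm x₀-supp ty , on-G {λ F S a → D X (F , S , a) ≈ 0#} zero-at (λ F S v t f _ → lift-D₁ sm x₀-supp ty F S v t f)) ,
              ≈∈ (Tens-sub (RelB-sub (suc p))) (λ j → sym (trans (+-congˡ (-‿cong (res-lift sm x₀-supp ty j))) (-‿inverseʳ _))) (0∈ (Tens-sub (RelB-sub (suc p))))
            where
            pr = potential {suc p} {Φ y} vb
            b = proj₁ pr
            x₀ : V (Subset d × Subset n)
            x₀ (S , F) = - sg S * b (S , F)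
            x₀-supp : ∀ S F → ¬ (Δ F ≡ true × suc ∣ F ∣ ≡ suc p × ∣ S ∣ ≡ i) → x₀ (S , F) ≈ 0#
            x₀-supp S F q = trans (*-congˡ (proj₁ (proj₂ pr) S F q)) (zeroʳ _)
            X = build x₀ (ray₁ y)
            zero-at : ∀ F S → Δ F ≡ true → D X (F , S , 𝟘) ≈ 0#
            zero-at F S f = begin
              D X (F , S , 𝟘)                                                    ≈⟨ lift-D₀ sm x₀-supp ty F S ⟩
              sg S * crt 𝟙 (λ F' → - sg S * b (S , F')) F + Φ y (S , F)          ≈⟨ +-congʳ (*-congˡ (fin-* (crt-fin 𝟙 F) (- sg S) _)) ⟩
              sg S * (- sg S * crt 𝟙 (λ F' → b (S , F')) F) + Φ y (S , F)        ≈⟨ +-congʳ (trans (solve 2 (λ s c → s :* (:- s :* c) := :- (s :* (s :* c))) refl (sg S) _) (-‿cong (sg-sg S _))) ⟩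
              - crt 𝟙 (λ F' → b (S , F')) F + Φ y (S , F)                        ≈⟨ +-congˡ (proj₂ (proj₂ pr) S F f) ⟩
              - crt 𝟙 (λ F' → b (S , F')) F + crt 𝟙 (λ F' → b (S , F')) F        ≈⟨ -‿inverseˡ _ ⟩
              0# ∎

        Mid-sub : IsSub (Mid (suc p) m)
        Mid-sub = ∩-sub (Z-sub G m) (preimage-sub (fin-lin res-fin) (Tens-sub (RelB-sub (suc p))))

        -- The trace of a differential is, up to sign, the coboundary of the trace, since the value
        -- at -2e_v is contracted twice.
        Bd⇒Mid : ∀ {X} → Bd G m X → Mid (suc p) m X
        Bd⇒Mid {X} b@(x , Y , y , e) = xz , λ v → let (a , z , u) = t v in a , z , λ S → proj₁ (u S) , pot v S , pot-supp v S , λ F f → eq v S F f (lookup F v Bool.≟ true)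
          where
          xz : Z G m X
          xz = Bd⇒Z (∧-convex nonpos-convex (small-up _ 1)) b
          t : Tens (RelZ (suc p)) (res X)
          t = res-Tens sm x (λ F S v f l → proj₂ xz F S (pt v 0) (G-ray 0 f l))
          pot : Fin n → Subset d → V (Subset n)
          pot v S F = - (sg S * ant (θ v) (λ S' → Y (F , S' , pt v 0)) S)
          pot-supp : ∀ v S → Supp (RelPre v (suc p)) (pot v S)
          pot-supp v S = lift (λ F q → trans (-‿cong (trans (*-congˡ (fin-0 (ant-fin (θ v) S) (λ S' → lower y (F , S' , pt v 0) (λ (k , gr) →
            let (f , l) = G-ray⁻ {F} {v} {0} k in q (f , ≡.cong suc (proj₁ (size-at {p} {suc m} {F} {S'} v sm⁺ gr)) , l))))) (zeroʳ _))) -0#≈0#)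
          eq : ∀ v S F → Δ F ≡ true → Dec (lookup F v ≡ true) → res X (v , S , F) ≈ crt 𝟙 (pot v S) F
          eq v S F f (no l) = trans (lower (proj₁ (proj₂ (proj₂ (t v)) S)) F (λ (_ , _ , l') → l l'))
            (sym (crt-rel {v} {pot v S} (λ F' l' → lower (pot-supp v S) F' (λ (_ , _ , l'') → true≢false l'' l')) F (¬true l)))
          eq v S F f (yes l) = begin
            ant (θ v) (λ S' → X (F , S' , pt v 0)) S                     ≈⟨ fin-cong (ant-fin (θ v) S) (λ S' → trans (e F S' (pt v 0) (G-ray 0 f l)) (trans (D≈ Y F S' (pt v 0)) (+-congˡ (κ-ray y F S' v 0)))) ⟩
            ant (θ v) (λ S' → sg S' * A S' + W S') S                     ≈⟨ fin-+ (ant-fin (θ v) S) (λ S' → sg S' * A S') W ⟩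
            ant (θ v) (λ S' → sg S' * A S') S + ant (θ v) W S            ≈⟨ trans (+-congˡ (ant² (θ v) _ S)) (+-identityʳ _) ⟩
            ant (θ v) (λ S' → sg S' * A S') S                            ≈⟨ ant-sg (θ v) A S ⟩
            - (sg S * ant (θ v) A S)                                     ≈⟨ -‿cong (*-congˡ (fubini (ant-fin (θ v) S) (crt-fin 𝟙 F) (λ S' F' → Y (F' , S' , pt v 0)))) ⟩
            - (sg S * crt 𝟙 (λ F' → ant (θ v) (λ S' → Y (F' , S' , pt v 0)) S) F)   ≈⟨ -‿cong (sym (fin-* (crt-fin 𝟙 F) (sg S) _)) ⟩
            - crt 𝟙 (λ F' → sg S * ant (θ v) (λ S' → Y (F' , S' , pt v 0)) S) F     ≈⟨ sym (fin-neg (crt-fin 𝟙 F) _) ⟩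
            crt 𝟙 (pot v S) F ∎
            where
            A W : Subset d → Carrier
            A S' = crt 𝟙 (λ F' → Y (F' , S' , pt v 0)) F
            W S' = ant (θ v) (λ S'' → Y (F , S'' , pt v 1)) S'

        private
          at₀ : V (Subset d × Subset n) → V Ix
          at₀ x = build x (λ _ _ _ → 0#)

          at₀-Cx : ∀ {x} → (∀ S F → ¬ ∣ S ∣ ≡ i → x (S , F) ≈ 0#) → (∀ S → Chain Δ p (λ F → x (S , F))) → Cx G m (at₀ x)
          at₀-Cx {x} z ch = build-Cx x _ sm (λ S F q → case ∣ S ∣ ℕ.≟ i of λ where
            (no r) → z S F r
            (yes r) → lower (Chain⇒Supp Δ (ch S)) F (λ (f , e) → q (f , ≡.cong suc e , r))) (λ _ _ _ _ _ → refl)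

          at₀-lin : Lin at₀
          at₀-lin = fin-lin (λ (F , S , a) → go F S (cls a))
            where
            go : ∀ F S k → IsFin (λ x → value x (λ _ _ _ → 0#) F S k)
            go F S origin    = pt-fin (S , F)
            go F S (ray _ _) = 0-fin
            go F S other     = 0-fin

          at₀-0 : ∀ x F S → at₀ x (F , S , 𝟘) ≈ x (S , F)
          at₀-0 x F S = ≡⇒≈ (build-0 x (λ _ _ _ → 0#) F S)

          at₀-1 : ∀ x F S v t → at₀ x (F , S , pt v t) ≈ 0#
          at₀-1 x F S v t = ≡⇒≈ (build-1 x (λ _ _ _ → 0#) F S v t)

        -- A cycle with trivial traces can be moved to the origin by a boundary. What arrives there
        -- is a cocycle, determined up to coboundaries and sums of traces of chains one homological
        -- degree higher.
        Mid/Bd-iso : QIso (VT (Zc Δ p)) (Coim p) (Mid (suc p) m) (Bd G m)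
        Mid/Bd-iso = record
          { φ = at₀ ; lin = at₀-lin ; subU = VT-sub (Zc-sub Δ p) ; subW' = Bd-sub G m
          ; toU = λ {x} (z , zc) → toU x z zc
          ; toW = λ {x} (z , zc) (_ , y , ty , vb) → toW x z zc y ty vb
          ; refW = λ {x} u (_ , T , t , z) → refW x u T t z
          ; surj = λ X ((x , z) , w) → surj X x z w }
          where
          toU : ∀ x → (∀ S F → ¬ ∣ S ∣ ≡ i → x (S , F) ≈ 0#) → (∀ S → Zc Δ p (λ F → x (S , F))) → Mid (suc p) m (at₀ x)
          toU x z zc = (ax , on-G {λ F S a → D (at₀ x) (F , S , a) ≈ 0#}
              (λ F S f → trans (D-build-0 x _ F S) (trans (+-cong (trans (*-congˡ (proj₂ (zc S) F f)) (zeroʳ _)) (sum-0 (λ v → fin-0 (ant-fin (θ v) S) (λ _ → refl)))) (+-identityˡ _)))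
              (λ F S v t f _ → trans (D-build-1 x _ ax F S v t) (trans (+-cong (trans (*-congˡ (fin-0 (crt-fin 𝟙 F) (λ _ → refl))) (zeroʳ _)) (fin-0 (ant-fin (θ v) S) (λ _ → refl))) (+-identityˡ _)))) ,
              ≈∈ (Tens-sub (RelB-sub (suc p))) (λ (v , S , F) → sym (fin-0 (ant-fin (θ v) S) (λ S' → at₀-1 x F S' v 0))) (0∈ (Tens-sub (RelB-sub (suc p))))
            where
            ax : Cx G m (at₀ x)
            ax = at₀-Cx z (λ S → proj₁ (zc S))
          toW : ∀ x → (∀ S F → ¬ ∣ S ∣ ≡ i → x (S , F) ≈ 0#) → (∀ S → Zc Δ p (λ F → x (S , F))) → ∀ y → Tens (RelZ p) y → VT (Bc Δ p) (λ j → x j - Φ y j) → Bd G m (at₀ x)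
          toW x z zc y ty vb = at₀-Cx z (λ S → proj₁ (zc S)) , build x₀ (ray₁ y) , lift-Cx sm⁺ x₀-supp ty ,
              on-G {λ F S a → at₀ x (F , S , a) ≈ D (build x₀ (ray₁ y)) (F , S , a)}
                (λ F S f → sym (begin
                  D (build x₀ (ray₁ y)) (F , S , 𝟘)                                ≈⟨ lift-D₀ sm⁺ x₀-supp ty F S ⟩
                  sg S * crt 𝟙 (λ F' → sg S * b (S , F')) F + Φ y (S , F)          ≈⟨ +-congʳ (trans (*-congˡ (fin-* (crt-fin 𝟙 F) (sg S) _)) (sg-sg S _)) ⟩
                  crt 𝟙 (λ F' → b (S , F')) F + Φ y (S , F)                        ≈⟨ +-congʳ (sym (proj₂ (proj₂ pr) S F f)) ⟩
                  (x (S , F) - Φ y (S , F)) + Φ y (S , F)                          ≈⟨ solve 2 (λ a c → (a :- c) :+ c := a) refl _ _ ⟩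
                  x (S , F)                                                        ≈⟨ sym (at₀-0 x F S) ⟩
                  at₀ x (F , S , 𝟘) ∎))
                (λ F S v t f _ → trans (at₀-1 x F S v t) (sym (lift-D₁ sm⁺ x₀-supp ty F S v t f)))
            where
            pr = potential {p} {λ j → x j - Φ y j} vb
            b = proj₁ pr
            x₀ : V (Subset d × Subset n)
            x₀ (S , F) = sg S * b (S , F)
            x₀-supp : ∀ S F → ¬ (Δ F ≡ true × suc ∣ F ∣ ≡ p × ∣ S ∣ ≡ i) → x₀ (S , F) ≈ 0#
            x₀-supp S F q = trans (*-congˡ (proj₁ (proj₂ pr) S F q)) (zeroʳ _)
          refW : ∀ x → VT (Zc Δ p) x → ∀ T → Cx G (suc m) T → (∀ F S a → G F a ≡ true → at₀ x (F , S , a) ≈ D T (F , S , a)) → Coim p x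
          refW x u T t z = u , res T , tr , (λ S F q → trans (+-cong (proj₁ u S F q) (trans (-‿cong (sum-0 (λ v → proj₁ (tr v) S F q))) -0#≈0#)) (+-identityˡ _)) ,
              λ S → -∈ (Chain-sub Δ p) (proj₁ (proj₂ u S)) (Σ∈ (Chain-sub Δ p) (λ v → RelFace⇒Face p v (proj₁ (proj₂ (proj₂ (tr v)) S)))) ,
                (λ F → sg S * T (F , S , 𝟘)) , lift (λ F q → trans (*-congˡ (at-origin⁺ t S F (λ (f , e , _) → q (f , e)))) (zeroʳ _)) ,
                λ F f → begin
                  x (S , F) - Φ (res T) (S , F)              ≈⟨ +-congʳ (trans (sym (at₀-0 x F S)) (trans (z F S 𝟘 (G-origin f)) (trans (D≈ T F S 𝟘) (+-congˡ (κ-origin T F S))))) ⟩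
                  (sg S * crt 𝟙 (λ F' → T (F' , S , 𝟘)) F + Φ (res T) (S , F)) - Φ (res T) (S , F)  ≈⟨ solve 2 (λ a c → (a :+ c) :- c := a) refl _ _ ⟩
                  sg S * crt 𝟙 (λ F' → T (F' , S , 𝟘)) F     ≈⟨ sym (fin-* (crt-fin 𝟙 F) (sg S) _) ⟩
                  crt 𝟙 (λ F' → sg S * T (F' , S , 𝟘)) F ∎
            where
            tr : Tens (RelZ p) (res T)
            tr = res-Tens sm⁺ t (λ F S v f fv → trans (sym (z F S (pt v 0) (G-ray 0 f fv))) (at₀-1 x F S v 0))
          surj : ∀ X → Cx G m X → (∀ F S a → G F a ≡ true → D X (F , S , a) ≈ 0#) → Tens (RelB (suc p)) (res X) →
                 Σ (V (Subset d × Subset n)) λ x → VT (Zc Δ p) x × Bd G m (λ j → X j - at₀ x j)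
          surj X x z w = xx , (vz , λ S → zch S , zcl S) , -∈ Supp-sub x (at₀-Cx vz zch) , T , t ,
              on-G {λ F S a → X (F , S , a) - at₀ xx (F , S , a) ≈ D T (F , S , a)}
                (λ F S f → trans (+-congˡ (-‿cong (trans (at₀-0 xx F S) (+-congˡ (-‿cong (≡⇒≈ (cut-true G (D T) (G-origin f)))))))) (solve 2 (λ a c → a :- (a :- c) := c) refl _ _))
                (λ F S v t f fv → trans (+-congˡ (trans (-‿cong (at₀-1 xx F S v t)) -0#≈0#)) (trans (+-identityʳ _) (sym (DT-ray F S v t f fv))))
            where
            bb : ∀ v S → Dec (∣ S ∣ ≡ i) → V (Subset n)
            bb v S (yes _) = proj₁ (proj₂ (proj₂ (proj₂ (w v)) S))
            bb v S (no _)  = λ _ → 0#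
            β : Fin n → Subset d → V (Subset n)
            β v S = bb v S (∣ S ∣ ℕ.≟ i)
            bb-supp : ∀ v S r F → ¬ (RelPre v (suc p) F × ∣ S ∣ ≡ i) → bb v S r F ≈ 0#
            bb-supp v S (yes r) F q = lower (proj₁ (proj₂ (proj₂ (proj₂ (proj₂ (w v)) S)))) F (λ f → q (f , r))
            bb-supp v S (no _)  F q = refl
            bb-eq : ∀ v S r F → Δ F ≡ true → res X (v , S , F) ≈ crt 𝟙 (bb v S r) F
            bb-eq v S (yes r) F f = proj₂ (proj₂ (proj₂ (proj₂ (proj₂ (w v)) S))) F f
            bb-eq v S (no r)  F f = trans (proj₁ (w v) S F r) (sym (fin-0 (crt-fin 𝟙 F) (λ _ → refl)))
            -- A primitive of `X` on the rays: g(v) times the potential of the trace at -e_v, and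
            -- g(v) times the preceding value of `X` further out. The homotopy identity for g(v)
            -- then gives back `X`.
            τ : Fin n → ℕ → V (Subset d × Subset n)
            τ v zero    (S , F) = sg S * crt (g v) (λ S' → β v S' F) S
            τ v (suc t) (S , F) = crt (g v) (λ S' → X (F , S' , pt v t)) S
            T : V Ix
            T = build (λ _ → 0#) τ
            t : Cx G (suc m) T
            t = build-Cx (λ _ → 0#) τ sm⁺ (λ _ _ _ → refl) (λ where
              v zero S F q → trans (*-congˡ (sum-0 (λ j → trans (*-congˡ (cr-loc j _ S (λ e → bb-supp v (S [ j ]≔ false) (∣ S [ j ]≔ false ∣ ℕ.≟ i) F (λ ((f , h , fv) , r) →
                  q ((f , ℕP.suc-injective h , fv) , ≡.trans (≡.sym (size-remove j S e)) (≡.cong suc r)))))) (zeroʳ _)))) (zeroʳ _)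
              v (suc t) S F q → sum-0 (λ j → trans (*-congˡ (cr-loc j _ S (λ e → lower x _ (λ (h , gr) → let (f , fv) = G-ray⁻ {F} {v} {t} h ; (a , b) = size-at {suc p} {m} {F} {S [ j ]≔ false} v sm {t} gr in
                  q ((f , ≡.trans a (ℕP.+-suc t p) , fv) , ≡.trans (≡.sym (size-remove j S e)) (≡.cong suc b)))))) (zeroʳ _)))
            X-closed : ∀ F S v t → Δ F ≡ true → lookup F v ≡ true → sg S * crt 𝟙 (λ F' → X (F' , S , pt v t)) F + ant (θ v) (λ S' → X (F , S' , pt v (suc t))) S ≈ 0#
            X-closed F S v t f fv = trans (+-congˡ (sym (κ-ray x F S v t))) (trans (sym (D≈ X F S (pt v t))) (z F S (pt v t) (G-ray t f fv)))
            DT-ray : ∀ F S v t → Δ F ≡ true → lookup F v ≡ true → D T (F , S , pt v t) ≈ X (F , S , pt v t)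
            DT-ray F S v zero f fv = begin
              D T (F , S , pt v 0)                     ≈⟨ D-build-1 (λ _ → 0#) τ t F S v 0 ⟩
              sg S * crt 𝟙 (λ F' → sg S * crt (g v) (λ S' → β v S' F') S) F + ant (θ v) (crt (g v) (λ S' → X (F , S' , pt v 0))) S
                ≈⟨ +-congʳ (trans (trans (*-congˡ (fin-* (crt-fin 𝟙 F) (sg S) _)) (sg-sg S _)) (fubini (crt-fin 𝟙 F) (crt-fin (g v) S) (λ F' S' → β v S' F'))) ⟩
              crt (g v) (λ S' → crt 𝟙 (β v S') F) S + ant (θ v) (crt (g v) (λ S' → X (F , S' , pt v 0))) S
                ≈⟨ +-congʳ (fin-cong (crt-fin (g v) S) (λ S' → sym (bb-eq v S' (∣ S' ∣ ℕ.≟ i) F f))) ⟩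
              crt (g v) (ant (θ v) (λ S' → X (F , S' , pt v 0))) S + ant (θ v) (crt (g v) (λ S' → X (F , S' , pt v 0))) S
                ≈⟨ trans (+-comm _ _) (ant-crt-id v (λ S' → X (F , S' , pt v 0)) S) ⟩
              X (F , S , pt v 0) ∎
            DT-ray F S v (suc t') f fv = begin
              D T (F , S , pt v (suc t'))              ≈⟨ D-build-1 (λ _ → 0#) τ t F S v (suc t') ⟩
              sg S * crt 𝟙 (λ F' → crt (g v) (λ S' → X (F' , S' , pt v t')) S) F + ant (θ v) (crt (g v) (λ S' → X (F , S' , pt v (suc t')))) S
                ≈⟨ +-congʳ (trans (*-congˡ (fubini (crt-fin 𝟙 F) (crt-fin (g v) S) (λ F' S' → X (F' , S' , pt v t')))) (trans (sym (-‿involutive _)) (trans (-‿cong (sym (crt-sg (g v) C′ S))) (sym (fin-neg (crt-fin (g v) S) _))))) ⟩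
              crt (g v) (λ S' → - (sg S' * C′ S')) S + ant (θ v) (crt (g v) (λ S' → X (F , S' , pt v (suc t')))) S
                ≈⟨ +-congʳ (fin-cong (crt-fin (g v) S) (λ S' → trans (solve 2 (λ a c → :- a := c :- (a :+ c)) refl (sg S' * C′ S') _) (trans (+-congˡ (trans (-‿cong (X-closed F S' v t' f fv)) -0#≈0#)) (+-identityʳ _)))) ⟩
              crt (g v) (ant (θ v) (λ S' → X (F , S' , pt v (suc t')))) S + ant (θ v) (crt (g v) (λ S' → X (F , S' , pt v (suc t')))) S
                ≈⟨ trans (+-comm _ _) (ant-crt-id v (λ S' → X (F , S' , pt v (suc t'))) S) ⟩
              X (F , S , pt v (suc t')) ∎
              where
              C′ : Subset d → Carrier
              C′ S' = crt 𝟙 (λ F' → X (F' , S' , pt v t')) F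
            -- The remainder vanishes on all rays and so is concentrated at the origin.
            R : V Ix
            R j = X j - cut G (D T) j
            rx : Cx G m R
            rx = -∈ Supp-sub x (Graded⇒Cx G (D-Graded (Cx⇒Graded t)))
            R-ray : ∀ F S v t → R (F , S , pt v t) ≈ 0#
            R-ray F S v t' = case G F (pt v t') Bool.≟ true of λ where
              (no e) → lower rx _ (λ (e' , _) → e e')
              (yes e) → let (f , fv) = G-ray⁻ {F} {v} {t'} e in trans (+-congˡ (-‿cong (trans (≡⇒≈ (cut-true G (D T) e)) (DT-ray F S v t' f fv)))) (-‿inverseʳ _)
            R-closed : ∀ F S → Δ F ≡ true → D R (F , S , 𝟘) ≈ 0#
            R-closed F S f = trans (φ-- D-lin X (cut G (D T)) _) (trans (+-cong (z F S 𝟘 (G-origin f)) (trans (-‿cong (DD (∧-convex nonpos-convex (small-up _ 1)) t F S 𝟘 (G-origin f))) -0#≈0#)) (+-identityˡ _))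
            xx : V (Subset d × Subset n)
            xx (S , F) = R (F , S , 𝟘)
            vz : ∀ S F → ¬ ∣ S ∣ ≡ i → xx (S , F) ≈ 0#
            vz S F q = at-origin rx S F (λ (_ , _ , r) → q r)
            zch : ∀ S → Chain Δ p (λ F → xx (S , F))
            zch S = Supp⇒Chain Δ (lift (λ F q → at-origin rx S F (λ (f , e , _) → q (f , e))))
            zcl : ∀ S F → Δ F ≡ true → crt 𝟙 (λ F' → xx (S , F')) F ≈ 0#
            zcl S F f = trans (sym (sg-sg S _)) (trans (*-congˡ (begin
              sg S * crt 𝟙 (λ F' → xx (S , F')) F        ≈⟨ sym (trans (+-congˡ (trans (κ-origin R F S) (sum-0 (λ v → fin-0 (ant-fin (θ v) S) (λ S' → R-ray F S' v 0))))) (+-identityʳ _)) ⟩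
              sg S * crt 𝟙 (λ F' → R (F' , S , 𝟘)) F + κ (λ q → R (F , q)) (S , 𝟘)   ≈⟨ sym (D≈ R F S 𝟘) ⟩
              D R (F , S , 𝟘)                            ≈⟨ R-closed F S f ⟩
              0# ∎)) (zeroʳ _))

  -- Dimensions of the tensor products

  module TensorDimensions {n d : ℕ} (Θ : Fin (suc d) → Fin n → Carrier) (i : ℕ)
    (Δ : Subset n → Bool) (cx : IsComplex Δ) (g : Fin n → Fin (suc d) → Carrier) where
    open TotalComplex Θ i
    open Singularities Θ i Δ cx g

    -- An element is its family of slices at the subsets of size `i`, so the space is a direct sum
    -- of copies.
    VT-dim : ∀ {Q R : Pr (Subset n)} → IsSub Q → IsSub R → (∀ {x} → R x → Q x) → ∀ {r} → Dim Q R r → Dim (VT Q) (VT R) ((suc d C i) ℕ.* r)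
    VT-dim {Q} {R} sQ sR R⊆Q {r} q = ≡.subst (Dim (VT Q) (VT R)) (sumℕ-const (suc d C i) r) (Dim← (record
        { φ = λ x (l , F) → x (en l , F)
        ; lin = record { φ-cong = λ e _ → e _ ; φ-+ = λ _ _ _ → refl ; φ-* = λ _ _ _ → refl }
        ; subU = VT-sub sQ ; subW' = ⨁-sub (λ _ → sR)
        ; toU = λ (_ , u) l → u (en l)
        ; toW = λ _ (_ , w) l → w (en l)
        ; refW = λ {x} (z , u) w → z , λ S → case ∣ S ∣ ℕ.≟ i of λ where
            (no r) → ≈∈ sR (λ F → sym (z S F r)) (0∈ sR)
            (yes r) → let (k , e) = en-sur {S} r in ≈∈ sR (λ F → ≡⇒≈ (≡.cong (λ T → x (T , F)) e)) (w k)
        ; surj = λ y u → (λ (S , F) → extend (λ l → y (l , F)) S) ,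
            ((λ S F r → ≡⇒≈ (extend-∉ (λ l → y (l , F)) {S} r)) , λ S → case ∣ S ∣ ℕ.≟ i of λ where
              (no r) → ≈∈ sQ (λ F → ≡⇒≈ (≡.sym (extend-∉ (λ l → y (l , F)) {S} r))) (0∈ sQ)
              (yes r) → let (k , e) = en-sur {S} r in ≈∈ sQ (λ F → ≡⇒≈ (≡.sym (≡.trans (≡.cong (extend (λ l → y (l , F))) (≡.sym e)) (extend-en (λ l → y (l , F)) k)))) (u k)) ,
            λ l → ≈∈ sR (λ F → sym (trans (+-congˡ (-‿cong (≡⇒≈ (extend-en (λ l → y (l , F)) l)))) (-‿inverseʳ _))) (0∈ sR) })
      (⨁-dim (λ _ → sQ) (λ _ → sR) (λ _ → R⊆Q) (λ _ → q)))
      where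
      open Card (Card-size (suc d) i)
      open Enumerated (λ S → ∣ S ∣ ℕ.≟ i) (Card-size (suc d) i)

    eval∈ : ∀ {A J : Set} {W : Pr J} → IsSub W → ∀ L (x : A → V J) → (∀ a → W (x a)) → W (λ j → eval L (λ a → x a j))
    eval∈ s []            x w = 0∈ s
    eval∈ s ((k , a) ∷ L) x w = +∈ s (*∈ s k (w a)) (eval∈ s L x w)

    -- A subspace is closed under finite combinations only, and a finitary functional produces
    -- nothing else.
    fin∈ : ∀ {A J : Set} {W : Pr J} → IsSub W → ∀ {f : V A → Carrier} → IsFin f → (x : A → V J) → (∀ a → W (x a)) → W (λ j → f (λ a → x a j))
    fin∈ s (L , e) x w = ≈∈ s (λ j → sym (e _)) (eval∈ s L x w)

    module _ (pv : ∀ v → Σ (Fin (suc d)) λ j → ¬ (θ v j ≈ 0#)) where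
      private
        j₀ : Fin n → Fin (suc d)
        j₀ v = proj₁ (pv v)
        iv : Fin n → Carrier
        iv v = proj₁ (inverse (θ v (j₀ v)) (proj₂ (pv v)))
        iv-eq : ∀ v → θ v (j₀ v) * iv v ≈ 1#
        iv-eq v = proj₂ (inverse (θ v (j₀ v)) (proj₂ (pv v)))

        Av : Fin n → Subset (suc d) → Set
        Av v S = ∣ S ∣ ≡ i × lookup S (j₀ v) ≡ false
        Av? : ∀ v S → Dec (Av v S)
        Av? v S = (∣ S ∣ ℕ.≟ i) ×-dec (lookup S (j₀ v) Bool.≟ false)
        cd : ∀ v → Card (Av v) (d C i)
        cd v = Card-avoid d i (j₀ v)
        module En v = Card (cd v)
        module Ex v = Enumerated (Av? v) (cd v)

        -- The projection onto W_v: multiply by the pivot basis vector, contract with θ(v),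
        -- normalise. It reads only sets avoiding the pivot and leaves the values at these
        -- unchanged.
        P : Fin n → V (Subset (suc d)) → V (Subset (suc d))
        P v x S = iv v * ant (θ v) (cr (j₀ v) x) S

        P-fin : ∀ v S → IsFin (λ x → P v x S)
        P-fin v S = *-fin (iv v) (∘-fin (ant-fin (θ v) S) (λ S' → cr-fin (j₀ v) S'))

        P-id : ∀ v x S → P v x S + iv v * cr (j₀ v) (ant (θ v) x) S ≈ x S
        P-id v x S = trans (sym (distribˡ _ _ _)) (trans (*-congˡ (cr-ant (j₀ v) (θ v) x S)) (trans (sym (*-assoc _ _ _)) (trans (*-congʳ (trans (*-comm _ _) (iv-eq v))) (*-identityˡ _))))

        P-closed : ∀ v x S → (∀ S' → ant (θ v) x S' ≈ 0#) → P v x S ≈ x S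
        P-closed v x S z = trans (sym (trans (+-congˡ (trans (*-congˡ (fin-0 (cr-fin (j₀ v) S) z)) (zeroʳ _))) (+-identityʳ _))) (P-id v x S)

        P-avoid : ∀ v x S → lookup S (j₀ v) ≡ false → P v x S ≈ x S
        P-avoid v x S e = trans (sym (trans (+-congˡ (trans (*-congˡ (cr-∉ (j₀ v) _ S e)) (zeroʳ _))) (+-identityʳ _))) (P-id v x S)

        P-loc : ∀ v x y S → (∀ T → lookup T (j₀ v) ≡ false → x T ≈ y T) → P v x S ≈ P v y S
        P-loc v x y S h = *-congˡ (fin-cong (ant-fin (θ v) S) (λ S' → cr-cong (j₀ v) x y S' (λ _ → h _ (lookup-[]≔ S' (j₀ v)))))

        P-supp : ∀ v x S → (∀ T → ¬ ∣ T ∣ ≡ i → x T ≈ 0#) → ¬ ∣ S ∣ ≡ i → P v x S ≈ 0#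
        P-supp v x S z q = trans (*-congˡ (sum-0 (λ j → trans (*-congˡ (an-loc j _ S (λ e → cr-loc (j₀ v) x _ (λ e' → z _ (λ r →
          q (ℕP.suc-injective (≡.trans (≡.sym (size-add j S e)) (≡.trans (≡.sym (size-remove (j₀ v) (S [ j ]≔ true) e')) (≡.cong suc r))))))))) (zeroʳ _)))) (zeroʳ _)

      -- Elements of W_v are determined by their values on the index sets avoiding a pivot of θ(v).
      Tens-dim : ∀ {U W : Fin n → Pr (Subset n)} → (∀ v → IsSub (U v)) → (∀ v → IsSub (W v)) → (∀ v {x} → W v x → U v x) →
                 ∀ {r} → Dim (⨁ U) (⨁ W) r → Dim (Tens U) (Tens W) ((d C i) ℕ.* r)
      Tens-dim {U} {W} sU sW W⊆U {r} q = ≡.subst (Dim (Tens U) (Tens W)) (sumℕ-const (d C i) r) (Dim← iso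
          (⨁-dim (λ _ → ⨁-sub sU) (λ _ → ⨁-sub sW) (λ _ w v → W⊆U v (w v)) (λ _ → q)))
        where
        N = d C i
        slice-W : ∀ y → Tens U y → (∀ l v → W v (λ F → y (v , En.en v l , F))) → ∀ v S → W v (λ F → y (v , S , F))
        slice-W y ty w v S = ≈∈ (sW v) (λ F → trans (P-loc v _ (λ T → y (v , T , F)) S (λ T e → ≡⇒≈ (≡.cong (λ b → if b then 0# else y (v , T , F)) e)))
              (P-closed v (λ T → y (v , T , F)) S (λ S' → proj₁ (proj₂ (ty v)) S' F)))
            (fin∈ (sW v) (P-fin v S) y' y'∈)
          where
          y' : Subset (suc d) → V (Subset n)
          y' T F = if lookup T (j₀ v) then 0# else y (v , T , F)
          y'∈ : ∀ T → W v (y' T)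
          y'∈ T = case lookup T (j₀ v) Bool.≟ true of λ where
            (yes e) → ≈∈ (sW v) (λ F → ≡⇒≈ (≡.sym (≡.cong (λ b → if b then 0# else y (v , T , F)) e))) (0∈ (sW v))
            (no e) → ≈∈ (sW v) (λ F → ≡⇒≈ (≡.sym (≡.cong (λ b → if b then 0# else y (v , T , F)) (¬true e)))) (case ∣ T ∣ ℕ.≟ i of λ where
              (no r) → ≈∈ (sW v) (λ F → sym (proj₁ (ty v) T F r)) (0∈ (sW v))
              (yes r) → let (k , eq) = En.en-sur v {T} (r , ¬true e) in ≈∈ (sW v) (λ F → ≡⇒≈ (≡.cong (λ R → y (v , R , F)) eq)) (w k v))
        lift-y : V (Fin N × Fin n × Subset n) → V (Fin n × Subset (suc d) × Subset n)
        lift-y c (v , S , F) = P v (Ex.extend v (λ l → c (l , v , F))) S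
        lift∈ : ∀ c → ⨁ (λ _ → ⨁ U) c → Tens U (lift-y c)
        lift∈ c u v = (λ S F r → P-supp v _ S (λ T q → ≡⇒≈ (Ex.extend-∉ v (λ l → c (l , v , F)) {T} (λ (p , _) → q p))) r) ,
          (λ S F → trans (fin-* (ant-fin (θ v) S) (iv v) _) (trans (*-congˡ (ant² (θ v) _ S)) (zeroʳ _))) ,
          λ S → fin∈ (sU v) (P-fin v S) (λ T F → Ex.extend v (λ l → c (l , v , F)) T) (λ T → case Av? v T of λ where
            (no q) → ≈∈ (sU v) (λ F → ≡⇒≈ (≡.sym (Ex.extend-∉ v (λ l → c (l , v , F)) {T} q))) (0∈ (sU v))
            (yes q) → let (k , e) = En.en-sur v {T} q in ≈∈ (sU v) (λ F → ≡⇒≈ (≡.sym (≡.trans (≡.cong (Ex.extend v (λ l → c (l , v , F))) (≡.sym e)) (Ex.extend-en v (λ l → c (l , v , F)) k)))) (u k v))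
        iso : QIso (Tens U) (Tens W) (⨁ {N} (λ _ → ⨁ U)) (⨁ (λ _ → ⨁ W))
        iso = record
          { φ = λ y (l , v , F) → y (v , En.en v l , F)
          ; lin = record { φ-cong = λ e _ → e _ ; φ-+ = λ _ _ _ → refl ; φ-* = λ _ _ _ → refl }
          ; subU = Tens-sub sU ; subW' = ⨁-sub (λ _ → ⨁-sub sW)
          ; toU = λ ty l v → proj₂ (proj₂ (ty v)) (En.en v l)
          ; toW = λ _ tw l v → proj₂ (proj₂ (tw v)) (En.en v l)
          ; refW = λ {y} ty w v → proj₁ (ty v) , proj₁ (proj₂ (ty v)) , slice-W y ty w v
          ; surj = λ c u → lift-y c , lift∈ c u , λ l v → ≈∈ (sW v) (λ F → sym (trans (+-congˡ (-‿cong (trans (P-avoid v _ (En.en v l) (proj₂ (En.en∈ v l)))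
              (≡⇒≈ (Ex.extend-en v (λ l → c (l , v , F)) l))))) (-‿inverseʳ _))) (0∈ (sW v)) }

  -- Membership in the ideal by coefficients

  module Ideals {n d : ℕ} (Θ : Fin d → Fin n → Carrier)
    (Δ : Subset n → Bool) (cx : IsComplex Δ) where
    leqᴹ⇒≤ : ∀ {k} (m e : Vec ℕ k) → leqᴹ {n} m e ≡ true → ∀ u → lookup m u ≤ lookup e u
    leqᴹ⇒≤ (a ∷ m) (b ∷ e) p zero    = ℕP.≤ᵇ⇒≤ a b (≡.subst Bool.T (≡.sym (proj₁ (∧-true p))) _)
    leqᴹ⇒≤ (a ∷ m) (b ∷ e) p (suc u) = leqᴹ⇒≤ m e (proj₂ (∧-true {a ℕ.≤ᵇ b} p)) u

    ≤⇒leqᴹ : ∀ {k} (m e : Vec ℕ k) → (∀ u → lookup m u ≤ lookup e u) → leqᴹ {n} m e ≡ true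
    ≤⇒leqᴹ []      []      p = ≡.refl
    ≤⇒leqᴹ (a ∷ m) (b ∷ e) p = ∧-intro (T⇒≡ (ℕP.≤⇒≤ᵇ (p zero))) (≤⇒leqᴹ m e (p ∘ suc))
      where
      T⇒≡ : ∀ {b} → Bool.T b → b ≡ true
      T⇒≡ {true} _ = ≡.refl

    lookup-unit : ∀ (w u : Fin n) → lookup (unitᴹ w) u ≡ (if does (u Fin.≟ w) then 1 else 0)
    lookup-unit w u = VecP.lookup∘tabulate _ u

    inc-∸ : ∀ (m : Vec ℕ n) w → zipWith _∸_ (inc w m) m ≡ unitᴹ w
    inc-∸ m w = vext (λ u → ≡.trans (lookup-∸ (inc w m) m u) (≡.trans (at u) (≡.sym (lookup-unit w u))))
      where
      at : ∀ u → lookup (inc w m) u ∸ lookup m u ≡ (if does (u Fin.≟ w) then 1 else 0)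
      at u with u Fin.≟ w
      ... | yes ≡.refl = ≡.trans (≡.cong (_∸ lookup m w) (VecP.lookup∘updateAt w m)) (ℕP.m+n∸n≡m 1 (lookup m w))
      ... | no p = ≡.trans (≡.cong (_∸ lookup m u) (VecP.lookup∘updateAt′ u w p m)) (ℕP.n∸n≡0 (lookup m u))

    ∸-unit⇒inc : ∀ (m e : Vec ℕ n) w → (∀ u → lookup m u ≤ lookup e u) → zipWith _∸_ e m ≡ unitᴹ w → e ≡ inc w m
    ∸-unit⇒inc m e w l q = vext (λ u → at u)
      where
      val : ∀ u → lookup e u ∸ lookup m u ≡ (if does (u Fin.≟ w) then 1 else 0)
      val u = ≡.trans (≡.sym (lookup-∸ e m u)) (≡.trans (≡.cong (λ z → lookup z u) q) (lookup-unit w u))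
      at : ∀ u → lookup e u ≡ lookup (inc w m) u
      at u with u Fin.≟ w | val u
      ... | yes ≡.refl | v = ≡.trans (≡.sym (ℕP.m∸n+n≡m (l w))) (≡.trans (≡.cong (ℕ._+ lookup m w) v) (≡.sym (VecP.lookup∘updateAt w m)))
      ... | no p | v = ≡.trans (≡.sym (ℕP.m∸n+n≡m (l u))) (≡.trans (≡.cong (ℕ._+ lookup m u) v) (≡.sym (VecP.lookup∘updateAt′ u w p m)))

    opaque
      at-point : Vec ℕ n → Vec ℕ n → Carrier → Carrier
      at-point e m x = if does (VecP.≡-dec ℕ._≟_ e m) then x else 0#

      at-on : ∀ {e m} x → e ≡ m → at-point e m x ≡ x
      at-on {e} {m} x p = ≡.cong (λ b → if b then x else 0#) (dec-true (VecP.≡-dec ℕ._≟_ e m) p)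

      at-off : ∀ {e m} x → ¬ e ≡ m → at-point e m x ≡ 0#
      at-off {e} {m} x p = ≡.cong (λ b → if b then x else 0#) (dec-false (VecP.≡-dec ℕ._≟_ e m) p)

    opaque
      gate : Vec ℕ n → Fin n → Carrier → Carrier
      gate e w x = if does (0 ℕ.<? lookup e w) then x else 0#

      gate-def : ∀ e w x → gate e w x ≡ (if does (0 ℕ.<? lookup e w) then x else 0#)
      gate-def e w x = ≡.refl

      gate-pos : ∀ {e w x} → 0 < lookup e w → gate e w x ≡ x
      gate-pos {e} {w} {x} p = ≡.cong (λ b → if b then x else 0#) (dec-true (0 ℕ.<? lookup e w) p)

      gate-neg : ∀ {e w x} → ¬ 0 < lookup e w → gate e w x ≡ 0#
      gate-neg {e} {w} {x} p = ≡.cong (λ b → if b then x else 0#) (dec-false (0 ℕ.<? lookup e w) p)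

    -- The coefficient of x^e in Σ y_j θ_j, collected by variables. The gate excludes variables not
    -- dividing x^e, where the truncated predecessor would be wrong.
    coeff-of : (Vec ℕ n → Fin d → Carrier) → Vec ℕ n → Carrier
    coeff-of y e = ∑ (λ w → gate e w (∑ (λ j → Θ j w * y (updateAt e w ℕ.pred) j)))

    coeff-cong : ∀ {y y'} e → (∀ w → 0 < lookup e w → ∀ j → y (updateAt e w ℕ.pred) j ≈ y' (updateAt e w ℕ.pred) j) → coeff-of y e ≈ coeff-of y' e
    coeff-cong {y} {y'} e h = sum-cong (λ w → case 0 ℕ.<? lookup e w of λ where
      (yes p) → trans (≡⇒≈ (gate-pos p)) (trans (sum-cong (λ j → *-congˡ (h w p j))) (≡⇒≈ (≡.sym (gate-pos p))))
      (no p) → trans (≡⇒≈ (gate-neg p)) (≡⇒≈ (≡.sym (gate-neg p))))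

    coeff-lin : ∀ k y y' e → coeff-of (λ m j → k * y m j + y' m j) e ≈ k * coeff-of y e + coeff-of y' e
    coeff-lin k y y' e = begin
      coeff-of (λ m j → k * y m j + y' m j) e     ≈⟨ sum-cong (λ w → case 0 ℕ.<? lookup e w of λ where
          (yes p) → trans (≡⇒≈ (gate-pos p)) (trans (sum-cong (λ j → solve 4 (λ t k a b → t :* (k :* a :+ b) := k :* (t :* a) :+ t :* b) refl (Θ j w) k (y (updateAt e w ℕ.pred) j) (y' (updateAt e w ℕ.pred) j)))
                     (trans (sum-+ _ _) (+-cong (trans (sum-* k _) (*-congˡ (≡⇒≈ (≡.sym (gate-pos p))))) (≡⇒≈ (≡.sym (gate-pos p))))))
          (no p) → trans (≡⇒≈ (gate-neg p)) (sym (trans (+-cong (trans (*-congˡ (≡⇒≈ (gate-neg p))) (zeroʳ k)) (≡⇒≈ (gate-neg p))) (+-identityˡ _)))) ⟩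
      ∑ (λ w → k * f y w + f y' w)                ≈⟨ trans (sum-+ _ _) (+-congʳ (sum-* k _)) ⟩
      k * coeff-of y e + coeff-of y' e ∎
      where
      f : (Vec ℕ n → Fin d → Carrier) → Fin n → Carrier
      f y w = gate e w (∑ (λ j → Θ j w * y (updateAt e w ℕ.pred) j))

    mulMon-linForm : ∀ m (t : Fin n → Carrier) e → mulMon m (linForm t) e ≈ ∑ (λ w → at-point e (inc w m) (t w))
    mulMon-linForm m t e = case leqᴹ {n} m e Bool.≟ true of λ where
        (yes p) → trans (≡⇒≈ (≡.cong (λ b → if b then linForm t (zipWith _∸_ e m) else 0#) p)) (trans (≡⇒≈ (≡.sym (∑≡sumF _)))
          (sum-cong (λ w → case VecP.≡-dec ℕ._≟_ e (inc w m) of λ where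
            (yes q) → trans (≡⇒≈ (≡.cong (λ b → if b then t w else 0#) (dec-true (VecP.≡-dec ℕ._≟_ (zipWith _∸_ e m) (unitᴹ w)) (≡.trans (≡.cong (λ z → zipWith _∸_ z m) q) (inc-∸ m w))))) (≡⇒≈ (≡.sym (at-on (t w) q)))
            (no q) → trans (≡⇒≈ (≡.cong (λ b → if b then t w else 0#) (dec-false (VecP.≡-dec ℕ._≟_ (zipWith _∸_ e m) (unitᴹ w)) (λ r → q (∸-unit⇒inc m e w (leqᴹ⇒≤ m e p) r))))) (≡⇒≈ (≡.sym (at-off (t w) q))))))
        (no p) → trans (≡⇒≈ (≡.cong (λ b → if b then linForm t (zipWith _∸_ e m) else 0#) (¬true p))) (sym (sum-0 (λ w → ≡⇒≈ (at-off (t w) (λ q → p (≡.subst (λ z → leqᴹ {n} m z ≡ true) (≡.sym q) (≤⇒leqᴹ m (inc w m) (inc-≤ m w))))))))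

    -- Every multiple of a nonface monomial has nonface support, so these generators are invisible
    -- at face monomials.
    mulMon-monoF : ∀ m F e → Δ F ≡ false → Δ (supp e) ≡ true → mulMon m (monoF F) e ≈ 0#
    mulMon-monoF m F e nf f = case leqᴹ {n} m e Bool.≟ true of λ where
      (no p) → ≡⇒≈ (≡.cong (λ b → if b then monoF F (zipWith _∸_ e m) else 0#) (¬true p))
      (yes p) → trans (≡⇒≈ (≡.cong (λ b → if b then monoF F (zipWith _∸_ e m) else 0#) p)) (≡⇒≈ (≡.cong (λ b → if b then 1# else 0#)
        (dec-false (VecP.≡-dec ℕ._≟_ (zipWith _∸_ e m) (indᵥ F)) (λ q → true≢false (Complex-down cx (λ u h → supp-intro e u
          (ℕP.<-≤-trans (≡.subst (0 <_) (≡.sym (≡.trans (≡.sym (lookup-∸ e m u)) (≡.trans (≡.cong (λ z → lookup z u) q) (≡.trans (lookup-ind F u) (≡.cong (λ b → if b then 1 else 0) h))))) (s≤s z≤n))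
            (ℕP.m∸n≤m (lookup e u) (lookup m u)))) f) nf))))

    single-coeff : ∀ m j e → coeff-of (λ m' j' → at-point m' m (δF j' j)) e ≈ mulMon m (linForm (Θ j)) e
    single-coeff m j e = trans (sum-cong (λ w → case 0 ℕ.<? lookup e w of λ where
        (no p) → trans (≡⇒≈ (gate-neg p)) (≡⇒≈ (≡.sym (at-off (Θ j w) (λ q → p (≡.subst (λ z → 0 < lookup z w) (≡.sym q) (inc-posᵥ m w))))))
        (yes p) → trans (≡⇒≈ (gate-pos p)) (case VecP.≡-dec ℕ._≟_ e (inc w m) of λ where
          (yes q) → trans (sum-cong (λ j' → trans (*-congˡ (≡⇒≈ (at-on (δF j' j) (≡.trans (≡.cong (λ z → updateAt z w ℕ.pred) q) (pred-incᵥ m w))))) (*-comm _ _)))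
                      (trans (sum-δ (λ j' → Θ j' w) j) (≡⇒≈ (≡.sym (at-on (Θ j w) q))))
          (no q) → trans (sum-0 (λ j' → trans (*-congˡ (≡⇒≈ (at-off (δF j' j) (λ r → q (pred⇒inc m e w p r))))) (zeroʳ _))) (≡⇒≈ (≡.sym (at-off (Θ j w) q))))))
      (sym (mulMon-linForm m (Θ j) e))

    mulMon-cong : ∀ m (g g' : Vec ℕ n → Carrier) → (∀ e → g e ≈ g' e) → ∀ e → mulMon m g e ≈ mulMon m g' e
    mulMon-cong m g g' h e = go (leqᴹ {n} m e)
      where
      go : ∀ b → (if b then g (zipWith _∸_ e m) else 0#) ≈ (if b then g' (zipWith _∸_ e m) else 0#)
      go true  = h _
      go false = refl

    Multiple : Pr (Vec ℕ n)
    Multiple g = Σ (Vec ℕ n) λ m → Σ (V (Vec ℕ n)) λ g₀ → GenSR Δ Θ g₀ × (∀ e → g e ≈ mulMon m g₀ e)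

    -- At face monomials only multiples of the linear forms are seen, and a monomial multiple of θ_j
    -- contributes to `y` one unit at that monomial and index `j`.
    ideal-coefficients : ∀ f → IdealSR Δ Θ f → Σ (Vec ℕ n → Fin d → Carrier) λ y → ∀ e → Δ (supp e) ≡ true → f e ≈ coeff-of y e
    ideal-coefficients f (L , gs , eq) = let (y , h) = go L gs in y , λ e p → trans (eq e) (h e p)
      where
      go : ∀ L → All (λ p → Multiple (proj₂ p)) L → Σ (Vec ℕ n → Fin d → Carrier) λ y → ∀ e → Δ (supp e) ≡ true → List.foldr (λ p s → proj₁ p * proj₂ p e + s) 0# L ≈ coeff-of y e
      go [] [] = (λ _ _ → 0#) , λ e p → sym (sum-0 (λ w → case 0 ℕ.<? lookup e w of λ where
        (yes q) → trans (≡⇒≈ (gate-pos q)) (sum-0 (λ j → zeroʳ _))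
        (no q) → ≡⇒≈ (gate-neg q)))
      go ((k , g) ∷ L) ((m , g₀ , lift (inj₁ (F , nf , h₀)) , h) ∷ gs) = let (y , ih) = go L gs in y , λ e p →
        trans (+-cong (trans (*-congˡ (trans (h e) (trans (mulMon-cong m g₀ (monoF F) h₀ e) (mulMon-monoF m F e nf p)))) (zeroʳ k)) (ih e p)) (+-identityˡ _)
      go ((k , g) ∷ L) ((m , g₀ , lift (inj₂ (j , h₀)) , h) ∷ gs) = let (y , ih) = go L gs in
        (λ m' j' → k * at-point m' m (δF j' j) + y m' j') , λ e p →
        trans (+-cong (*-congˡ (trans (h e) (trans (mulMon-cong m g₀ (linForm (Θ j)) h₀ e) (sym (single-coeff m j e))))) (ih e p)) (sym (coeff-lin k (λ m' j' → at-point m' m (δF j' j)) y e))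

    Ideal-sub : IsSub (IdealSR Δ Θ)
    Ideal-sub = record
      { 0∈ = [] , [] , λ e → refl
      ; +∈ = λ (L , a , p) (M , b , q) → L List.++ M , ++⁺ a b , λ e → trans (+-cong (p e) (q e)) (fold-++ L M e)
      ; *∈ = λ k {x} (L , a , p) → List.map (λ (c , g) → k * c , g) L , scale k L a , λ e → trans (*-congˡ (p e)) (fold-scale k L e)
      ; ≈∈ = λ h (L , a , p) → L , a , λ e → trans (sym (h e)) (p e) }
      where
      fold : List (Carrier × (Vec ℕ n → Carrier)) → Vec ℕ n → Carrier
      fold L e = List.foldr (λ p s → proj₁ p * proj₂ p e + s) 0# L
      fold-++ : ∀ L M e → fold L e + fold M e ≈ fold (L List.++ M) e
      fold-++ []      M e = +-identityˡ _
      fold-++ (x ∷ L) M e = trans (+-assoc _ _ _) (+-congˡ (fold-++ L M e))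
      fold-scale : ∀ k L e → k * fold L e ≈ fold (List.map (λ (c , g) → k * c , g) L) e
      fold-scale k []      e = zeroʳ k
      fold-scale k ((c , g) ∷ L) e = trans (distribˡ k _ _) (+-cong (sym (*-assoc k c _)) (fold-scale k L e))
      scale : ∀ {P : (Vec ℕ n → Carrier) → Set (c ⊔ ℓ)} k L → All (λ p → P (proj₂ p)) L → All (λ p → P (proj₂ p)) (List.map (λ (c , g) → k * c , g) L)
      scale k []      []       = []
      scale k (x ∷ L) (p ∷ ps) = p ∷ scale k L ps

    generator∈ : ∀ m {g} → GenSR Δ Θ g → IdealSR Δ Θ (mulMon m g)
    generator∈ m {g} G = (1# , mulMon m g) ∷ [] , (m , g , G , λ e → refl) ∷ [] , λ e → sym (trans (+-identityʳ _) (*-identityˡ _))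

    private
      module En k = Card (Card-monomials n (λ _ → true) k)

      enumerate : ∀ k e → Vec.sum e ≡ k → Σ (Fin (cnt n (λ _ → true) k)) λ l → En.en k l ≡ e
      enumerate k e p = En.en-sur k (p , ≡.refl)

      sum-at : ∀ k (z : Vec ℕ n → Carrier) e → Vec.sum e ≡ k → ∑ (λ l → at-point e (En.en k l) (z (En.en k l))) ≈ z e
      sum-at k z e p = let (l , q) = enumerate k e p in
        trans (sum-single _ l (λ l' ne → ≡⇒≈ (at-off (z (En.en k l')) (λ r → ne (En.en-inj k (≡.trans (≡.sym r) (≡.sym q)))))))
          (trans (≡⇒≈ (at-on (z (En.en k l)) (≡.sym q))) (≡⇒≈ (≡.cong z q)))

    Hom-list : ∀ k f → (∀ e → ¬ Vec.sum e ≡ k → f e ≈ 0#) → Hom k f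
    Hom-list k f z = lift (List.tabulate (En.en k) , λ e ne → z e (λ p → let (l , q) = enumerate k e p in ne (≡.subst (LMem._∈ List.tabulate (En.en k)) q (∈-tabulate⁺ {f = En.en k} l)))) , z

    Poly-sub : IsSub (Poly {n})
    Poly-sub = record
      { 0∈ = lift ([] , λ _ _ → refl)
      ; +∈ = λ { (lift (L , p)) (lift (M , q)) → lift (L List.++ M , λ e ne → trans (+-cong (p e (ne ∘ ∈-++⁺ˡ)) (q e (ne ∘ ∈-++⁺ʳ L))) (+-identityˡ _)) }
      ; *∈ = λ { k (lift (L , p)) → lift (L , λ e ne → trans (*-congˡ (p e ne)) (zeroʳ k)) }
      ; ≈∈ = λ { h (lift (L , p)) → lift (L , λ e ne → trans (sym (h e)) (p e ne)) } }

    Hom-sub : ∀ k → IsSub (Hom k)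
    Hom-sub k = record
      { 0∈ = 0∈ Poly-sub , λ _ _ → refl
      ; +∈ = λ (a , p) (b , q) → +∈ Poly-sub a b , λ e ne → trans (+-cong (p e ne) (q e ne)) (+-identityˡ _)
      ; *∈ = λ c (a , p) → *∈ Poly-sub c a , λ e ne → trans (*-congˡ (p e ne)) (zeroʳ c)
      ; ≈∈ = λ h (a , p) → ≈∈ Poly-sub h a , λ e ne → trans (sym (h e)) (p e ne) }

    -- In a fixed degree `f` is the finite sum Σ y_j θ_j plus a `defect` on nonface monomials, and
    -- each term of both is a multiple of a generator.
    coefficients-ideal : ∀ k f y → (∀ e → ¬ Vec.sum e ≡ k → f e ≈ 0#) → (∀ m j → ¬ suc (Vec.sum m) ≡ k → y m j ≈ 0#) →
      (∀ e → Vec.sum e ≡ k → Δ (supp e) ≡ true → f e ≈ coeff-of y e) → IdealSR Δ Θ f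
    coefficients-ideal k f y z yz h = ≈∈ Ideal-sub same (+∈ Ideal-sub part₁ part₂)
      where
      -- For `k` zero this is not one degree less, but then `y` vanishes altogether.
      k' = ℕ.pred k
      N₁ = cnt n (λ _ → true) k'
      N₂ = cnt n (λ _ → true) k
      part₁ : IdealSR Δ Θ (λ e → ∑ {N₁} (λ l → ∑ (λ j → y (En.en k' l) j * mulMon (En.en k' l) (linForm (Θ j)) e)))
      part₁ = Σ∈ Ideal-sub (λ l → Σ∈ Ideal-sub (λ j → *∈ Ideal-sub (y (En.en k' l) j) (generator∈ (En.en k' l) {linForm (Θ j)} (lift (inj₂ (j , λ e → refl))))))
      defect : Vec ℕ n → Carrier
      defect e = if Δ (supp e) then 0# else f e - coeff-of y e
      mon : Vec ℕ n → Vec ℕ n → Carrier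
      mon m e = at-point e m 1#
      -- A monomial is the squarefree monomial of its support times the remaining factor.
      mon-eq : ∀ m → mulMon (zipWith _∸_ m (indᵥ (supp m))) (monoF (supp m)) ≋ mon m
      mon-eq m e = case VecP.≡-dec ℕ._≟_ e m of λ where
          (yes ≡.refl) → trans (≡⇒≈ (≡.cong (λ b → if b then monoF (supp m) (zipWith _∸_ m q) else 0#) (≤⇒leqᴹ q m (λ u → ℕP.≤-trans (ℕP.≤-reflexive (lookup-∸ m (indᵥ (supp m)) u)) (ℕP.m∸n≤m (lookup m u) (lookup (indᵥ (supp m)) u))))))
              (trans (≡⇒≈ (≡.cong (λ b → if b then 1# else 0#) (dec-true (VecP.≡-dec ℕ._≟_ (zipWith _∸_ m q) (indᵥ (supp m))) mq))) (≡⇒≈ (≡.sym (at-on {m} {m} 1# ≡.refl))))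
          (no ne) → trans (case leqᴹ {n} q e Bool.≟ true of λ where
              (no p) → ≡⇒≈ (≡.cong (λ b → if b then monoF (supp m) (zipWith _∸_ e q) else 0#) (¬true p))
              (yes p) → trans (≡⇒≈ (≡.cong (λ b → if b then monoF (supp m) (zipWith _∸_ e q) else 0#) p)) (≡⇒≈ (≡.cong (λ b → if b then 1# else 0#)
                (dec-false (VecP.≡-dec ℕ._≟_ (zipWith _∸_ e q) (indᵥ (supp m))) (λ r → ne (vext (λ u → ≡.trans (≡.sym (ℕP.m∸n+n≡m (leqᴹ⇒≤ q e p u)))
                   (≡.trans (≡.cong₂ ℕ._+_ (≡.trans (≡.sym (lookup-∸ e q u)) (≡.cong (λ z → lookup z u) r)) (lookup-∸ m (indᵥ (supp m)) u)) (ℕP.m+[n∸m]≡n (ind-supp-≤ m u)))))))))) (≡⇒≈ (≡.sym (at-off 1# ne)))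
        where
        q = zipWith _∸_ m (indᵥ (supp m))
        mq : zipWith _∸_ m q ≡ indᵥ (supp m)
        mq = vext (λ u → ≡.trans (lookup-∸ m q u) (≡.trans (≡.cong (lookup m u ∸_) (lookup-∸ m (indᵥ (supp m)) u)) (ℕP.m∸[m∸n]≡n (ind-supp-≤ m u))))
      mon∈ : ∀ m → IdealSR Δ Θ (λ e → defect m * mon m e)
      mon∈ m = case Δ (supp m) Bool.≟ true of λ where
        (yes p) → ≈∈ Ideal-sub (λ e → sym (trans (*-congʳ (≡⇒≈ (≡.cong (λ b → if b then 0# else f m - coeff-of y m) p))) (zeroˡ _))) (0∈ Ideal-sub)
        (no p) → *∈ Ideal-sub (defect m) (≈∈ Ideal-sub (mon-eq m) (generator∈ (zipWith _∸_ m (indᵥ (supp m))) {monoF (supp m)} (lift (inj₁ (supp m , ¬true p , λ e → refl)))))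
      part₂ : IdealSR Δ Θ (λ e → ∑ {N₂} (λ l → defect (En.en k l) * mon (En.en k l) e))
      part₂ = Σ∈ Ideal-sub (λ l → mon∈ (En.en k l))
      eval₁ : ∀ e → Vec.sum e ≡ k → ∑ {N₁} (λ l → ∑ (λ j → y (En.en k' l) j * mulMon (En.en k' l) (linForm (Θ j)) e)) ≈ coeff-of y e
      eval₁ e p = begin
        ∑ {N₁} (λ l → ∑ (λ j → y (En.en k' l) j * mulMon (En.en k' l) (linForm (Θ j)) e))
          ≈⟨ sum-cong (λ l → trans (sum-cong (λ j → trans (*-congˡ (mulMon-linForm (En.en k' l) (Θ j) e)) (sym (sum-* _ _)))) (sum-swap _)) ⟩
        ∑ {N₁} (λ l → ∑ (λ w → ∑ (λ j → y (En.en k' l) j * at-point e (inc w (En.en k' l)) (Θ j w))))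
          ≈⟨ trans (sum-swap _) (sum-cong (λ w → by-vertex w (0 ℕ.<? lookup e w))) ⟩
        coeff-of y e ∎
        where
        by-vertex : ∀ w → Dec (0 < lookup e w) → ∑ {N₁} (λ l → ∑ (λ j → y (En.en k' l) j * at-point e (inc w (En.en k' l)) (Θ j w)))
                     ≈ gate e w (∑ (λ j → Θ j w * y (updateAt e w ℕ.pred) j))
        by-vertex w (no q) = trans (sum-0 (λ l → sum-0 (λ j → trans (*-congˡ (≡⇒≈ (at-off (Θ j w) (λ r → q (≡.subst (λ z → 0 < lookup z w) (≡.sym r) (inc-posᵥ (En.en k' l) w)))))) (zeroʳ _)))) (≡⇒≈ (≡.sym (gate-neg q)))
        by-vertex w (yes q) = trans (sum-cong (λ l → case VecP.≡-dec ℕ._≟_ e⁻ (En.en k' l) of λ where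
              (yes r) → trans (sum-cong (λ j → trans (*-congˡ (≡⇒≈ (at-on (Θ j w) (pred⇒inc (En.en k' l) e w q r)))) (*-comm _ _))) (≡⇒≈ (≡.sym (at-on (∑ (λ j → Θ j w * y (En.en k' l) j)) r)))
              (no r) → trans (sum-0 (λ j → trans (*-congˡ (≡⇒≈ (at-off (Θ j w) (λ r' → r (≡.trans (≡.cong (λ z → updateAt z w ℕ.pred) r') (pred-incᵥ (En.en k' l) w)))))) (zeroʳ _))) (≡⇒≈ (≡.sym (at-off (∑ (λ j → Θ j w * y (En.en k' l) j)) r)))))
            (trans (sum-at k' (λ m → ∑ (λ j → Θ j w * y m j)) e⁻ (≡.trans (≡.cong ℕ.pred (≡.trans (≡.sym (sum-inc e⁻ w)) (≡.cong Vec.sum (inc-pred e w q)))) (≡.cong ℕ.pred p))) (≡⇒≈ (≡.sym (gate-pos q))))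
          where e⁻ = updateAt e w ℕ.pred
      eval₂ : ∀ e → Vec.sum e ≡ k → ∑ {N₂} (λ l → defect (En.en k l) * mon (En.en k l) e) ≈ defect e
      eval₂ e p = trans (sum-cong (λ l → case VecP.≡-dec ℕ._≟_ e (En.en k l) of λ where
          (yes r) → trans (*-congˡ (≡⇒≈ (at-on 1# r))) (trans (*-identityʳ _) (≡⇒≈ (≡.sym (at-on (defect (En.en k l)) r))))
          (no r) → trans (*-congˡ (≡⇒≈ (at-off 1# r))) (trans (zeroʳ _) (≡⇒≈ (≡.sym (at-off (defect (En.en k l)) r)))))) (sum-at k defect e p)
      off₁ : ∀ e → ¬ Vec.sum e ≡ k → ∀ l j → y (En.en k' l) j * mulMon (En.en k' l) (linForm (Θ j)) e ≈ 0#
      off₁ e p l j = case suc (Vec.sum (En.en k' l)) ℕ.≟ k of λ where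
        (no r) → trans (*-congʳ (yz _ j r)) (zeroˡ _)
        (yes r) → trans (*-congˡ (trans (mulMon-linForm (En.en k' l) (Θ j) e) (sum-0 (λ w → ≡⇒≈ (at-off (Θ j w) (λ s → p (≡.trans (≡.cong Vec.sum s) (≡.trans (sum-inc (En.en k' l) w) r)))))))) (zeroʳ _)
      same : ∀ e → ∑ {N₁} (λ l → ∑ (λ j → y (En.en k' l) j * mulMon (En.en k' l) (linForm (Θ j)) e)) + ∑ {N₂} (λ l → defect (En.en k l) * mon (En.en k l) e) ≈ f e
      same e = case Vec.sum e ℕ.≟ k of λ where
        (yes p) → trans (+-cong (eval₁ e p) (eval₂ e p)) (case Δ (supp e) Bool.≟ true of λ where
          (yes q) → trans (+-congˡ (≡⇒≈ (≡.cong (λ b → if b then 0# else f e - coeff-of y e) q))) (trans (+-identityʳ _) (sym (h e p q)))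
          (no q) → trans (+-congˡ (≡⇒≈ (≡.cong (λ b → if b then 0# else f e - coeff-of y e) (¬true q)))) (solve 2 (λ a b → a :+ (b :- a) := b) refl _ _))
        (no p) → trans (+-cong (sum-0 (λ l → sum-0 (λ j → off₁ e p l j))) (sum-0 (λ l → trans (*-congˡ (≡⇒≈ (at-off 1# (λ r → p (≡.trans (≡.cong Vec.sum r) (proj₁ (En.en∈ k l))))))) (zeroʳ _)))) (trans (+-identityˡ _) (sym (z e p)))

  -- The Koszul complex of the face ring

  module Koszul {n d : ℕ} (Θ : Fin d → Fin n → Carrier) (i : ℕ)
    (Δ : Subset n → Bool) (cxV : IsComplexOnV Δ) where
    private
      cx : IsComplex Δ
      cx = proj₁ cxV
    open TotalComplex Θ i
    open Localisation Θ i Δ cx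
    open Ideals Θ Δ cx

    private
      -- Coefficients obtained from ideal membership need not be homogeneous; dropping all but one
      -- degree does not affect the products in the degree above.
      restrict-deg : ℕ → (Vec ℕ n → Fin d → Carrier) → Vec ℕ n → Fin d → Carrier
      restrict-deg k y m j = if does (suc (Vec.sum m) ℕ.≟ k) then y m j else 0#

      restrict-on : ∀ {k} y {m} j → suc (Vec.sum m) ≡ k → restrict-deg k y m j ≡ y m j
      restrict-on {k} y {m} j p = ≡.cong (λ b → if b then y m j else 0#) (dec-true (suc (Vec.sum m) ℕ.≟ k) p)

      restrict-off : ∀ {k} y {m} j → ¬ suc (Vec.sum m) ≡ k → restrict-deg k y m j ≡ 0#
      restrict-off {k} y {m} j p = ≡.cong (λ b → if b then y m j else 0#) (dec-false (suc (Vec.sum m) ℕ.≟ k) p)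

      restrict-coeff : ∀ {k} y e → Vec.sum e ≡ k → coeff-of (restrict-deg k y) e ≈ coeff-of y e
      restrict-coeff {k} y e p = coeff-cong {restrict-deg k y} {y} e (λ w q j → ≡⇒≈ (restrict-on {k} y {updateAt e w ℕ.pred} j (≡.trans (sum-pred e w q) p)))

    coeff-gate : ∀ y e → coeff-of y e ≈ ∑ (λ w → if does (0 ℕ.<? lookup e w) then ∑ (λ j → θ w j * y (updateAt e w ℕ.pred) j) else 0#)
    coeff-gate y e = sum-cong (λ w → ≡⇒≈ (gate-def e w _))

    -- Basis elements of k[Δ]/(Θ) have bounded degree, so a high power of x_v lies in the ideal.
    nilpotent : LSOP Δ Θ → ∀ v → Nilpotent v
    nilpotent (r , bs , bP , _ , spn) v = record
        { N = N ; y = y' ; y-deg = λ e j p → ≡⇒≈ (restrict-off y j (λ q → p (ℕP.suc-injective q)))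
        ; expand = λ e p f ne → trans (sym (coeff-gate y' e)) (trans (restrict-coeff y e p) (trans (sym (hy e f)) (trans (value e p) (≡⇒≈ (at-off 1# ne)))))
        ; top = trans (sym (coeff-gate y' pw)) (trans (restrict-coeff y pw pw-sum) (trans (sym (hy pw pw-face)) (trans (value pw pw-sum) (≡⇒≈ (at-on 1# ≡.refl))))) }
      where
      bound : ∀ {r} (L : Fin r → List (Vec ℕ n)) → Σ ℕ λ N → ∀ j e → e LMem.∈ L j → Vec.sum e ≤ N
      bound {zero}  L = 0 , λ ()
      bound {suc r} L = let (N , p) = bound (L ∘ suc) ; (M , q) = bl (L zero) in
        N ℕ.+ M , λ { zero e m → ℕP.≤-trans (q e m) (ℕP.m≤n+m M N) ; (suc j) e m → ℕP.≤-trans (p j e m) (ℕP.m≤m+n N M) }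
        where
        bl : ∀ L → Σ ℕ λ M → ∀ e → e LMem.∈ L → Vec.sum e ≤ M
        bl []      = 0 , λ _ ()
        bl (x ∷ L) = let (M , q) = bl L in Vec.sum x ℕ.+ M , λ { e (here ≡.refl) → ℕP.m≤m+n _ M ; e (there m) → ℕP.≤-trans (q e m) (ℕP.m≤n+m M _) }
      bd = bound (λ j → proj₁ (lower (bP j)))
      N = proj₁ bd
      pw = powᵥ v (suc N)
      mono : V (Vec ℕ n)
      mono e = at-point e pw 1#
      mono-poly : Poly mono
      mono-poly = lift (pw ∷ [] , λ e ne → ≡⇒≈ (at-off 1# (λ p → ne (here p))))
      sp = spn mono mono-poly
      rem : V (Vec ℕ n)
      rem e = mono e - linComb (proj₁ sp) bs e
      ic = ideal-coefficients rem (proj₂ sp)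
      y = proj₁ ic
      hy = proj₂ ic
      y' = restrict-deg (suc N) y
      value : ∀ e → Vec.sum e ≡ suc N → rem e ≈ mono e
      value e p = trans (+-congˡ (trans (-‿cong (trans (lc∑ (proj₁ sp) bs e) (sum-0 (λ j → trans (*-congˡ (proj₂ (lower (bP j)) e (λ m → ℕP.1+n≰n (≡.subst (_≤ N) p (proj₂ bd j e m))))) (zeroʳ _))))) -0#≈0#)) (+-identityʳ _)
      pw-sum : Vec.sum pw ≡ suc N
      pw-sum = go v
        where
        zeros : ∀ k → Vec.sum (replicate k 0) ≡ 0
        zeros zero    = ≡.refl
        zeros (suc k) = zeros k
        go : ∀ {k} (v : Fin k) → Vec.sum (powᵥ v (suc N)) ≡ suc N
        go {suc k} zero    = ≡.trans (≡.cong (suc N ℕ.+_) (zeros k)) (ℕP.+-identityʳ _)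
        go {suc k} (suc v) = go v
      pw-face : Δ (supp pw) ≡ true
      pw-face = Complex-down cx (λ u p → case u Fin.≟ v of λ where
        (yes ≡.refl) → VecP.[]=⇒lookup (SubP.x∈⁅x⁆ v)
        (no ne) → ⊥-elim (ℕP.<-irrefl (≡.sym (≡.trans (VecP.lookup∘update′ ne (replicate n 0) (suc N)) (VecP.lookup-replicate u 0))) (supp-true pw u p))) (proj₂ cxV v)

    module _ (nl : ∀ v → Nilpotent v) where
      -- In Σ y_j θ_j the monomial x_v^(N+1) arises only as x_v times x_v^N, so the coefficients of
      -- `y` at x_v^N pair to one with θ(v).
      dual : Fin n → Fin d → Carrier
      dual v j = Nilpotent.y (nl v) (powᵥ v (Nilpotent.N (nl v))) j

      dual-pairing : ∀ v → ∑ (λ j → θ v j * dual v j) ≈ 1#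
      dual-pairing v = trans (sym (trans (sum-single _ v (λ w ne → ≡⇒≈ (≡.cong (λ b → if b then ∑ (λ j → θ w j * y (updateAt (powᵥ v (suc N)) w ℕ.pred) j) else 0#) (dec-false (0 ℕ.<? lookup (powᵥ v (suc N)) w)
          (λ p → ℕP.<-irrefl (≡.sym (≡.trans (VecP.lookup∘update′ ne (replicate n 0) (suc N)) (VecP.lookup-replicate w 0))) p)))))
        (trans (≡⇒≈ (≡.cong (λ b → if b then ∑ (λ j → θ v j * y (updateAt (powᵥ v (suc N)) v ℕ.pred) j) else 0#) (dec-true (0 ℕ.<? lookup (powᵥ v (suc N)) v) (≡.subst (0 <_) (≡.sym (VecP.lookup∘update v (replicate n 0) (suc N))) (s≤s z≤n)))))
          (≡⇒≈ (≡.cong (λ m → ∑ (λ j → θ v j * y m j)) (VecP.updateAt-updateAt v (replicate n 0))))))) top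
        where open Nilpotent (nl v)

    opaque
      kz : Mask n
      kz = Without E₁ okᵐ (allFin n)

      kz-def : kz ≡ Without E₁ okᵐ (allFin n)
      kz-def = ≡.refl

      kz-elim : ∀ {F a} → kz F a ≡ true → F ≡ ∅ × (∀ u → + 0 ℤ.≤ lookup a u) × Δ (mrg ∅ a) ≡ true
      kz-elim {F} {a} e = let (o , w) = Without-elim E₁ (allFin n) e
                              F≡ : F ≡ ∅
                              F≡ = sub-ext F ∅ (λ u p → ⊥-elim (true≢false p (w (∈-allFin u)))) (λ u p → ⊥-elim (true≢false p (lookup-⊥ u))) in
        F≡ , (λ u → ok-nonneg o u (w (∈-allFin u))) , ≡.subst (λ G → Δ (mrg G a) ≡ true) F≡ (ok-face o)

      kz-intro : ∀ {a} → (∀ u → + 0 ℤ.≤ lookup a u) → Δ (mrg ∅ a) ≡ true → kz ∅ a ≡ true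
      kz-intro {a} p f = Without-intro E₁ (allFin n) (ok-intro (λ u _ → p u) f) (λ {v} _ → lookup-⊥ v)

    kz-toℤ : ∀ e → Δ (supp e) ≡ true → kz ∅ (toℤ e) ≡ true
    kz-toℤ e f = kz-intro (λ u → ≡.subst (+ 0 ℤ.≤_) (≡.sym (lookup-toℤ e u)) (ℤ.+≤+ z≤n)) (≡.trans (≡.cong Δ (mrg-toℤ e)) f)

    -- Matching on a shape replaces a nonnegative multidegree by the exponent vector it comes from.
    data Shape : Subset n → Vec ℤ n → Set where
      shape : ∀ e → Δ (supp e) ≡ true → Shape ∅ (toℤ e)

    kz-shape : ∀ {F a} → kz F a ≡ true → Shape F a
    kz-shape {F} {a} e with kz-elim {F} {a} e
    ... | ≡.refl , p , f = ≡.subst (Shape ∅) (toℤ-abs a p) (shape (absᵥ a) (≡.trans (≡.cong Δ (≡.trans (≡.sym (mrg-toℤ (absᵥ a))) (≡.cong (mrg ∅) (toℤ-abs a p)))) f))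

    gr-kz : ∀ {q} {S : Subset d} {e : Vec ℕ n} → Gr (suc q) ∅ S (toℤ e) → ∣ S ∣ ≡ q × Vec.sum e ℕ.+ ∣ S ∣ ≡ i
    gr-kz {q} {S} {e} (g , h) = ≡.sym (ℕP.suc-injective (≡.trans (≡.cong (ℕ._+ suc q) (≡.sym (∣∅∣≡0 n))) g)) ,
      ℤP.+-injective (≡.trans (ℤP.pos-+ (Vec.sum e) ∣ S ∣) (≡.trans (≡.cong (ℤ._+ + ∣ S ∣) (≡.sym (sum-map+ e))) h))

    kz-gr : ∀ {q} {S : Subset d} {e : Vec ℕ n} → ∣ S ∣ ≡ q → Vec.sum e ℕ.+ ∣ S ∣ ≡ i → Gr (suc q) ∅ S (toℤ e)
    kz-gr {q} {S} {e} p h = ≡.trans (≡.cong (ℕ._+ suc q) (∣∅∣≡0 n)) (≡.cong suc (≡.sym p)) ,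
      ≡.trans (≡.cong (ℤ._+ + ∣ S ∣) (sum-map+ e)) (≡.trans (≡.sym (ℤP.pos-+ (Vec.sum e) ∣ S ∣)) (≡.cong +_ h))

    -- A basis consists of the e_S x^e with `S` of size `q` and `e` supported on a face; since e_S
    -- has internal degree `q`, the monomial has degree `i ∸ q`.
    Koszul-dim : ∀ q → q ≤ i → Dim (Cx kz (suc q)) Zero ((d C q) ℕ.* cnt n Δ (i ∸ q))
    Koszul-dim q l = Supp-dim (In? kz (suc q)) (Card-image (λ (S , e) → ∅ , S , toℤ e)
      (λ {(S , e)} {(S' , e')} p → ≡.cong₂ _,_ (≡.cong (λ (F , S , a) → S) p) (≡.trans (≡.sym (abs-toℤ e)) (≡.trans (≡.cong (λ (F , S , a) → absᵥ a) p) (abs-toℤ e'))))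
      (λ {(S , e)} (p , h , f) → kz-toℤ e f , kz-gr {q} {S} {e} p (≡.trans (≡.cong₂ ℕ._+_ h p) (ℕP.m∸n+n≡m l)))
      (λ {(F , S , a)} (k , g) → back F S a g (kz-shape {F} {a} k))
      (Card-× (Card-size d q) (Card-monomials n Δ (i ∸ q))))
      where
      back : ∀ F S a → Gr (suc q) F S a → Shape F a → Σ (Subset d × Vec ℕ n) λ (S' , e) → (∣ S' ∣ ≡ q × Vec.sum e ≡ i ∸ q × Δ (supp e) ≡ true) × (∅ , S' , toℤ e) ≡ (F , S , a)
      back .∅ S .(toℤ e) g (shape e f) = let (p , h) = gr-kz {q} {S} {e} g in
        (S , e) , (p , ≡.trans (≡.sym (ℕP.m+n∸n≡m (Vec.sum e) q)) (≡.cong (_∸ q) (≡.trans (≡.cong (Vec.sum e ℕ.+_) (≡.sym p)) h)) , f) , ≡.refl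

    Koszul-vanishes : ∀ q → i < q → ∀ {X} → Cx kz (suc q) X → Zero X
    Koszul-vanishes q l (lift s) = lift (λ (F , S , a) → s _ (λ (k , g) → absurd F S a g (kz-shape {F} {a} k)))
      where
      absurd : ∀ F S a → Gr (suc q) F S a → Shape F a → ⊥
      absurd .∅ S .(toℤ e) g (shape e f) = let (p , h) = gr-kz {q} {S} {e} g in
        ℕP.<⇒≱ l (≡.subst (_≤ i) p (≡.subst (∣ S ∣ ≤_) h (ℕP.m≤n+m ∣ S ∣ (Vec.sum e))))

    -- The degree i part of k[Δ]/(Θ) is the zeroth Koszul homology.
    hilbert-iso : QIso (Hom i) (λ f → Hom i f × IdealSR Δ Θ f) (Cx kz 1) (Bd kz 1)
    hilbert-iso = record
        { φ = φ₀ ; lin = fin-lin (λ p → go-fin p (In? kz 1 p)) ; subU = Hom-sub i ; subW' = Bd-sub kz 1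
        ; toU = λ {f} _ → φ₀-Cx f
        ; toW = λ {f} _ (_ , id) → toW f id
        ; refW = λ {f} h (_ , Y , y , z) → h , refW f h Y y z
        ; surj = surj }
      where
      sel : ∀ {P : Set} → Dec P → V (Vec ℕ n) → Vec ℤ n → Carrier
      sel (yes _) f a = f (absᵥ a)
      sel (no _)  f a = 0#
      φ₀ : V (Vec ℕ n) → V Ix
      φ₀ f (F , S , a) = sel (In? kz 1 (F , S , a)) f a
      go-fin : ∀ p (r : Dec (In kz 1 p)) → IsFin (λ f → sel r f (proj₂ (proj₂ p)))
      go-fin (F , S , a) (yes _) = pt-fin (absᵥ a)
      go-fin (F , S , a) (no _)  = 0-fin
      sel-yes : ∀ {P : Set} (r : Dec P) → P → ∀ f a → sel r f a ≡ f (absᵥ a)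
      sel-yes (yes _) p f a = ≡.refl
      sel-yes (no q)  p f a = ⊥-elim (q p)
      sel-no : ∀ {P : Set} (r : Dec P) → ¬ P → ∀ f a → sel r f a ≡ 0#
      sel-no (yes p) q f a = ⊥-elim (q p)
      sel-no (no _)  q f a = ≡.refl
      φ₀-Cx : ∀ f → Cx kz 1 (φ₀ f)
      φ₀-Cx f = lift (λ (F , S , a) q → ≡⇒≈ (sel-no (In? kz 1 (F , S , a)) q f a))
      φ₀-at : ∀ f e → Vec.sum e ≡ i → Δ (supp e) ≡ true → φ₀ f (∅ , ∅ , toℤ e) ≈ f e
      φ₀-at f e p q = ≡⇒≈ (≡.trans (sel-yes (In? kz 1 (∅ , ∅ , toℤ e)) (kz-toℤ e q , kz-gr {0} {∅} {e} (∣∅∣≡0 d) (≡.trans (≡.cong₂ ℕ._+_ p (∣∅∣≡0 d)) (ℕP.+-identityʳ i))) f (toℤ e)) (≡.cong f (abs-toℤ e)))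
      D-at : ∀ Y e → Cx kz 2 Y → D Y (∅ , ∅ , toℤ e) ≈ ∑ (λ w → gate e w (ant (θ w) (λ S' → Y (∅ , S' , toℤ (updateAt e w ℕ.pred))) ∅))
      D-at Y e (lift s) = trans (D≈ Y ∅ ∅ (toℤ e)) (trans (+-cong (trans (*-congˡ (sum-0 (λ v → trans (*-congˡ (cr-∉ v _ ∅ (lookup-⊥ v))) (zeroʳ _)))) (zeroʳ _)) (κ≈ _ ∅ (toℤ e)))
        (trans (+-identityˡ _) (sum-cong (λ w → case 0 ℕ.<? lookup e w of λ where
          (yes p) → trans (≡⇒≈ (≡.cong (λ b → ant (θ w) (λ S' → Y (∅ , S' , b)) ∅) (dec-toℤ e w p))) (≡⇒≈ (≡.sym (gate-pos p)))
          (no p) → trans (fin-0 (ant-fin (θ w) ∅) (λ S' → s _ (λ (k , _) → ℤP.<⇒≱ (neg e w p) (proj₁ (proj₂ (kz-elim {∅} {dec w (toℤ e)} k)) w)))) (≡⇒≈ (≡.sym (gate-neg p)))))))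
        where
        neg : ∀ e w → ¬ 0 < lookup e w → lookup (dec w (toℤ e)) w ℤ.< + 0
        neg e w p = ≡.subst (ℤ._< + 0) (≡.sym (≡.trans (lookup-- (toℤ e) (unit w) w) (≡.cong₂ ℤ._-_ (≡.trans (lookup-toℤ e w) (≡.cong +_ (ℕP.n≤0⇒n≡0 (ℕP.≮⇒≥ p)))) (unit-refl w)))) ℤ.-<+
      on-kz : ∀ {X X'} → Cx kz 1 X → Graded 1 X' → (∀ e → Vec.sum e ≡ i → Δ (supp e) ≡ true → X (∅ , ∅ , toℤ e) ≈ X' (∅ , ∅ , toℤ e)) →
              ∀ F S a → kz F a ≡ true → X (F , S , a) ≈ X' (F , S , a)
      on-kz {X} {X'} x x' h F S a k = go F S a (kz-shape {F} {a} k)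
        where
        go : ∀ F S a → Shape F a → X (F , S , a) ≈ X' (F , S , a)
        go .∅ S .(toℤ e) (shape e f) = case Gr? 1 ∅ S (toℤ e) of λ where
          (no g) → trans (Cx⇒Graded x _ _ _ g) (sym (x' _ _ _ g))
          (yes g) → let (p , q) = gr-kz {0} {S} {e} g in
            ≡.subst (λ S → X (∅ , S , toℤ e) ≈ X' (∅ , S , toℤ e)) (≡.sym (size-zero-∅ S p)) (h e (≡.trans (≡.sym (ℕP.+-identityʳ _)) (≡.trans (≡.cong (Vec.sum e ℕ.+_) (≡.sym p)) q)) f)
      toW : ∀ f → IdealSR Δ Θ f → Bd kz 1 (φ₀ f)
      toW f id = φ₀-Cx f , Y , yc , on-kz (φ₀-Cx f) (D-Graded (Cx⇒Graded yc)) (λ e p q → trans (φ₀-at f e p q) (trans (hy e q) (sym (trans (D-at Y e yc) (sum-cong (λ w → case 0 ℕ.<? lookup e w of λ where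
          (no r) → trans (≡⇒≈ (gate-neg r)) (≡⇒≈ (≡.sym (gate-neg r)))
          (yes r) → trans (≡⇒≈ (gate-pos r)) (trans (slice (updateAt e w ℕ.pred) w (≡.trans (sum-pred e w r) p) (Complex-down cx (λ u h → supp-intro e u (ℕP.<-≤-trans (supp-true (updateAt e w ℕ.pred) u h) (pred-≤ e w u))) q)) (≡⇒≈ (≡.sym (gate-pos r))))))))))
        where
        ic = ideal-coefficients f id
        y = proj₁ ic
        hy = proj₂ ic
        -- The chain Σ y_j e_j, written as multiplication of the exterior unit so that `ant-crt`
        -- evaluates its contraction.
        raw : Subset d → Vec ℤ n → Carrier
        raw S a = crt (y (absᵥ a)) (indicator ∅) S
        selY : ∀ {P : Set} → Dec P → Carrier → Carrier
        selY (yes _) x = x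
        selY (no _)  x = 0#
        selY-yes : ∀ {P : Set} (r : Dec P) → P → ∀ x → selY r x ≡ x
        selY-yes (yes _) p x = ≡.refl
        selY-yes (no q)  p x = ⊥-elim (q p)
        selY-no : ∀ {P : Set} (r : Dec P) → ¬ P → ∀ x → selY r x ≡ 0#
        selY-no (yes p) q x = ⊥-elim (q p)
        selY-no (no _)  q x = ≡.refl
        Y : V Ix
        Y (F , S , a) = selY (In? kz 2 (F , S , a)) (raw S a)
        yc : Cx kz 2 Y
        yc = lift (λ (F , S , a) q → ≡⇒≈ (selY-no (In? kz 2 (F , S , a)) q (raw S a)))
        pred-≤ : ∀ {k} (e : Vec ℕ k) w u → lookup (updateAt e w ℕ.pred) u ≤ lookup e u
        pred-≤ (x ∷ e) zero    zero    = ℕP.pred[n]≤n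
        pred-≤ (x ∷ e) zero    (suc u) = ℕP.≤-refl
        pred-≤ (x ∷ e) (suc w) zero    = ℕP.≤-refl
        pred-≤ (x ∷ e) (suc w) (suc u) = pred-≤ e w u
        raw-off : ∀ S a → ¬ ∣ S ∣ ≡ 1 → raw S a ≈ 0#
        raw-off S a q = sum-0 (λ j → trans (*-congˡ (cr-loc j _ S (λ e → indicator-off ∅ (λ r → q (≡.trans (≡.sym (size-remove j S e)) (≡.cong suc (≡.trans (≡.cong ∣_∣ r) (∣∅∣≡0 d)))))))) (zeroʳ _))
        slice : ∀ m w → suc (Vec.sum m) ≡ i → Δ (supp m) ≡ true → ant (θ w) (λ S' → Y (∅ , S' , toℤ m)) ∅ ≈ ∑ (λ j → θ w j * y m j)
        slice m w p f = begin
          ant (θ w) (λ S' → Y (∅ , S' , toℤ m)) ∅        ≈⟨ fin-cong (ant-fin (θ w) ∅) (λ S' → case ∣ S' ∣ ℕ.≟ 1 of λ where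
               (yes r) → ≡⇒≈ (selY-yes (In? kz 2 (∅ , S' , toℤ m)) (kz-toℤ m f , kz-gr {1} {S'} {m} r (≡.trans (≡.cong (Vec.sum m ℕ.+_) r) (≡.trans (ℕP.+-comm (Vec.sum m) 1) p))) (raw S' (toℤ m)))
               (no r) → trans (≡⇒≈ (selY-no (In? kz 2 (∅ , S' , toℤ m)) (λ (_ , g) → r (proj₁ (gr-kz {1} {S'} {m} g))) (raw S' (toℤ m)))) (sym (raw-off S' (toℤ m) r))) ⟩
          ant (θ w) (crt (y (absᵥ (toℤ m))) (indicator ∅)) ∅   ≈⟨ ≡⇒≈ (≡.cong (λ m' → ant (θ w) (crt (y m') (indicator ∅)) ∅) (abs-toℤ m)) ⟩
          ant (θ w) (crt (y m) (indicator ∅)) ∅          ≈⟨ sym (trans (+-congˡ (fin-0 (crt-fin (y m) ∅) (λ S → sum-0 (λ j → trans (*-congˡ (an-loc j _ S (λ e → indicator-off ∅ (λ r → case ≡.trans (≡.sym (size-add j S e)) (≡.trans (≡.cong ∣_∣ r) (∣∅∣≡0 d)) of λ ())))) (zeroʳ _))))) (+-identityʳ _)) ⟩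
          _                                              ≈⟨ ant-crt (θ w) (y m) (indicator ∅) ∅ ⟩
          ∑ (λ j → θ w j * y m j) * indicator ∅ ∅        ≈⟨ trans (*-congˡ (indicator-on ∅)) (*-identityʳ _) ⟩
          ∑ (λ j → θ w j * y m j) ∎
      refW : ∀ f → Hom i f → ∀ Y → Cx kz 2 Y → (∀ F S a → kz F a ≡ true → φ₀ f (F , S , a) ≈ D Y (F , S , a)) → IdealSR Δ Θ f
      refW f (_ , z) Y yc h = coefficients-ideal i f y z
          (λ m j q → lower yc _ (λ (_ , g) → let (a , b) = gr-kz {1} {∅ [ j ]≔ true} {m} g in q (≡.trans (≡.sym (ℕP.+-comm (Vec.sum m) 1)) (≡.trans (≡.cong (Vec.sum m ℕ.+_) (≡.sym a)) b)) ))
          (λ e p q → trans (sym (φ₀-at f e p q)) (trans (h ∅ ∅ (toℤ e) (kz-toℤ e q)) (trans (D-at Y e yc) (sum-cong (λ w → case 0 ℕ.<? lookup e w of λ where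
            (no r) → trans (≡⇒≈ (gate-neg r)) (≡⇒≈ (≡.sym (gate-neg r)))
            (yes r) → trans (≡⇒≈ (gate-pos r)) (trans (sum-cong (λ j → *-congˡ (an-∅ j _))) (≡⇒≈ (≡.sym (gate-pos r)))))))))
        where
        y : Vec ℕ n → Fin d → Carrier
        y m j = Y (∅ , ∅ [ j ]≔ true , toℤ m)
        an-∅ : ∀ {k} (j : Fin k) X → an j X ∅ ≈ X (∅ [ j ]≔ true)
        an-∅ zero    X = refl
        an-∅ (suc j) X = an-∅ j (λ G → X (false ∷ G))
      surj : ∀ X → Cx kz 1 X → Σ (V (Vec ℕ n)) λ f → Hom i f × Bd kz 1 (λ j → X j - φ₀ f j)
      surj X x = f , Hom-list i f (λ e p → lower x _ (λ (_ , g) → p (≡.trans (≡.sym (ℕP.+-identityʳ _)) (≡.trans (≡.cong (Vec.sum e ℕ.+_) (≡.sym (∣∅∣≡0 d))) (proj₂ (gr-kz {0} {∅} {e} g)))))) ,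
          ≈∈ (Bd-sub kz 1) (λ (F , S , a) → sym (trans (+-congʳ (case kz F a Bool.≟ true of λ where
            (yes k) → on-kz x (Cx⇒Graded (φ₀-Cx f)) (λ e p q → sym (φ₀-at f e p q)) F S a k
            (no k) → trans (lower x (F , S , a) (λ (k' , _) → k k')) (sym (lower (φ₀-Cx f) (F , S , a) (λ (k' , _) → k k'))))) (-‿inverseʳ _))) (0∈ (Bd-sub kz 1))
        where
        f : V (Vec ℕ n)
        f e = X (∅ , ∅ , toℤ e)

  -- The Euler characteristic of the Koszul complex

  module EulerCharacteristic {n d : ℕ} (Θ : Fin d → Fin n → Carrier) (i : ℕ)
    (Δ : Subset n → Bool) (cxV : IsComplexOnV Δ) where
    open TotalComplex Θ i
    open Localisation Θ i Δ (proj₁ cxV)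
    open Layers Θ i Δ (proj₁ cxV)
    open Koszul Θ i Δ cxV

    private
      kz-convex : Convex kz
      kz-convex = ≡.subst Convex (≡.sym kz-def) (Without-convex E₁ ok-Convex (E₁-up _) (allFin n))

      ψ : V Ix → V Ix
      ψ X = cut kz (D X)

      ψ-lin : Lin ψ
      ψ-lin = record
        { φ-cong = λ e → φ-cong (cut-lin kz) (φ-cong D-lin e)
        ; φ-+ = λ x y j → trans (φ-cong (cut-lin kz) (φ-+ D-lin x y) j) (φ-+ (cut-lin kz) (D x) (D y) j)
        ; φ-* = λ k x j → trans (φ-cong (cut-lin kz) (φ-* D-lin k x) j) (φ-* (cut-lin kz) k (D x) j) }

      ψ-Cx : ∀ {m X} → Cx kz (suc m) X → Cx kz m (ψ X)
      ψ-Cx x = Graded⇒Cx kz (D-Graded (Cx⇒Graded x))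

      ψ-zero : ∀ {X} → (∀ F S a → kz F a ≡ true → D X (F , S , a) ≈ 0#) → Zero (ψ X)
      ψ-zero {X} z = lift (λ (F , S , a) → case kz F a Bool.≟ true of λ where
        (yes e) → trans (≡⇒≈ (cut-true kz (D X) e)) (z F S a e)
        (no e) → ≡⇒≈ (cut-false kz (D X) (¬true e)))

      ψ-Bd : ∀ {m X} → Bd kz (suc m) X → Zero (ψ X)
      ψ-Bd b = ψ-zero (proj₂ (Bd⇒Z kz-convex b))

      Kernel⇒Z : ∀ {m X} → Kernel ψ (Cx kz m) Zero X → Z kz m X
      Kernel⇒Z {m} {X} (x , lift z) = x , λ F S a k → trans (≡⇒≈ (≡.sym (cut-true kz (D X) k))) (z (F , S , a))

      Image⇒Bd : ∀ {m X} → Image ψ (Cx kz (suc m)) (Cx kz m) Zero X → Bd kz m X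
      Image⇒Bd {m} {X} (x , Y , y , lift z) = x , Y , y , λ F S a k →
        trans (solve 2 (λ a b → a := (a :- b) :+ b) refl (X (F , S , a)) (ψ Y (F , S , a))) (trans (+-congʳ (z (F , S , a))) (trans (+-identityˡ _) (≡⇒≈ (cut-true kz (D Y) k))))

      Bd⇒Image : ∀ {m X} → Bd kz m X → Image ψ (Cx kz (suc m)) (Cx kz m) Zero X
      Bd⇒Image {m} {X} (x , Y , y , e) = x , Y , y , lift (λ (F , S , a) → case kz F a Bool.≟ true of λ where
        (yes k) → trans (+-congˡ (-‿cong (trans (≡⇒≈ (cut-true kz (D Y) k)) (sym (e F S a k))))) (-‿inverseʳ _)
        (no k) → trans (+-cong (lower x (F , S , a) (λ (k' , _) → k k')) (-‿cong (≡⇒≈ (cut-false kz (D Y) (¬true k))))) (-‿inverseʳ _))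

      N : ℕ → ℕ
      N q = (d C q) ℕ.* cnt n Δ (i ∸ q)

    -- Degree -1 would require a nonempty face, and the Koszul part has none.
    Koszul-Z₁ : ∀ {X} → Cx kz 1 X → Z kz 1 X
    Koszul-Z₁ {X} x = x , λ F S a k → D-Graded (Cx⇒Graded x) F S a (λ (g , _) → case ≡.trans (≡.sym (≡.trans (≡.cong (λ G → ∣ G ∣ ℕ.+ 0) (proj₁ (kz-elim {F} {a} k))) (≡.trans (ℕP.+-identityʳ _) (∣∅∣≡0 n)))) g of λ ())

    -- `E` has to be correct only where a dimension exists; existence itself comes from the tower
    -- under double negation.
    module _ (E : ℕ → ℕ) (hE : ∀ q → 1 ≤ q → q ≤ i → ∀ {e} → Dim (Z kz (suc q)) (Bd kz (suc q)) e → e ≡ E q) where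
      -- Descending induction from the last nonzero term. The differential induces a map from the
      -- cokernel at `suc q` to the term at `q`; its kernel is the homology at `suc q` and its
      -- cokernel is the next one in the tower.
      Koszul-tower : ∀ k q → q ℕ.+ k ≡ i → DN (Σ ℕ λ r → Dim (Cx kz (suc q)) (Bd kz (suc q)) r ×
        + r ≡ alt (λ j → + N (q ℕ.+ j)) k ℤ.+ alt′ (λ j → + E (suc (q ℕ.+ j))) k)
      Koszul-tower zero q e = return (N q ,
          Dim-≐ id id (Zero-min (Bd-sub kz (suc q))) (λ {X} → bd0 {X}) (Koszul-dim q (ℕP.≤-reflexive q≡i)) ,
          ≡.trans (≡.cong (λ p → + N p) (≡.sym (ℕP.+-identityʳ q))) (≡.sym (ℤP.+-identityʳ _)))
        where
        q≡i : q ≡ i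
        q≡i = ≡.trans (≡.sym (ℕP.+-identityʳ q)) e
        bd0 : ∀ {X} → Bd kz (suc q) X → Zero X
        bd0 {X} (x , Y , y , h) = lift (λ (F , S , a) → case kz F a Bool.≟ true of λ where
          (yes k) → trans (h F S a k) (trans (φ-cong D-lin (lower (Koszul-vanishes (suc q) (ℕP.≤-reflexive (≡.cong suc (≡.sym q≡i))) y)) (F , S , a)) (φ-0 D-lin _))
          (no k) → lower x (F , S , a) (λ (k' , _) → k k'))
      Koszul-tower (suc k) q e = do
          (r , dr , er) ← Koszul-tower k (suc q) (≡.trans (≡.sym (ℕP.+-suc q k)) e)
          R ← rank-lemma ψ-lin {Cx kz (suc (suc q))} {Bd kz (suc (suc q))} {Cx kz (suc q)} {Zero} Supp-sub (Bd-sub kz (suc (suc q))) Supp-sub Zero-sub proj₁ (Zero-min Supp-sub)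
                ψ-Cx ψ-Bd dr (Koszul-dim q (ℕP.≤-trans (ℕP.m≤m+n q (suc k)) (ℕP.≤-reflexive e)))
          return (finish r er R)
        where
        finish : ∀ r → + r ≡ alt (λ j → + N (suc q ℕ.+ j)) k ℤ.+ alt′ (λ j → + E (suc (suc q ℕ.+ j))) k →
                 Rank ψ (Cx kz (suc (suc q))) (Bd kz (suc (suc q))) (Cx kz (suc q)) Zero r (N q) →
                 Σ ℕ λ r → Dim (Cx kz (suc q)) (Bd kz (suc q)) r × + r ≡ alt (λ j → + N (q ℕ.+ j)) (suc k) ℤ.+ alt′ (λ j → + E (suc (q ℕ.+ j))) (suc k)
        finish r er R = coker , Dim-≐ id id (λ {X} → Image⇒Bd {suc q} {X}) (λ {X} → Bd⇒Image {suc q} {X}) coker-dim ,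
          ≡.trans (euler coker+rank ker+rank) (≡.trans (≡.cong₂ (λ x y → x ℤ.+ (y ℤ.- + r)) (≡.cong (λ p → + N p) (≡.sym (ℕP.+-identityʳ q)))
              (≡.trans (≡.cong +_ ker≡) (≡.cong (λ p → + E (suc p)) (≡.sym (ℕP.+-identityʳ q)))))
            (≡.trans (≡.cong (λ z → + N (q ℕ.+ 0) ℤ.+ (+ E (suc (q ℕ.+ 0)) ℤ.- z)) (≡.trans er (≡.cong₂ ℤ._+_
                (alt-cong k (λ j _ → ≡.cong (λ p → + N p) (≡.sym (ℕP.+-suc q j))))
                (alt′-cong k (λ j _ → ≡.cong (λ p → + E (suc p)) (≡.sym (ℕP.+-suc q j)))))))
              (rearrange (+ N (q ℕ.+ 0)) (+ E (suc (q ℕ.+ 0))) (alt (λ j → + N (q ℕ.+ suc j)) k) (alt′ (λ j → + E (suc (q ℕ.+ suc j))) k))))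
          where
          open Rank R
          ker≡ : ker ≡ E (suc q)
          ker≡ = hE (suc q) (s≤s z≤n) (ℕP.≤-trans (ℕP.≤-trans (s≤s (ℕP.m≤m+n q k)) (ℕP.≤-reflexive (≡.sym (ℕP.+-suc q k)))) (ℕP.≤-reflexive e))
            (Dim-≐ (λ {X} → Kernel⇒Z {suc (suc q)} {X}) (λ {X} (x , z) → x , ψ-zero {X} z) id id ker-dim)
          euler : ∀ {a b r s k} → a ℕ.+ r ≡ s → k ℕ.+ r ≡ b → + a ≡ + s ℤ.+ (+ k ℤ.- + b)
          euler {a} {b} {r} {s} {k} ≡.refl ≡.refl = ≡.trans (cancel (+ a) (+ r) (+ k)) (≡.sym (≡.cong₂ (λ x y → x ℤ.+ (+ k ℤ.- y)) (ℤP.pos-+ a r) (ℤP.pos-+ k r)))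
            where
            cancel : ∀ a r k → a ≡ (a ℤ.+ r) ℤ.+ (k ℤ.- (k ℤ.+ r))
            cancel = solve-∀
          rearrange : ∀ x y s t → x ℤ.+ (y ℤ.- (s ℤ.+ t)) ≡ (x ℤ.- s) ℤ.+ (y ℤ.- t)
          rearrange = solve-∀

      -- The equation is between integers, hence stable under the double negation of the tower.
      hilbert-function : (∀ F → Δ F ≡ true → ∣ F ∣ ≤ d) → ∀ {r} → HilbDim Δ Θ i r → + r ≡ hvec Δ d i ℤ.+ alt′ (λ j → + E (suc j)) i
      hilbert-function dm {r} h = decidable-stable (_ ℤ.≟ _) (do
          (r' , dr , er) ← Koszul-tower i 0 ≡.refl
          return (≡.trans (≡.cong +_ (Dim-unique (Bd-sub kz 1) (Dim→ hilbert-iso (fromQDim (Hom i) (λ f → Hom i f × IdealSR Δ Θ f) h)) dr))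
            (≡.trans er (≡.cong (ℤ._+ alt′ (λ j → + E (suc j)) i) (≡.trans (alt-cong i (λ j _ → ℤP.pos-* (d C j) _)) (hvec-Σalt n Δ d dm i))))))

    module _ (nl : ∀ v → Nilpotent v) where
      Koszul→nonpositive : ∀ m {r} → Dim (Z kz (suc m)) (Bd kz (suc m)) r → Dim (Z nonpos (suc m)) (Bd nonpos (suc m)) r
      Koszul→nonpositive m {r} q = ≡.subst (λ B → Dim (Z B (suc m)) (Bd B (suc m)) r) (≡.sym nonpos-def)
        (Čech→nonpositive (allFin n) m (Koszul→Čech nl (allFin n) m (≡.subst (λ B → Dim (Z B (suc m)) (Bd B (suc m)) r) kz-def q)))

      -- With nonpositive multidegrees the internal degree is at most the exterior degree, which is
      -- at most `d`; beyond that there are no cochains at all.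
      hilbert-vanishes : d < i → ∀ {r} → HilbDim Δ Θ i r → r ≡ 0
      hilbert-vanishes l {r} h = Dim-0⁻ (Bd-sub nonpos 1) zeros
          (Koszul→nonpositive 0 (Dim-≐ (λ {X} → Koszul-Z₁ {X}) proj₁ id id (Dim→ hilbert-iso (fromQDim (Hom i) (λ f → Hom i f × IdealSR Δ Θ f) h))))
        where
        zeros : ∀ {X} → Z nonpos 1 X → Bd nonpos 1 X
        zeros {X} (x , _) = Zero-min (Bd-sub nonpos 1) (lift (λ (F , S , a) → lower x (F , S , a) (λ (k , _ , e) → ℕP.<⇒≱ l (ℤP.drop‿+≤+
          (ℤP.≤-trans (ℤP.≤-reflexive (≡.sym e)) (ℤP.+-mono-≤ (sum-nonpos a (proj₁ (nonpos-elim {F} {a} k))) (ℤ.+≤+ (SubP.∣p∣≤n S))))))))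

  -- Reduced cohomology in degree -1

  module LowCohomology {n : ℕ} {Γ : Subset n → Bool} (cx : IsComplex Γ) where
    -- The coboundary of a function on the empty face repeats its value at every vertex.
    Zc₀-vanishes : ∀ {v} → IsVertex Γ v → ∀ {x} → Zc Γ 0 x → Zero x
    Zc₀-vanishes {v} p {x} (ch , z) = lift (λ F → case ∣ F ∣ ℕ.≟ 0 of λ where
        (no q) → lower (Chain⇒Supp Γ ch) F (λ (_ , e) → q e)
        (yes q) → trans (≡⇒≈ (≡.cong x (size-zero-∅ F q))) at∅)
      where
      at∅ : x ∅ ≈ 0#
      at∅ = begin
        x ∅                                        ≈⟨ sym (trans (an-crt v 𝟙 x ∅) (*-identityˡ _)) ⟩
        an v (crt 𝟙 x) ∅ + crt 𝟙 (an v x) ∅        ≈⟨ +-cong (an-loc v (crt 𝟙 x) ∅ (λ _ → z (∅ [ v ]≔ true) (≡.trans (≡.cong Γ (≡.trans (≡.sym (∪⁅⁆≡ ∅ v)) (SubP.∪-identityˡ ⁅ v ⁆))) p)))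
                                                              (sum-0 (λ w → trans (*-congˡ (cr-∉ w (an v x) ∅ (lookup-⊥ w))) (zeroʳ _))) ⟩
        0# + 0#                                    ≈⟨ +-identityˡ _ ⟩
        0# ∎

    H₀-dim-point : (∀ F → Γ F ≡ true → ∣ F ∣ ≤ 0) → Dim (Zc Γ 0) (Bc Γ 0) 1
    H₀-dim-point sm = Dim-≐
        (λ {x} s → Supp⇒Chain Γ s , λ F f → crt-drop Γ {0} {x} (Supp⇒Chain Γ s) F (λ e → ℕP.1+n≰n (≡.subst (_≤ 0) e (sm F f))))
        (λ (ch , _) → Chain⇒Supp Γ ch)
        (Zero-min (Bc-sub Γ 0))
        (λ {x} (ch , y , pre , h) → lift (λ F → case Γ F Bool.≟ true of λ where
          (yes f) → trans (h F f) (fin-0 (crt-fin 𝟙 F) (λ G → lower pre G (λ { (_ , ()) })))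
          (no f) → lower (Chain⇒Supp Γ ch) F (λ (f' , _) → f f')))
        (Supp-dim (Face? Γ 0) (Card-1 ∅ (proj₁ cx , ∣∅∣≡0 n) (λ {F} (_ , e) → ≡.sym (size-zero-∅ F e))))

  -- Betti numbers, ranks and the formula in positive degree

  module Contributions {n d : ℕ} (Θ : Fin (suc d) → Fin n → Carrier) (I : ℕ)
    (Δ : Subset n → Bool) (cxV : IsComplexOnV Δ) (his : HIS Δ (suc d)) (ls : LSOP Δ Θ) where
    private
      cx : IsComplex Δ
      cx = proj₁ cxV
      i : ℕ
      i = suc I
      module Ko = Koszul Θ i Δ cxV
    open TotalComplex Θ i
    open Layers Θ i Δ cx
    open EulerCharacteristic Θ i Δ cxV
    private
      nl = Ko.nilpotent ls
      g = Ko.dual nl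
      g1 = Ko.dual-pairing nl
    open Singularities Θ i Δ cx g
    open TensorDimensions Θ i Δ cx g
    open Ko using (kz)

    private
      -- The vector θ(v) cannot vanish since it pairs to one with its dual, but a nonzero coordinate
      -- can be located only under double negation.
      pivot : ∀ v → DN (Σ (Fin (suc d)) λ j → ¬ (θ v j ≈ 0#))
      pivot v k = DN-Fin (λ j ne → k (j , ne)) (λ z → 1≉0 (trans (sym (g1 v)) (sum-0 (λ j → trans (*-congʳ (z j)) (zeroˡ _)))))

      RelZ⇒RelCocycles : ∀ s v {x} → RelZ (suc s) v x → RelCocycles Δ v s x
      RelZ⇒RelCocycles s v {x} (a , z) = (RelFace⇒Face (suc s) v a , λ F ne → lower a F (λ (_ , _ , l) → ne (VecP.lookup⇒[]= v F l))) ,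
        λ F f → trans (δ≈crt Δ x F) (z F f)

      RelCocycles⇒RelZ : ∀ s v {x} → RelCocycles Δ v s x → RelZ (suc s) v x
      RelCocycles⇒RelZ s v {x} ((ch , r) , z) = lift (λ F q → case lookup F v Bool.≟ true of λ where
          (yes l) → lower (Chain⇒Supp Δ ch) F (λ (f , e) → q (f , e , l))
          (no l) → r F (lookup⇒∉ (¬true l))) , λ F f → trans (sym (δ≈crt Δ x F)) (z F f)

      RelB⇒RelCoboundaries : ∀ s v {x} → RelB (suc s) v x → RelCoboundaries Δ v s x
      RelB⇒RelCoboundaries s v {x} (a , y , b , h) = (RelFace⇒Face (suc s) v a , λ F ne → lower a F (λ (_ , _ , l) → ne (VecP.lookup⇒[]= v F l))) ,
        y , (Supp⇒Chain Δ (lift (λ F q → lower b F (λ (f , e , _) → q (f , ℕP.suc-injective e)))) , λ F ne → lower b F (λ (_ , _ , l) → ne (VecP.lookup⇒[]= v F l))) ,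
        λ F f → trans (h F f) (sym (δ≈crt Δ y F))

      RelCoboundaries⇒RelB : ∀ s v {x} → RelCoboundaries Δ v s x → RelB (suc s) v x
      RelCoboundaries⇒RelB s v {x} ((ch , r) , y , (ch' , r') , h) = lift (λ F q → case lookup F v Bool.≟ true of λ where
          (yes l) → lower (Chain⇒Supp Δ ch) F (λ (f , e) → q (f , e , l))
          (no l) → r F (lookup⇒∉ (¬true l))) ,
        y , lift (λ F q → case lookup F v Bool.≟ true of λ where
          (yes l) → lower (Chain⇒Supp Δ ch') F (λ (f , e) → q (f , ≡.cong suc e , l))
          (no l) → r' F (lookup⇒∉ (¬true l))) , λ F f → trans (h F f) (δ≈crt Δ y F)

      Tens-mono : ∀ {U W : Fin n → Pr (Subset n)} → (∀ v {x} → U v x → W v x) → ∀ {y} → Tens U y → Tens W y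
      Tens-mono f t v = let (a , b , u) = t v in a , b , λ S → f v (u S)

      Φ-VT : ∀ {U : Fin n → Pr (Subset n)} {Q} → IsSub Q → (∀ v {x} → U v x → Q x) → ∀ {y} → Tens U y → VT Q (Φ y)
      Φ-VT sQ f t = (λ S F ne → sum-0 (λ v → proj₁ (t v) S F ne)) , λ S → Σ∈ sQ (λ v → f v (proj₂ (proj₂ (t v)) S))

      is : IsolatedSing Δ (suc d)
      is = proj₁ his

      lk-cx : ∀ v → IsComplex (lk Δ v)
      lk-cx v = lk-complex cx v (proj₂ cxV v)

    module _ (β : ℕ → ℕ) (hβ : ∀ m → Betti Δ m (β m)) (βlk : Fin n → ℕ → ℕ) (hlk : ∀ v m → Betti (lk Δ v) m (βlk v m)) where
      private
        b e : ℕ → ℕ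
        b = bettiΔ β βlk
        e = bettiLks β βlk (point d)

        b-dim : ∀ s → DN (Dim (Zc Δ s) (Bc Δ s) (b s))
        b-dim zero    = return (Dim-0 (Bc-sub Δ 0) (λ {x} z → Zero-min (Bc-sub Δ 0) (LowCohomology.Zc₀-vanishes cx (proj₂ (pure-vertex cx (proj₁ is))) {x} z)))
        b-dim (suc s) = cohomology-dim cx (hβ s)

        lk₀-dim : ∀ d v → Pure (lk Δ v) d → Dim (Zc (lk Δ v) 0) (Bc (lk Δ v) 0) (point d)
        lk₀-dim zero    v p = LowCohomology.H₀-dim-point (lk-cx v) (proj₁ p)
        lk₀-dim (suc d) v p = Dim-0 (Bc-sub (lk Δ v) 0) (λ {x} z → Zero-min (Bc-sub (lk Δ v) 0) (LowCohomology.Zc₀-vanishes (lk-cx v) (proj₂ (pure-vertex (lk-cx v) p)) {x} z))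

        lk-dim : ∀ s v → DN (Dim (Zc (lk Δ v) s) (Bc (lk Δ v) s) (bettiLk β βlk (point d) v s))
        lk-dim zero    v = return (lk₀-dim d v (proj₁ (proj₂ is v (proj₂ cxV v))))
        lk-dim (suc s) v = cohomology-dim (lk-cx v) (hlk v s)

        e-dim : ∀ s → DN (Dim (⨁ (RelZ s)) (⨁ (RelB s)) (e s))
        e-dim zero    = return (Dim-0 (⨁-sub (RelB-sub 0)) (λ {x} z v → Zero-min (RelB-sub 0 v)
          (lift (λ F → lower (proj₁ (z v)) F (λ (_ , p , l) → true≢false l (size-zero F p v))))))
        e-dim (suc s) = do
          ds ← DN-Fin (lk-dim s)
          return (⨁-dim (RelZ-sub (suc s)) (RelB-sub (suc s)) (λ v → RelB⇒RelZ (suc s) v)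
            (λ v → Dim-≐ (RelCocycles⇒RelZ s v) (RelZ⇒RelCocycles s v) (RelCoboundaries⇒RelB s v) (RelB⇒RelCoboundaries s v) (Dim← (rel-iso Δ v cx s) (ds v))))

        -- The numbers stand outside the record, so that a single function can be chosen for all
        -- levels at once.
        record Ranks (s : ℕ) (r : ℕ × ℕ × ℕ) : Set (c ⊔ ℓ) where
          ker = proj₁ r
          coker = proj₁ (proj₂ r)
          rank = proj₂ (proj₂ r)
          field
            ker+rank   : ker ℕ.+ rank ≡ (d C i) ℕ.* e s
            coker+rank : coker ℕ.+ rank ≡ (suc d C i) ℕ.* b s
            ker-dim    : Dim (Ker g1 s) (Tens (RelB s)) ker
            coker-dim  : Dim (VT (Zc Δ s)) (Coim g1 s) coker

        ranks : (pv : ∀ v → Σ (Fin (suc d)) λ j → ¬ (θ v j ≈ 0#)) → ∀ s → DN (Σ (ℕ × ℕ × ℕ) (Ranks s))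
        ranks pv s = do
          eD ← e-dim s
          bD ← b-dim s
          R ← rank-lemma Φ-lin {Tens (RelZ s)} {Tens (RelB s)} {VT (Zc Δ s)} {VT (Bc Δ s)} (Tens-sub (RelZ-sub s)) (Tens-sub (RelB-sub s)) (VT-sub (Zc-sub Δ s)) (VT-sub (Bc-sub Δ s))
                (Tens-mono (RelB⇒RelZ s)) (λ (p , q) → p , λ S → Bc⇒Zc Δ cx s (q S))
                (Φ-VT (Zc-sub Δ s) (RelZ⇒Zc s)) (Φ-VT (Bc-sub Δ s) (RelB⇒Bc s))
                (Tens-dim pv (RelZ-sub s) (RelB-sub s) (RelB⇒RelZ s) eD) (VT-dim (Zc-sub Δ s) (Bc-sub Δ s) (Bc⇒Zc Δ cx s) bD)
          return ((Rank.ker R , Rank.coker R , Rank.rank R) , record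
            { ker+rank = Rank.ker+rank R ; coker+rank = Rank.coker+rank R ; ker-dim = Rank.ker-dim R ; coker-dim = Rank.coker-dim R })

        -- Cocycle representatives of the kernel of ι* at `v`.
        Exc : Fin n → Pr (Subset n)
        Exc v x = RelCocycles Δ v I x × Coboundaries Δ I x

        Exc-sub : ∀ v → IsSub (Exc v)
        Exc-sub v = ∩-sub (RelCocycles-sub Δ v I) (Coboundaries-sub Δ I)

        RelCob⇒Exc : ∀ v {x} → RelCoboundaries Δ v I x → Exc v x
        RelCob⇒Exc v {x} w = RelCoboundaries⇒Cocycles Δ v cx w , Bc⇒Coboundaries Δ (RelB⇒Bc (suc I) v (RelCoboundaries⇒RelB I v w))

        -- Linear independence of the images turns membership of a sum into membership of its terms.
        split : suc (suc I) ≤ suc d → ∀ (x : Fin n → V (Subset n)) → (∀ v → RelCocycles Δ v I (x v)) → Coboundaries Δ I (λ F → ∑ (λ v → x v F)) → ∀ v → Coboundaries Δ I (x v)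
        split l x z w = proj₂ his I l x z (≈∈ (Coboundaries-sub Δ I) (λ F → ≡⇒≈ (∑≡sumF (λ v → x v F))) w)

        -- By independence each scaled summand is a coboundary by itself, and the nonzero scalar can
        -- be divided out; this is why the choice of coefficients does not matter.
        KDim⇒Exc : suc (suc I) ≤ suc d → ∀ {κ} → KDim Δ I κ → Dim (⨁ Exc) (⨁ (λ v → RelCoboundaries Δ v I)) κ
        KDim⇒Exc l (a , a≉0 , q) = Dim-≐ to from id id (fromQDim (KerF Δ a I) (KerF₀ Δ I) q)
          where
          to : ∀ {x} → KerF Δ a I x → ⨁ Exc x
          to {x} (z , w) v = z v , ≈∈ (Coboundaries-sub Δ I) (λ F → begin
              iv * (a v * x (v , F))   ≈⟨ sym (*-assoc _ _ _) ⟩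
              (iv * a v) * x (v , F)   ≈⟨ *-congʳ (trans (*-comm _ _) (proj₂ (inverse (a v) (a≉0 v)))) ⟩
              1# * x (v , F)           ≈⟨ *-identityˡ _ ⟩
              x (v , F)                ∎)
            (*∈ (Coboundaries-sub Δ I) iv (split l (λ v F → a v * x (v , F)) (λ v → *∈ (RelCocycles-sub Δ v I) (a v) (z v)) (≈∈ (Coboundaries-sub Δ I) (λ F → ≡⇒≈ (≡.sym (∑≡sumF (λ v → a v * x (v , F))))) w) v))
            where iv = proj₁ (inverse (a v) (a≉0 v))
          from : ∀ {x} → ⨁ Exc x → KerF Δ a I x
          from {x} z = (λ v → proj₁ (z v)) , ≈∈ (Coboundaries-sub Δ I) (λ F → ≡⇒≈ (∑≡sumF (λ v → a v * x (v , F)))) (Σ∈ (Coboundaries-sub Δ I) (λ v → *∈ (Coboundaries-sub Δ I) (a v) (proj₂ (z v))))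

        -- Independence is applied in each exterior coordinate separately, which decouples the
        -- vertices although the spaces W_v overlap inside Λ^i.
        top-dim : suc (suc I) ≤ suc d → (pv : ∀ v → Σ (Fin (suc d)) λ j → ¬ (θ v j ≈ 0#)) → ∀ {κ} → KDim Δ I κ → Dim (Ker g1 (suc I)) (Tens (RelB (suc I))) ((d C i) ℕ.* κ)
        top-dim l pv q = Dim-≐ to from (Tens-mono (RelCoboundaries⇒RelB I)) (Tens-mono (RelB⇒RelCoboundaries I))
            (Tens-dim pv Exc-sub (λ v → RelCoboundaries-sub Δ v I) RelCob⇒Exc (KDim⇒Exc l q))
          where
          to : ∀ {y} → Tens Exc y → Ker g1 (suc I) y
          to {y} t = Tens-mono {Exc} {RelZ (suc I)} (λ v {x} z → RelCocycles⇒RelZ I v (proj₁ z)) t , Φ-VT {Exc} (Bc-sub Δ (suc I)) (λ v {x} z → Coboundaries⇒Bc Δ (proj₂ z)) t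
          from : ∀ {y} → Ker g1 (suc I) y → Tens Exc y
          from {y} (t , w) v = proj₁ (t v) , proj₁ (proj₂ (t v)) , λ S → RelZ⇒RelCocycles I v (proj₂ (proj₂ (t v)) S) ,
            split l (λ u F → y (u , S , F)) (λ u → RelZ⇒RelCocycles I u (proj₂ (proj₂ (t u)) S)) (Bc⇒Coboundaries Δ (proj₂ w S)) v

        -- Independence is available only for `i ≤ d`. In the remaining case, `i` equal to `suc d`,
        -- the spaces W_v are zero and both sides vanish with the binomial.
        top-ker : (pv : ∀ v → Σ (Fin (suc d)) λ j → ¬ (θ v j ≈ 0#)) → ∀ {κ} → KDim Δ I κ → i ≤ suc d → ∀ {r} → Ranks (suc I) r → proj₁ r ≡ (d C i) ℕ.* κ
        top-ker pv {κ} q l {k , _ , rk} R = case i ℕ.≤? d of λ where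
            (yes p) → Dim-unique (Tens-sub (RelB-sub (suc I))) (Ranks.ker-dim R) (top-dim (s≤s p) pv q)
            (no p) → let z = k>n⇒nCk≡0 (ℕP.≰⇒> p) in
              ≡.trans (ℕP.m+n≡0⇒m≡0 k {rk} (≡.trans (Ranks.ker+rank R) (≡.cong (ℕ._* e (suc I)) z))) (≡.sym (≡.cong (ℕ._* κ) z))

        -- Koszul degree `q` is `m` equal to `suc q`, so faces at the origin have size `i ∸ q`: the
        -- cokernel of `Φ` enters at that size and the kernel one size higher.
        level-dim : ∀ {f : ℕ → ℕ × ℕ × ℕ} → (∀ s → s ≤ suc I → Ranks s (f s)) → ∀ q → 1 ≤ q → q ≤ i → ∀ {r} → Dim (Z kz (suc q)) (Bd kz (suc q)) r →
                    r ≡ proj₁ (f (suc (i ∸ q))) ℕ.+ proj₁ (proj₂ (f (i ∸ q)))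
        level-dim {f} R q (s≤s {n = q'} _) l {r} h = Dim-unique (Bd-sub G (suc q))
            (nonpositive→layer (λ H two → contraction cx H (suc d) (relative-acyclic cxV is H two)) (suc q) (s≤s (s≤s z≤n)) (Koszul→nonpositive nl q h))
            (Dim-+ (Mid-sub g1 pm) (Bd-sub G (suc q)) proj₁ (Bd⇒Mid g1 pm) (Dim← (Z/Mid-iso g1 pm) (Ranks.ker-dim (R (suc (i ∸ q)) (s≤s (ℕP.m∸n≤m I q')))))
              (Dim→ (Mid/Bd-iso g1 pm) (Ranks.coker-dim (R (i ∸ q) (ℕP.m≤n⇒m≤1+n (ℕP.m∸n≤m I q'))))))
          where
          pm : (i ∸ q) ℕ.+ suc q ≡ suc i
          pm = ≡.trans (ℕP.+-suc (i ∸ q) q) (≡.cong suc (ℕP.m∸n+n≡m l))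

      Hilbert-formula : ∀ {κ} → KDim Δ I κ → i ≤ suc d → ∀ {r} → HilbDim Δ Θ i r →
        + r ≡ hvec Δ (suc d) i ℤ.+ (+ (suc d C i)) ℤ.* alt (λ j → + b (I ∸ j)) I ℤ.+ (+ (d C i)) ℤ.* (+ κ ℤ.- alt (λ j → + e (I ∸ j)) I)
      Hilbert-formula {κ} q l {r} h = decidable-stable (_ ℤ.≟ _) (do
          pv ← DN-Fin pivot
          (f , R) ← DN-choice (ranks pv) (suc I)
          return (finish pv f R))
        where
        finish : (∀ v → Σ (Fin (suc d)) λ j → ¬ (θ v j ≈ 0#)) → ∀ f → (∀ s → s ≤ suc I → Ranks s (f s)) → _
        finish pv f R = ≡R.begin
          + r
            ≡R.≡⟨ hilbert-function (λ q → ker (suc (i ∸ q)) ℕ.+ coker (i ∸ q)) (level-dim {f} R) (proj₁ (proj₁ is)) h ⟩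
          H ℤ.+ alt′ (λ j → + (ker (suc (I ∸ j)) ℕ.+ coker (I ∸ j))) (suc I)
            ≡R.≡⟨ ≡.cong (ℤ._+_ H) (alt′≡alt (λ j → + (ker (suc (I ∸ j)) ℕ.+ coker (I ∸ j))) I) ⟩
          H ℤ.+ alt (λ j → + (ker (suc (I ∸ j)) ℕ.+ coker (I ∸ j))) I
            ≡R.≡⟨ ≡.cong (ℤ._+_ H) (rank-telescope ker coker rank (λ s → N ℕ.* e s) (λ s → M ℕ.* b s) I (λ s l → Ranks.ker+rank (R s (ℕP.m≤n⇒m≤1+n l))) (λ s l → Ranks.coker+rank (R s (ℕP.m≤n⇒m≤1+n l))) (ℕP.*-zeroʳ N)) ⟩
          H ℤ.+ (+ ker (suc I) ℤ.+ alt (λ j → + (M ℕ.* b (I ∸ j)) ℤ.- + (N ℕ.* e (I ∸ j))) I)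
            ≡R.≡⟨ ≡.cong₂ (λ x y → H ℤ.+ (x ℤ.+ y)) (≡.trans (≡.cong +_ (top-ker pv q l (R (suc I) ℕP.≤-refl))) (ℤP.pos-* N κ)) split-alt ⟩
          H ℤ.+ (+ N ℤ.* + κ ℤ.+ (+ M ℤ.* B ℤ.+ (ℤ.- + N) ℤ.* E))
            ≡R.≡⟨ rearrange H (+ N) (+ κ) (+ M) B E ⟩
          H ℤ.+ + M ℤ.* B ℤ.+ + N ℤ.* (+ κ ℤ.- E) ≡R.∎
          where
          module ≡R = ≡.≡-Reasoning
          ker coker rank : ℕ → ℕ
          ker s = proj₁ (f s)
          coker s = proj₁ (proj₂ (f s))
          rank s = proj₂ (proj₂ (f s))
          H = hvec Δ (suc d) i
          N = d C i
          M = suc d C i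
          B = alt (λ j → + b (I ∸ j)) I
          E = alt (λ j → + e (I ∸ j)) I
          split-alt : alt (λ j → + (M ℕ.* b (I ∸ j)) ℤ.- + (N ℕ.* e (I ∸ j))) I ≡ + M ℤ.* B ℤ.+ (ℤ.- + N) ℤ.* E
          split-alt = ≡.trans (alt-cong I (λ j _ → ≡.cong₂ ℤ._+_ (ℤP.pos-* M (b (I ∸ j))) (≡.trans (≡.cong ℤ.-_ (ℤP.pos-* N (e (I ∸ j)))) (ℤP.neg-distribˡ-* (+ N) (+ e (I ∸ j))))))
            (≡.trans (alt-+ (λ j → + M ℤ.* + b (I ∸ j)) (λ j → (ℤ.- + N) ℤ.* + e (I ∸ j)) I) (≡.cong₂ ℤ._+_ (alt-* (+ M) (λ j → + b (I ∸ j)) I) (alt-* (ℤ.- + N) (λ j → + e (I ∸ j)) I)))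
          rearrange : ∀ H N κ M B E → H ℤ.+ (N ℤ.* κ ℤ.+ (M ℤ.* B ℤ.+ (ℤ.- N) ℤ.* E)) ≡ H ℤ.+ M ℤ.* B ℤ.+ N ℤ.* (κ ℤ.- E)
          rearrange = solve-∀

theorem4p2 : ∀ {c ℓ : Level} (K : Field c ℓ) → OverField.Infinite K →
  ∀ (n d : ℕ) (Δ : Subset n → Bool) → IsComplexOnV Δ →
  OverField.HIS K Δ d →
  (Θ : Fin d → Fin n → Field.Carrier K) → OverField.LSOP K Δ Θ →
  (β : ℕ → ℕ) → (∀ m → OverField.Betti K Δ m (β m)) →
  (βlk : Fin n → ℕ → ℕ) → (∀ v m → OverField.Betti K (lk Δ v) m (βlk v m)) →
  (𝒦 : ℕ → ℕ) → (∀ m → OverField.KDim K Δ m (𝒦 m)) →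
  ∀ (i r : ℕ) → OverField.HilbDim K Δ Θ i r →
  (i ≤ d → + r ≡ hprime Δ d β βlk 𝒦 i) × (d < i → r ≡ 0)
theorem4p2 K _ n d Δ cxV his Θ ls β hβ βlk hlk 𝒦 h𝒦 i r h = (λ l → formula d i his Θ ls h l) ,
    λ l → FaceRing.EulerCharacteristic.hilbert-vanishes K Θ i Δ cxV (FaceRing.Koszul.nilpotent K Θ i Δ cxV ls) l h
  where
  formula : ∀ d i → OverField.HIS K Δ d → (Θ : Fin d → Fin n → Field.Carrier K) → OverField.LSOP K Δ Θ →
            OverField.HilbDim K Δ Θ i r → i ≤ d → + r ≡ hprime Δ d β βlk 𝒦 i
  -- In degree zero no positive Koszul homology takes part, and all correction sums are empty.
  formula d zero his Θ ls h _ = ≡.trans (FaceRing.EulerCharacteristic.hilbert-function K Θ 0 Δ cxV (λ _ → 0) (λ { _ () z≤n }) (proj₁ (proj₁ (proj₁ his))) h)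
    (≡.trans (rearrange (hvec Δ d 0) (+ (d C 0)) (+ ((d ∸ 1) C 0)))
      (≡.cong₂ (λ x y → hvec Δ d 0 ℤ.+ + (d C 0) ℤ.* x ℤ.+ + ((d ∸ 1) C 0) ℤ.* (+ 0 ℤ.- y))
        (≡.sym (sumℤ≡ (λ j → sgnℤ (0 ∸ j ∸ 1) ℤ.* + β (j ∸ 1)) 1 0))
        (≡.sym (sumFinℤ-0 (λ v → sumℤ≡ (λ j → sgnℤ (0 ∸ j) ℤ.* + βlk v (j ∸ 1)) 1 0)))))
    where
    rearrange : ∀ x y z → x ℤ.+ + 0 ≡ x ℤ.+ y ℤ.* + 0 ℤ.+ z ℤ.* (+ 0 ℤ.- + 0)
    rearrange = solve-∀
  formula (suc d) (suc I) his Θ ls h l@(s≤s I≤d) = ≡.trans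
    (FaceRing.Contributions.Hilbert-formula K Θ I Δ cxV his ls β hβ βlk hlk (h𝒦 I) l h)
    (≡.cong₂ (λ x y → hvec Δ (suc d) (suc I) ℤ.+ + (suc d C suc I) ℤ.* x ℤ.+ + (d C suc I) ℤ.* (+ 𝒦 I ℤ.- y))
      -- A link with cohomology in degree -1 occurs only for `d` equal to zero, which `1 ≤ I` and
      -- `I ≤ d` exclude.
      (betti-sum β βlk I) (bettiLk-sum β βlk (point d) I (λ p → no-point d (ℕP.≤-trans p I≤d))))
    where
    no-point : ∀ d → 1 ≤ d → point d ≡ 0
    no-point (suc d) _ = ≡.refl
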